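{- For $k\ge1$, $\ell\ge1$ and $\mu\in\mathrm{Par}^k_\ell$, $$s^{(k)}_\mu=\sum_{T\in\mathrm{VSMT}^{k+1}_{(\ell)}(\mu+1^\ell)}t^{\mathrm{spin}(T)}\,s^{(k+1)}_{\mathrm{inside}(T)},$$ where $1^\ell=(1,\dots,1)\in\mathbb Z^\ell$.
   Context: $\mathrm{Par}^k_\ell=\{\mu\in\mathbb Z^\ell:k\ge\mu_1\ge\dots\ge\mu_\ell\ge0\}$; $\mathrm{Par}^k$ is the set of partitions with largest part $\le k$; partitions are identified with themselves padded by zeros. Hook length of a box (English notation): number of boxes below it in its column plus those weakly to its right in its row. For $K\ge1$, a $(K+1)$-core is a partition with no box of hook length $K+1$; $\mathfrak p(\kappa)$ has $r$-th part equal to the number of boxes in row $r$ of $\kappa$ with hook length $\le K$, a bijection from $(K+1)$-cores to $\mathrm{Par}^K$. A strong cover $\tau\Rightarrow\kappa$: $(K+1)$-cores with $\tau\subset\kappa$, $|\mathfrak p(\tau)|+1=|\mathfrak p(\kappa)|$; a strong marked cover $\tau\xRightarrow{r}\kappa$ adds a positive integer $r$ equal to the smallest row index of some connected component of $\kappa/\tau$; its spin is $c(h-1)+N$ with $c$ the number of components of $\kappa/\tau$, $h$ the common number of rows of each component, $N$ the number of components entirely in rows $>r$. For $\eta\in\mathbb Z^\infty_{\ge0}$, $m=|\eta|<\infty$, a strong marked tableau (resp. vertical strong marked tableau) of weight $\eta$ is a chain $T=(\kappa^{(0)}\xRightarrow{r_1}\cdots\xRightarrow{r_m}\kappa^{(m)})$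 of strong marked covers with $r_{v_i+1}\ge\dots\ge r_{v_i+\eta_i}$ (resp. $r_{v_i+1}<\dots<r_{v_i+\eta_i}$) for all $i$, where $v_i=\eta_1+\dots+\eta_{i-1}$; $\mathrm{spin}(T)$ is the sum of spins, $\mathrm{inside}(T)=\mathfrak p(\kappa^{(0)})$; $\mathrm{SMT}^K_\eta(\mu)$ (resp. $\mathrm{VSMT}^K_\eta(\mu)$) is the set of those with $\mathfrak p(\kappa^{(m)})=\mu$. The $K$-Schur function is $s^{(K)}_\mu(x;t)=\sum_{\eta\in\mathbb Z^\infty_{\ge0},\,|\eta|=|\mu|}\sum_{T\in\mathrm{SMT}^K_\eta(\mu)}t^{\mathrm{spin}(T)}x^\eta$. -}

module Defs where

-- Conventions: a partition / core is a List ℕ of weakly decreasing positive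
-- parts (row 0 first); rows and columns are 0-indexed internally, while the
-- marks r of strong marked covers are 1-indexed as in the paper.
-- "IsCore K κ" means κ is a (K+1)-core; "pOf K κ" is 𝔭(κ) (boxes of hook ≤ K).

open import Data.Nat using (ℕ; zero; suc; _+_; _*_; _∸_; _≤ᵇ_; _<ᵇ_; _≡ᵇ_; _⊓_; _⊔_; _≤_)
open import Data.Bool using (Bool; true; false; _∧_; _∨_; not; if_then_else_; T)
open import Data.Nat.ListAction using (sum)
open import Data.Bool.ListAction using (all; any)
open import Data.List using (List; []; _∷_; length; map; filterᵇ; upTo; concatMap; drop; take; foldr; _++_)
open import Data.Product using (_×_; _,_; proj₁; proj₂)
open import Relation.Binary.PropositionalEquality using (_≡_)

get : List ℕ → ℕ → ℕ
get []       _       = 0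
get (x ∷ xs) zero    = x
get (x ∷ xs) (suc i) = get xs i

_≈ₚ_ : List ℕ → List ℕ → Set
a ≈ₚ b = ∀ i → get a i ≡ get b i

size : List ℕ → ℕ
size = sum

isPartᵇ : List ℕ → Bool
isPartᵇ []           = true
isPartᵇ (x ∷ [])     = 1 ≤ᵇ x
isPartᵇ (x ∷ y ∷ xs) = (y ≤ᵇ x) ∧ isPartᵇ (y ∷ xs)

Box : Set
Box = ℕ × ℕ   -- (row , column)

boxes : List ℕ → List Box
boxes κ = concatMap (λ r → map (λ c → (r , c)) (upTo (get κ r))) (upTo (length κ))

hook : List ℕ → ℕ → ℕ → ℕ
hook κ r c = (get κ r ∸ c) + length (filterᵇ (λ a → c <ᵇ a) (drop (suc r) κ))

isCoreᵇ : ℕ → List ℕ → Bool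
isCoreᵇ K κ = all (λ b → not (hook κ (proj₁ b) (proj₂ b) ≡ᵇ suc K)) (boxes κ)

pOf : ℕ → List ℕ → List ℕ
pOf K κ = map (λ r → length (filterᵇ (λ c → hook κ r c ≤ᵇ K) (upTo (get κ r)))) (upTo (length κ))

⊆ᵇ : List ℕ → List ℕ → Bool
⊆ᵇ τ κ = all (λ i → get τ i ≤ᵇ get κ i) (upTo (length τ + length κ))

skew : List ℕ → List ℕ → List Box
skew κ τ = filterᵇ (λ b → get τ (proj₁ b) ≤ᵇ proj₂ b) (boxes κ)

eqBox : Box → Box → Bool
eqBox (r , c) (r' , c') = (r ≡ᵇ r') ∧ (c ≡ᵇ c')

adj : Box → Box → Bool
adj (r , c) (r' , c') =
  ((r ≡ᵇ r') ∧ ((suc c ≡ᵇ c') ∨ (suc c' ≡ᵇ c))) ∨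
  ((c ≡ᵇ c') ∧ ((suc r ≡ᵇ r') ∨ (suc r' ≡ᵇ r)))

memᵇ : Box → List Box → Bool
memᵇ b S = any (eqBox b) S

grow : ℕ → List Box → List Box → List Box
grow zero    U S = S
grow (suc n) U S = grow n U (filterᵇ (λ b → memᵇ b S ∨ any (adj b) S) U)

componentsF : ℕ → List Box → List (List Box)
componentsF zero    _       = []
componentsF (suc n) []      = []
componentsF (suc n) (b ∷ U) =
  grow (length (b ∷ U)) (b ∷ U) (b ∷ []) ∷
  componentsF n (filterᵇ (λ x → not (memᵇ x (grow (length (b ∷ U)) (b ∷ U) (b ∷ [])))) (b ∷ U))

components : List Box → List (List Box)
components U = componentsF (length U) U

minRow : List Box → ℕ
minRow []            = 0
minRow ((r , _) ∷ bs) = foldr (λ b m → proj₁ b ⊓ m) r bs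

maxRow : List Box → ℕ
maxRow bs = foldr (λ b m → proj₁ b ⊔ m) 0 bs

height : List Box → ℕ
height C = length (filterᵇ (λ i → any (λ b → proj₁ b ≡ᵇ i) C) (upTo (suc (maxRow C))))

heightAt : ℕ → List (List Box) → ℕ
heightAt r []       = 0
heightAt r (C ∷ Cs) = if suc (minRow C) ≡ᵇ r then height C else heightAt r Cs

markedCoverᵇ : ℕ → List ℕ → ℕ → List ℕ → Bool
markedCoverᵇ K τ r κ =
  isCoreᵇ K τ ∧ isCoreᵇ K κ ∧ ⊆ᵇ τ κ ∧
  (suc (size (pOf K τ)) ≡ᵇ size (pOf K κ)) ∧
  any (λ C → suc (minRow C) ≡ᵇ r) (components (skew κ τ))

coverSpin : List ℕ → ℕ → List ℕ → ℕ
coverSpin τ r κ =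
  length (components (skew κ τ)) * (heightAt r (components (skew κ τ)) ∸ 1) +
  length (filterᵇ (λ C → r <ᵇ suc (minRow C)) (components (skew κ τ)))

-- a chain κ⁽⁰⁾ =r₁=> κ⁽¹⁾ … =rₘ=> κ⁽ᵐ⁾ : (κ⁽⁰⁾ , [(r₁ , κ⁽¹⁾) , … , (rₘ , κ⁽ᵐ⁾)])
Tab : Set
Tab = List ℕ × List (ℕ × List ℕ)

inside : ℕ → Tab → List ℕ
inside K T = pOf K (proj₁ T)

validChainᵇ : ℕ → List ℕ → List (ℕ × List ℕ) → Bool
validChainᵇ K τ []             = true
validChainᵇ K τ ((r , κ) ∷ st) = markedCoverᵇ K τ r κ ∧ validChainᵇ K κ st

chainSpin : List ℕ → List (ℕ × List ℕ) → ℕ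
chainSpin τ []             = 0
chainSpin τ ((r , κ) ∷ st) = coverSpin τ r κ + chainSpin κ st

spin : Tab → ℕ
spin (κ₀ , st) = chainSpin κ₀ st

blocks : List ℕ → List ℕ → List (List ℕ)
blocks []       ms = []
blocks (e ∷ es) ms = take e ms ∷ blocks es (drop e ms)

weakDecᵇ : List ℕ → Bool
weakDecᵇ []           = true
weakDecᵇ (x ∷ [])     = true
weakDecᵇ (x ∷ y ∷ xs) = (y ≤ᵇ x) ∧ weakDecᵇ (y ∷ xs)

strictIncᵇ : List ℕ → Bool
strictIncᵇ []           = true
strictIncᵇ (x ∷ [])     = true
strictIncᵇ (x ∷ y ∷ xs) = (x <ᵇ y) ∧ strictIncᵇ (y ∷ xs)

marks : Tab → List ℕ
marks T = map proj₁ (proj₂ T)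

isSMTᵇ : ℕ → List ℕ → Tab → Bool
isSMTᵇ K η T = isCoreᵇ K (proj₁ T) ∧ validChainᵇ K (proj₁ T) (proj₂ T) ∧
               (length (proj₂ T) ≡ᵇ sum η) ∧ all weakDecᵇ (blocks η (marks T))

isVSMTᵇ : ℕ → List ℕ → Tab → Bool
isVSMTᵇ K η T = isCoreᵇ K (proj₁ T) ∧ validChainᵇ K (proj₁ T) (proj₂ T) ∧
                (length (proj₂ T) ≡ᵇ sum η) ∧ all strictIncᵇ (blocks η (marks T))

ext : ℕ → List ℕ → List (List ℕ)
ext a []      = [] ∷ map (λ b → suc b ∷ []) (upTo a)
ext a (x ∷ ν) = map (λ b → (x + b) ∷ x ∷ ν) (upTo (suc (a ∸ x)))

subs : List ℕ → List (List ℕ)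
subs []      = [] ∷ []
subs (a ∷ κ) = concatMap (ext a) (subs κ)

-- finite universe of candidate chains of m steps ending at κ: every
-- intermediate shape is contained in κ and marks range over 1..(#rows of κ)
chainsEnd : List ℕ → ℕ → List Tab
chainsEnd κ zero    = (κ , []) ∷ []
chainsEnd κ (suc m) =
  concatMap (λ τ → concatMap (λ r →
     map (λ T → (proj₁ T , proj₂ T ++ ((suc r , κ) ∷ []))) (chainsEnd τ m))
     (upTo (length κ))) (subs κ)

-- number of T ∈ SMT^K_η(𝔭 κ) with spin T = d, for κ the (K+1)-core with given 𝔭
smtCount : ℕ → List ℕ → List ℕ → ℕ → ℕ
smtCount K η κ d = length (filterᵇ (λ T → isSMTᵇ K η T ∧ (spin T ≡ᵇ d)) (chainsEnd κ (sum η)))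

-- coefficient of x^η t^d in s^{(K)}_{𝔭 κ}(x;t)   (κ a (K+1)-core)
kSchurCoeff : ℕ → List ℕ → List ℕ → ℕ → ℕ
kSchurCoeff K κ η d = if sum η ≡ᵇ size (pOf K κ) then smtCount K η κ d else 0

vsmtList : ℕ → List ℕ → List ℕ → List Tab
vsmtList K η κ = filterᵇ (isVSMTᵇ K η) (chainsEnd κ (sum η))

-- coefficient of x^η t^d in Σ_{T ∈ VSMT^{K}_{(ℓ)}(𝔭 κ')} t^{spin T} s^{(K)}_{inside T};
-- s^{(K)}_{inside T} is indexed by the (K+1)-core κ⁽⁰⁾ of T, the unique core with 𝔭 = inside T
rhsCoeff : ℕ → ℕ → List ℕ → List ℕ → ℕ → ℕ
rhsCoeff K ℓ κ' η d =
  sum (map (λ T → if spin T ≤ᵇ d then kSchurCoeff K (proj₁ T) η (d ∸ spin T) else 0)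
           (vsmtList K (ℓ ∷ []) κ'))

boundedParᵇ : ℕ → List ℕ → Bool
boundedParᵇ k μ = all (λ x → x ≤ᵇ k) μ ∧ weakDecᵇ μ

{-# OPTIONS --safe #-}
module Submission where

-- Write n = K + 1. A (K+1)-core is recorded by its bead map d, which sends row r to the row whose bead
-- lies n below that of r; then d r = n + r − 𝔭(κ)_r, so d also encodes the root ideal {(i , j) : d i ≤ j} and the
-- weight 𝔭(κ) of a Catalan function ∏ (1 − t R_β)⁻¹ s_γ. Raising K to K + 1 and adding 1 to all ℓ parts of 𝔭(κ)
-- keeps d, and e_ℓ^⊥ subtracts 1 from all ℓ entries of the weight; hence e_ℓ^⊥ sends the Catalan function of κ'
-- to that of κ. On the other hand e_ℓ^⊥ is peeled off one row z at a time: lowering the weight of a core in row z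
-- and straightening, by the antisymmetry of s_γ under the dot action, leaves exactly the strong covers with mark z,
-- with their spins, so e_i^⊥ acts by vertical strong marked tableaux. As h_i is the same polynomial in the e_i for
-- the operators h^⊥, e^⊥ and for the sums over weakly decreasing and strictly increasing marks, h_i^⊥ acts by strong
-- marked tableaux, and the coefficients of the Catalan function of a core are those of its K-Schur function.

open import Defs
open import Data.Bool using (Bool; true; false; if_then_else_; T; not; _∧_; _∨_)
open import Data.Bool.Properties using (T-∧; T-∨; T-≡; T?; ∧-identityʳ; ∧-zeroʳ; ∧-assoc)
open import Data.Bool.ListAction using (all; any)
open import Data.Nat using (ℕ; zero; suc; _≤_; _<_; z≤n; s≤s; _≟_; _≤?_; _<?_)
import Data.Nat as ℕ
import Data.Nat.Properties as ℕₚ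
open import Data.Integer using (ℤ; +_; -[1+_]; 0ℤ; 1ℤ; -1ℤ)
import Data.Integer as ℤ
import Data.Integer.Properties as ℤₚ
open import Data.Integer.Tactic.RingSolver using () renaming (solve-∀ to ℤ-ring)
open import Data.Nat.Tactic.RingSolver using () renaming (solve-∀ to ℕ-ring)
open import Data.List using (List; []; _∷_; _++_; map; filter; filterᵇ; length; foldr; take; drop; applyUpTo; upTo; concatMap; cartesianProduct)
import Data.List.Properties as Listₚ
open import Data.Nat.ListAction using (sum)
open import Data.Nat.ListAction.Properties using (sum-↭)
open import Data.List.Membership.Propositional using (_∈_; lose; find)
open import Data.List.Membership.Propositional.Properties using (∈-filter⁺; ∈-filter⁻; ∈-cartesianProduct⁺; ∈-cartesianProduct⁻; ∈-upTo⁺; ∈-upTo⁻; ∈-map⁺; ∈-map⁻; ∈-concatMap⁺; ∈-concatMap⁻)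
open import Data.List.Membership.Propositional.Properties.WithK using (unique∧set⇒bag)
open import Data.List.Relation.Unary.Any using (here; there)
open import Data.List.Relation.Unary.All using (All; []; _∷_)
import Data.List.Relation.Unary.All as All
import Data.List.Relation.Unary.All.Properties as Allₚ
import Data.List.Relation.Unary.Any as Any
import Data.List.Relation.Unary.Any.Properties as Anyₚ
open import Data.List.Relation.Unary.Unique.Propositional using (Unique)
import Data.List.Relation.Unary.Unique.Propositional.Properties as Uniqueₚ
import Data.List.Relation.Unary.AllPairs as AllPairs
import Data.List.Relation.Unary.AllPairs.Properties as AllPairsₚ
open import Data.List.Relation.Binary.Permutation.Propositional using (_↭_; refl; prep; swap; trans; ↭-sym)
open import Data.List.Relation.Binary.BagAndSetEquality using (∼bag⇒↭)
open import Data.Vec using (Vec; []; _∷_; toList; zipWith; replicate)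
open import Data.Vec.Properties using (length-toList)
open import Data.Product using (Σ; ∃; _×_; _,_; proj₁; proj₂)
open import Data.Sum using (_⊎_; inj₁; inj₂)
open import Data.Empty using (⊥; ⊥-elim)
open import Relation.Nullary using (¬_; ¬?; Dec; yes; no; does)
open import Relation.Nullary.Decidable using (dec-true; dec-false; _×-dec_)
open import Data.List.Relation.Binary.Pointwise using (Pointwise; []; _∷_)
import Data.List.Relation.Binary.Permutation.Propositional.Properties as Permₚ
open import Relation.Binary.PropositionalEquality using (_≡_; _≢_; refl; sym; cong; cong₂; subst; subst₂; module ≡-Reasoning)
import Relation.Binary.PropositionalEquality as ≡
open import Function.Bundles using (mk⇔; module Equivalence)
open import Function using (_∘_; id; case_of_)
open import Relation.Binary.Definitions using (Tri; tri<; tri≈; tri>)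

-- Catalan functions

-- Schur functions are never constructed. A symmetric function is seen through functionals on
-- weights that are antisymmetric under the dot action and vanish on weights with a negative tail
-- sum; straightening needs no more. Taking the coefficient of x^η becomes one such functional, the
-- same for every K, and this ties level k to level k + 1. The obstacle is that e_i^⊥ respects
-- antisymmetry only as a whole: its part on subsets of {0, ..., m - 1} loses it at the
-- transposition of m - 1 and m. A mark with row m is therefore resolved with functionals
-- antisymmetric everywhere else, and no straightening step may swap m - 1 and m. None does, because
-- an orbit of the bead map never visits a row strictly between a visited row and its image. The
-- spin arises in two pieces: N counts steps along the orbit of the marked row, and c(h - 1) counts
-- straightenings, one for each component and each of its rows but one. That no strong cover is
-- missed needs a separate argument: between two distinct nested cores there is always a cover of
-- the larger one made from a ladder.

unique-⇔⇒↭ : ∀ {A : Set} {xs ys : List A} → Unique xs → Unique ys →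
  (∀ {x} → x ∈ xs → x ∈ ys) → (∀ {x} → x ∈ ys → x ∈ xs) → xs ↭ ys
unique-⇔⇒↭ u v f g = ∼bag⇒↭ (unique∧set⇒bag u v (mk⇔ f g))

infixr 7 _▹_
-- Multiplication by t^c, a series in t being given by its coefficients.
_▹_ : ℕ → (ℕ → ℤ) → ℕ → ℤ
(zero ▹ f) d = f d
(suc c ▹ f) zero = 0ℤ
(suc c ▹ f) (suc d) = (c ▹ f) d

▹-cong : ∀ c {f g : ℕ → ℤ} → (∀ d → f d ≡ g d) → ∀ d → (c ▹ f) d ≡ (c ▹ g) d
▹-cong zero e d = e d
▹-cong (suc c) e zero = refl
▹-cong (suc c) e (suc d) = ▹-cong c e d

▹-zero : ∀ c d → (c ▹ λ _ → 0ℤ) d ≡ 0ℤ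
▹-zero zero d = refl
▹-zero (suc c) zero = refl
▹-zero (suc c) (suc d) = ▹-zero c d

▹-+ : ∀ c (f g : ℕ → ℤ) d → (c ▹ λ e → f e ℤ.+ g e) d ≡ (c ▹ f) d ℤ.+ (c ▹ g) d
▹-+ zero f g d = refl
▹-+ (suc c) f g zero = refl
▹-+ (suc c) f g (suc d) = ▹-+ c f g d

▹-neg : ∀ c (f : ℕ → ℤ) d → (c ▹ λ e → ℤ.- f e) d ≡ ℤ.- (c ▹ f) d
▹-neg zero f d = refl
▹-neg (suc c) f zero = refl
▹-neg (suc c) f (suc d) = ▹-neg c f d

▹-▹ : ∀ a b (f : ℕ → ℤ) d → (a ▹ b ▹ f) d ≡ ((a ℕ.+ b) ▹ f) d
▹-▹ zero b f d = refl
▹-▹ (suc a) b f zero = refl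
▹-▹ (suc a) b f (suc d) = ▹-▹ a b f d

Weight : Set
Weight = ℕ → ℤ

Root : Set
Root = ℕ × ℕ

infixl 6 _⊕_ _⊖_
_⊕_ _⊖_ : Weight → Weight → Weight
(γ ⊕ δ) j = γ j ℤ.+ δ j
(γ ⊖ δ) j = γ j ℤ.- δ j

abstract

  ind : ℕ → Weight
  ind a j = if does (a ≟ j) then 1ℤ else 0ℤ

  ind-same : ∀ a → ind a a ≡ 1ℤ
  ind-same a rewrite dec-true (a ≟ a) refl = refl

  ind-diff : ∀ {a j} → a ≢ j → ind a j ≡ 0ℤ
  ind-diff {a} {j} a≢j rewrite dec-false (a ≟ j) a≢j = refl

root : Root → Weight
root (a , b) = ind a ⊖ ind b

abstract

  transpose : ℕ → ℕ → ℕ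
  transpose i j = if does (j ≟ i) then suc i else if does (j ≟ suc i) then i else j

  transpose-fst : ∀ i → transpose i i ≡ suc i
  transpose-fst i rewrite dec-true (i ≟ i) refl = refl

  transpose-snd : ∀ i → transpose i (suc i) ≡ i
  transpose-snd i rewrite dec-false (suc i ≟ i) ℕₚ.1+n≢n | dec-true (suc i ≟ suc i) refl = refl

  transpose-else : ∀ {i j} → j ≢ i → j ≢ suc i → transpose i j ≡ j
  transpose-else {i} {j} p q rewrite dec-false (j ≟ i) p | dec-false (j ≟ suc i) q = refl

data Position (i : ℕ) : ℕ → Set where
  fst : Position i i
  snd : Position i (suc i)
  else : ∀ {j} → j ≢ i → j ≢ suc i → Position i j

position : ∀ i j → Position i j
position i j with j ≟ i
... | yes refl = fst
... | no p with j ≟ suc i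
...   | yes refl = snd
...   | no q = else p q

transpose-involutive : ∀ i j → transpose i (transpose i j) ≡ j
transpose-involutive i j with position i j
... | fst rewrite transpose-fst i = transpose-snd i
... | snd rewrite transpose-snd i = transpose-fst i
... | else p q rewrite transpose-else p q = transpose-else p q

ind-transpose : ∀ i a j → ind a (transpose i j) ≡ ind (transpose i a) j
ind-transpose i a j with a ≟ transpose i j
... | yes refl rewrite transpose-involutive i j = ≡.trans (ind-same (transpose i j)) (sym (ind-same j))
... | no p = ≡.trans (ind-diff p) (sym (ind-diff λ { refl → p (sym (transpose-involutive i a)) }))

-- The dot action of the i-th simple transposition on weights, s • γ = s (γ + ρ) − ρ.
dot : ℕ → Weight → Weight
dot i γ j = γ (transpose i j) ℤ.+ (ind (suc i) j ℤ.- ind i j)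

transposeRoot : ℕ → Root → Root
transposeRoot i (a , b) = transpose i a , transpose i b

transpose-< : ∀ {m i j} → suc i < m → j < m → transpose i j < m
transpose-< {m} {i} {j} si<m j<m with position i j
... | fst rewrite transpose-fst i = si<m
... | snd rewrite transpose-snd i = ℕₚ.<-trans (ℕₚ.n<1+n i) si<m
... | else p q rewrite transpose-else p q = j<m

dot-fst : ∀ i γ → dot i γ i ≡ γ (suc i) ℤ.- 1ℤ
dot-fst i γ rewrite transpose-fst i | ind-same i | ind-diff {suc i} {i} ℕₚ.1+n≢n = refl

dot-snd : ∀ i γ → dot i γ (suc i) ≡ γ i ℤ.+ 1ℤ
dot-snd i γ rewrite transpose-snd i | ind-same (suc i) | ind-diff {i} {suc i} (ℕₚ.1+n≢n ∘ sym) = refl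

dot-else : ∀ {i j} γ → j ≢ i → j ≢ suc i → dot i γ j ≡ γ j
dot-else {i} {j} γ p q rewrite transpose-else p q | ind-diff (p ∘ sym) | ind-diff (q ∘ sym) = ℤₚ.+-identityʳ _

self-neg⇒0 : ∀ x → x ≡ ℤ.- x → x ≡ 0ℤ
self-neg⇒0 (+ zero) e = refl

sumTo : ℕ → (ℕ → ℤ) → ℤ
sumTo zero f = 0ℤ
sumTo (suc m) f = sumTo m f ℤ.+ f m

sumTo-cong : ∀ m {f g : ℕ → ℤ} → (∀ i → i < m → f i ≡ g i) → sumTo m f ≡ sumTo m g
sumTo-cong zero e = refl
sumTo-cong (suc m) e =
  cong₂ ℤ._+_ (sumTo-cong m λ i i<m → e i (ℕₚ.m<n⇒m<1+n i<m)) (e m (ℕₚ.n<1+n m))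

sumTo-+ : ∀ m (f g : ℕ → ℤ) → sumTo m (λ i → f i ℤ.+ g i) ≡ sumTo m f ℤ.+ sumTo m g
sumTo-+ zero f g = refl
sumTo-+ (suc m) f g rewrite sumTo-+ m f g = eq (sumTo m f) (sumTo m g) (f m) (g m)
  where eq : ∀ a b c d → (a ℤ.+ b) ℤ.+ (c ℤ.+ d) ≡ (a ℤ.+ c) ℤ.+ (b ℤ.+ d)
        eq = ℤ-ring

sumTo-- : ∀ m (f g : ℕ → ℤ) → sumTo m (λ i → f i ℤ.- g i) ≡ sumTo m f ℤ.- sumTo m g
sumTo-- zero f g = refl
sumTo-- (suc m) f g rewrite sumTo-- m f g = eq (sumTo m f) (sumTo m g) (f m) (g m)
  where eq : ∀ a b c d → (a ℤ.- b) ℤ.+ (c ℤ.- d) ≡ (a ℤ.+ c) ℤ.- (b ℤ.+ d)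
        eq = ℤ-ring

sumTo-0 : ∀ m → sumTo m (λ _ → 0ℤ) ≡ 0ℤ
sumTo-0 zero = refl
sumTo-0 (suc m) rewrite sumTo-0 m = refl

sumTo-ind-≥ : ∀ m (w : ℕ → ℤ) {a} → m ≤ a → sumTo m (λ i → w i ℤ.* ind a i) ≡ 0ℤ
sumTo-ind-≥ m w {a} m≤a = ≡.trans
  (sumTo-cong m λ i i<m → ≡.trans (cong (w i ℤ.*_) (ind-diff (ℕₚ.<⇒≢ (ℕₚ.<-≤-trans i<m m≤a) ∘ sym))) (ℤₚ.*-zeroʳ (w i)))
  (sumTo-0 m)

sumTo-ind : ∀ m (w : ℕ → ℤ) {a} → a < m → sumTo m (λ i → w i ℤ.* ind a i) ≡ w a
sumTo-ind (suc m) w {a} a<1+m with a ≟ m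
... | yes refl = ≡.trans (cong₂ ℤ._+_ (sumTo-ind-≥ m w ℕₚ.≤-refl) (cong (w m ℤ.*_) (ind-same m)))
                   (≡.trans (ℤₚ.+-identityˡ _) (ℤₚ.*-identityʳ _))
... | no a≢m = ≡.trans (cong₂ ℤ._+_ (sumTo-ind m w (ℕₚ.≤∧≢⇒< (ℕₚ.≤-pred a<1+m) a≢m)) (≡.trans (cong (w m ℤ.*_) (ind-diff a≢m)) (ℤₚ.*-zeroʳ (w m))))
                   (ℤₚ.+-identityʳ _)

abstract

  atLeast : ℕ → Weight
  atLeast j i = if does (j ≤? i) then 1ℤ else 0ℤ

  atLeast-≤ : ∀ {j i} → j ≤ i → atLeast j i ≡ 1ℤ
  atLeast-≤ {j} {i} p rewrite dec-true (j ≤? i) p = refl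

  atLeast-> : ∀ {j i} → i < j → atLeast j i ≡ 0ℤ
  atLeast-> {j} {i} p rewrite dec-false (j ≤? i) (ℕₚ.<⇒≱ p) = refl

atLeast-nonneg : ∀ j i → 0ℤ ℤ.≤ atLeast j i
atLeast-nonneg j i with j ≤? i
... | yes p rewrite atLeast-≤ p = ℤ.+≤+ z≤n
... | no p rewrite atLeast-> (ℕₚ.≰⇒> p) = ℤ.+≤+ z≤n

atLeast-mono : ∀ j {a b} → a ≤ b → atLeast j a ℤ.≤ atLeast j b
atLeast-mono j {a} {b} a≤b with j ≤? a
... | no p rewrite atLeast-> (ℕₚ.≰⇒> p) = atLeast-nonneg j b
... | yes p rewrite atLeast-≤ p | atLeast-≤ (ℕₚ.≤-trans p a≤b) = ℤₚ.≤-refl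

abstract

  upd : (ℕ → ℕ) → ℕ → ℕ → ℕ → ℕ
  upd s a v r = if does (r ≟ a) then v else s r

  upd-same : ∀ s a v → upd s a v a ≡ v
  upd-same s a v rewrite dec-true (a ≟ a) refl = refl

  upd-diff : ∀ s {a} v {r} → r ≢ a → upd s a v r ≡ s r
  upd-diff s {a} v {r} p rewrite dec-false (r ≟ a) p = refl

module Catalan (ℓ : ℕ) where

  infix 4 _≈_
  _≈_ : Weight → Weight → Set
  γ ≈ δ = ∀ j → j < ℓ → γ j ≡ δ j

  Functional : Set
  Functional = Weight → ℤ

  Congruent : Functional → Set
  Congruent ψ = ∀ {γ δ} → γ ≈ δ → ψ γ ≡ ψ δ

  Antisym : Functional → ℕ → Set
  Antisym ψ i = suc i < ℓ → ∀ γ → ψ (dot i γ) ≡ ℤ.- ψ γ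

  pairing : Weight → Weight → ℤ
  pairing w γ = sumTo ℓ λ i → w i ℤ.* γ i

  -- The pairing is the tail sum γ_j + ... + γ_{ℓ-1}. Tail sums are the right test because adding a
  -- root ε_a - ε_b with a < b, or subtracting a unit vector, can only decrease them, so a vanishing
  -- once forced stays forced.
  Supported : Functional → Set
  Supported ψ = ∀ γ j → pairing (atLeast j) γ ℤ.< 0ℤ → ψ γ ≡ 0ℤ

  pairing-cong : ∀ w {γ δ} → γ ≈ δ → pairing w γ ≡ pairing w δ
  pairing-cong w e = sumTo-cong ℓ λ i i<ℓ → cong (w i ℤ.*_) (e i i<ℓ)

  pairing-root : ∀ w γ {a b} → a < ℓ → b < ℓ → pairing w (γ ⊕ root (a , b)) ≡ pairing w γ ℤ.+ (w a ℤ.- w b)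
  pairing-root w γ {a} {b} a<ℓ b<ℓ = begin
    pairing w (γ ⊕ root (a , b))
      ≡⟨ sumTo-cong ℓ (λ i _ → eq (w i) (γ i) (ind a i) (ind b i)) ⟩
    sumTo ℓ (λ i → w i ℤ.* γ i ℤ.+ (w i ℤ.* ind a i ℤ.- w i ℤ.* ind b i))
      ≡⟨ sumTo-+ ℓ _ _ ⟩
    pairing w γ ℤ.+ sumTo ℓ (λ i → w i ℤ.* ind a i ℤ.- w i ℤ.* ind b i)
      ≡⟨ cong (λ z → pairing w γ ℤ.+ z) (sumTo-- ℓ _ _) ⟩
    pairing w γ ℤ.+ (pairing w (ind a) ℤ.- pairing w (ind b))
      ≡⟨ cong₂ (λ x y → pairing w γ ℤ.+ (x ℤ.- y)) (sumTo-ind ℓ w a<ℓ) (sumTo-ind ℓ w b<ℓ) ⟩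
    pairing w γ ℤ.+ (w a ℤ.- w b) ∎
    where
      open ≡-Reasoning
      eq : ∀ u v x y → u ℤ.* (v ℤ.+ (x ℤ.- y)) ≡ u ℤ.* v ℤ.+ (u ℤ.* x ℤ.- u ℤ.* y)
      eq = ℤ-ring

  pairing-ind : ∀ w γ {a} → a < ℓ → pairing w (γ ⊖ ind a) ≡ pairing w γ ℤ.- w a
  pairing-ind w γ {a} a<ℓ = ≡.trans (sumTo-cong ℓ (λ i _ → eq (w i) (γ i) (ind a i)))
    (≡.trans (sumTo-- ℓ _ _) (cong (λ z → pairing w γ ℤ.- z) (sumTo-ind ℓ w a<ℓ)))
    where
      eq : ∀ u v x → u ℤ.* (v ℤ.- x) ≡ u ℤ.* v ℤ.- u ℤ.* x
      eq = ℤ-ring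

  -- H ψ Ψ γ d is the coefficient of t^d in ψ applied to ∏_{β ∈ Ψ} (1 − t R_β)⁻¹ γ, where R_β γ = γ ⊕ root β.
  H : Functional → List Root → Weight → ℕ → ℤ
  H ψ [] γ zero = ψ γ
  H ψ [] γ (suc d) = 0ℤ
  H ψ (β ∷ Ψ) γ zero = H ψ Ψ γ zero
  H ψ (β ∷ Ψ) γ (suc d) = H ψ Ψ γ (suc d) ℤ.+ H ψ (β ∷ Ψ) (γ ⊕ root β) d

  ⊕-cong : ∀ {γ δ} η → γ ≈ δ → γ ⊕ η ≈ δ ⊕ η
  ⊕-cong η e j j<ℓ = cong (ℤ._+ η j) (e j j<ℓ)

  ⊕-swap : ∀ γ η θ → γ ⊕ η ⊕ θ ≈ γ ⊕ θ ⊕ η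
  ⊕-swap γ η θ j _ = eq (γ j) (η j) (θ j)
    where
      eq : ∀ a b c → a ℤ.+ b ℤ.+ c ≡ a ℤ.+ c ℤ.+ b
      eq = ℤ-ring

  dot-cong : ∀ {γ δ i} → suc i < ℓ → γ ≈ δ → dot i γ ≈ dot i δ
  dot-cong si<ℓ e j j<ℓ = cong (ℤ._+ _) (e _ (transpose-< si<ℓ j<ℓ))

  dot-root : ∀ i γ β → dot i (γ ⊕ root β) ≈ dot i γ ⊕ root (transposeRoot i β)
  dot-root i γ (a , b) j _
    rewrite ind-transpose i a j | ind-transpose i b j = eq (γ (transpose i j)) (ind (transpose i a) j) (ind (transpose i b) j) (ind (suc i) j) (ind i j)
    where
      eq : ∀ g x y u v → g ℤ.+ (x ℤ.- y) ℤ.+ (u ℤ.- v) ≡ g ℤ.+ (u ℤ.- v) ℤ.+ (x ℤ.- y)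
      eq = ℤ-ring

  module _ {ψ : Functional} (cψ : Congruent ψ) where

    H-cong : ∀ Ψ {γ δ} → γ ≈ δ → ∀ d → H ψ Ψ γ d ≡ H ψ Ψ δ d
    H-cong [] e zero = cψ e
    H-cong [] e (suc d) = refl
    H-cong (β ∷ Ψ) e zero = H-cong Ψ e zero
    H-cong (β ∷ Ψ) e (suc d) = cong₂ ℤ._+_ (H-cong Ψ e (suc d)) (H-cong (β ∷ Ψ) (⊕-cong (root β) e) d)

    private
      combine : ∀ P A B C D E F → C ≡ A ℤ.+ E → D ≡ B ℤ.+ F → E ≡ F →
        (P ℤ.+ B) ℤ.+ C ≡ (P ℤ.+ A) ℤ.+ D
      combine P A B C D E F refl refl refl = eq P A B E
        where
          eq : ∀ P A B E → (P ℤ.+ B) ℤ.+ (A ℤ.+ E) ≡ (P ℤ.+ A) ℤ.+ (B ℤ.+ E)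
          eq = ℤ-ring

    -- Both expansions contain the double raising by α and β, in either order; it sits two degrees
    -- lower, so degree 1 is a case of its own.
    H-swap : ∀ α β Ψ γ d → H ψ (α ∷ β ∷ Ψ) γ d ≡ H ψ (β ∷ α ∷ Ψ) γ d
    H-swap α β Ψ γ zero = refl
    H-swap α β Ψ γ (suc zero) = combine (H ψ Ψ γ 1) (H ψ Ψ (γ ⊕ root α) 0) (H ψ Ψ (γ ⊕ root β) 0) _ _ 0ℤ 0ℤ
      (sym (ℤₚ.+-identityʳ _)) (sym (ℤₚ.+-identityʳ _)) refl
    H-swap α β Ψ γ (suc (suc d)) =
      combine (H ψ Ψ γ (suc (suc d))) (H ψ (α ∷ Ψ) (γ ⊕ root α) (suc d)) (H ψ (β ∷ Ψ) (γ ⊕ root β) (suc d))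
        (H ψ (α ∷ β ∷ Ψ) (γ ⊕ root α) (suc d)) (H ψ (β ∷ α ∷ Ψ) (γ ⊕ root β) (suc d))
        (H ψ (β ∷ α ∷ Ψ) (γ ⊕ root α ⊕ root β) d) (H ψ (α ∷ β ∷ Ψ) (γ ⊕ root β ⊕ root α) d)
        (H-swap α β Ψ (γ ⊕ root α) (suc d))
        (sym (H-swap α β Ψ (γ ⊕ root β) (suc d)))
        (≡.trans (sym (H-swap α β Ψ _ d)) (H-cong (α ∷ β ∷ Ψ) (⊕-swap γ (root α) (root β)) d))

    H-↭ : ∀ {Φ Ψ} → Φ ↭ Ψ → ∀ γ d → H ψ Φ γ d ≡ H ψ Ψ γ d
    H-↭ refl γ d = refl
    H-↭ (prep β p) γ zero = H-↭ p γ zero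
    H-↭ (prep β p) γ (suc d) = cong₂ ℤ._+_ (H-↭ p γ (suc d)) (H-↭ (prep β p) (γ ⊕ root β) d)
    H-↭ {α ∷ β ∷ Φ} {β ∷ α ∷ Ψ} (swap α β p) γ d =
      ≡.trans (H-swap α β Φ γ d) (H-↭₂ d γ)
      where
        H-↭₁ : ∀ d γ → H ψ (α ∷ Φ) γ d ≡ H ψ (α ∷ Ψ) γ d
        H-↭₁ zero γ = H-↭ p γ zero
        H-↭₁ (suc d) γ = cong₂ ℤ._+_ (H-↭ p γ (suc d)) (H-↭₁ d (γ ⊕ root α))
        H-↭₂ : ∀ d γ → H ψ (β ∷ α ∷ Φ) γ d ≡ H ψ (β ∷ α ∷ Ψ) γ d
        H-↭₂ zero γ = H-↭₁ zero γ
        H-↭₂ (suc d) γ = cong₂ ℤ._+_ (H-↭₁ (suc d) γ) (H-↭₂ d (γ ⊕ root β))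
    H-↭ (trans p q) γ d = ≡.trans (H-↭ p γ d) (H-↭ q γ d)

    module _ {i} (si<ℓ : suc i < ℓ) (aψ : Antisym ψ i) where

      -- The dot action carries raising by β to raising by the reflected root, so reflecting the
      -- weight and the whole root list together costs only the sign of ψ.
      H-antisym : ∀ Ψ γ d → H ψ (map (transposeRoot i) Ψ) (dot i γ) d ≡ ℤ.- H ψ Ψ γ d
      H-antisym [] γ zero = aψ si<ℓ γ
      H-antisym [] γ (suc d) = refl
      H-antisym (β ∷ Ψ) γ zero = H-antisym Ψ γ zero
      H-antisym (β ∷ Ψ) γ (suc d) = ≡.trans
        (cong₂ ℤ._+_ (H-antisym Ψ γ (suc d))
          (≡.trans (H-cong (map (transposeRoot i) (β ∷ Ψ)) (λ j j<ℓ → sym (dot-root i γ β j j<ℓ)) d)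
            (H-antisym (β ∷ Ψ) (γ ⊕ root β) d)))
        (sym (ℤₚ.neg-distrib-+ (H ψ Ψ γ (suc d)) _))

      module _ {Ψ} (stable : map (transposeRoot i) Ψ ↭ Ψ) where

        H-dot : ∀ γ d → H ψ Ψ (dot i γ) d ≡ ℤ.- H ψ Ψ γ d
        H-dot γ d = ≡.trans (sym (H-↭ stable (dot i γ) d)) (H-antisym Ψ γ d)

        -- The hypothesis on γ says that the dot action fixes it; with a stable root set the value
        -- then equals its own negative.
        H-fixed : ∀ γ → γ (suc i) ≡ γ i ℤ.+ 1ℤ → ∀ d → H ψ Ψ γ d ≡ 0ℤ
        H-fixed γ e d = self-neg⇒0 _ (≡.trans (H-cong Ψ fixed d) (H-dot γ d))
          where
            fixed : γ ≈ dot i γ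
            fixed j _ with position i j
            ... | fst rewrite dot-fst i γ | e = eq (γ i)
              where
                eq : ∀ x → x ≡ x ℤ.+ 1ℤ ℤ.- 1ℤ
                eq = ℤ-ring
            ... | snd rewrite dot-snd i γ = e
            ... | else p q = sym (dot-else γ p q)

    H-vanish : ∀ (P : Weight → Set) → (∀ {γ} → P γ → ψ γ ≡ 0ℤ) →
      ∀ Ψ → (∀ {β} → β ∈ Ψ → ∀ {γ} → P γ → P (γ ⊕ root β)) →
      ∀ γ → P γ → ∀ d → H ψ Ψ γ d ≡ 0ℤ
    H-vanish P z [] s γ p zero = z p
    H-vanish P z [] s γ p (suc d) = refl
    H-vanish P z (β ∷ Ψ) s γ p zero = H-vanish P z Ψ (s ∘ there) γ p zero
    H-vanish P z (β ∷ Ψ) s γ p (suc d) =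
      cong₂ ℤ._+_ (H-vanish P z Ψ (s ∘ there) γ p (suc d)) (H-vanish P z (β ∷ Ψ) s _ (s (here refl) p) d)

    Increasing : Root → Set
    Increasing (a , b) = a < b × b < ℓ

    H-supported : Supported ψ → ∀ Ψ → (∀ {β} → β ∈ Ψ → Increasing β) →
      ∀ γ j → pairing (atLeast j) γ ℤ.< 0ℤ → ∀ d → H ψ Ψ γ d ≡ 0ℤ
    H-supported sψ Ψ inc γ j = H-vanish (λ γ → pairing (atLeast j) γ ℤ.< 0ℤ) (sψ _ j) Ψ step γ
      where
        step : ∀ {β} → β ∈ Ψ → ∀ {γ} → pairing (atLeast j) γ ℤ.< 0ℤ → pairing (atLeast j) (γ ⊕ root β) ℤ.< 0ℤ
        step {a , b} β∈ {γ} p with inc β∈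
        ... | a<b , b<ℓ rewrite pairing-root (atLeast j) γ (ℕₚ.<-trans a<b b<ℓ) b<ℓ =
          ℤₚ.≤-<-trans (ℤₚ.≤-trans (ℤₚ.+-monoʳ-≤ (pairing (atLeast j) γ)
             (ℤₚ.i≤j⇒i-j≤0 (atLeast-mono j (ℕₚ.<⇒≤ a<b)))) (ℤₚ.≤-reflexive (ℤₚ.+-identityʳ _))) p

  H-+ : ∀ φ ψ Ψ γ d → H (λ δ → φ δ ℤ.+ ψ δ) Ψ γ d ≡ H φ Ψ γ d ℤ.+ H ψ Ψ γ d
  H-+ φ ψ [] γ zero = refl
  H-+ φ ψ [] γ (suc d) = refl
  H-+ φ ψ (β ∷ Ψ) γ zero = H-+ φ ψ Ψ γ zero
  H-+ φ ψ (β ∷ Ψ) γ (suc d) =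
    ≡.trans (cong₂ ℤ._+_ (H-+ φ ψ Ψ γ (suc d)) (H-+ φ ψ (β ∷ Ψ) _ d)) (eq (H φ Ψ γ (suc d)) _ _ _)
    where
      eq : ∀ a b c d → (a ℤ.+ b) ℤ.+ (c ℤ.+ d) ≡ (a ℤ.+ c) ℤ.+ (b ℤ.+ d)
      eq = ℤ-ring

  H-neg : ∀ φ Ψ γ d → H (λ δ → ℤ.- φ δ) Ψ γ d ≡ ℤ.- H φ Ψ γ d
  H-neg φ [] γ zero = refl
  H-neg φ [] γ (suc d) = refl
  H-neg φ (β ∷ Ψ) γ zero = H-neg φ Ψ γ zero
  H-neg φ (β ∷ Ψ) γ (suc d) =
    ≡.trans (cong₂ ℤ._+_ (H-neg φ Ψ γ (suc d)) (H-neg φ (β ∷ Ψ) _ d)) (sym (ℤₚ.neg-distrib-+ (H φ Ψ γ (suc d)) _))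

  H-0 : ∀ Ψ γ d → H (λ _ → 0ℤ) Ψ γ d ≡ 0ℤ
  H-0 [] γ zero = refl
  H-0 [] γ (suc d) = refl
  H-0 (β ∷ Ψ) γ zero = H-0 Ψ γ zero
  H-0 (β ∷ Ψ) γ (suc d) = cong₂ ℤ._+_ (H-0 Ψ γ (suc d)) (H-0 (β ∷ Ψ) _ d)

  H-translate : ∀ {φ} → Congruent φ → ∀ η Ψ γ d → H (λ δ → φ (δ ⊖ η)) Ψ γ d ≡ H φ Ψ (γ ⊖ η) d
  H-translate c η [] γ zero = refl
  H-translate c η [] γ (suc d) = refl
  H-translate c η (β ∷ Ψ) γ zero = H-translate c η Ψ γ zero
  H-translate c η (β ∷ Ψ) γ (suc d) = cong₂ ℤ._+_ (H-translate c η Ψ γ (suc d))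
    (≡.trans (H-translate c η (β ∷ Ψ) _ d) (H-cong c (β ∷ Ψ) (λ j _ → eq (γ j) (root β j) (η j)) d))
    where
      eq : ∀ a b c → a ℤ.+ b ℤ.- c ≡ a ℤ.- c ℤ.+ b
      eq = ℤ-ring

-- Straightening of Catalan functions by one reflection

module Straightening (n ℓ : ℕ) where

  open Catalan ℓ

  -- `s` is an arbitrary map and not only a bead map: the shapes met during straightening need not
  -- come from cores, and only their roots and weights are used.
  Δ : (ℕ → ℕ) → List Root
  Δ s = filter (λ β → s (proj₁ β) ≤? proj₂ β) (cartesianProduct (upTo ℓ) (upTo ℓ))

  ∈Δ⁺ : ∀ s {i j} → i < ℓ → j < ℓ → s i ≤ j → (i , j) ∈ Δ s
  ∈Δ⁺ s i<ℓ j<ℓ p = ∈-filter⁺ _ (∈-cartesianProduct⁺ (∈-upTo⁺ i<ℓ) (∈-upTo⁺ j<ℓ)) p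

  ∈Δ⁻ : ∀ s {i j} → (i , j) ∈ Δ s → i < ℓ × j < ℓ × s i ≤ j
  ∈Δ⁻ s m with ∈-filter⁻ (λ β → s (proj₁ β) ≤? proj₂ β) {xs = cartesianProduct (upTo ℓ) (upTo ℓ)} m
  ... | m′ , p with ∈-cartesianProduct⁻ (upTo ℓ) (upTo ℓ) m′
  ...   | i∈ , j∈ = ∈-upTo⁻ i∈ , ∈-upTo⁻ j∈ , p

  Δ-unique : ∀ s → Unique (Δ s)
  Δ-unique s = Uniqueₚ.filter⁺ _ (Uniqueₚ.cartesianProduct⁺ (Uniqueₚ.upTo⁺ ℓ) (Uniqueₚ.upTo⁺ ℓ))

  ∷-unique : ∀ {α : Root} {Ψ} → ¬ (α ∈ Ψ) → Unique Ψ → Unique (α ∷ Ψ)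
  ∷-unique α∉ u = All.tabulate (λ β∈ e → α∉ (subst (_∈ _) (sym e) β∈)) AllPairs.∷ u

  stable⇒↭ : ∀ i {Ψ} → Unique Ψ → (∀ {β} → β ∈ Ψ → transposeRoot i β ∈ Ψ) → map (transposeRoot i) Ψ ↭ Ψ
  stable⇒↭ i {Ψ} u st = unique-⇔⇒↭ (Uniqueₚ.map⁺ inj u) u to from
    where
      inv : ∀ β → transposeRoot i (transposeRoot i β) ≡ β
      inv (a , b) = cong₂ _,_ (transpose-involutive i a) (transpose-involutive i b)
      inj : ∀ {α β} → transposeRoot i α ≡ transposeRoot i β → α ≡ β
      inj {α} {β} e = ≡.trans (sym (inv α)) (≡.trans (cong (transposeRoot i) e) (inv β))
      to : ∀ {β} → β ∈ map (transposeRoot i) Ψ → β ∈ Ψ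
      to m with ∈-map⁻ (transposeRoot i) m
      ... | α , α∈ , refl = st α∈
      from : ∀ {β} → β ∈ Ψ → β ∈ map (transposeRoot i) Ψ
      from {β} m = subst (_∈ map (transposeRoot i) Ψ) (inv β) (∈-map⁺ (transposeRoot i) (st m))

  wt : (ℕ → ℕ) → Weight
  wt s r = + (n ℕ.+ r) ℤ.- + s r

  S : Functional → (ℕ → ℕ) → ℕ → ℤ
  S ψ s = H ψ (Δ s) (wt s)

  module _ {ψ : Functional} (cψ : Congruent ψ) where

    S-cong : ∀ {s s′} → (∀ r → r < ℓ → s r ≡ s′ r) → ∀ d → S ψ s d ≡ S ψ s′ d
    S-cong {s} {s′} e d = ≡.trans
      (H-↭ cψ (unique-⇔⇒↭ (Δ-unique s) (Δ-unique s′) (to e) (to λ r r<ℓ → sym (e r r<ℓ))) (wt s) d)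
      (H-cong cψ (Δ s′) (λ r r<ℓ → cong (λ k → + (n ℕ.+ r) ℤ.- + k) (e r r<ℓ)) d)
      where
        to : ∀ {s s′} → (∀ r → r < ℓ → s r ≡ s′ r) → ∀ {β} → β ∈ Δ s → β ∈ Δ s′
        to {s} {s′} e m with ∈Δ⁻ s m
        ... | i<ℓ , j<ℓ , p = ∈Δ⁺ s′ i<ℓ j<ℓ (subst (_≤ _) (e _ i<ℓ) p)

    private
      -- Equal values of `s` on two neighbouring rows mean that the dot action of their
      -- transposition fixes the weight.
      wt-step : ∀ {s Z x} → s Z ≡ x → s (suc Z) ≡ x → wt s (suc Z) ≡ wt s Z ℤ.+ 1ℤ
      wt-step {s} {Z} {x} p q rewrite p | q | ℕₚ.+-suc n Z = eq (+ (n ℕ.+ Z)) (+ x)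
        where
          eq : ∀ a b → 1ℤ ℤ.+ a ℤ.- b ≡ a ℤ.- b ℤ.+ 1ℤ
          eq = ℤ-ring

    -- Rows Z and Z + 1 have the same roots because `s` agrees on them, and columns Z and Z + 1
    -- could differ only in a row sent to Z + 1. Without such a row the root set is stable and
    -- `H-fixed` applies. The bound `suc Z < x` excludes roots between the two rows themselves.
    straighten-zero : ∀ s {Z x} → suc Z < ℓ → Antisym ψ Z →
      s Z ≡ x → s (suc Z) ≡ x → suc Z < x → (∀ r → r < ℓ → s r ≢ suc Z) → ∀ d → S ψ s d ≡ 0ℤ
    straighten-zero s {Z} {x} sZ<ℓ aψ p q Z<x none =
      H-fixed cψ sZ<ℓ aψ (stable⇒↭ Z (Δ-unique s) st) (wt s) (wt-step {s} p q)
      where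
        st : ∀ {β} → β ∈ Δ s → transposeRoot Z β ∈ Δ s
        st {i , j} m with ∈Δ⁻ s m
        ... | i<ℓ , j<ℓ , r = ∈Δ⁺ s (transpose-< sZ<ℓ i<ℓ) (transpose-< sZ<ℓ j<ℓ) (go i<ℓ (position Z i) (position Z j) r)
          where
            go : ∀ {i j} → i < ℓ → Position Z i → Position Z j → s i ≤ j → s (transpose Z i) ≤ transpose Z j
            go i<ℓ fst fst r = ⊥-elim (ℕₚ.<⇒≱ Z<x (ℕₚ.≤-trans (subst (_≤ Z) p r) (ℕₚ.n≤1+n Z)))
            go i<ℓ fst snd r = ⊥-elim (ℕₚ.<⇒≱ Z<x (subst (_≤ suc Z) p r))
            go i<ℓ fst (else a b) r rewrite transpose-fst Z | transpose-else a b | p | q = r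
            go i<ℓ snd fst r = ⊥-elim (ℕₚ.<⇒≱ Z<x (ℕₚ.≤-trans (subst (_≤ Z) q r) (ℕₚ.n≤1+n Z)))
            go i<ℓ snd snd r = ⊥-elim (ℕₚ.<⇒≱ Z<x (subst (_≤ suc Z) q r))
            go i<ℓ snd (else a b) r rewrite transpose-snd Z | transpose-else a b | p | q = r
            go i<ℓ (else a b) fst r rewrite transpose-else a b | transpose-fst Z = ℕₚ.m≤n⇒m≤1+n r
            go {i} i<ℓ (else a b) snd r rewrite transpose-else a b | transpose-snd Z with s i <? suc Z
            ... | yes u = ℕₚ.≤-pred u
            ... | no u = ⊥-elim (none i i<ℓ (ℕₚ.≤-antisym r (ℕₚ.≮⇒≥ u)))
            go i<ℓ (else a b) (else c e) r rewrite transpose-else a b | transpose-else c e = r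

    private
      H-∷ : ∀ α Ψ γ d → H ψ (α ∷ Ψ) γ d ≡ H ψ Ψ γ d ℤ.+ (1 ▹ H ψ (α ∷ Ψ) (γ ⊕ root α)) d
      H-∷ α Ψ γ zero = sym (ℤₚ.+-identityʳ _)
      H-∷ α Ψ γ (suc d) = refl

      add-neg : ∀ a b → a ℤ.+ b ≡ 0ℤ → a ≡ ℤ.- b
      add-neg a b e = ≡.trans (eq a b) (≡.trans (cong (ℤ._- b) e) (ℤₚ.+-identityˡ _))
        where
          eq : ∀ a b → a ≡ a ℤ.+ b ℤ.- b
          eq = ℤ-ring

    -- Row y spoils the stability by one missing root, α = (y , Z). With it added, the set `Ψ⁺` is
    -- stable and gives 0 on the present weight, so S ψ s is -t times the value of `Ψ⁺` at the
    -- weight raised by α. Reflecting that weight absorbs the sign and produces `wt s′`; it remains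
    -- to exchange `Ψ⁺` for `Δ s′`.
    straighten : ∀ s s′ {Z x y} → suc Z < ℓ → Antisym ψ Z →
      s Z ≡ x → s (suc Z) ≡ x → suc Z < x →
      y < ℓ → s y ≡ suc Z → (∀ r → r < ℓ → s r ≡ suc Z → r ≡ y) →
      s′ y ≡ Z → s′ (suc Z) ≡ suc x → (∀ r → r ≢ y → r ≢ suc Z → s′ r ≡ s r) →
      ∀ d → S ψ s d ≡ (1 ▹ S ψ s′) d
    straighten s s′ {Z} {x} {y} sZ<ℓ aψ p q Z<x y<ℓ sy uniq s′y s′Z s′r = main
      where
        α : Root
        α = y , Z

        Ψ⁺ : List Root
        Ψ⁺ = α ∷ Δ s

        Z<ℓ : Z < ℓ
        Z<ℓ = ℕₚ.<-trans (ℕₚ.n<1+n Z) sZ<ℓ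

        y≢Z : y ≢ Z
        y≢Z refl = ℕₚ.<⇒≢ Z<x (≡.trans (sym sy) p)

        y≢sZ : y ≢ suc Z
        y≢sZ refl = ℕₚ.<⇒≢ Z<x (≡.trans (sym sy) q)

        s′Z′ : s′ Z ≡ x
        s′Z′ = ≡.trans (s′r Z (y≢Z ∘ sym) (ℕₚ.1+n≢n ∘ sym)) p

        In : ℕ → ℕ → Set
        In i j = s i ≤ j ⊎ (i ≡ y × j ≡ Z)

        in⁺ : ∀ {i j} → i < ℓ → j < ℓ → In i j → (i , j) ∈ Ψ⁺
        in⁺ i<ℓ j<ℓ (inj₁ u) = there (∈Δ⁺ s i<ℓ j<ℓ u)
        in⁺ i<ℓ j<ℓ (inj₂ (refl , refl)) = here refl

        in⁻ : ∀ {i j} → (i , j) ∈ Ψ⁺ → i < ℓ × j < ℓ × In i j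
        in⁻ (here refl) = y<ℓ , Z<ℓ , inj₂ (refl , refl)
        in⁻ (there m) with ∈Δ⁻ s m
        ... | i<ℓ , j<ℓ , u = i<ℓ , j<ℓ , inj₁ u

        Ψ⁺-unique : Unique Ψ⁺
        Ψ⁺-unique = ∷-unique (λ m → ℕₚ.<⇒≱ (ℕₚ.n<1+n Z) (subst (_≤ Z) sy (proj₂ (proj₂ (∈Δ⁻ s m))))) (Δ-unique s)

        In-stable : ∀ {i j} → i < ℓ → Position Z i → Position Z j → In i j → In (transpose Z i) (transpose Z j)
        In-stable i<ℓ fst _ (inj₂ (i≡y , _)) = ⊥-elim (y≢Z (sym i≡y))
        In-stable i<ℓ snd _ (inj₂ (i≡y , _)) = ⊥-elim (y≢sZ (sym i≡y))
        In-stable i<ℓ (else a b) _ (inj₂ (refl , refl))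
          rewrite transpose-else a b | transpose-fst Z = inj₁ (ℕₚ.≤-reflexive sy)
        In-stable i<ℓ fst fst (inj₁ r) = ⊥-elim (ℕₚ.<⇒≱ Z<x (ℕₚ.≤-trans (subst (_≤ Z) p r) (ℕₚ.n≤1+n Z)))
        In-stable i<ℓ fst snd (inj₁ r) = ⊥-elim (ℕₚ.<⇒≱ Z<x (subst (_≤ suc Z) p r))
        In-stable i<ℓ fst (else a b) (inj₁ r) rewrite transpose-fst Z | transpose-else a b | p | q = inj₁ r
        In-stable i<ℓ snd fst (inj₁ r) = ⊥-elim (ℕₚ.<⇒≱ Z<x (ℕₚ.≤-trans (subst (_≤ Z) q r) (ℕₚ.n≤1+n Z)))
        In-stable i<ℓ snd snd (inj₁ r) = ⊥-elim (ℕₚ.<⇒≱ Z<x (subst (_≤ suc Z) q r))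
        In-stable i<ℓ snd (else a b) (inj₁ r) rewrite transpose-snd Z | transpose-else a b | p | q = inj₁ r
        In-stable i<ℓ (else a b) fst (inj₁ r) rewrite transpose-else a b | transpose-fst Z = inj₁ (ℕₚ.m≤n⇒m≤1+n r)
        In-stable {i} i<ℓ (else a b) snd (inj₁ r) rewrite transpose-else a b | transpose-snd Z with s i <? suc Z
        ... | yes u = inj₁ (ℕₚ.≤-pred u)
        ... | no u = inj₂ (uniq i i<ℓ (ℕₚ.≤-antisym r (ℕₚ.≮⇒≥ u)) , refl)
        In-stable i<ℓ (else a b) (else c e) (inj₁ r) rewrite transpose-else a b | transpose-else c e = inj₁ r

        stable : map (transposeRoot Z) Ψ⁺ ↭ Ψ⁺
        stable = stable⇒↭ Z Ψ⁺-unique st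
          where
            st : ∀ {β} → β ∈ Ψ⁺ → transposeRoot Z β ∈ Ψ⁺
            st {i , j} m with in⁻ m
            ... | i<ℓ , j<ℓ , r =
              in⁺ (transpose-< sZ<ℓ i<ℓ) (transpose-< sZ<ℓ j<ℓ) (In-stable i<ℓ (position Z i) (position Z j) r)

        H⁺≡0 : ∀ γ → γ (suc Z) ≡ γ Z ℤ.+ 1ℤ → ∀ d → H ψ Ψ⁺ γ d ≡ 0ℤ
        H⁺≡0 = H-fixed cψ sZ<ℓ aψ stable

        reflected : dot Z (wt s ⊕ root α) ≈ wt s′
        reflected j _ with position Z j
        ... | fst rewrite dot-fst Z (wt s ⊕ root α) | ind-diff y≢sZ | ind-diff {Z} {suc Z} (ℕₚ.1+n≢n ∘ sym)
              | wt-step {s} p q | p | s′Z′ = eq (+ (n ℕ.+ Z) ℤ.- + x)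
          where
            eq : ∀ a → a ℤ.+ 1ℤ ℤ.+ (0ℤ ℤ.- 0ℤ) ℤ.- 1ℤ ≡ a
            eq = ℤ-ring
        ... | snd rewrite dot-snd Z (wt s ⊕ root α) | ind-diff y≢Z | ind-same Z | p | s′Z | ℕₚ.+-suc n Z = eq (+ (n ℕ.+ Z)) (+ x)
          where
            eq : ∀ a b → a ℤ.- b ℤ.+ (0ℤ ℤ.- 1ℤ) ℤ.+ 1ℤ ≡ 1ℤ ℤ.+ a ℤ.- (1ℤ ℤ.+ b)
            eq = ℤ-ring
        ... | else a b rewrite dot-else (wt s ⊕ root α) a b | ind-diff {Z} {j} (a ∘ sym) with j ≟ y
        ...   | yes refl rewrite ind-same y | sy | s′y = eq (+ (n ℕ.+ y)) (+ Z)
          where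
            eq : ∀ a b → a ℤ.- (1ℤ ℤ.+ b) ℤ.+ (1ℤ ℤ.- 0ℤ) ≡ a ℤ.- b
            eq = ℤ-ring
        ...   | no j≢y rewrite ind-diff {y} {j} (j≢y ∘ sym) | s′r j j≢y b = ℤₚ.+-identityʳ _

        S-suc : ∀ d → S ψ s (suc d) ≡ H ψ Ψ⁺ (wt s′) d
        S-suc d = ≡.trans (add-neg (S ψ s (suc d)) (H ψ Ψ⁺ (wt s ⊕ root α) d) (H⁺≡0 (wt s) (wt-step {s} p q) (suc d)))
          (≡.trans (sym (H-dot cψ sZ<ℓ aψ stable _ d)) (H-cong cψ Ψ⁺ reflected d))

        -- `s′` has moved row Z + 1 from x to x + 1, so for x < ℓ this is the one root of `Ψ⁺` that
        -- `Δ s′` lacks. Raising `wt s′` by it gives a fixed weight again, so its contribution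
        -- vanishes.
        δ : Root
        δ = suc Z , x

        x≢sZ : x ≢ suc Z
        x≢sZ e = ℕₚ.<⇒≢ Z<x (sym e)

        x≢Z : x ≢ Z
        x≢Z e = ℕₚ.<⇒≢ (ℕₚ.<-trans (ℕₚ.n<1+n Z) Z<x) (sym e)

        wt′δ : (wt s′ ⊕ root δ) (suc Z) ≡ (wt s′ ⊕ root δ) Z ℤ.+ 1ℤ
        wt′δ rewrite ind-same (suc Z) | ind-diff x≢sZ | ind-diff x≢Z | ind-diff {suc Z} {Z} ℕₚ.1+n≢n
          | s′Z | s′Z′ | ℕₚ.+-suc n Z = eq (+ (n ℕ.+ Z)) (+ x)
          where
            eq : ∀ a b → 1ℤ ℤ.+ a ℤ.- (1ℤ ℤ.+ b) ℤ.+ (1ℤ ℤ.- 0ℤ) ≡ a ℤ.- b ℤ.+ (0ℤ ℤ.- 0ℤ) ℤ.+ 1ℤ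
            eq = ℤ-ring

        In⇒ : ∀ {i j} → In i j → s′ i ≤ j ⊎ (i ≡ suc Z × j ≡ x)
        In⇒ (inj₂ (refl , refl)) = inj₁ (ℕₚ.≤-reflexive s′y)
        In⇒ {i} {j} (inj₁ r) with i ≟ y | i ≟ suc Z | j ≟ x
        ... | yes refl | _ | _ = inj₁ (ℕₚ.≤-trans (ℕₚ.≤-reflexive s′y) (ℕₚ.≤-trans (ℕₚ.n≤1+n Z) (subst (_≤ j) sy r)))
        ... | no _ | yes refl | yes refl = inj₂ (refl , refl)
        ... | no _ | yes refl | no j≢x = inj₁ (subst (_≤ j) (sym s′Z) (ℕₚ.≤∧≢⇒< (subst (_≤ j) q r) (j≢x ∘ sym)))
        ... | no a | no b | _ = inj₁ (subst (_≤ j) (sym (s′r i a b)) r)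

        ⇒In : ∀ {i j} → s′ i ≤ j ⊎ (i ≡ suc Z × j ≡ x) → In i j
        ⇒In (inj₂ (refl , refl)) = inj₁ (ℕₚ.≤-reflexive q)
        ⇒In {i} {j} (inj₁ r) with i ≟ y | i ≟ suc Z | j ≟ Z
        ... | yes refl | _ | yes refl = inj₂ (refl , refl)
        ... | yes refl | _ | no j≢Z = inj₁ (subst (_≤ j) (sym sy) (ℕₚ.≤∧≢⇒< (subst (_≤ j) s′y r) (j≢Z ∘ sym)))
        ... | no _ | yes refl | _ = inj₁ (subst (_≤ j) (sym q) (ℕₚ.≤-trans (ℕₚ.n≤1+n x) (subst (_≤ j) s′Z r)))
        ... | no a | no b | _ = inj₁ (subst (_≤ j) (s′r i a b) r)

        H⁺ : ∀ d → H ψ Ψ⁺ (wt s′) d ≡ S ψ s′ d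
        H⁺ d with x <? ℓ
        ... | no x≮ℓ = H-↭ cψ (unique-⇔⇒↭ Ψ⁺-unique (Δ-unique s′) to from) (wt s′) d
          where
            to : ∀ {β} → β ∈ Ψ⁺ → β ∈ Δ s′
            to m with in⁻ m
            ... | i<ℓ , j<ℓ , r with In⇒ r
            ...   | inj₁ u = ∈Δ⁺ s′ i<ℓ j<ℓ u
            ...   | inj₂ (_ , refl) = ⊥-elim (x≮ℓ j<ℓ)
            from : ∀ {β} → β ∈ Δ s′ → β ∈ Ψ⁺
            from m with ∈Δ⁻ s′ m
            ... | i<ℓ , j<ℓ , r = in⁺ i<ℓ j<ℓ (⇒In (inj₁ r))
        ... | yes x<ℓ = begin
          H ψ Ψ⁺ (wt s′) d ≡⟨ H-↭ cψ perm (wt s′) d ⟩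
          H ψ (δ ∷ Δ s′) (wt s′) d ≡⟨ H-∷ δ (Δ s′) (wt s′) d ⟩
          S ψ s′ d ℤ.+ (1 ▹ H ψ (δ ∷ Δ s′) (wt s′ ⊕ root δ)) d
            ≡⟨ cong (λ z → S ψ s′ d ℤ.+ z) (≡.trans (▹-cong 1 (λ e → ≡.trans (sym (H-↭ cψ perm _ e)) (H⁺≡0 _ wt′δ e)) d) (▹-zero 1 d)) ⟩
          S ψ s′ d ℤ.+ 0ℤ ≡⟨ ℤₚ.+-identityʳ _ ⟩
          S ψ s′ d ∎
          where
            open ≡-Reasoning
            δ∉ : ¬ (δ ∈ Δ s′)
            δ∉ m = ℕₚ.<⇒≱ (ℕₚ.n<1+n x) (subst (_≤ x) s′Z (proj₂ (proj₂ (∈Δ⁻ s′ m))))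
            to : ∀ {β} → β ∈ Ψ⁺ → β ∈ δ ∷ Δ s′
            to m with in⁻ m
            ... | i<ℓ , j<ℓ , r with In⇒ r
            ...   | inj₁ u = there (∈Δ⁺ s′ i<ℓ j<ℓ u)
            ...   | inj₂ (refl , refl) = here refl
            from : ∀ {β} → β ∈ δ ∷ Δ s′ → β ∈ Ψ⁺
            from (here refl) = in⁺ sZ<ℓ x<ℓ (⇒In (inj₂ (refl , refl)))
            from (there m) with ∈Δ⁻ s′ m
            ... | i<ℓ , j<ℓ , r = in⁺ i<ℓ j<ℓ (⇒In (inj₁ r))
            perm : Ψ⁺ ↭ δ ∷ Δ s′
            perm = unique-⇔⇒↭ Ψ⁺-unique (∷-unique δ∉ (Δ-unique s′)) to from

        main : ∀ d → S ψ s d ≡ (1 ▹ S ψ s′) d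
        main zero = H⁺≡0 (wt s) (wt-step {s} p q) zero
        main (suc d) = ≡.trans (S-suc d) (H⁺ d)

    module _ (s s⁺ : ℕ → ℕ) {z} (z<ℓ : z < ℓ) (s⁺z : s⁺ z ≡ suc (s z)) (s⁺r : ∀ r → r ≢ z → s⁺ r ≡ s r) where

      private
        lowered : wt s ⊖ ind z ≈ wt s⁺
        lowered j _ with j ≟ z
        ... | yes refl rewrite ind-same z | s⁺z = eq (+ (n ℕ.+ z)) (+ s z)
          where
            eq : ∀ a b → a ℤ.- b ℤ.- 1ℤ ≡ a ℤ.- (1ℤ ℤ.+ b)
            eq = ℤ-ring
        ... | no j≢z rewrite ind-diff {z} {j} (j≢z ∘ sym) | s⁺r j j≢z = ℤₚ.+-identityʳ _

        ⊆ : ∀ {β} → β ∈ Δ s⁺ → β ∈ Δ s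
        ⊆ {i , j} m with ∈Δ⁻ s⁺ m
        ... | i<ℓ , j<ℓ , r with i ≟ z
        ...   | yes refl = ∈Δ⁺ s i<ℓ j<ℓ (ℕₚ.≤-trans (ℕₚ.n≤1+n _) (subst (_≤ j) s⁺z r))
        ...   | no i≢z = ∈Δ⁺ s i<ℓ j<ℓ (subst (_≤ j) (s⁺r i i≢z) r)

      lower-last : ℓ ≤ s z → ∀ d → H ψ (Δ s) (wt s ⊖ ind z) d ≡ S ψ s⁺ d
      lower-last ℓ≤sz d = ≡.trans (H-↭ cψ (unique-⇔⇒↭ (Δ-unique s) (Δ-unique s⁺) to ⊆) _ d) (H-cong cψ (Δ s⁺) lowered d)
        where
          to : ∀ {β} → β ∈ Δ s → β ∈ Δ s⁺
          to {i , j} m with ∈Δ⁻ s m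
          ... | i<ℓ , j<ℓ , r with i ≟ z
          ...   | yes refl = ⊥-elim (ℕₚ.<⇒≱ j<ℓ (ℕₚ.≤-trans ℓ≤sz r))
          ...   | no i≢z = ∈Δ⁺ s⁺ i<ℓ j<ℓ (subst (_≤ j) (sym (s⁺r i i≢z)) r)

      -- Raising s z by one removes the single root (z , s z). Expanding along it replaces the
      -- lowering in row z by a lowering in row s z at the price of one factor t: the lowering
      -- travels along the orbit of the bead map. This is the source of N in the spin.
      lower-step : s z < ℓ → ∀ d →
        H ψ (Δ s) (wt s ⊖ ind z) d ≡ S ψ s⁺ d ℤ.+ (1 ▹ H ψ (Δ s) (wt s ⊖ ind (s z))) d
      lower-step sz<ℓ d = begin
        H ψ (Δ s) (wt s ⊖ ind z) d ≡⟨ H-↭ cψ perm _ d ⟩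
        H ψ (β ∷ Δ s⁺) (wt s ⊖ ind z) d ≡⟨ H-∷ β (Δ s⁺) _ d ⟩
        H ψ (Δ s⁺) (wt s ⊖ ind z) d ℤ.+ (1 ▹ H ψ (β ∷ Δ s⁺) (wt s ⊖ ind z ⊕ root β)) d
          ≡⟨ cong₂ ℤ._+_ (H-cong cψ (Δ s⁺) lowered d)
              (▹-cong 1 (λ e → ≡.trans (sym (H-↭ cψ perm _ e)) (H-cong cψ (Δ s) (λ j _ → eq (wt s j) (ind z j) (ind (s z) j)) e)) d) ⟩
        S ψ s⁺ d ℤ.+ (1 ▹ H ψ (Δ s) (wt s ⊖ ind (s z))) d ∎
        where
          open ≡-Reasoning
          β : Root
          β = z , s z
          eq : ∀ a b c → a ℤ.- b ℤ.+ (b ℤ.- c) ≡ a ℤ.- c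
          eq = ℤ-ring
          β∉ : ¬ (β ∈ Δ s⁺)
          β∉ m = ℕₚ.<⇒≱ (ℕₚ.n<1+n (s z)) (subst (_≤ s z) s⁺z (proj₂ (proj₂ (∈Δ⁻ s⁺ m))))
          to : ∀ {α} → α ∈ Δ s → α ∈ β ∷ Δ s⁺
          to {i , j} m with ∈Δ⁻ s m
          ... | i<ℓ , j<ℓ , r with i ≟ z | j ≟ s z
          ...   | yes refl | yes refl = here refl
          ...   | yes refl | no j≢ = there (∈Δ⁺ s⁺ i<ℓ j<ℓ (subst (_≤ j) (sym s⁺z) (ℕₚ.≤∧≢⇒< r (j≢ ∘ sym))))
          ...   | no i≢z | _ = there (∈Δ⁺ s⁺ i<ℓ j<ℓ (subst (_≤ j) (sym (s⁺r i i≢z)) r))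
          from : ∀ {α} → α ∈ β ∷ Δ s⁺ → α ∈ Δ s
          from (here refl) = ∈Δ⁺ s z<ℓ sz<ℓ ℕₚ.≤-refl
          from (there m) = ⊆ m
          perm : Δ s ↭ β ∷ Δ s⁺
          perm = unique-⇔⇒↭ (Δ-unique s) (∷-unique β∉ (Δ-unique s⁺)) to from

-- Ladders of rows

iter : (ℕ → ℕ) → ℕ → ℕ → ℕ
iter d zero r = r
iter d (suc e) r = iter d e (d r)

iter-shift : ∀ d e r → iter d e (d r) ≡ d (iter d e r)
iter-shift d zero r = refl
iter-shift d (suc e) r = iter-shift d e (d r)

module Ladders (d : ℕ → ℕ) (d-mono : ∀ {r s} → r < s → d r < d s) (d> : ∀ r → r < d r) where

  d-inj : ∀ {r s} → d r ≡ d s → r ≡ s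
  d-inj {r} {s} e with ℕₚ.<-cmp r s
  ... | tri< r<s _ _ = ⊥-elim (ℕₚ.<⇒≢ (d-mono r<s) e)
  ... | tri≈ _ r≡s _ = r≡s
  ... | tri> _ _ s<r = ⊥-elim (ℕₚ.<⇒≢ (d-mono s<r) (sym e))

  d-reflect : ∀ {r s} → d r < d s → r < s
  d-reflect {r} {s} p with ℕₚ.<-cmp r s
  ... | tri< r<s _ _ = r<s
  ... | tri≈ _ refl _ = ⊥-elim (ℕₚ.<-irrefl refl p)
  ... | tri> _ _ s<r = ⊥-elim (ℕₚ.<-asym p (d-mono s<r))

  d-mono-≤ : ∀ {r s} → r ≤ s → d r ≤ d s
  d-mono-≤ {r} {s} p with ℕₚ.m≤n⇒m<n∨m≡n p
  ... | inj₁ r<s = ℕₚ.<⇒≤ (d-mono r<s)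
  ... | inj₂ refl = ℕₚ.≤-refl

  d-consecutive : ∀ {r s v} → d r ≡ v → d s ≡ suc v → s ≡ suc r
  d-consecutive {r} {s} {v} p q = ℕₚ.≤-antisym (ℕₚ.≮⇒≥ no-gap) (d-reflect (subst₂ _<_ (sym p) (sym q) (ℕₚ.n<1+n v)))
    where
      no-gap : ¬ (suc r < s)
      no-gap sr<s = ℕₚ.<⇒≱ (subst₂ _<_ refl q (d-mono sr<s)) (subst (_< d (suc r)) p (d-mono (ℕₚ.n<1+n r)))

  preimage : ∀ v → (∃ λ r → d r ≡ v) ⊎ (∀ r → d r ≢ v)
  preimage v with ℕₚ.anyUpTo? (λ r → d r ≟ v) v
  ... | yes (r , _ , e) = inj₁ (r , e)
  ... | no none = inj₂ λ r e → none (r , subst (r <_) e (d> r) , e)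

  iter-≤ : ∀ e r → r ≤ iter d e r
  iter-≤ zero r = ℕₚ.≤-refl
  iter-≤ (suc e) r = ℕₚ.≤-trans (ℕₚ.<⇒≤ (d> r)) (iter-≤ e (d r))

  -- Ladder g z c y: the rows z, …, z + g are the lowest of c translates under inverse images of d;
  -- the top translate Z, …, Z + g has no preimage of Z while y, …, y + g − 1 map to Z + 1, …, Z + g.
  data Ladder (g : ℕ) : ℕ → ℕ → ℕ → Set where
    top : ∀ {z y} → (∀ r → d r ≢ z) → (∀ i → i < g → d (y ℕ.+ i) ≡ suc (z ℕ.+ i)) → Ladder g z 1 y
    up : ∀ {z z′ c y} → (∀ i → i ≤ g → d (z′ ℕ.+ i) ≡ z ℕ.+ i) → Ladder g z′ c y → Ladder g z (suc c) y

  -- The obstruction to widening a ladder by one row: climbing with the wider block leads to a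
  -- translate whose next row z + g + 1 is the image of no row.
  data Blocked (g y : ℕ) : ℕ → Set where
    stop : ∀ {z c} → Ladder g z c y → (∀ r → d r ≢ suc (z ℕ.+ g)) → Blocked g y z
    up : ∀ {z z′} → (∀ i → i ≤ suc g → d (z′ ℕ.+ i) ≡ z ℕ.+ i) → Blocked g y z′ → Blocked g y z

  ladder-row : ∀ {z′ z} → d (z′ ℕ.+ 0) ≡ z ℕ.+ 0 → d z′ ≡ z
  ladder-row {z′} {z} e rewrite ℕₚ.+-identityʳ z′ | ℕₚ.+-identityʳ z = e

  row-+1 : ∀ {z′ z g} → d (z′ ℕ.+ suc g) ≡ z ℕ.+ suc g → d (suc (z′ ℕ.+ g)) ≡ suc (z ℕ.+ g)
  row-+1 {z′} {z} {g} e rewrite ℕₚ.+-suc z′ g | ℕₚ.+-suc z g = e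

  above : ∀ {z′ z} → d z′ ≡ z → z′ < z
  above {z′} e = subst (z′ <_) e (d> z′)

  ladder-top-≤ : ∀ {g z c y} → Ladder g z c y → ∀ i → i < g → d (y ℕ.+ i) ≤ suc (z ℕ.+ i)
  ladder-top-≤ (top _ t) i i<g = ℕₚ.≤-reflexive (t i i<g)
  ladder-top-≤ (up f L) i i<g =
    ℕₚ.≤-trans (ladder-top-≤ L i i<g) (s≤s (ℕₚ.+-monoˡ-≤ i (ℕₚ.<⇒≤ (above (ladder-row (f 0 z≤n))))))

  ladder-weaken : ∀ {g g′ z c y} → g ≤ g′ → Ladder g′ z c y → Ladder g z c y
  ladder-weaken g≤g′ (top n t) = top n λ i i<g → t i (ℕₚ.<-≤-trans i<g g≤g′)
  ladder-weaken g≤g′ (up f L) = up (λ i i≤g → f i (ℕₚ.≤-trans i≤g g≤g′)) (ladder-weaken g≤g′ L)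

  blocked-top-≤ : ∀ {g z y} → Blocked g y z → ∀ i → i < g → d (y ℕ.+ i) ≤ suc (z ℕ.+ i)
  blocked-top-≤ (stop L _) = ladder-top-≤ L
  blocked-top-≤ (up f B) i i<g =
    ℕₚ.≤-trans (blocked-top-≤ B i i<g) (s≤s (ℕₚ.+-monoˡ-≤ i (ℕₚ.<⇒≤ (above (ladder-row (f 0 z≤n))))))

  blocked-¬ladder : ∀ {g z y c y′} → Blocked g y z → ¬ Ladder (suc g) z c y′
  blocked-¬ladder {g} (stop _ none) (top _ t) = none _ (t g (ℕₚ.n<1+n g))
  blocked-¬ladder {g} (stop {z} _ none) (up f _) = none _ (≡.trans (f (suc g) ℕₚ.≤-refl) (ℕₚ.+-suc z g))
  blocked-¬ladder (up f B) (top none _) = none _ (ladder-row (f 0 z≤n))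
  blocked-¬ladder (up f B) (up f′ L)
    with d-inj (≡.trans (ladder-row (f 0 z≤n)) (sym (ladder-row (f′ 0 z≤n))))
  ... | refl = blocked-¬ladder B L

  ladder-start : ∀ fuel z → z < fuel → ∃ λ c → ∃ λ y → Ladder 0 z c y
  ladder-start (suc fuel) z z<f with preimage z
  -- With g = 0 there are no apex rows, so the value 0 for y is arbitrary.
  ... | inj₂ none = 1 , 0 , top none λ i ()
  ... | inj₁ (z′ , e) with ladder-start fuel z′ (ℕₚ.<-≤-trans (above e) (ℕₚ.≤-pred z<f))
  ...   | c , y , L = suc c , y , up (λ { .0 z≤n → subst₂ (λ a b → d a ≡ b) (sym (ℕₚ.+-identityʳ z′)) (sym (ℕₚ.+-identityʳ z)) e }) L

  extend-range : ∀ {P : ℕ → Set} g → (∀ i → i ≤ g → P i) → P (suc g) → ∀ i → i ≤ suc g → P i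
  extend-range g f p i i≤ with ℕₚ.m≤n⇒m<n∨m≡n i≤
  ... | inj₁ (s≤s i≤g) = f i i≤g
  ... | inj₂ refl = p

  -- The apex is determined only once g > 0; when g = 0 it is chosen here, as the preimage of z + 1.
  top-extend : ∀ g {z y w} → (∀ r → d r ≢ z) → (∀ i → i < g → d (y ℕ.+ i) ≡ suc (z ℕ.+ i)) → d w ≡ suc (z ℕ.+ g) →
    ∃ λ y′ → Ladder (suc g) z 1 y′ × (0 < g → y′ ≡ y)
  top-extend zero {z} {y} {w} none t e =
    w , top none (λ { .0 (s≤s z≤n) → subst (λ a → d a ≡ suc (z ℕ.+ 0)) (sym (ℕₚ.+-identityʳ w)) e }) , λ ()
  top-extend (suc h) {z} {y} {w} none t e = y , top none range , λ _ → refl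
    where
      w≡ : w ≡ y ℕ.+ suc h
      w≡ = ≡.trans (d-consecutive (t h (ℕₚ.n<1+n h)) (≡.trans e (cong suc (ℕₚ.+-suc z h)))) (sym (ℕₚ.+-suc y h))
      range : ∀ i → i < suc (suc h) → d (y ℕ.+ i) ≡ suc (z ℕ.+ i)
      range i i< with ℕₚ.m≤n⇒m<n∨m≡n (ℕₚ.≤-pred i<)
      ... | inj₁ i<h = t i i<h
      ... | inj₂ refl = subst (λ a → d a ≡ suc (z ℕ.+ suc h)) w≡ e

  -- The next row of a translate is either hit, and below the summit then by the row that follows
  -- the translate above it because d is increasing, or it is not hit and the ladder is blocked
  -- there.
  ladder-extend : ∀ {g z c y} → Ladder g z c y →
    (∃ λ y′ → Ladder (suc g) z c y′ × (0 < g → y′ ≡ y)) ⊎ Blocked g y z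
  ladder-extend {g} {z} {c} {y} L@(top none t) with preimage (suc (z ℕ.+ g))
  ... | inj₂ none′ = inj₂ (stop L none′)
  ... | inj₁ (w , e) = inj₁ (top-extend g none t e)
  ladder-extend {g} {z} L@(up {z′ = z′} f L′) with preimage (suc (z ℕ.+ g))
  ... | inj₂ none = inj₂ (stop L none)
  ... | inj₁ (w , e) with ladder-extend L′
  ...   | inj₁ (y′ , L″ , k) = inj₁ (y′ , up f′ L″ , k)
    where
      f′ = extend-range {λ i → d (z′ ℕ.+ i) ≡ z ℕ.+ i} g f
        (subst₂ (λ a b → d a ≡ b) (≡.trans (d-consecutive (f g ℕₚ.≤-refl) e) (sym (ℕₚ.+-suc z′ g))) (sym (ℕₚ.+-suc z g)) e)
  ...   | inj₂ B = inj₂ (up f′ B)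
    where
      f′ = extend-range {λ i → d (z′ ℕ.+ i) ≡ z ℕ.+ i} g f
        (subst₂ (λ a b → d a ≡ b) (≡.trans (d-consecutive (f g ℕₚ.≤-refl) e) (sym (ℕₚ.+-suc z′ g))) (sym (ℕₚ.+-suc z g)) e)

  -- If the two translates overlapped, z would be z′ + i for some i ≤ g, so d z = z + i would lie
  -- inside the block, against the gap. Hence disjointness has to be tested only at the bottom of a
  -- ladder.
  gap-up : ∀ {g z z′} → (∀ i → i ≤ g → d (z′ ℕ.+ i) ≡ z ℕ.+ i) → z ℕ.+ g < d z → z′ ℕ.+ g < z
  gap-up {g} {z} {z′} f gap with z′ ℕ.+ g <? z
  ... | yes p = p
  ... | no p = ⊥-elim (ℕₚ.<⇒≱ gap (subst (_≤ z ℕ.+ g) (sym dz) (ℕₚ.+-monoʳ-≤ z i≤g)))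
    where
      z′<z = above (ladder-row (f 0 z≤n))
      i = z ℕ.∸ z′
      z≡ : z′ ℕ.+ i ≡ z
      z≡ = ℕₚ.m+[n∸m]≡n (ℕₚ.<⇒≤ z′<z)
      i≤g : i ≤ g
      i≤g = ℕₚ.≤-trans (ℕₚ.∸-monoˡ-≤ z′ (ℕₚ.≮⇒≥ p)) (ℕₚ.≤-reflexive (ℕₚ.m+n∸m≡n z′ g))
      dz : d z ≡ z ℕ.+ i
      dz = ≡.trans (cong d (sym z≡)) (f i i≤g)

  range-out : ∀ {g y r} → y ≤ r → (∀ i → i < g → r ≢ y ℕ.+ i) → ¬ (r < y ℕ.+ g)
  range-out {g} {y} {r} y≤r q r< =
    q (r ℕ.∸ y) (ℕₚ.+-cancelˡ-< y _ _ (subst (_< y ℕ.+ g) (sym (ℕₚ.m+[n∸m]≡n y≤r)) r<)) (sym (ℕₚ.m+[n∸m]≡n y≤r))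

  abstract

    -- The bead map after a ribbon is removed from every translate. Inner translates move together
    -- with their images, so only the two ends change: the lowest block is sent one row further, and
    -- the rows that met Z + 1, ..., Z + g in the top translate now meet Z, ..., Z + g - 1.
    covered : ℕ → ℕ → ℕ → ℕ → ℕ
    covered g z y r =
      if does (z ≤? r) then (if does (r ≤? z ℕ.+ g) then suc (d r) else d r)
      else (if does (y ≤? r) then (if does (r <? y ℕ.+ g) then ℕ.pred (d r) else d r) else d r)

    covered-low : ∀ {g z y r} → z ≤ r → r ≤ z ℕ.+ g → covered g z y r ≡ suc (d r)
    covered-low {g} {z} {y} {r} p q rewrite dec-true (z ≤? r) p | dec-true (r ≤? z ℕ.+ g) q = refl

    covered-top : ∀ {g z y} i → i < g → y ℕ.+ i < z → suc (covered g z y (y ℕ.+ i)) ≡ d (y ℕ.+ i)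
    covered-top {g} {z} {y} i i<g p
      rewrite dec-false (z ≤? y ℕ.+ i) (ℕₚ.<⇒≱ p) | dec-true (y ≤? y ℕ.+ i) (ℕₚ.m≤m+n y i)
        | dec-true (y ℕ.+ i <? y ℕ.+ g) (ℕₚ.+-monoʳ-< y i<g) = ℕₚ.suc-pred (d (y ℕ.+ i)) {{ℕ.>-nonZero (ℕₚ.≤-<-trans z≤n (d> (y ℕ.+ i)))}}

    covered-below : ∀ {g z y r} → z ℕ.+ g < r → covered g z y r ≡ d r
    covered-below {g} {z} {y} {r} p
      rewrite dec-true (z ≤? r) (ℕₚ.≤-trans (ℕₚ.m≤m+n z g) (ℕₚ.<⇒≤ p)) | dec-false (r ≤? z ℕ.+ g) (ℕₚ.<⇒≱ p) = refl

    covered-else : ∀ {g z y r} → r < z → (∀ i → i < g → r ≢ y ℕ.+ i) → covered g z y r ≡ d r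
    covered-else {g} {z} {y} {r} p q rewrite dec-false (z ≤? r) (ℕₚ.<⇒≱ p) with y ≤? r
    ... | no y≰r rewrite dec-false (y ≤? r) y≰r = refl
    ... | yes y≤r rewrite dec-true (y ≤? r) y≤r | dec-false (r <? y ℕ.+ g) (range-out y≤r q) = refl

  -- In terms of 𝔭, the entries in rows z, ..., z + g are equal and the next one differs. Nothing is
  -- asked of the row above z.
  record Block (z g : ℕ) : Set where
    field
      equal : ∀ i → i ≤ g → d (z ℕ.+ i) ≡ d z ℕ.+ i
      maximal : d (z ℕ.+ suc g) ≢ d z ℕ.+ suc g

  block-unique : ∀ {z g g′} → Block z g → Block z g′ → g ≡ g′
  block-unique {z} {g} {g′} B B′ with ℕₚ.<-cmp g g′
  ... | tri< p _ _ = ⊥-elim (Block.maximal B (Block.equal B′ (suc g) p))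
  ... | tri≈ _ e _ = e
  ... | tri> _ _ p = ⊥-elim (Block.maximal B′ (Block.equal B (suc g′) p))

  find-block : ∀ z N → ¬ (∀ i → i ≤ suc N → d (z ℕ.+ i) ≡ d z ℕ.+ i) → ∃ λ g → g ≤ N × Block z g
  find-block z N break = go N 0 refl λ { .0 z≤n → ≡.trans (cong d (ℕₚ.+-identityʳ z)) (sym (ℕₚ.+-identityʳ (d z))) }
    where
      go : ∀ k g → g ℕ.+ k ≡ N → (∀ i → i ≤ g → d (z ℕ.+ i) ≡ d z ℕ.+ i) → ∃ λ g → g ≤ N × Block z g
      go k g eq h with d (z ℕ.+ suc g) ≟ d z ℕ.+ suc g
      ... | no ne = g , subst (g ≤_) eq (ℕₚ.m≤m+n g k) , record { equal = h ; maximal = ne }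
      go zero g eq h | yes p = ⊥-elim (break (subst (λ x → ∀ i → i ≤ suc x → d (z ℕ.+ i) ≡ d z ℕ.+ i) (≡.trans (sym (ℕₚ.+-identityʳ g)) eq)
        (extend-range {λ i → d (z ℕ.+ i) ≡ d z ℕ.+ i} g h p)))
      go (suc k) g eq h | yes p = go k (suc g) (≡.trans (sym (ℕₚ.+-suc g k)) eq) (extend-range {λ i → d (z ℕ.+ i) ≡ d z ℕ.+ i} g h p)

  run-step : ∀ {z} N → (∀ i → i ≤ suc N → d (z ℕ.+ i) ≡ d z ℕ.+ i) → d (suc (z ℕ.+ N)) ≡ suc (d (z ℕ.+ N))
  run-step {z} N h = ≡.trans (cong d (sym (ℕₚ.+-suc z N)))
    (≡.trans (h (suc N) ℕₚ.≤-refl) (≡.trans (ℕₚ.+-suc (d z) N) (cong suc (sym (h N (ℕₚ.n≤1+n N))))))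

  ladder-apex-unique : ∀ {g z c c′ y y′} → Ladder g z c y → Ladder g z c′ y′ → 0 < g → y ≡ y′
  ladder-apex-unique {y = y} {y′} (top _ t) (top _ t′) 0<g =
    ≡.trans (sym (ℕₚ.+-identityʳ y)) (≡.trans (d-inj (≡.trans (t 0 0<g) (sym (t′ 0 0<g)))) (ℕₚ.+-identityʳ y′))
  ladder-apex-unique (top none _) (up h _) _ = ⊥-elim (none _ (ladder-row (h 0 z≤n)))
  ladder-apex-unique (up h _) (top none _) _ = ⊥-elim (none _ (ladder-row (h 0 z≤n)))
  ladder-apex-unique (up h L) (up h′ L′) 0<g with d-inj (≡.trans (ladder-row (h 0 z≤n)) (sym (ladder-row (h′ 0 z≤n))))
  ... | refl = ladder-apex-unique L L′ 0<g

  -- The conditions under which removing ribbons from the block at z and from all its translates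
  -- leaves a core: the whole block is taken, it lies strictly above its image, and the ladder is
  -- wide enough up to its summit.
  record Admissible (z : ℕ) : Set where
    field
      height-1 copies apex : ℕ
      block : Block z height-1
      gap : z ℕ.+ height-1 < d z
      ladder : Ladder height-1 z copies apex

    cover : ℕ → ℕ
    cover = covered height-1 z apex

  iter-+ : ∀ a b r → iter d (a ℕ.+ b) r ≡ iter d b (iter d a r)
  iter-+ zero b r = refl
  iter-+ (suc a) b r = iter-+ a b (d r)

  iter-between : ∀ {a b m z v} → iter d a m ≡ z → iter d b m ≡ v → v ≤ z ⊎ d z ≤ v
  iter-between {a} {b} {m} {z} {v} p q with b ≤? a
  ... | yes b≤a = inj₁ (subst₂ _≤_ q (≡.trans (≡.trans (sym (iter-+ b (a ℕ.∸ b) m)) (cong (λ k → iter d k m) (ℕₚ.m+[n∸m]≡n b≤a))) p)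
                    (iter-≤ (a ℕ.∸ b) (iter d b m)))
  ... | no b≰a = inj₂ (subst₂ _≤_ (≡.trans (iter-shift d a m) (cong d p))
                    (≡.trans (≡.trans (sym (iter-+ (suc a) (b ℕ.∸ suc a) m)) (cong (λ k → iter d k m) (ℕₚ.m+[n∸m]≡n (ℕₚ.≰⇒> b≰a)))) q)
                    (iter-≤ (b ℕ.∸ suc a) (iter d (suc a) m)))

-- Straightening along a ladder

module LadderStraightening (n ℓ : ℕ) (d : ℕ → ℕ) (d-mono : ∀ {r s} → r < s → d r < d s) (d> : ∀ r → r < d r) where

  open Catalan ℓ
  open Straightening n ℓ
  open Ladders d d-mono d>

  Leads : ℕ → ℕ → Set
  Leads w v = ∃ λ e → iter d e w ≡ v

  leads-up : ∀ {w v′ v} → d v′ ≡ v → Leads w v′ → Leads w v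
  leads-up {w} {v′} p (e , q) = suc e , ≡.trans (iter-shift d e w) (≡.trans (cong d q) p)

  -- The shapes met while the row z + g + 1 is being lowered: rows z + g and z + g + 1 agree, and
  -- above z only the rows y, …, y + g − 1 have changed.
  record Stage (g z y x : ℕ) (s : ℕ → ℕ) : Set where
    field
      pair₁ : s (z ℕ.+ g) ≡ x
      pair₂ : s (suc (z ℕ.+ g)) ≡ x
      unchanged : ∀ r → r < z → (∀ i → i < g → r ≢ y ℕ.+ i) → s r ≡ d r
      tops : ∀ i → i < g → suc (s (y ℕ.+ i)) ≡ d (y ℕ.+ i)
      below : ∀ r → z ≤ r → suc (z ℕ.+ g) < s r

    far : suc (z ℕ.+ g) < x
    far = subst (suc (z ℕ.+ g) <_) pair₁ (below (z ℕ.+ g) (ℕₚ.m≤m+n z g))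

    hit : (∀ i → i < g → d (y ℕ.+ i) ≤ suc (z ℕ.+ i)) → ∀ r → s r ≡ suc (z ℕ.+ g) → r < z × d r ≡ suc (z ℕ.+ g)
    hit bound r e with r <? z
    ... | no r≮z = ⊥-elim (ℕₚ.<⇒≢ (below r (ℕₚ.≮⇒≥ r≮z)) (sym e))
    ... | yes r<z with ℕₚ.anyUpTo? (λ i → r ≟ y ℕ.+ i) g
    ...   | no none = r<z , ≡.trans (sym (unchanged r r<z (λ i i<g p → none (i , i<g , p)))) e
    ...   | yes (i , i<g , refl) = ⊥-elim (ℕₚ.<⇒≱ (ℕₚ.+-monoʳ-< z i<g) (ℕₚ.≤-pred (ℕₚ.≤-trans
              (ℕₚ.≤-trans (ℕₚ.≤-reflexive (sym e)) (ℕₚ.n≤1+n (s r)))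
              (ℕₚ.≤-trans (ℕₚ.≤-reflexive (tops i i<g)) (bound i i<g)))))

  tops-above : ∀ {g z y} → (∀ i → i < g → d (y ℕ.+ i) ≤ suc (z ℕ.+ i)) → z ℕ.+ g < d z → ∀ i → i < g → y ℕ.+ i < z
  tops-above {g} {z} b gap i i<g = d-reflect (ℕₚ.≤-<-trans (b i i<g) (ℕₚ.≤-<-trans (ℕₚ.+-monoʳ-< z i<g) gap))

  -- One reflection of rows z + g and z + g + 1, with row z′ + g + 1 in the role of the row sent to
  -- z + g + 1. It settles the lower pair and recreates the coincidence, now with value z + g, in
  -- rows z′ + g and z′ + g + 1 of the next translate.
  module Up {g z z′ y x : ℕ} {s : ℕ → ℕ} (f : ∀ i → i ≤ suc g → d (z′ ℕ.+ i) ≡ z ℕ.+ i)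
    (bound : ∀ i → i < g → d (y ℕ.+ i) ≤ suc (z′ ℕ.+ i)) (gap : suc (z ℕ.+ g) < d z) (st : Stage g z y x s) where

    open Stage st

    dz′ : d z′ ≡ z
    dz′ = ladder-row (f 0 z≤n)

    z′<z : z′ < z
    z′<z = above dz′

    dz′g : d (suc (z′ ℕ.+ g)) ≡ suc (z ℕ.+ g)
    dz′g = row-+1 (f (suc g) ℕₚ.≤-refl)

    z′g<z : suc (z′ ℕ.+ g) < z
    z′g<z = subst (_< z) (ℕₚ.+-suc z′ g) (gap-up f (subst (_< d z) (sym (ℕₚ.+-suc z g)) gap))

    z′gap : suc (z′ ℕ.+ g) < d z′
    z′gap = subst (suc (z′ ℕ.+ g) <_) (sym dz′) z′g<z

    tops<z′ : ∀ i → i < g → y ℕ.+ i < z′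
    tops<z′ = tops-above bound (ℕₚ.<-trans (ℕₚ.n<1+n _) z′gap)

    free : ∀ {r} → z′ ≤ r → ∀ i → i < g → r ≢ y ℕ.+ i
    free z′≤r i i<g refl = ℕₚ.<⇒≱ (tops<z′ i i<g) z′≤r

    zg≢z′g : suc (z′ ℕ.+ g) ≢ suc (z ℕ.+ g)
    zg≢z′g e = ℕₚ.<⇒≢ z′<z (ℕₚ.+-cancelʳ-≡ g z′ z (ℕₚ.suc-injective e))

    zg≥z : z ≤ suc (z ℕ.+ g)
    zg≥z = ℕₚ.m≤n⇒m≤1+n (ℕₚ.m≤m+n z g)

    s₁ : ℕ → ℕ
    s₁ = upd (upd s (suc (z ℕ.+ g)) (suc x)) (suc (z′ ℕ.+ g)) (z ℕ.+ g)

    s₁-hit : s₁ (suc (z′ ℕ.+ g)) ≡ z ℕ.+ g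
    s₁-hit = upd-same _ _ _

    s₁-low : s₁ (suc (z ℕ.+ g)) ≡ suc x
    s₁-low = ≡.trans (upd-diff _ _ (zg≢z′g ∘ sym)) (upd-same _ _ _)

    s₁-else : ∀ r → r ≢ suc (z′ ℕ.+ g) → r ≢ suc (z ℕ.+ g) → s₁ r ≡ s r
    s₁-else r p q = ≡.trans (upd-diff _ _ p) (upd-diff _ _ q)

    s-row : s (suc (z′ ℕ.+ g)) ≡ suc (z ℕ.+ g)
    s-row = ≡.trans (unchanged _ z′g<z (free (ℕₚ.m≤n⇒m≤1+n (ℕₚ.m≤m+n z′ g)))) dz′g

    s₁-above : ∀ {r} → r < z′ → s₁ r ≡ s r
    s₁-above {r} r<z′ = s₁-else r (ℕₚ.<⇒≢ (ℕₚ.<-≤-trans r<z′ (ℕₚ.m≤n⇒m≤1+n (ℕₚ.m≤m+n z′ g))))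
                           (ℕₚ.<⇒≢ (ℕₚ.<-≤-trans (ℕₚ.<-trans r<z′ z′<z) zg≥z))

    stage₁ : Stage g z′ y (z ℕ.+ g) s₁
    stage₁ = record
      { pair₁ = ≡.trans (s₁-else (z′ ℕ.+ g) (ℕₚ.1+n≢n ∘ sym) (ℕₚ.<⇒≢ (ℕₚ.<-≤-trans row<z zg≥z)))
                  (≡.trans (unchanged _ row<z (free (ℕₚ.m≤m+n z′ g))) (f g (ℕₚ.n≤1+n g)))
      ; pair₂ = s₁-hit
      ; unchanged = λ r r<z′ ne → ≡.trans (s₁-above r<z′) (unchanged r (ℕₚ.<-trans r<z′ z′<z) ne)
      ; tops = λ i i<g → ≡.trans (cong suc (s₁-above (tops<z′ i i<g))) (tops i i<g)
      ; below = below₁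
      }
      where
        row<z : z′ ℕ.+ g < z
        row<z = ℕₚ.<-trans (ℕₚ.n<1+n _) z′g<z
        below₁ : ∀ r → z′ ≤ r → suc (z′ ℕ.+ g) < s₁ r
        below₁ r z′≤r with r ≟ suc (z′ ℕ.+ g)
        ... | yes refl = subst (suc (z′ ℕ.+ g) <_) (sym s₁-hit) (ℕₚ.<-≤-trans z′g<z (ℕₚ.m≤m+n z g))
        ... | no p with r ≟ suc (z ℕ.+ g)
        ...   | yes refl = subst (suc (z′ ℕ.+ g) <_) (sym s₁-low)
                  (ℕₚ.<-trans (ℕₚ.<-≤-trans z′g<z zg≥z) (ℕₚ.m<n⇒m<1+n far))
        ...   | no q with r <? z
        ...     | yes r<z = subst (suc (z′ ℕ.+ g) <_) (sym (≡.trans (s₁-else r p q) (unchanged r r<z (free z′≤r))))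
                    (ℕₚ.<-≤-trans z′gap (d-mono-≤ z′≤r))
        ...     | no r≮z = subst (suc (z′ ℕ.+ g) <_) (sym (s₁-else r p q))
                    (ℕₚ.<-trans (ℕₚ.<-≤-trans z′g<z zg≥z) (below r (ℕₚ.≮⇒≥ r≮z)))

  module _ {ψ : Functional} (cψ : Congruent ψ) where

    -- One reflection per translate, each with a factor t. An inner row z′ + g + 1 first drops to z
    -- + g and is put back to z + g + 1 by the next reflection, so only the lowest row and the apex
    -- row y + g keep a change. This is why `s″` is described by its values and not as a composite.
    climb : ∀ {g z c y x s} → Ladder (suc g) z c y → suc (z ℕ.+ g) < d z → suc (z ℕ.+ g) < ℓ →
      Stage g z y x s → (∀ Z → Leads (suc Z) (suc (z ℕ.+ g)) → Antisym ψ Z) →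
      ∀ s″ → s″ (suc (z ℕ.+ g)) ≡ suc x → suc (s″ (y ℕ.+ g)) ≡ d (y ℕ.+ g) →
      (∀ r → r ≢ y ℕ.+ g → r ≢ suc (z ℕ.+ g) → s″ r ≡ s r) →
      ∀ e → S ψ s e ≡ (c ▹ S ψ s″) e
    climb {g} {z} {c} {y} {x} {s} L@(top none t) gap zg<ℓ st aψ s″ low topv rest =
      straighten cψ s s″ zg<ℓ (aψ _ (0 , refl)) pair₁ pair₂ far (ℕₚ.<-trans yg<z z<ℓ)
        (≡.trans s-yg dyg) uniq
        (ℕₚ.suc-injective (≡.trans topv dyg)) low rest
      where
        open Stage st
        bound = λ i (i<g : i < g) → ladder-top-≤ L i (ℕₚ.m<n⇒m<1+n i<g)
        dyg = t g (ℕₚ.n<1+n g)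
        z<ℓ : z < ℓ
        z<ℓ = ℕₚ.≤-<-trans (ℕₚ.m≤n⇒m≤1+n (ℕₚ.m≤m+n z g)) zg<ℓ
        yg<z : y ℕ.+ g < z
        yg<z = d-reflect (subst (_< d z) (sym dyg) gap)
        s-yg : s (y ℕ.+ g) ≡ d (y ℕ.+ g)
        s-yg = unchanged _ yg<z λ i i<g e → ℕₚ.<⇒≢ i<g (sym (ℕₚ.+-cancelˡ-≡ y g i e))
        uniq : ∀ r → r < ℓ → s r ≡ suc (z ℕ.+ g) → r ≡ y ℕ.+ g
        uniq r _ e = d-inj (≡.trans (proj₂ (hit bound r e)) (sym dyg))
    climb {g} {z} {suc c} {y} {x} {s} L@(up {z′ = z′} f L′) gap zg<ℓ st aψ s″ low topv rest e =
      begin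
        S ψ s e ≡⟨ straighten cψ s s₁ zg<ℓ (aψ _ (0 , refl)) pair₁ pair₂ far
                     (ℕₚ.<-trans z′g<z z<ℓ) s-row uniq s₁-hit s₁-low s₁-else e ⟩
        (1 ▹ S ψ s₁) e ≡⟨ ▹-cong 1 (climb L′ z′gap (ℕₚ.<-trans z′g<z z<ℓ) stage₁ (λ Z w → aψ Z (leads-up dz′g w)) s″ s″-hit topv s″-else) e ⟩
        (1 ▹ c ▹ S ψ s″) e ≡⟨ ▹-▹ 1 c _ e ⟩
        (suc c ▹ S ψ s″) e ∎
      where
        open ≡-Reasoning
        open Stage st
        open Up f (λ i i<g → ladder-top-≤ L′ i (ℕₚ.m<n⇒m<1+n i<g)) gap st
        z<ℓ : z < ℓ
        z<ℓ = ℕₚ.≤-<-trans (ℕₚ.m≤n⇒m≤1+n (ℕₚ.m≤m+n z g)) zg<ℓ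
        uniq : ∀ r → r < ℓ → s r ≡ suc (z ℕ.+ g) → r ≡ suc (z′ ℕ.+ g)
        uniq r _ e = d-inj (≡.trans (proj₂ (hit (λ i i<g → ladder-top-≤ L i (ℕₚ.m<n⇒m<1+n i<g)) r e)) (sym dz′g))
        y<z′ : y ℕ.+ g < z′
        y<z′ = tops-above (ladder-top-≤ L′) (subst (_< d z′) (sym (ℕₚ.+-suc z′ g)) z′gap) g (ℕₚ.n<1+n g)
        s″-hit : s″ (suc (z′ ℕ.+ g)) ≡ suc (z ℕ.+ g)
        s″-hit = ≡.trans (rest _ (λ e → ℕₚ.<⇒≢ (ℕₚ.<-≤-trans y<z′ (ℕₚ.m≤n⇒m≤1+n (ℕₚ.m≤m+n z′ g))) (sym e)) zg≢z′g) s-row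
        s″-else : ∀ r → r ≢ y ℕ.+ g → r ≢ suc (z′ ℕ.+ g) → s″ r ≡ s₁ r
        s″-else r p q with r ≟ suc (z ℕ.+ g)
        ... | yes refl = ≡.trans low (sym s₁-low)
        ... | no k = ≡.trans (rest r p k) (sym (s₁-else r q k))

    -- The same climb, ending at a translate for which no row is sent to z + g + 1, so that
    -- `straighten-zero` takes over.
    climb-blocked : ∀ {g z y x s} → Blocked g y z → suc (z ℕ.+ g) < d z → suc (z ℕ.+ g) < ℓ →
      Stage g z y x s → (∀ Z → Leads (suc Z) (suc (z ℕ.+ g)) → Antisym ψ Z) → ∀ e → S ψ s e ≡ 0ℤ
    climb-blocked {s = s} (stop L none) gap zg<ℓ st aψ =
      straighten-zero cψ s zg<ℓ (aψ _ (0 , refl)) pair₁ pair₂ far λ r _ e → none r (proj₂ (hit (ladder-top-≤ L) r e))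
      where open Stage st
    climb-blocked {g} {z} {y} {x} {s} B@(up {z′ = z′} f B′) gap zg<ℓ st aψ e =
      ≡.trans (straighten cψ s s₁ zg<ℓ (aψ _ (0 , refl)) pair₁ pair₂ far
                 (ℕₚ.<-trans z′g<z z<ℓ) s-row uniq s₁-hit s₁-low s₁-else e)
        (≡.trans (▹-cong 1 (climb-blocked B′ z′gap (ℕₚ.<-trans z′g<z z<ℓ) stage₁ (λ Z w → aψ Z (leads-up dz′g w))) e) (▹-zero 1 e))
      where
        open Stage st
        open Up f (blocked-top-≤ B′) gap st
        z<ℓ : z < ℓ
        z<ℓ = ℕₚ.≤-<-trans (ℕₚ.m≤n⇒m≤1+n (ℕₚ.m≤m+n z g)) zg<ℓ
        uniq : ∀ r → r < ℓ → s r ≡ suc (z ℕ.+ g) → r ≡ suc (z′ ℕ.+ g)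
        uniq r _ e = d-inj (≡.trans (proj₂ (hit (blocked-top-≤ B) r e)) (sym dz′g))

module CoverStraightening (n ℓ : ℕ) (d : ℕ → ℕ) (d-mono : ∀ {r s} → r < s → d r < d s) (d> : ∀ r → r < d r) where

  open Catalan ℓ
  open Straightening n ℓ
  open Ladders d d-mono d>
  open LadderStraightening n ℓ d d-mono d>

  block-next : ∀ {G g z} → Block z G → suc g ≤ G → d (suc (z ℕ.+ g)) ≡ suc (d (z ℕ.+ g))
  block-next {G} {g} {z} B sg≤G = begin
    d (suc (z ℕ.+ g)) ≡⟨ cong d (sym (ℕₚ.+-suc z g)) ⟩
    d (z ℕ.+ suc g) ≡⟨ Block.equal B (suc g) sg≤G ⟩
    d z ℕ.+ suc g ≡⟨ ℕₚ.+-suc (d z) g ⟩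
    suc (d z ℕ.+ g) ≡⟨ cong suc (sym (Block.equal B g (ℕₚ.≤-trans (ℕₚ.n≤1+n g) sg≤G))) ⟩
    suc (d (z ℕ.+ g)) ∎
    where open ≡-Reasoning

  stage : ∀ {G g z c y} → Block z G → suc g ≤ G → Ladder g z c y → suc (z ℕ.+ g) < d z →
    Stage g z y (suc (d (z ℕ.+ g))) (covered g z y)
  stage {G} {g} {z} {c} {y} B sg≤G L gap = record
    { pair₁ = covered-low (ℕₚ.m≤m+n z g) ℕₚ.≤-refl
    ; pair₂ = ≡.trans (covered-below (ℕₚ.n<1+n (z ℕ.+ g))) (block-next B sg≤G)
    ; unchanged = λ r → covered-else
    ; tops = λ i i<g → covered-top i i<g (tops-above (ladder-top-≤ L) (ℕₚ.<-trans (ℕₚ.n<1+n _) gap) i i<g)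
    ; below = below
    }
    where
      below : ∀ r → z ≤ r → suc (z ℕ.+ g) < covered g z y r
      below r z≤r with r ≤? z ℕ.+ g
      ... | yes r≤ = subst (suc (z ℕ.+ g) <_) (sym (covered-low z≤r r≤)) (ℕₚ.m<n⇒m<1+n (ℕₚ.<-≤-trans gap (d-mono-≤ z≤r)))
      ... | no r≰ = subst (suc (z ℕ.+ g) <_) (sym (covered-below (ℕₚ.≰⇒> r≰))) (ℕₚ.<-≤-trans gap (d-mono-≤ z≤r))

  covered-rest : ∀ {g z y} → (∀ i → i < suc g → y ℕ.+ i < z) →
    ∀ r → r ≢ y ℕ.+ g → r ≢ suc (z ℕ.+ g) → covered (suc g) z y r ≡ covered g z y r
  covered-rest {g} {z} {y} tops r p q with r <? z
  ... | yes r<z with ℕₚ.anyUpTo? (λ i → r ≟ y ℕ.+ i) g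
  ...   | yes (i , i<g , refl) = ℕₚ.suc-injective (≡.trans (covered-top i (ℕₚ.m<n⇒m<1+n i<g) r<z) (sym (covered-top i i<g r<z)))
  ...   | no none = ≡.trans (covered-else r<z ne) (sym (covered-else r<z λ i i<g e → none (i , i<g , e)))
    where
      ne : ∀ i → i < suc g → r ≢ y ℕ.+ i
      ne i i<sg e with ℕₚ.m≤n⇒m<n∨m≡n (ℕₚ.≤-pred i<sg)
      ... | inj₁ i<g = none (i , i<g , e)
      ... | inj₂ refl = p e
  covered-rest {g} {z} {y} tops r p q | no r≮z with r ≤? z ℕ.+ g
  ...   | yes r≤ = ≡.trans (covered-low (ℕₚ.≮⇒≥ r≮z) (ℕₚ.≤-trans r≤ (ℕₚ.+-monoʳ-≤ z (ℕₚ.n≤1+n g)))) (sym (covered-low (ℕₚ.≮⇒≥ r≮z) r≤))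
  ...   | no r≰ = ≡.trans (covered-below (subst (_< r) (sym (ℕₚ.+-suc z g)) (ℕₚ.≤∧≢⇒< (ℕₚ.≰⇒> r≰) (q ∘ sym)))) (sym (covered-below (ℕₚ.≰⇒> r≰)))

  covered-0 : ∀ z y y′ r → covered 0 z y r ≡ covered 0 z y′ r
  covered-0 z y y′ r with r <? z
  ... | yes r<z = ≡.trans (covered-else r<z λ i ()) (sym (covered-else r<z λ i ()))
  ... | no r≮z with r ≤? z ℕ.+ 0
  ...   | yes r≤ = ≡.trans (covered-low (ℕₚ.≮⇒≥ r≮z) r≤) (sym (covered-low (ℕₚ.≮⇒≥ r≮z) r≤))
  ...   | no r≰ = ≡.trans (covered-below (ℕₚ.≰⇒> r≰)) (sym (covered-below (ℕₚ.≰⇒> r≰)))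

  covered-apex : ∀ {g z y y′} → (0 < g → y′ ≡ y) → ∀ r → covered g z y r ≡ covered g z y′ r
  covered-apex {zero} {z} {y} {y′} _ r = covered-0 z y y′ r
  covered-apex {suc g} {z} e r = cong (λ a → covered (suc g) z a r) (sym (e (s≤s z≤n)))

  module _ {ψ : Functional} (cψ : Congruent ψ) {m : ℕ} (aψ : ∀ Z → suc Z ≢ m → Antisym ψ Z)
    {z G e₀ : ℕ} (m↝z : iter d e₀ m ≡ z) (B : Block z G) (zG<ℓ : z ℕ.+ G < ℓ)
    {s : ℕ → ℕ} (sz : s z ≡ suc (d z)) (s-else : ∀ r → r ≢ z → s r ≡ d r) where

    -- The exponent is the summand c(h - 1) of the spin, with c components of h rows each.
    Resolution : Set
    Resolution = (Σ (Admissible z) λ a → ∀ e → S ψ s e ≡ ((Admissible.copies a ℕ.* Admissible.height-1 a) ▹ S ψ (Admissible.cover a)) e)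
      ⊎ (¬ Admissible z × (∀ e → S ψ s e ≡ 0ℤ))

    private
      antisym : ∀ {g} → suc (z ℕ.+ g) < d z → ∀ Z → Leads (suc Z) (suc (z ℕ.+ g)) → Antisym ψ Z
      antisym {g} gap Z (b , p) = aψ Z λ { refl → case iter-between {a = e₀} {b = b} m↝z p of λ
        { (inj₁ q) → ℕₚ.<⇒≱ (s≤s (ℕₚ.m≤m+n z g)) q
        ; (inj₂ q) → ℕₚ.<⇒≱ gap q } }

      vanish : ∀ c {f : ℕ → ℤ} → (∀ e → f e ≡ 0ℤ) → ∀ e → (c ▹ f) e ≡ 0ℤ
      vanish c p e = ≡.trans (▹-cong c p e) (▹-zero c e)

      -- The block is widened one row at a time. Each widening is one climb through the c
      -- translates, so the exponent of t grows by c.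
      go : ∀ k {g c y} → g ℕ.+ k ≡ G → Ladder g z c y → z ℕ.+ g < d z →
        (∀ e → S ψ s e ≡ ((c ℕ.* g) ▹ S ψ (covered g z y)) e) → Resolution
      go zero {g} {c} {y} e L gap eq rewrite sym e | ℕₚ.+-identityʳ g =
        inj₁ (record { height-1 = g ; copies = c ; apex = y ; block = B ; gap = gap ; ladder = L } , eq)
      go (suc k) {g} {c} {y} e L gap eq = continue (suc (z ℕ.+ g) <? d z)
        where
          sg≤G : suc g ≤ G
          sg≤G = subst (suc g ≤_) (≡.trans (sym (ℕₚ.+-suc g k)) e) (ℕₚ.m≤m+n (suc g) k)
          zg<ℓ : suc (z ℕ.+ g) < ℓ
          zg<ℓ = ℕₚ.≤-<-trans (subst (_≤ z ℕ.+ G) (ℕₚ.+-suc z g) (ℕₚ.+-monoʳ-≤ z sg≤G)) zG<ℓ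
          continue : Dec (suc (z ℕ.+ g) < d z) → Resolution
          -- Here d z = z + g + 1. Only row z had this value under d, and row z has been raised, so
          -- no row takes it any more and the coincidence straightens to zero.
          continue (no ¬gap) = inj₂ (¬adm , λ e → ≡.trans (eq e) (vanish (c ℕ.* g) zeroes e))
            where
              dz : d z ≡ suc (z ℕ.+ g)
              dz = ℕₚ.≤-antisym (ℕₚ.≮⇒≥ ¬gap) gap
              ¬adm : ¬ Admissible z
              ¬adm a = ℕₚ.<⇒≱ (Admissible.gap a)
                (subst₂ (λ u v → u ≤ z ℕ.+ v) (≡.trans (ℕₚ.+-suc z g) (sym dz)) (block-unique B (Admissible.block a)) (ℕₚ.+-monoʳ-≤ z sg≤G))
              tops : ∀ i → i < g → y ℕ.+ i < z
              tops = tops-above (ladder-top-≤ L) gap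
              none : ∀ r → covered g z y r ≢ suc (z ℕ.+ g)
              none r with r <? z
              ... | yes r<z with ℕₚ.anyUpTo? (λ i → r ≟ y ℕ.+ i) g
              ...   | yes (i , i<g , refl) = λ p → ℕₚ.<⇒≢ (ℕₚ.<-trans (ℕₚ.n<1+n _)
                        (subst (_< d z) (sym (covered-top {z = z} i i<g r<z)) (d-mono r<z))) (≡.trans p (sym dz))
              ...   | no q = λ p → ℕₚ.<⇒≢ (d-mono r<z)
                        (≡.trans (sym (covered-else r<z λ i i<g e → q (i , i<g , e))) (≡.trans p (sym dz)))
              none r | no r≮z with r ≤? z ℕ.+ g
              ...   | yes r≤ = λ p → ℕₚ.<⇒≢ (s≤s (d-mono-≤ (ℕₚ.≮⇒≥ r≮z))) (≡.trans dz (≡.trans (sym p) (covered-low (ℕₚ.≮⇒≥ r≮z) r≤)))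
              ...   | no r≰ = λ p → ℕₚ.<⇒≢ (d-mono (ℕₚ.≤-<-trans (ℕₚ.m≤m+n z g) (ℕₚ.≰⇒> r≰)))
                        (≡.trans dz (≡.trans (sym p) (covered-below (ℕₚ.≰⇒> r≰))))
              zeroes : ∀ e → S ψ (covered g z y) e ≡ 0ℤ
              zeroes = straighten-zero cψ _ zg<ℓ (aψ _ λ p → ℕₚ.<⇒≱ (s≤s (ℕₚ.m≤m+n z g)) (subst₂ _≤_ (sym p) m↝z (iter-≤ e₀ m)))
                (covered-low (ℕₚ.m≤m+n z g) ℕₚ.≤-refl)
                (≡.trans (covered-below (ℕₚ.n<1+n (z ℕ.+ g)))
                  (block-next B sg≤G))
                (subst (_< suc (d (z ℕ.+ g))) dz (s≤s (d-mono-≤ (ℕₚ.m≤m+n z g))))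
                (λ r _ → none r)
          continue (yes gap′) with ladder-extend L
          ... | inj₂ blocked = inj₂ (¬adm , λ e → ≡.trans (eq e)
                  (vanish (c ℕ.* g) (climb-blocked cψ blocked gap′ zg<ℓ (stage B sg≤G L gap′) (antisym gap′)) e))
            where
              ¬adm : ¬ Admissible z
              ¬adm a = blocked-¬ladder blocked
                (ladder-weaken (subst (suc g ≤_) (block-unique B (Admissible.block a)) sg≤G) (Admissible.ladder a))
          ... | inj₁ (y′ , L′ , same) = go k (≡.trans (sym (ℕₚ.+-suc g k)) e) L′ (subst (_< d z) (sym (ℕₚ.+-suc z g)) gap′) eq′
            where
              open ≡-Reasoning
              tops : ∀ i → i < suc g → y′ ℕ.+ i < z
              tops = tops-above (ladder-top-≤ L′) (subst (_< d z) (sym (ℕₚ.+-suc z g)) gap′)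
              eq′ : ∀ e → S ψ s e ≡ ((c ℕ.* suc g) ▹ S ψ (covered (suc g) z y′)) e
              eq′ e = begin
                S ψ s e ≡⟨ eq e ⟩
                ((c ℕ.* g) ▹ S ψ (covered g z y)) e
                  ≡⟨ ▹-cong (c ℕ.* g) (S-cong cψ λ r _ → covered-apex same r) e ⟩
                ((c ℕ.* g) ▹ S ψ (covered g z y′)) e
                  ≡⟨ ▹-cong (c ℕ.* g) (climb cψ L′ gap′ zg<ℓ (stage B sg≤G (ladder-weaken (ℕₚ.n≤1+n g) L′) gap′) (antisym gap′) (covered (suc g) z y′)
                       (≡.trans (covered-low (ℕₚ.m≤n⇒m≤1+n (ℕₚ.m≤m+n z g)) (ℕₚ.≤-reflexive (sym (ℕₚ.+-suc z g))))
                         (cong suc (block-next B sg≤G)))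
                       (covered-top g (ℕₚ.n<1+n g) (tops g (ℕₚ.n<1+n g)))
                       (covered-rest tops)) e ⟩
                ((c ℕ.* g) ▹ c ▹ S ψ (covered (suc g) z y′)) e
                  ≡⟨ ▹-▹ (c ℕ.* g) c _ e ⟩
                ((c ℕ.* g ℕ.+ c) ▹ S ψ (covered (suc g) z y′)) e
                  ≡⟨ cong (λ a → (a ▹ S ψ (covered (suc g) z y′)) e) (≡.trans (ℕₚ.+-comm (c ℕ.* g) c) (sym (ℕₚ.*-suc c g))) ⟩
                ((c ℕ.* suc g) ▹ S ψ (covered (suc g) z y′)) e ∎

    resolve : z < d z → Resolution
    resolve z<dz with ladder-start (suc z) z (ℕₚ.n<1+n z)
    ... | c , y , L = go G refl L (subst (_< d z) (sym (ℕₚ.+-identityʳ z)) z<dz)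
          λ e → ≡.trans (S-cong cψ (λ r _ → base r) e) (cong (λ a → (a ▹ S ψ (covered 0 z y)) e) (sym (ℕₚ.*-zeroʳ c)))
      where
        base : ∀ r → s r ≡ covered 0 z y r
        base r with r ≟ z
        ... | yes refl = ≡.trans sz (sym (covered-low ℕₚ.≤-refl (ℕₚ.m≤m+n z 0)))
        ... | no r≢z with r <? z
        ...   | yes r<z = ≡.trans (s-else r r≢z) (sym (covered-else r<z λ i ()))
        ...   | no r≮z = ≡.trans (s-else r r≢z)
                (sym (covered-below (subst (_< r) (sym (ℕₚ.+-identityʳ z)) (ℕₚ.≤∧≢⇒< (ℕₚ.≮⇒≥ r≮z) (r≢z ∘ sym)))))

-- Cores and their beads

∧⁻ : ∀ {x y} → T (x ∧ y) → T x × T y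
∧⁻ = Equivalence.to T-∧

∧⁺ : ∀ {x y} → T x → T y → T (x ∧ y)
∧⁺ p q = Equivalence.from T-∧ (p , q)

T⇒≡true : ∀ {b} → T b → b ≡ true
T⇒≡true = Equivalence.to T-≡

¬T⇒≡false : ∀ {b} → ¬ T b → b ≡ false
¬T⇒≡false {false} _ = refl
¬T⇒≡false {true} p = ⊥-elim (p _)

not⁺ : ∀ {b} → ¬ T b → T (not b)
not⁺ {false} _ = _
not⁺ {true} p = ⊥-elim (p _)

not⁻ : ∀ {b} → T (not b) → ¬ T b
not⁻ {false} _ ()

-- Linear arithmetic: `L ≤ R` is a sum of hypotheses formed with `_⊞_`, `c` is what cancels from it,
-- and the two equations are left to the ring solver.
linear : ∀ {L R X Y} c → L ≤ R → X ℕ.+ c ≡ L → R ≡ Y ℕ.+ c → X ≤ Y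
linear {X = X} {Y} c L≤R p q = ℕₚ.+-cancelʳ-≤ c X Y (subst₂ _≤_ (sym p) q L≤R)

infixr 5 _⊞_
_⊞_ : ∀ {a b c d} → a ≤ b → c ≤ d → a ℕ.+ c ≤ b ℕ.+ d
_⊞_ = ℕₚ.+-mono-≤

eq≤ : ∀ {a b} → a ≡ b → a ≤ b
eq≤ = ℕₚ.≤-reflexive

eq≥ : ∀ {a b} → a ≡ b → b ≤ a
eq≥ e = ℕₚ.≤-reflexive (sym e)

get-≥length : ∀ xs {i} → length xs ≤ i → get xs i ≡ 0
get-≥length [] _ = refl
get-≥length (x ∷ xs) (s≤s p) = get-≥length xs p

get>0⇒<length : ∀ xs {i} → 0 < get xs i → i < length xs
get>0⇒<length xs {i} p with i <? length xs
... | yes q = q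
... | no q = ⊥-elim (ℕₚ.<⇒≢ p (sym (get-≥length xs (ℕₚ.≮⇒≥ q))))

get-drop : ∀ m xs i → get (drop m xs) i ≡ get xs (m ℕ.+ i)
get-drop zero xs i = refl
get-drop (suc m) [] i = refl
get-drop (suc m) (x ∷ xs) i = get-drop m xs i

get-applyUpTo : ∀ (h : ℕ → ℕ) m {i} → i < m → get (applyUpTo h m) i ≡ h i
get-applyUpTo h (suc m) {zero} _ = refl
get-applyUpTo h (suc m) {suc i} (s≤s p) = get-applyUpTo (h ∘ suc) m p

get-map-upTo : ∀ (h : ℕ → ℕ) m {i} → i < m → get (map h (upTo m)) i ≡ h i
get-map-upTo h m {i} p rewrite Listₚ.map-upTo h m = get-applyUpTo h m p

length-map-upTo : ∀ (h : ℕ → ℕ) m → length (map h (upTo m)) ≡ m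
length-map-upTo h m = ≡.trans (Listₚ.length-map h (upTo m)) (Listₚ.length-upTo m)

part-tail : ∀ x xs → T (isPartᵇ (x ∷ xs)) → T (isPartᵇ xs)
part-tail x [] _ = _
part-tail x (y ∷ ys) p = proj₂ (∧⁻ p)

part-pos : ∀ xs → T (isPartᵇ xs) → ∀ {i} → i < length xs → 0 < get xs i
part-pos (x ∷ []) p {zero} _ = ℕₚ.≤ᵇ⇒≤ 1 x p
part-pos (x ∷ []) p {suc i} (s≤s ())
part-pos (x ∷ y ∷ xs) p {zero} _ = ℕₚ.<-≤-trans (part-pos (y ∷ xs) (proj₂ (∧⁻ p)) (s≤s z≤n)) (ℕₚ.≤ᵇ⇒≤ y x (proj₁ (∧⁻ {y ℕ.≤ᵇ x} p)))
part-pos (x ∷ y ∷ xs) p {suc i} (s≤s q) = part-pos (y ∷ xs) (proj₂ (∧⁻ {y ℕ.≤ᵇ x} p)) q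

part-step : ∀ xs → T (isPartᵇ xs) → ∀ i → get xs (suc i) ≤ get xs i
part-step [] p i = z≤n
part-step (x ∷ []) p i = z≤n
part-step (x ∷ y ∷ xs) p zero = ℕₚ.≤ᵇ⇒≤ y x (proj₁ (∧⁻ {y ℕ.≤ᵇ x} p))
part-step (x ∷ y ∷ xs) p (suc i) = part-step (y ∷ xs) (proj₂ (∧⁻ {y ℕ.≤ᵇ x} p)) i

Decreasing : (ℕ → ℕ) → Set
Decreasing f = ∀ {r s} → r ≤ s → f s ≤ f r

step⇒decreasing : ∀ {f} → (∀ i → f (suc i) ≤ f i) → Decreasing f
step⇒decreasing {f} step {r} {s} r≤s = subst (λ a → f a ≤ f r) (ℕₚ.m+[n∸m]≡n r≤s) (go r (s ℕ.∸ r))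
  where
    go : ∀ r k → f (r ℕ.+ k) ≤ f r
    go r zero = eq≤ (cong f (ℕₚ.+-identityʳ r))
    go r (suc k) = ℕₚ.≤-trans (eq≤ (cong f (ℕₚ.+-suc r k))) (ℕₚ.≤-trans (step (r ℕ.+ k)) (go r k))

part-decreasing : ∀ xs → T (isPartᵇ xs) → Decreasing (get xs)
part-decreasing xs p = step⇒decreasing (part-step xs p)

part-ext : ∀ xs ys → T (isPartᵇ xs) → T (isPartᵇ ys) → (∀ i → get xs i ≡ get ys i) → xs ≡ ys
part-ext [] [] p q e = refl
part-ext [] (y ∷ ys) p q e = ⊥-elim (ℕₚ.<⇒≢ (part-pos (y ∷ ys) q {0} (s≤s z≤n)) (e 0))
part-ext (x ∷ xs) [] p q e = ⊥-elim (ℕₚ.<⇒≢ (part-pos (x ∷ xs) p {0} (s≤s z≤n)) (sym (e 0)))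
part-ext (x ∷ xs) (y ∷ ys) p q e =
  cong₂ _∷_ (e 0) (part-ext xs ys (part-tail x xs p) (part-tail y ys q) (e ∘ suc))

filterᵇ-true : ∀ {A : Set} (p : A → Bool) {x xs} → T (p x) → filterᵇ p (x ∷ xs) ≡ x ∷ filterᵇ p xs
filterᵇ-true p t = Listₚ.filter-accept (T? ∘ p) t

filterᵇ-false : ∀ {A : Set} (p : A → Bool) {x xs} → ¬ T (p x) → filterᵇ p (x ∷ xs) ≡ filterᵇ p xs
filterᵇ-false p t = Listₚ.filter-reject (T? ∘ p) t

length-filterᵇ-∷ : ∀ {A : Set} (p : A → Bool) x xs → length (filterᵇ p (x ∷ xs)) ≤ suc (length (filterᵇ p xs))
length-filterᵇ-∷ p x xs with p x
... | true = ℕₚ.≤-refl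
... | false = ℕₚ.n≤1+n _

count-≥ : ∀ c xs m → (∀ i → i < m → c < get xs i) → m ≤ length (filterᵇ (λ a → c ℕ.<ᵇ a) xs)
count-≥ c xs zero _ = z≤n
count-≥ c [] (suc m) p = ⊥-elim (ℕₚ.n≮0 (p 0 (s≤s z≤n)))
count-≥ c (x ∷ xs) (suc m) p rewrite filterᵇ-true (λ a → c ℕ.<ᵇ a) {x} {xs} (ℕₚ.<⇒<ᵇ (p 0 (s≤s z≤n))) =
  s≤s (count-≥ c xs m (λ i i<m → p (suc i) (s≤s i<m)))

count-≤ : ∀ c xs m → (∀ i → m ≤ i → get xs i ≤ c) → length (filterᵇ (λ a → c ℕ.<ᵇ a) xs) ≤ m
count-≤ c [] m p = z≤n
count-≤ c (x ∷ xs) zero p rewrite filterᵇ-false (λ a → c ℕ.<ᵇ a) {x} {xs} (λ t → ℕₚ.<⇒≱ (ℕₚ.<ᵇ⇒< c x t) (p 0 z≤n)) =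
  count-≤ c xs zero (λ i _ → p (suc i) z≤n)
count-≤ c (x ∷ xs) (suc m) p = ℕₚ.≤-trans (length-filterᵇ-∷ (λ a → c ℕ.<ᵇ a) x xs) (s≤s (count-≤ c xs m (λ i m≤i → p (suc i) (s≤s m≤i))))

count-interval : ∀ (p : ℕ → Bool) (h : ℕ → ℕ) a m → (∀ c → c < a → ¬ T (p (h c))) → (∀ c → a ≤ c → c < m → T (p (h c))) →
  length (filterᵇ p (applyUpTo h m)) ≡ m ℕ.∸ a
count-interval p h a zero f t = sym (ℕₚ.0∸n≡0 a)
count-interval p h zero (suc m) f t rewrite filterᵇ-true p {h 0} {applyUpTo (h ∘ suc) m} (t 0 z≤n (s≤s z≤n)) =
  cong suc (count-interval p (h ∘ suc) zero m (λ _ ()) (λ c _ c<m → t (suc c) z≤n (s≤s c<m)))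
count-interval p h (suc a) (suc m) f t rewrite filterᵇ-false p {h 0} {applyUpTo (h ∘ suc) m} (f 0 (s≤s z≤n)) =
  count-interval p (h ∘ suc) a m (λ c c<a → f (suc c) (s≤s c<a)) (λ c a≤c c<m → t (suc c) (s≤s a≤c) (s≤s c<m))

sumTo-front : ∀ m (h : ℕ → ℤ) → sumTo (suc m) h ≡ h 0 ℤ.+ sumTo m (h ∘ suc)
sumTo-front zero h = ℤₚ.+-comm 0ℤ (h 0)
sumTo-front (suc m) h = ≡.trans (cong (ℤ._+ h (suc m)) (sumTo-front m h)) (ℤₚ.+-assoc (h 0) (sumTo m (h ∘ suc)) (h (suc m)))

sum-get : ∀ xs ℓ → length xs ≤ ℓ → + sum xs ≡ sumTo ℓ (λ r → + get xs r)
sum-get [] ℓ _ = sym (sumTo-0 ℓ)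
sum-get (x ∷ xs) (suc ℓ) (s≤s p) = ≡.trans (cong (λ a → + x ℤ.+ a) (sum-get xs ℓ p)) (sym (sumTo-front ℓ (λ r → + get (x ∷ xs) r)))

-- The bead equation: in row r of a K-bounded core, the row d strictly below r carries the bead
-- (get κ r − r) − (K + 1); all hooks of row r exceed K to the left of column get κ d and are at most K from there on.
record BeadEquation (K : ℕ) (κ : List ℕ) (r d : ℕ) : Set where
  constructor bead
  field
    below : r < d
    equation : get κ r ℕ.+ d ≡ get κ d ℕ.+ (r ℕ.+ suc K)

module Hooks {K : ℕ} {κ : List ℕ} (dec : Decreasing (get κ)) {r d : ℕ} (be : BeadEquation K κ r d) where

  open BeadEquation be

  leg : ℕ → ℕ
  leg c = length (filterᵇ (λ a → c ℕ.<ᵇ a) (drop (suc r) κ))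

  get-leg : ∀ i → get (drop (suc r) κ) i ≡ get κ (suc (r ℕ.+ i))
  get-leg = get-drop (suc r) κ

  -- Every row from r + 1 to d reaches beyond column c, so the leg is at least d - r; by the bead
  -- equation arm and leg together exceed K + 1.
  hook-large : ∀ {c} → c < get κ d → suc (suc K) ≤ hook κ r c
  hook-large {c} c<fd = linear (get κ r ℕ.+ c ℕ.+ get κ d ℕ.+ r ℕ.+ d)
    (arm ⊞ c<fd ⊞ eq≥ equation ⊞ leg≥)
    (e₁ K (get κ r) c (get κ d) r d) (e₂ (get κ r ℕ.∸ c) c (get κ d) (get κ r) d r (leg c))
    where
      arm : get κ r ≤ (get κ r ℕ.∸ c) ℕ.+ c
      arm = eq≥ (ℕₚ.m∸n+n≡m (ℕₚ.≤-trans (ℕₚ.<⇒≤ c<fd) (dec (ℕₚ.<⇒≤ below))))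
      leg≥ : d ≤ r ℕ.+ leg c
      leg≥ = subst (_≤ r ℕ.+ leg c) (ℕₚ.m+[n∸m]≡n (ℕₚ.<⇒≤ below)) (ℕₚ.+-monoʳ-≤ r (count-≥ c (drop (suc r) κ) (d ℕ.∸ r) λ i i<m →
        ℕₚ.<-≤-trans c<fd (ℕₚ.≤-trans (dec (subst (suc (r ℕ.+ i) ≤_) (ℕₚ.m+[n∸m]≡n (ℕₚ.<⇒≤ below)) (ℕₚ.+-monoʳ-< r i<m))) (eq≥ (get-leg i)))))
      e₁ : ∀ K a c b r d → suc (suc K) ℕ.+ (a ℕ.+ c ℕ.+ b ℕ.+ r ℕ.+ d) ≡ a ℕ.+ (suc c ℕ.+ ((b ℕ.+ (r ℕ.+ suc K)) ℕ.+ d))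
      e₁ = ℕ-ring
      e₂ : ∀ x c b a d r l → (x ℕ.+ c) ℕ.+ (b ℕ.+ ((a ℕ.+ d) ℕ.+ (r ℕ.+ l))) ≡ (x ℕ.+ l) ℕ.+ (a ℕ.+ c ℕ.+ b ℕ.+ r ℕ.+ d)
      e₂ = ℕ-ring

  hook-small : ∀ {c} → get κ d ≤ c → c < get κ r → hook κ r c ≤ K
  hook-small {c} fd≤c c<fr = linear (c ℕ.+ get κ d ℕ.+ get κ r ℕ.+ d ℕ.+ suc r)
    (arm ⊞ fd≤c ⊞ eq≤ equation ⊞ leg≤)
    (e₁ (get κ r ℕ.∸ c) (leg c) c (get κ d) (get κ r) d r) (e₂ (get κ r) c (get κ d) r K d)
    where
      arm : (get κ r ℕ.∸ c) ℕ.+ c ≤ get κ r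
      arm = eq≤ (ℕₚ.m∸n+n≡m (ℕₚ.<⇒≤ c<fr))
      leg≤ : suc (r ℕ.+ leg c) ≤ d
      leg≤ = subst (suc r ℕ.+ leg c ≤_) (ℕₚ.m+[n∸m]≡n below) (ℕₚ.+-monoʳ-≤ (suc r) (count-≤ c (drop (suc r) κ) (d ℕ.∸ suc r) λ i m≤i →
        ℕₚ.≤-trans (eq≤ (get-leg i)) (ℕₚ.≤-trans (dec (subst (_≤ suc (r ℕ.+ i)) (ℕₚ.m+[n∸m]≡n below) (ℕₚ.+-monoʳ-≤ (suc r) m≤i))) fd≤c)))
      e₁ : ∀ x l c b a d r → (x ℕ.+ l) ℕ.+ (c ℕ.+ b ℕ.+ a ℕ.+ d ℕ.+ suc r) ≡ (x ℕ.+ c) ℕ.+ (b ℕ.+ ((a ℕ.+ d) ℕ.+ suc (r ℕ.+ l)))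
      e₁ = ℕ-ring
      e₂ : ∀ a c b r K d → a ℕ.+ (c ℕ.+ ((b ℕ.+ (r ℕ.+ suc K)) ℕ.+ d)) ≡ K ℕ.+ (c ℕ.+ b ℕ.+ a ℕ.+ d ℕ.+ suc r)
      e₂ = ℕ-ring

  hook-≢ : ∀ {c} → c < get κ r → hook κ r c ≢ suc K
  hook-≢ {c} c<fr e with c <? get κ d
  ... | yes p = ℕₚ.<⇒≢ (hook-large p) (sym e)
  ... | no p = ℕₚ.<⇒≢ (s≤s (hook-small (ℕₚ.≮⇒≥ p) c<fr)) e

  get-pOf : r < length κ → get (pOf K κ) r ≡ get κ r ℕ.∸ get κ d
  get-pOf r<len = ≡.trans (get-map-upTo _ (length κ) r<len)
    (count-interval (λ c → hook κ r c ℕ.≤ᵇ K) id (get κ d) (get κ r)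
      (λ c c<fd t → ℕₚ.<⇒≱ (ℕₚ.<-trans (ℕₚ.n<1+n K) (hook-large c<fd)) (ℕₚ.≤ᵇ⇒≤ _ K t))
      (λ c fd≤c c<fr → ℕₚ.≤⇒≤ᵇ (hook-small fd≤c c<fr)))

∈boxes⁺ : ∀ κ {r c} → r < length κ → c < get κ r → (r , c) ∈ boxes κ
∈boxes⁺ κ r<len c<κr = ∈-concatMap⁺ _ (lose (∈-upTo⁺ r<len) (∈-map⁺ _ (∈-upTo⁺ c<κr)))

∈boxes⁻ : ∀ κ {r c} → (r , c) ∈ boxes κ → r < length κ × c < get κ r
∈boxes⁻ κ {r} {c} m with find (∈-concatMap⁻ (λ r → map (λ c → (r , c)) (upTo (get κ r))) {xs = upTo (length κ)} m)
... | r′ , r′∈ , m′ with ∈-map⁻ (λ c → (r′ , c)) m′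
...   | c′ , c′∈ , refl = ∈-upTo⁻ r′∈ , ∈-upTo⁻ c′∈

all⁻ : ∀ {A : Set} (p : A → Bool) {xs} → T (all p xs) → ∀ {x} → x ∈ xs → T (p x)
all⁻ p {xs} t x∈ = All.lookup (Allₚ.all⁺ p xs t) x∈

all⁺ : ∀ {A : Set} (p : A → Bool) {xs} → (∀ {x} → x ∈ xs → T (p x)) → T (all p xs)
all⁺ p h = Allₚ.all⁻ p (All.tabulate h)

core-hook : ∀ K κ → T (isCoreᵇ K κ) → ∀ {r c} → c < get κ r → hook κ r c ≢ suc K
core-hook K κ core {r} {c} c<fr e =
  not⁻ (all⁻ (λ b → not (hook κ (proj₁ b) (proj₂ b) ℕ.≡ᵇ suc K)) core (∈boxes⁺ κ (get>0⇒<length κ (ℕₚ.≤-<-trans z≤n c<fr)) c<fr))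
    (ℕₚ.≡⇒≡ᵇ _ _ e)

beads⇒core : ∀ K κ → Decreasing (get κ) → (∀ r → r < length κ → ∃ λ d → BeadEquation K κ r d) → T (isCoreᵇ K κ)
beads⇒core K κ dec be = all⁺ _ λ {b} m → case ∈boxes⁻ κ m of λ
  { (r<len , c<fr) → not⁺ λ t → Hooks.hook-≢ dec (proj₂ (be _ r<len)) c<fr (ℕₚ.≡ᵇ⇒≡ _ _ t) }

module FindBead (K : ℕ) (κ : List ℕ) (dec : Decreasing (get κ)) (core : T (isCoreᵇ K κ)) (r : ℕ) where

  private
    n = suc K
    f = get κ

    -- The difference (f r + q) - (f q + r + n) grows with q, from -n at q = r to at least 0 at q =
    -- r + n. If it jumped over 0 between q and q + 1, the box of row r in column f r + q - (r + n)
    -- would have leg q - r and hook length n.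
    no-skip : ∀ q → r ≤ q → suc (f r ℕ.+ q) ≤ f q ℕ.+ (r ℕ.+ n) → ¬ (f (suc q) ℕ.+ (r ℕ.+ n) < f r ℕ.+ suc q)
    no-skip q r≤q before after = core-hook K κ core c<fr hook≡
      where
        after′ : f (suc q) ℕ.+ (r ℕ.+ n) ≤ f r ℕ.+ q
        after′ = ℕₚ.≤-pred (subst (suc (f (suc q) ℕ.+ (r ℕ.+ n)) ≤_) (ℕₚ.+-suc (f r) q) after)
        c = f r ℕ.+ q ℕ.∸ (r ℕ.+ n)
        c≡ : c ℕ.+ (r ℕ.+ n) ≡ f r ℕ.+ q
        c≡ = ℕₚ.m∸n+n≡m (ℕₚ.≤-trans (ℕₚ.m≤n+m (r ℕ.+ n) (f (suc q))) after′)
        c≥ : f (suc q) ≤ c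
        c≥ = ℕₚ.+-cancelʳ-≤ (r ℕ.+ n) _ _ (subst (f (suc q) ℕ.+ (r ℕ.+ n) ≤_) (sym c≡) after′)
        c<fq : c < f q
        c<fq = ℕₚ.+-cancelʳ-< (r ℕ.+ n) _ _ (subst (_< f q ℕ.+ (r ℕ.+ n)) (sym c≡) before)
        c<fr : c < f r
        c<fr = ℕₚ.<-≤-trans c<fq (dec r≤q)
        leg = length (filterᵇ (λ a → c ℕ.<ᵇ a) (drop (suc r) κ))
        leg≡ : leg ≡ q ℕ.∸ r
        leg≡ = ℕₚ.≤-antisym
          (count-≤ c (drop (suc r) κ) (q ℕ.∸ r) λ i m≤i → ℕₚ.≤-trans (eq≤ (get-drop (suc r) κ i))
            (ℕₚ.≤-trans (dec (s≤s (subst (_≤ r ℕ.+ i) (ℕₚ.m+[n∸m]≡n r≤q) (ℕₚ.+-monoʳ-≤ r m≤i)))) c≥))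
          (count-≥ c (drop (suc r) κ) (q ℕ.∸ r) λ i i<m → ℕₚ.<-≤-trans c<fq
            (ℕₚ.≤-trans (dec (subst (suc (r ℕ.+ i) ≤_) (ℕₚ.m+[n∸m]≡n r≤q) (ℕₚ.+-monoʳ-< r i<m))) (eq≥ (get-drop (suc r) κ i))))
        hook≡ : hook κ r c ≡ n
        hook≡ = ≡.trans (cong (λ l → (f r ℕ.∸ c) ℕ.+ l) leg≡) (ℕₚ.+-cancelʳ-≡ (c ℕ.+ r) _ _ (begin
          (f r ℕ.∸ c) ℕ.+ (q ℕ.∸ r) ℕ.+ (c ℕ.+ r) ≡⟨ e₁ (f r ℕ.∸ c) (q ℕ.∸ r) c r ⟩
          (f r ℕ.∸ c ℕ.+ c) ℕ.+ (q ℕ.∸ r ℕ.+ r) ≡⟨ cong₂ ℕ._+_ (ℕₚ.m∸n+n≡m (ℕₚ.<⇒≤ c<fr)) (ℕₚ.m∸n+n≡m r≤q) ⟩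
          f r ℕ.+ q ≡⟨ sym c≡ ⟩
          c ℕ.+ (r ℕ.+ n) ≡⟨ e₂ c r n ⟩
          n ℕ.+ (c ℕ.+ r) ∎))
          where
            open ≡-Reasoning
            e₁ : ∀ a b c r → a ℕ.+ b ℕ.+ (c ℕ.+ r) ≡ (a ℕ.+ c) ℕ.+ (b ℕ.+ r)
            e₁ = ℕ-ring
            e₂ : ∀ c r n → c ℕ.+ (r ℕ.+ n) ≡ n ℕ.+ (c ℕ.+ r)
            e₂ = ℕ-ring

    search : ∀ k q → r ≤ q → q ℕ.+ k ≡ r ℕ.+ n → suc (f r ℕ.+ q) ≤ f q ℕ.+ (r ℕ.+ n) → ∃ λ d → BeadEquation K κ r d
    search zero q r≤q e before = ⊥-elim (ℕₚ.<⇒≱ before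
      (subst (λ a → f q ℕ.+ a ≤ f r ℕ.+ q) (≡.trans (sym (ℕₚ.+-identityʳ q)) e) (ℕₚ.+-monoˡ-≤ q (dec r≤q))))
    search (suc k) q r≤q e before with ℕₚ.<-cmp (f r ℕ.+ suc q) (f (suc q) ℕ.+ (r ℕ.+ n))
    ... | tri< lt _ _ = search k (suc q) (ℕₚ.m≤n⇒m≤1+n r≤q) (≡.trans (sym (ℕₚ.+-suc q k)) e) lt
    ... | tri≈ _ eq _ = suc q , bead (s≤s r≤q) eq
    ... | tri> _ _ gt = ⊥-elim (no-skip q r≤q before gt)

  find-bead : ∃ λ d → BeadEquation K κ r d
  find-bead = search n r ℕₚ.≤-refl refl (subst (suc (f r ℕ.+ r) ≤_) (e (f r) r K) (ℕₚ.m≤m+n (suc (f r ℕ.+ r)) K))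
    where
      e : ∀ a r K → suc (a ℕ.+ r) ℕ.+ K ≡ a ℕ.+ (r ℕ.+ suc K)
      e = ℕ-ring

down : ℕ → List ℕ → ℕ → ℕ
down K κ r = (suc K ℕ.+ r) ℕ.∸ get (pOf K κ) r

get-pOf-0 : ∀ K κ {r} → length κ ≤ r → get (pOf K κ) r ≡ 0
get-pOf-0 K κ len≤r = get-≥length (pOf K κ) (subst (_≤ _) (sym (length-map-upTo _ (length κ))) len≤r)

module _ {K : ℕ} {κ : List ℕ} (dec : Decreasing (get κ)) where

  bead-sum : ∀ {r d} → BeadEquation K κ r d → get (pOf K κ) r ℕ.+ d ≡ suc K ℕ.+ r
  bead-sum {r} {d} be with r <? length κ
  ... | yes r<len = ℕₚ.+-cancelʳ-≡ (get κ d) _ _ (begin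
      get (pOf K κ) r ℕ.+ d ℕ.+ get κ d ≡⟨ cong (λ a → a ℕ.+ d ℕ.+ get κ d) (Hooks.get-pOf dec be r<len) ⟩
      (get κ r ℕ.∸ get κ d) ℕ.+ d ℕ.+ get κ d ≡⟨ e₁ (get κ r ℕ.∸ get κ d) d (get κ d) ⟩
      (get κ r ℕ.∸ get κ d ℕ.+ get κ d) ℕ.+ d ≡⟨ cong (ℕ._+ d) (ℕₚ.m∸n+n≡m (dec (ℕₚ.<⇒≤ (BeadEquation.below be)))) ⟩
      get κ r ℕ.+ d ≡⟨ BeadEquation.equation be ⟩
      get κ d ℕ.+ (r ℕ.+ suc K) ≡⟨ e₂ (get κ d) r K ⟩
      suc K ℕ.+ r ℕ.+ get κ d ∎)
    where
      open ≡-Reasoning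
      e₁ : ∀ a d b → a ℕ.+ d ℕ.+ b ≡ (a ℕ.+ b) ℕ.+ d
      e₁ = ℕ-ring
      e₂ : ∀ b r K → b ℕ.+ (r ℕ.+ suc K) ≡ suc K ℕ.+ r ℕ.+ b
      e₂ = ℕ-ring
  ... | no r≮len = begin
      get (pOf K κ) r ℕ.+ d ≡⟨ cong (ℕ._+ d) (≡.trans (get-pOf-0 K κ (ℕₚ.≮⇒≥ r≮len)) (sym (get-≥length κ (ℕₚ.≮⇒≥ r≮len)))) ⟩
      get κ r ℕ.+ d ≡⟨ BeadEquation.equation be ⟩
      get κ d ℕ.+ (r ℕ.+ suc K) ≡⟨ cong (ℕ._+ (r ℕ.+ suc K)) (get-≥length κ (ℕₚ.≤-trans (ℕₚ.≮⇒≥ r≮len) (ℕₚ.<⇒≤ (BeadEquation.below be)))) ⟩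
      r ℕ.+ suc K ≡⟨ ℕₚ.+-comm r (suc K) ⟩
      suc K ℕ.+ r ∎
    where open ≡-Reasoning

  down-unique : ∀ {r d} → BeadEquation K κ r d → down K κ r ≡ d
  down-unique {r} {d} be = ≡.trans (cong (ℕ._∸ get (pOf K κ) r) (sym (bead-sum be))) (ℕₚ.m+n∸m≡n (get (pOf K κ) r) d)

-- The data of a core with at most ℓ rows that the combinatorics uses: its row lengths f and bead map d.
record Shape (n ℓ : ℕ) (f d : ℕ → ℕ) : Set where
  field
    n>0 : 0 < n
    decreasing : Decreasing f
    d> : ∀ r → r < d r
    beads : ∀ r → f r ℕ.+ d r ≡ f (d r) ℕ.+ (r ℕ.+ n)
    f-zero : ∀ {r} → ℓ ≤ r → f r ≡ 0

  private
    -- The bead f x - x strictly decreases with x, and row d r carries the bead of row r lowered by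
    -- n.
    mono : ∀ {r s} → r < s → d r < d s
    mono {r} {s} r<s with d r <? d s
    ... | yes p = p
    ... | no p = ⊥-elim (ℕₚ.1+n≰n {0} (linear (f r ℕ.+ f s ℕ.+ f (d r) ℕ.+ f (d s) ℕ.+ r ℕ.+ d r ℕ.+ d s ℕ.+ s ℕ.+ n)
        (r<s ⊞ ds≤dr ⊞ decreasing (ℕₚ.<⇒≤ r<s) ⊞ decreasing ds≤dr ⊞ eq≤ (beads r) ⊞ eq≥ (beads s))
        (e₁ (f r) (f s) (f (d r)) (f (d s)) r (d r) (d s) s n)
        (e₂ (f r) (f s) (f (d r)) (f (d s)) r (d r) (d s) s n)))
      where
        ds≤dr = ℕₚ.≮⇒≥ p
        e₁ : ∀ fr fs fdr fds r dr ds s n → 1 ℕ.+ (fr ℕ.+ fs ℕ.+ fdr ℕ.+ fds ℕ.+ r ℕ.+ dr ℕ.+ ds ℕ.+ s ℕ.+ n)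
          ≡ suc r ℕ.+ (ds ℕ.+ (fs ℕ.+ (fdr ℕ.+ ((fr ℕ.+ dr) ℕ.+ (fds ℕ.+ (s ℕ.+ n))))))
        e₁ = ℕ-ring
        e₂ : ∀ fr fs fdr fds r dr ds s n → s ℕ.+ (dr ℕ.+ (fr ℕ.+ (fds ℕ.+ ((fdr ℕ.+ (r ℕ.+ n)) ℕ.+ (fs ℕ.+ ds))))) ≡ 0 ℕ.+ (fr ℕ.+ fs ℕ.+ fdr ℕ.+ fds ℕ.+ r ℕ.+ dr ℕ.+ ds ℕ.+ s ℕ.+ n)
        e₂ = ℕ-ring

  abstract

    d-mono : ∀ {r s} → r < s → d r < d s
    d-mono = mono

  d≤ : ∀ r → d r ≤ r ℕ.+ n
  d≤ r = linear (f r ℕ.+ f (d r)) (decreasing (ℕₚ.<⇒≤ (d> r)) ⊞ eq≤ (beads r)) (e₁ (f r) (f (d r)) (d r)) (e₂ (f r) (f (d r)) (r ℕ.+ n))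
    where
      e₁ : ∀ a b c → c ℕ.+ (a ℕ.+ b) ≡ b ℕ.+ (a ℕ.+ c)
      e₁ = ℕ-ring
      e₂ : ∀ a b c → a ℕ.+ (b ℕ.+ c) ≡ c ℕ.+ (a ℕ.+ b)
      e₂ = ℕ-ring

  d-zero : ∀ {r} → ℓ ≤ r → d r ≡ r ℕ.+ n
  d-zero {r} ℓ≤r = begin
    d r ≡⟨ cong (ℕ._+ d r) (sym (f-zero ℓ≤r)) ⟩
    f r ℕ.+ d r ≡⟨ beads r ⟩
    f (d r) ℕ.+ (r ℕ.+ n) ≡⟨ cong (ℕ._+ (r ℕ.+ n)) (f-zero (ℕₚ.≤-trans ℓ≤r (ℕₚ.<⇒≤ (d> r)))) ⟩
    r ℕ.+ n ∎
    where open ≡-Reasoning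

  -- Otherwise d r = r + n, so f agrees in rows r and r + n and hence in row r + 1, and the growth
  -- of d forces the same equality there. Then f would be constant from r on, but it vanishes
  -- eventually.
  d-positive : ∀ {r} → 0 < f r → d r < r ℕ.+ n
  d-positive {r} fr>0 with d r <? r ℕ.+ n
  ... | yes p = p
  ... | no p = ⊥-elim (ℕₚ.<⇒≢ fr>0 (sym (≡.trans (sym (proj₁ (go ℓ))) (f-zero (ℕₚ.m≤n+m ℓ r)))))
    where
      go : ∀ k → f (r ℕ.+ k) ≡ f r × d (r ℕ.+ k) ≡ r ℕ.+ k ℕ.+ n
      go zero rewrite ℕₚ.+-identityʳ r = refl , ℕₚ.≤-antisym (d≤ r) (ℕₚ.≮⇒≥ p)
      go (suc k) with go k
      ... | fk , dk = ≡.trans (ℕₚ.≤-antisym (decreasing (ℕₚ.+-monoʳ-≤ r (ℕₚ.n≤1+n k))) f≥) fk , ds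
        where
          s = r ℕ.+ k
          f-const : f s ≡ f (d s)
          f-const = ℕₚ.+-cancelʳ-≡ (s ℕ.+ n) _ _ (≡.trans (cong (λ a → f s ℕ.+ a) (sym dk)) (beads s))
          f≥ : f s ≤ f (r ℕ.+ suc k)
          f≥ = ℕₚ.≤-trans (eq≤ f-const) (decreasing (subst₂ _≤_ (sym (ℕₚ.+-suc r k)) (sym dk)
                 (subst (_≤ s ℕ.+ n) (ℕₚ.+-comm s 1) (ℕₚ.+-monoʳ-≤ s n>0))))
          ds : d (r ℕ.+ suc k) ≡ r ℕ.+ suc k ℕ.+ n
          ds = ℕₚ.≤-antisym (d≤ (r ℕ.+ suc k)) (subst (_≤ d (r ℕ.+ suc k)) (≡.trans (cong suc dk) (cong (ℕ._+ n) (sym (ℕₚ.+-suc r k))))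
                 (d-mono (subst (s <_) (sym (ℕₚ.+-suc r k)) (ℕₚ.n<1+n s))))

-- The bead equation determines f r from f (d r), and every orbit ends in the rows where both shapes
-- vanish.
shape-ext : ∀ {n ℓ f d f′ d′} → Shape n ℓ f d → Shape n ℓ f′ d′ → (∀ r → d r ≡ d′ r) → ∀ r → f r ≡ f′ r
shape-ext {n} {ℓ} {f} {d} {f′} {d′} S S′ e r = go ℓ r (ℕₚ.m≤n+m ℓ r)
  where
    module S = Shape S
    module S′ = Shape S′
    go : ∀ k r → ℓ ≤ r ℕ.+ k → f r ≡ f′ r
    go zero r ℓ≤ = ≡.trans (S.f-zero ℓ≤r) (sym (S′.f-zero ℓ≤r))
      where ℓ≤r = subst (ℓ ≤_) (ℕₚ.+-identityʳ r) ℓ≤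
    go (suc k) r ℓ≤ = ℕₚ.+-cancelʳ-≡ (d r) _ _ (≡.trans (S.beads r)
      (≡.trans (cong (ℕ._+ (r ℕ.+ n)) (≡.trans (go k (d r) (ℕₚ.≤-trans ℓ≤ (subst (_≤ d r ℕ.+ k) (sym (ℕₚ.+-suc r k)) (ℕₚ.+-monoˡ-≤ k (S.d> r))))) (cong f′ (e r))))
        (≡.trans (sym (S′.beads r)) (cong (λ v → f′ r ℕ.+ v) (sym (e r))))))

core-bead : ∀ K κ → T (isPartᵇ κ) → T (isCoreᵇ K κ) → ∀ r → BeadEquation K κ r (down K κ r)
core-bead K κ part core r = subst (BeadEquation K κ r) (sym (down-unique dec (proj₂ fb))) (proj₂ fb)
  where
    dec = part-decreasing κ part
    fb = FindBead.find-bead K κ dec core r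

abstract

  core-shape : ∀ K ℓ κ → T (isPartᵇ κ) → T (isCoreᵇ K κ) → length κ ≤ ℓ → Shape (suc K) ℓ (get κ) (down K κ)
  core-shape K ℓ κ part core len≤ℓ = record
    { n>0 = s≤s z≤n
    ; decreasing = part-decreasing κ part
    ; d> = λ r → BeadEquation.below (core-bead K κ part core r)
    ; beads = λ r → BeadEquation.equation (core-bead K κ part core r)
    ; f-zero = λ ℓ≤r → get-≥length κ (ℕₚ.≤-trans len≤ℓ ℓ≤r)
    }

module FromDown (n ℓ : ℕ) (n>0 : 0 < n) (d : ℕ → ℕ) (d-mono : ∀ {r s} → r < s → d r < d s) (d> : ∀ r → r < d r)
  (d≤ : ∀ r → d r ≤ r ℕ.+ n) (d-zero : ∀ {r} → ℓ ≤ r → d r ≡ r ℕ.+ n) where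

  private
    part : ℕ → ℕ
    part r = r ℕ.+ n ℕ.∸ d r

    -- A row length is recovered as the sum of the parts along the orbit of the row. Fuel ℓ suffices
    -- because an orbit advances by at least one row in each step and the parts vanish from row ℓ
    -- on.
    go : ℕ → ℕ → ℕ
    go zero r = 0
    go (suc k) r = part r ℕ.+ go k (d r)

    go-zero : ∀ k {r} → ℓ ≤ r → go k r ≡ 0
    go-zero zero ℓ≤r = refl
    go-zero (suc k) {r} ℓ≤r = cong₂ ℕ._+_ (≡.trans (cong (r ℕ.+ n ℕ.∸_) (d-zero ℓ≤r)) (ℕₚ.n∸n≡0 (r ℕ.+ n)))
      (go-zero k (ℕₚ.≤-trans ℓ≤r (ℕₚ.<⇒≤ (d> r))))

    go-stable : ∀ k r → ℓ ≤ r ℕ.+ k → go k r ≡ go (suc k) r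
    go-stable zero r ℓ≤ = sym (go-zero 1 (subst (ℓ ≤_) (ℕₚ.+-identityʳ r) ℓ≤))
    go-stable (suc k) r ℓ≤ = cong (part r ℕ.+_) (go-stable k (d r)
      (ℕₚ.≤-trans ℓ≤ (subst (_≤ d r ℕ.+ k) (sym (ℕₚ.+-suc r k)) (ℕₚ.+-monoˡ-≤ k (d> r)))))

    d-spread : ∀ r k → d r ℕ.+ k ≤ d (r ℕ.+ k)
    d-spread r zero = eq≤ (≡.trans (ℕₚ.+-identityʳ (d r)) (cong d (sym (ℕₚ.+-identityʳ r))))
    d-spread r (suc k) = subst₂ _≤_ (sym (ℕₚ.+-suc (d r) k)) (cong d (sym (ℕₚ.+-suc r k)))
      (ℕₚ.≤-<-trans (d-spread r k) (d-mono (ℕₚ.n<1+n (r ℕ.+ k))))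

    part-dec : Decreasing part
    part-dec {r} {s} r≤s = ℕₚ.+-cancelʳ-≤ (d r ℕ.+ d s) _ _ (begin
      part s ℕ.+ (d r ℕ.+ d s) ≡⟨ e₁ (part s) (d r) (d s) ⟩
      (part s ℕ.+ d s) ℕ.+ d r ≡⟨ cong (ℕ._+ d r) (ℕₚ.m∸n+n≡m (d≤ s)) ⟩
      s ℕ.+ n ℕ.+ d r ≡⟨ cong (λ a → a ℕ.+ n ℕ.+ d r) (sym (ℕₚ.m+[n∸m]≡n r≤s)) ⟩
      r ℕ.+ (s ℕ.∸ r) ℕ.+ n ℕ.+ d r ≡⟨ e₂ r (s ℕ.∸ r) n (d r) ⟩
      (r ℕ.+ n) ℕ.+ (d r ℕ.+ (s ℕ.∸ r)) ≤⟨ ℕₚ.+-monoʳ-≤ (r ℕ.+ n) (subst (λ a → d r ℕ.+ (s ℕ.∸ r) ≤ d a) (ℕₚ.m+[n∸m]≡n r≤s) (d-spread r (s ℕ.∸ r))) ⟩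
      (r ℕ.+ n) ℕ.+ d s ≡⟨ cong (ℕ._+ d s) (sym (ℕₚ.m∸n+n≡m (d≤ r))) ⟩
      part r ℕ.+ d r ℕ.+ d s ≡⟨ ℕₚ.+-assoc (part r) (d r) (d s) ⟩
      part r ℕ.+ (d r ℕ.+ d s) ∎)
      where
        open ℕₚ.≤-Reasoning
        e₁ : ∀ p a b → p ℕ.+ (a ℕ.+ b) ≡ (p ℕ.+ b) ℕ.+ a
        e₁ = ℕ-ring
        e₂ : ∀ r k n a → r ℕ.+ k ℕ.+ n ℕ.+ a ≡ (r ℕ.+ n) ℕ.+ (a ℕ.+ k)
        e₂ = ℕ-ring

    d-mono-≤ : ∀ {r s} → r ≤ s → d r ≤ d s
    d-mono-≤ {r} {s} p with ℕₚ.m≤n⇒m<n∨m≡n p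
    ... | inj₁ r<s = ℕₚ.<⇒≤ (d-mono r<s)
    ... | inj₂ refl = ℕₚ.≤-refl

    go-dec : ∀ k → Decreasing (go k)
    go-dec zero r≤s = z≤n
    go-dec (suc k) r≤s = ℕₚ.+-mono-≤ (part-dec r≤s) (go-dec k (d-mono-≤ r≤s))

    go-beads : ∀ r → go ℓ r ℕ.+ d r ≡ go ℓ (d r) ℕ.+ (r ℕ.+ n)
    go-beads r = begin
      go ℓ r ℕ.+ d r ≡⟨ cong (ℕ._+ d r) (go-stable ℓ r (ℕₚ.m≤n+m ℓ r)) ⟩
      part r ℕ.+ go ℓ (d r) ℕ.+ d r ≡⟨ e (part r) (go ℓ (d r)) (d r) ⟩
      go ℓ (d r) ℕ.+ (part r ℕ.+ d r) ≡⟨ cong (go ℓ (d r) ℕ.+_) (ℕₚ.m∸n+n≡m (d≤ r)) ⟩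
      go ℓ (d r) ℕ.+ (r ℕ.+ n) ∎
      where
        open ≡-Reasoning
        e : ∀ p g a → p ℕ.+ g ℕ.+ a ≡ g ℕ.+ (p ℕ.+ a)
        e = ℕ-ring

  abstract

    row : ℕ → ℕ
    row = go ℓ

    shape : Shape n ℓ row d
    shape = record { n>0 = n>0 ; decreasing = go-dec ℓ ; d> = d> ; beads = go-beads ; f-zero = go-zero ℓ }

rows : ℕ → (ℕ → ℕ) → List ℕ
rows zero f = []
rows (suc m) f with f 0
... | zero = []
... | suc a = suc a ∷ rows m (f ∘ suc)

get-rows : ∀ m f → Decreasing f → (∀ {r} → m ≤ r → f r ≡ 0) → ∀ r → get (rows m f) r ≡ f r
get-rows zero f dec z r = sym (z z≤n)
get-rows (suc m) f dec z r with f 0 in e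
... | zero = sym (ℕₚ.n≤0⇒n≡0 (subst (f r ≤_) e (dec z≤n)))
get-rows (suc m) f dec z zero | suc a = sym e
get-rows (suc m) f dec z (suc r) | suc a = get-rows m (f ∘ suc) (λ p → dec (s≤s p)) (λ p → z (s≤s p)) r

length-rows : ∀ m f → length (rows m f) ≤ m
length-rows zero f = z≤n
length-rows (suc m) f with f 0
... | zero = z≤n
... | suc a = s≤s (length-rows m (f ∘ suc))

positive-step⇒part : ∀ xs → (∀ i → i < length xs → 0 < get xs i) → (∀ i → get xs (suc i) ≤ get xs i) → T (isPartᵇ xs)
positive-step⇒part [] p s = _
positive-step⇒part (x ∷ []) p s = ℕₚ.≤⇒≤ᵇ (p 0 (s≤s z≤n))
positive-step⇒part (x ∷ y ∷ xs) p s = ∧⁺ (ℕₚ.≤⇒≤ᵇ (s 0)) (positive-step⇒part (y ∷ xs) (λ i i< → p (suc i) (s≤s i<)) (s ∘ suc))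

rows-positive : ∀ m f i → i < length (rows m f) → 0 < get (rows m f) i
rows-positive (suc m) f i p with f 0
rows-positive (suc m) f zero p | suc a = s≤s z≤n
rows-positive (suc m) f (suc i) (s≤s p) | suc a = rows-positive m (f ∘ suc) i p

rows-part : ∀ m f → Decreasing f → (∀ {r} → m ≤ r → f r ≡ 0) → T (isPartᵇ (rows m f))
rows-part m f dec z = positive-step⇒part (rows m f) (rows-positive m f)
  (λ i → subst₂ _≤_ (sym (get-rows m f dec z (suc i))) (sym (get-rows m f dec z i)) (dec (ℕₚ.n≤1+n i)))

-- Lowering a ladder of a core

module LadderTops (d : ℕ → ℕ) (d-mono : ∀ {r s} → r < s → d r < d s) (d> : ∀ r → r < d r) where

  open Ladders d d-mono d>

  tops : ∀ {g z c y} → Ladder g z c y → List ℕ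
  tops {z = z} (top _ _) = z ∷ []
  tops {z = z} (up _ L) = z ∷ tops L

  summit : ∀ {g z c y} → Ladder g z c y → ℕ
  summit {z = z} (top _ _) = z
  summit (up _ L) = summit L

  length-tops : ∀ {g z c y} (L : Ladder g z c y) → length (tops L) ≡ c
  length-tops (top _ _) = refl
  length-tops (up _ L) = cong suc (length-tops L)

  z∈tops : ∀ {g z c y} (L : Ladder g z c y) → z ∈ tops L
  z∈tops (top _ _) = here refl
  z∈tops (up _ L) = here refl

  summit∈tops : ∀ {g z c y} (L : Ladder g z c y) → summit L ∈ tops L
  summit∈tops (top _ _) = here refl
  summit∈tops (up _ L) = there (summit∈tops L)

  ladder-above : ∀ {g z z′} → (∀ i → i ≤ g → d (z′ ℕ.+ i) ≡ z ℕ.+ i) → z′ < z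
  ladder-above f = above (ladder-row (f 0 z≤n))

  tops-≤ : ∀ {g z c y} (L : Ladder g z c y) → ∀ {Z} → Z ∈ tops L → Z ≤ z
  tops-≤ (top _ _) (here refl) = ℕₚ.≤-refl
  tops-≤ (up _ _) (here refl) = ℕₚ.≤-refl
  tops-≤ (up f L) (there m) = ℕₚ.≤-trans (tops-≤ L m) (ℕₚ.<⇒≤ (ladder-above f))

  summit-≤ : ∀ {g z c y} (L : Ladder g z c y) → summit L ≤ z
  summit-≤ L = tops-≤ L (summit∈tops L)

  summit-top : ∀ {g z c y} (L : Ladder g z c y) → ∀ r → d r ≢ summit L
  summit-top (top none _) = none
  summit-top (up _ L) = summit-top L

  summit-apex : ∀ {g z c y} (L : Ladder g z c y) → ∀ i → i < g → d (y ℕ.+ i) ≡ suc (summit L ℕ.+ i)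
  summit-apex (top _ t) = t
  summit-apex (up _ L) = summit-apex L

  apex-above : ∀ {g z c y} (L : Ladder g z c y) → z ℕ.+ g < d z → ∀ i → i < g → y ℕ.+ i < summit L
  apex-above {g} {z} (top none t) gap i i<g = d-reflect (ℕₚ.≤-<-trans (eq≤ (t i i<g)) (ℕₚ.≤-<-trans (ℕₚ.+-monoʳ-< z i<g) gap))
  apex-above (up f L) gap = apex-above L (subst (_ <_) (sym (ladder-row (f 0 z≤n))) (gap-up f gap))

  tops-preimage : ∀ {g z c y} (L : Ladder g z c y) → ∀ {Z r} i → Z ∈ tops L → i ≤ g → d r ≡ Z ℕ.+ i →
    (∃ λ Z′ → Z′ ∈ tops L × r ≡ Z′ ℕ.+ i) ⊎ (∃ λ i′ → i′ < g × r ≡ y ℕ.+ i′)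
  tops-preimage {z = z} {y = y} (top none t) zero (here refl) i≤g e = ⊥-elim (none _ (≡.trans e (ℕₚ.+-identityʳ z)))
  tops-preimage {z = z} {y = y} (top none t) (suc i) (here refl) i<g e =
    inj₂ (i , i<g , d-inj (≡.trans e (≡.trans (ℕₚ.+-suc z i) (sym (t i i<g)))))
  tops-preimage (up {z′ = z′} f L) i (here refl) i≤g e = inj₁ (z′ , there (z∈tops L) , d-inj (≡.trans e (sym (f i i≤g))))
  tops-preimage (up f L) i (there m) i≤g e with tops-preimage L i m i≤g e
  ... | inj₁ (Z′ , m′ , p) = inj₁ (Z′ , there m′ , p)
  ... | inj₂ q = inj₂ q

  count-below : ℕ → List ℕ → ℕ
  count-below w Zs = length (filterᵇ (λ Z → w ℕ.<ᵇ Z) Zs)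

  tops-none-above : ∀ {g z c y} (L : Ladder g z c y) → count-below z (tops L) ≡ 0
  tops-none-above {z = z} L = cong length (Listₚ.filter-none (T? ∘ (λ Z → z ℕ.<ᵇ Z))
    (All.tabulate λ m t → ℕₚ.<⇒≱ (ℕₚ.<ᵇ⇒< z _ t) (tops-≤ L m)))

  -- The tops are the orbit ending in z, read backwards, so j steps from w to z mean exactly j tops
  -- of larger row index. This is the number N of components below the mark.
  path-tops : ∀ {g z c y} (L : Ladder g z c y) → ∀ j {w} → iter d j w ≡ z → w ∈ tops L × count-below w (tops L) ≡ j
  path-tops L zero refl = z∈tops L , tops-none-above L
  path-tops (top none _) (suc j) {w} e = ⊥-elim (none _ (≡.trans (sym (iter-shift d j w)) e))
  path-tops {z = z} (up {z′ = z′} f L) (suc j) {w} e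
    with path-tops L j {w} (d-inj (≡.trans (≡.trans (sym (iter-shift d j w)) e) (sym (ladder-row (f 0 z≤n)))))
  ... | m , n = there m , ≡.trans (cong length (filterᵇ-true (λ Z → w ℕ.<ᵇ Z) {z} {tops L}
                  (ℕₚ.<⇒<ᵇ (ℕₚ.≤-<-trans (tops-≤ L m) (ladder-above f))))) (cong suc n)

  tops-path : ∀ {g z c y} (L : Ladder g z c y) → ∀ {w} → w ∈ tops L → ∃ λ j → iter d j w ≡ z
  tops-path (top _ _) (here refl) = 0 , refl
  tops-path (up _ _) (here refl) = 0 , refl
  tops-path (up f L) {w} (there m) with tops-path L m
  ... | j , e = suc j , ≡.trans (iter-shift d j w) (≡.trans (cong d e) (ladder-row (f 0 z≤n)))

  module CoverDown {n ℓ z : ℕ} (d≤ : ∀ r → d r ≤ r ℕ.+ n) (d-zero : ∀ {r} → ℓ ≤ r → d r ≡ r ℕ.+ n)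
    (a : Admissible z) (zℓ : z ℕ.+ Admissible.height-1 a < ℓ) (dz< : d z < z ℕ.+ n) where

    open Admissible a renaming (height-1 to g; copies to c; apex to y)

    apex-z : ∀ i → i < g → y ℕ.+ i < z
    apex-z i i<g = ℕₚ.<-≤-trans (apex-above ladder gap i i<g) (summit-≤ ladder)

    data Row (r : ℕ) : Set where
      raised : z ≤ r → r ≤ z ℕ.+ g → cover r ≡ suc (d r) → Row r
      lowered : ∀ i → i < g → r ≡ y ℕ.+ i → suc (cover r) ≡ d r → Row r
      kept : (r < z → ∀ i → i < g → r ≢ y ℕ.+ i) → (r < z ⊎ z ℕ.+ g < r) → cover r ≡ d r → Row r

    classify : ∀ r → Row r
    classify r with r <? z
    ... | no r≮z with r ≤? z ℕ.+ g
    ...   | yes r≤ = raised (ℕₚ.≮⇒≥ r≮z) r≤ (covered-low (ℕₚ.≮⇒≥ r≮z) r≤)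
    ...   | no r≰ = kept (λ r<z → ⊥-elim (r≮z r<z)) (inj₂ (ℕₚ.≰⇒> r≰)) (covered-below (ℕₚ.≰⇒> r≰))
    classify r | yes r<z with ℕₚ.anyUpTo? (λ i → r ≟ y ℕ.+ i) g
    ...   | yes (i , i<g , refl) = lowered i i<g refl (covered-top i i<g r<z)
    ...   | no none = kept (λ _ → ne) (inj₁ r<z) (covered-else r<z ne)
      where
        ne : ∀ i → i < g → r ≢ y ℕ.+ i
        ne i i<g e = none (i , i<g , e)

    -- Maximality of the block is what leaves room to raise its last row by one.
    block-last : suc (d (z ℕ.+ g)) < d (suc (z ℕ.+ g))
    block-last = ℕₚ.≤∧≢⇒< (d-mono (ℕₚ.n<1+n (z ℕ.+ g))) λ e → Block.maximal block (begin
      d (z ℕ.+ suc g) ≡⟨ cong d (ℕₚ.+-suc z g) ⟩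
      d (suc (z ℕ.+ g)) ≡⟨ sym e ⟩
      suc (d (z ℕ.+ g)) ≡⟨ cong suc (Block.equal block g ℕₚ.≤-refl) ⟩
      suc (d z ℕ.+ g) ≡⟨ sym (ℕₚ.+-suc (d z) g) ⟩
      d z ℕ.+ suc g ∎)
      where open ≡-Reasoning

    cover-mono-step : ∀ r → cover r < cover (suc r)
    cover-mono-step r with classify r | classify (suc r)
    ... | raised _ _ p | raised _ _ q = subst₂ _<_ (sym p) (sym q) (s≤s (d-mono (ℕₚ.n<1+n r)))
    ... | raised z≤r _ p | lowered i i<g e q = ⊥-elim (ℕₚ.<⇒≱ (apex-z i i<g) (subst (z ≤_) e (ℕₚ.m≤n⇒m≤1+n z≤r)))
    ... | raised z≤r _ p | kept _ (inj₁ sr<z) q = ⊥-elim (ℕₚ.<⇒≱ sr<z (ℕₚ.m≤n⇒m≤1+n z≤r))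
    ... | raised z≤r r≤ p | kept _ (inj₂ zg<sr) q with ℕₚ.≤-antisym r≤ (ℕₚ.≤-pred zg<sr)
    ...   | refl = subst₂ _<_ (sym p) (sym q) block-last
    cover-mono-step r | lowered i i<g e p | raised _ _ q =
      subst₂ _<_ refl (sym q) (ℕₚ.<-trans (ℕₚ.<-trans (ℕₚ.n<1+n _) (eq≤ (cong suc p))) (s≤s (d-mono (ℕₚ.n<1+n r))))
    cover-mono-step r | lowered i i<g e p | lowered i′ _ e′ q = ℕₚ.≤-pred (subst₂ _<_ (sym p) (sym q) (d-mono (ℕₚ.n<1+n r)))
    cover-mono-step r | lowered i i<g e p | kept _ _ q = subst (cover r <_) (sym q) (ℕₚ.<-trans (eq≤ p) (d-mono (ℕₚ.n<1+n r)))
    cover-mono-step r | kept _ _ p | raised _ _ q = subst₂ _<_ (sym p) (sym q) (ℕₚ.m<n⇒m<1+n (d-mono (ℕₚ.n<1+n r)))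
    cover-mono-step r | kept _ _ p | kept _ _ q = subst₂ _<_ (sym p) (sym q) (d-mono (ℕₚ.n<1+n r))
    cover-mono-step r | kept not-top (inj₂ zg<r) p | lowered i i<g e q =
      ⊥-elim (ℕₚ.<⇒≱ (apex-z i i<g) (subst (z ≤_) e (ℕₚ.m≤n⇒m≤1+n (ℕₚ.≤-trans (ℕₚ.m≤m+n z g) (ℕₚ.<⇒≤ zg<r)))))
    cover-mono-step r | kept not-top (inj₁ r<z) p | lowered (suc i) i<g e q =
      ⊥-elim (not-top r<z i (ℕₚ.<-trans (ℕₚ.n<1+n i) i<g) (ℕₚ.suc-injective (≡.trans e (ℕₚ.+-suc y i))))
    -- The row just above the apex has a value below summit + 1. It cannot be the summit, which has
    -- no preimage, so it stays below the lowered apex row.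
    cover-mono-step r | kept not-top (inj₁ r<z) p | lowered zero i<g e q =
      subst (_< cover (suc r)) (sym p) (ℕₚ.≤∧≢⇒< (ℕₚ.≤-pred (subst (d r <_) (sym q) (d-mono (ℕₚ.n<1+n r))))
        λ eq → summit-top ladder r (≡.trans eq (ℕₚ.suc-injective (≡.trans q (≡.trans (cong d e) (≡.trans (summit-apex ladder 0 i<g) (cong suc (ℕₚ.+-identityʳ _))))))))

    cover-mono : ∀ {r s} → r < s → cover r < cover s
    cover-mono {r} {suc s} (s≤s r≤s) with ℕₚ.m≤n⇒m<n∨m≡n r≤s
    ... | inj₁ r<s = ℕₚ.<-trans (cover-mono r<s) (cover-mono-step s)
    ... | inj₂ refl = cover-mono-step s

    cover> : ∀ r → r < cover r
    cover> r with classify r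
    ... | raised _ _ p = subst (r <_) (sym p) (ℕₚ.m<n⇒m<1+n (d> r))
    ... | kept _ _ p = subst (r <_) (sym p) (d> r)
    ... | lowered i i<g refl p = ℕₚ.≤-pred (subst (suc r <_) (sym (≡.trans p (summit-apex ladder i i<g)))
            (s≤s (ℕₚ.<-≤-trans (apex-above ladder gap i i<g) (ℕₚ.m≤m+n _ i))))

    cover≤ : ∀ r → cover r ≤ r ℕ.+ n
    cover≤ r with classify r
    ... | kept _ _ p = subst (_≤ r ℕ.+ n) (sym p) (d≤ r)
    ... | lowered i i<g e p = ℕₚ.≤-trans (ℕₚ.n≤1+n _) (subst (_≤ r ℕ.+ n) (sym p) (d≤ r))
    ... | raised z≤r r≤ p = subst (_≤ r ℕ.+ n) (sym p) (subst (λ x → d x < x ℕ.+ n) (ℕₚ.m+[n∸m]≡n z≤r)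
            (subst₂ _<_ (sym (Block.equal block i i≤g)) (e z n i) (ℕₚ.+-monoˡ-< i dz<)))
      where
        i = r ℕ.∸ z
        i≤g : i ≤ g
        i≤g = ℕₚ.+-cancelˡ-≤ z _ _ (subst (_≤ z ℕ.+ g) (sym (ℕₚ.m+[n∸m]≡n z≤r)) r≤)
        e : ∀ z n i → z ℕ.+ n ℕ.+ i ≡ z ℕ.+ i ℕ.+ n
        e = ℕ-ring

    cover-zero : ∀ {r} → ℓ ≤ r → cover r ≡ r ℕ.+ n
    cover-zero ℓ≤r = ≡.trans (covered-below (ℕₚ.<-≤-trans zℓ ℓ≤r)) (d-zero ℓ≤r)

    -- Growing a block by one row raises one value of d and lowers another.
    sum-covered : ∀ h → h ≤ g → sumTo ℓ (λ r → + covered h z y r) ≡ sumTo ℓ (λ r → + d r) ℤ.+ 1ℤ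
    sum-covered zero _ = ≡.trans (sumTo-cong ℓ pointwise) (≡.trans (sumTo-+ ℓ (λ r → + d r) (λ r → 1ℤ ℤ.* ind z r))
        (cong (λ a → sumTo ℓ (λ r → + d r) ℤ.+ a) (sumTo-ind ℓ (λ _ → 1ℤ) (ℕₚ.≤-<-trans (ℕₚ.m≤m+n z g) zℓ))))
      where
        pointwise : ∀ r → r < ℓ → + covered 0 z y r ≡ + d r ℤ.+ 1ℤ ℤ.* ind z r
        pointwise r _ with r ≟ z
        ... | yes refl rewrite covered-low {0} {z} {y} ℕₚ.≤-refl (ℕₚ.m≤m+n z 0) | ind-same z = ℤₚ.+-comm 1ℤ (+ d z)
        ... | no r≢z rewrite ind-diff {z} {r} (r≢z ∘ sym) with r <? z
        ...   | yes r<z rewrite covered-else {0} {z} {y} r<z (λ i ()) = sym (ℤₚ.+-identityʳ (+ d r))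
        ...   | no r≮z rewrite covered-below {0} {z} {y} {r} (subst (_< r) (sym (ℕₚ.+-identityʳ z)) (ℕₚ.≤∧≢⇒< (ℕₚ.≮⇒≥ r≮z) (r≢z ∘ sym))) =
                sym (ℤₚ.+-identityʳ (+ d r))
    sum-covered (suc h) h<g = ≡.trans (sumTo-cong ℓ pointwise) (≡.trans (sumTo-+ ℓ (λ r → + covered h z y r) _)
        (≡.trans (cong₂ ℤ._+_ (sum-covered h (ℕₚ.<⇒≤ h<g)) (≡.trans (sumTo-- ℓ (λ r → 1ℤ ℤ.* ind (suc (z ℕ.+ h)) r) (λ r → 1ℤ ℤ.* ind (y ℕ.+ h) r))
            (cong₂ ℤ._-_ (sumTo-ind ℓ (λ _ → 1ℤ) zh<ℓ) (sumTo-ind ℓ (λ _ → 1ℤ) (ℕₚ.<-trans yh<z (ℕₚ.≤-<-trans (ℕₚ.m≤m+n z g) zℓ))))))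
          (ℤₚ.+-identityʳ _)))
      where
        zh<ℓ : suc (z ℕ.+ h) < ℓ
        zh<ℓ = ℕₚ.≤-<-trans (subst (_≤ z ℕ.+ g) (ℕₚ.+-suc z h) (ℕₚ.+-monoʳ-≤ z h<g)) zℓ
        yh<z : y ℕ.+ h < z
        yh<z = apex-z h h<g
        pointwise : ∀ r → r < ℓ → + covered (suc h) z y r ≡ + covered h z y r ℤ.+ (1ℤ ℤ.* ind (suc (z ℕ.+ h)) r ℤ.- 1ℤ ℤ.* ind (y ℕ.+ h) r)
        pointwise r _ with r ≟ suc (z ℕ.+ h) | r ≟ y ℕ.+ h
        ... | yes refl | yes e = ⊥-elim (ℕₚ.<⇒≱ yh<z (subst (z ≤_) e (ℕₚ.m≤n⇒m≤1+n (ℕₚ.m≤m+n z h))))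
        ... | yes refl | no r≢y rewrite ind-same (suc (z ℕ.+ h)) | ind-diff {y ℕ.+ h} {suc (z ℕ.+ h)} (r≢y ∘ sym)
            | covered-low {suc h} {z} {y} {suc (z ℕ.+ h)} (ℕₚ.m≤n⇒m≤1+n (ℕₚ.m≤m+n z h)) (eq≥ (ℕₚ.+-suc z h))
            | covered-below {h} {z} {y} {suc (z ℕ.+ h)} (ℕₚ.n<1+n (z ℕ.+ h)) = ℤₚ.+-comm 1ℤ (+ d (suc (z ℕ.+ h)))
        ... | no r≢z | yes refl rewrite ind-same (y ℕ.+ h) | ind-diff {suc (z ℕ.+ h)} {y ℕ.+ h} (r≢z ∘ sym)
            | covered-else {h} {z} {y} {y ℕ.+ h} yh<z (λ i i<h e → ℕₚ.<⇒≢ i<h (sym (ℕₚ.+-cancelˡ-≡ y h i e)))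
            | sym (covered-top {suc h} {z} {y} h (ℕₚ.n<1+n h) yh<z) = eq (+ covered (suc h) z y (y ℕ.+ h))
          where
            eq : ∀ a → a ≡ 1ℤ ℤ.+ a ℤ.+ (0ℤ ℤ.- 1ℤ)
            eq = ℤ-ring
        ... | no r≢z | no r≢y rewrite ind-diff {suc (z ℕ.+ h)} {r} (r≢z ∘ sym) | ind-diff {y ℕ.+ h} {r} (r≢y ∘ sym)
            | CoverStraightening.covered-rest n ℓ d d-mono d> {h} {z} {y} (λ i i<sh → apex-z i (ℕₚ.<-≤-trans i<sh h<g)) r r≢y r≢z =
              sym (ℤₚ.+-identityʳ (+ covered h z y r))

  tops-step : ∀ {g z c y} (L : Ladder g z c y) → ∀ {Z} → Z ∈ tops L →
    Z ≡ z ⊎ (d Z ∈ tops L × (∀ i → i ≤ g → d (Z ℕ.+ i) ≡ d Z ℕ.+ i))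
  tops-step (top _ _) (here refl) = inj₁ refl
  tops-step (up _ _) (here refl) = inj₁ refl
  tops-step (up h L) (there m) with tops-step L m
  ... | inj₂ (m′ , e) = inj₂ (there m′ , e)
  ... | inj₁ refl = inj₂ (here (ladder-row (h 0 z≤n)) , λ i i≤g → ≡.trans (h i i≤g) (cong (ℕ._+ i) (sym (ladder-row (h 0 z≤n)))))

  summit-min : ∀ {g z c y} (L : Ladder g z c y) → ∀ {Z} → Z ∈ tops L → summit L ≤ Z
  summit-min (top _ _) (here refl) = ℕₚ.≤-refl
  summit-min (up h L) (here refl) = ℕₚ.≤-trans (summit-≤ L) (ℕₚ.<⇒≤ (ladder-above h))
  summit-min (up h L) (there m) = summit-min L m

-- Rows Z, ..., Z + g of the skew shape f / f′. By `linked` consecutive rows share exactly one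
-- column; by `lower` the last row has no column in common with the next row of f.
record Ribbon (f f′ : ℕ → ℕ) (g Z : ℕ) : Set where
  field
    linked : ∀ i → i < g → suc (f′ (Z ℕ.+ i)) ≡ f (suc (Z ℕ.+ i))
    lower : f (suc (Z ℕ.+ g)) ≤ f′ (Z ℕ.+ g)
    upper : f′ (Z ℕ.+ g) < f (Z ℕ.+ g)

  strict : Decreasing f → ∀ i → i ≤ g → f′ (Z ℕ.+ i) < f (Z ℕ.+ i)
  strict dec i i≤g with ℕₚ.m≤n⇒m<n∨m≡n i≤g
  ... | inj₁ i<g = subst (_≤ f (Z ℕ.+ i)) (sym (linked i i<g)) (dec (ℕₚ.n≤1+n (Z ℕ.+ i)))
  ... | inj₂ refl = upper

module CoverShape {n ℓ : ℕ} {f d : ℕ → ℕ} (S : Shape n ℓ f d) where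

  open Shape S
  open Ladders d d-mono d>
  open LadderTops d d-mono d>

  module _ {z : ℕ} (a : Admissible z) {f′ : ℕ → ℕ} (S′ : Shape n ℓ f′ (Admissible.cover a)) where

    open Admissible a renaming (height-1 to g; copies to c; apex to y)
    module S′ = Shape S′

    beads-at : ∀ {r v} → d r ≡ v → f r ℕ.+ v ≡ f v ℕ.+ (r ℕ.+ n)
    beads-at {r} refl = beads r

    beads′-at : ∀ {r v} → cover r ≡ v → f′ r ℕ.+ v ≡ f′ v ℕ.+ (r ℕ.+ n)
    beads′-at {r} refl = S′.beads r

    unchanged-below : ∀ {r} → z ℕ.+ g < r → f′ r ≡ f r
    unchanged-below {r} = go ℓ r (ℕₚ.m≤n+m ℓ r)
      where
        go : ∀ k r → ℓ ≤ r ℕ.+ k → z ℕ.+ g < r → f′ r ≡ f r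
        go zero r ℓ≤ _ = ≡.trans (S′.f-zero ℓ≤r) (sym (f-zero ℓ≤r))
          where ℓ≤r = subst (ℓ ≤_) (ℕₚ.+-identityʳ r) ℓ≤
        go (suc k) r ℓ≤ zg<r = ℕₚ.+-cancelʳ-≡ (d r) _ _ (≡.trans (beads′-at (covered-below zg<r))
          (≡.trans (cong (ℕ._+ (r ℕ.+ n)) (go k (d r) (ℕₚ.≤-trans ℓ≤ (subst (_≤ d r ℕ.+ k) (sym (ℕₚ.+-suc r k)) (ℕₚ.+-monoˡ-≤ k (d> r)))) (ℕₚ.<-trans zg<r (d> r))))
            (sym (beads r))))

    -- The bead equation of f′ for a block row ends in a row below the block, where f and f′ agree,
    -- so it can be compared with the equations of f.
    ribbon-base : Ribbon f f′ g z
    ribbon-base = record { linked = linked ; lower = lower ; upper = upper }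
      where
        zg<D : ∀ {r} → z ≤ r → z ℕ.+ g < d r
        zg<D z≤r = ℕₚ.<-≤-trans gap (d-mono-≤ z≤r)
        linked : ∀ i → i < g → suc (f′ (z ℕ.+ i)) ≡ f (suc (z ℕ.+ i))
        linked i i<g = ℕₚ.+-cancelʳ-≡ D _ _ (begin
          suc (f′ r) ℕ.+ D ≡⟨ cong suc (beads′-at (covered-low (ℕₚ.m≤m+n z i) (ℕₚ.+-monoʳ-≤ z (ℕₚ.<⇒≤ i<g)))) ⟩
          suc (f′ D ℕ.+ (r ℕ.+ n)) ≡⟨ cong (λ a → suc (a ℕ.+ (r ℕ.+ n))) (unchanged-below (ℕₚ.m<n⇒m<1+n (zg<D (ℕₚ.m≤m+n z i)))) ⟩
          suc (f D ℕ.+ (r ℕ.+ n)) ≡⟨ sym (ℕₚ.+-suc (f D) (r ℕ.+ n)) ⟩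
          f D ℕ.+ (suc r ℕ.+ n) ≡⟨ sym (beads-at (CoverStraightening.block-next n ℓ d d-mono d> block i<g)) ⟩
          f (suc r) ℕ.+ D ∎)
          where
            open ≡-Reasoning
            r = z ℕ.+ i
            D = suc (d r)
        r = z ℕ.+ g
        D = suc (d r)
        bead-r : f′ r ℕ.+ D ≡ f D ℕ.+ (r ℕ.+ n)
        bead-r = ≡.trans (beads′-at (covered-low (ℕₚ.m≤m+n z g) ℕₚ.≤-refl))
          (cong (ℕ._+ (r ℕ.+ n)) (unchanged-below (ℕₚ.m<n⇒m<1+n (zg<D (ℕₚ.m≤m+n z g)))))
        upper : f′ r < f r
        upper = linear (d r ℕ.+ f D ℕ.+ f (d r) ℕ.+ (r ℕ.+ n)) (eq≤ bead-r ⊞ decreasing (ℕₚ.n≤1+n (d r)) ⊞ eq≥ (beads r))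
          (e₁ (f′ r) (d r) (f D) (f (d r)) (r ℕ.+ n)) (e₂ (f D) (r ℕ.+ n) (f (d r)) (f r) (d r))
          where
            e₁ : ∀ x v a b k → suc x ℕ.+ (v ℕ.+ a ℕ.+ b ℕ.+ k) ≡ (x ℕ.+ suc v) ℕ.+ (a ℕ.+ (b ℕ.+ k))
            e₁ = ℕ-ring
            e₂ : ∀ a k b x v → (a ℕ.+ k) ℕ.+ (b ℕ.+ (x ℕ.+ v)) ≡ x ℕ.+ (v ℕ.+ a ℕ.+ b ℕ.+ k)
            e₂ = ℕ-ring
        lower : f (suc r) ≤ f′ r
        lower = linear (d (suc r) ℕ.+ f (d (suc r)) ℕ.+ f D ℕ.+ (r ℕ.+ n) ℕ.+ suc (suc (d r)))
          (eq≤ (beads (suc r)) ⊞ decreasing (ℕₚ.<⇒≤ next) ⊞ eq≥ bead-r ⊞ next)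
          (e₁ (f (suc r)) (d (suc r)) (f (d (suc r))) (f D) (r ℕ.+ n) (d r))
          (e₂ (f (d (suc r))) r n (f D) (f′ r) (d r) (d (suc r)))
          where
            next : suc (d r) < d (suc r)
            next = ℕₚ.≤∧≢⇒< (d-mono (ℕₚ.n<1+n r)) λ e → Block.maximal block
              (≡.trans (cong d (ℕₚ.+-suc z g)) (≡.trans (sym e) (≡.trans (cong suc (Block.equal block g ℕₚ.≤-refl)) (sym (ℕₚ.+-suc (d z) g)))))
            e₁ : ∀ x v a b k w → x ℕ.+ (v ℕ.+ a ℕ.+ b ℕ.+ k ℕ.+ suc (suc w)) ≡ (x ℕ.+ v) ℕ.+ (a ℕ.+ ((b ℕ.+ k) ℕ.+ suc (suc w)))
            e₁ = ℕ-ring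
            e₂ : ∀ a r n b x w v → (a ℕ.+ (suc r ℕ.+ n)) ℕ.+ (b ℕ.+ ((x ℕ.+ suc w) ℕ.+ v)) ≡ x ℕ.+ (v ℕ.+ a ℕ.+ b ℕ.+ (r ℕ.+ n) ℕ.+ suc (suc w))
            e₂ = ℕ-ring

    -- Both bead maps send the upper translate to the lower one, so from one to the other f and f′
    -- change by the same amount and the relations between them are carried along. Only `lower`
    -- needs the growth of d in addition, because the row after the upper block need not be sent to
    -- the row after the lower one.
    ribbon-up : ∀ {Z Z′} → (∀ i → i ≤ g → d (Z′ ℕ.+ i) ≡ Z ℕ.+ i) → (∀ i → i ≤ g → cover (Z′ ℕ.+ i) ≡ Z ℕ.+ i) →
      Ribbon f f′ g Z → Ribbon f f′ g Z′
    ribbon-up {Z} {Z′} h h′ R = record { linked = linked ; lower = lower ; upper = upper }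
      where
        module R = Ribbon R
        linked : ∀ i → i < g → suc (f′ (Z′ ℕ.+ i)) ≡ f (suc (Z′ ℕ.+ i))
        linked i i<g = ℕₚ.+-cancelʳ-≡ (suc q) _ _ (begin
          suc (f′ r) ℕ.+ suc q ≡⟨ cong suc (ℕₚ.+-suc (f′ r) q) ⟩
          suc (suc (f′ r ℕ.+ q)) ≡⟨ cong (suc ∘ suc) (beads′-at (h′ i (ℕₚ.<⇒≤ i<g))) ⟩
          suc (suc (f′ q) ℕ.+ (r ℕ.+ n)) ≡⟨ cong (λ a → suc (a ℕ.+ (r ℕ.+ n))) (R.linked i i<g) ⟩
          suc (f (suc q) ℕ.+ (r ℕ.+ n)) ≡⟨ sym (ℕₚ.+-suc (f (suc q)) (r ℕ.+ n)) ⟩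
          f (suc q) ℕ.+ (suc r ℕ.+ n) ≡⟨ sym (beads-at (subst₂ (λ a b → d a ≡ b) (ℕₚ.+-suc Z′ i) (ℕₚ.+-suc Z i) (h (suc i) i<g))) ⟩
          f (suc r) ℕ.+ suc q ∎)
          where
            open ≡-Reasoning
            r = Z′ ℕ.+ i
            q = Z ℕ.+ i
        r = Z′ ℕ.+ g
        q = Z ℕ.+ g
        upper : f′ r < f r
        upper = ℕₚ.+-cancelʳ-< q _ _ (subst₂ _<_ (sym (beads′-at (h′ g ℕₚ.≤-refl))) (sym (beads-at (h g ℕₚ.≤-refl)))
          (ℕₚ.+-monoˡ-< (r ℕ.+ n) R.upper))
        lower : f (suc r) ≤ f′ r
        lower = linear (d (suc r) ℕ.+ f (d (suc r)) ℕ.+ f (suc q) ℕ.+ f′ q ℕ.+ (r ℕ.+ n) ℕ.+ suc q)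
          (eq≤ (beads (suc r)) ⊞ decreasing next ⊞ R.lower ⊞ eq≥ (beads′-at (h′ g ℕₚ.≤-refl)) ⊞ next)
          (e₁ (f (suc r)) (d (suc r)) (f (d (suc r))) (f (suc q)) (f′ q) (r ℕ.+ n) q)
          (e₂ (f (d (suc r))) r n (f (suc q)) (f′ q) (f′ r) q (d (suc r)))
          where
            next : suc q ≤ d (suc r)
            next = subst (_< d (suc r)) (h g ℕₚ.≤-refl) (d-mono (ℕₚ.n<1+n r))
            e₁ : ∀ x v a b m k w → x ℕ.+ (v ℕ.+ a ℕ.+ b ℕ.+ m ℕ.+ k ℕ.+ suc w) ≡ (x ℕ.+ v) ℕ.+ (a ℕ.+ (b ℕ.+ ((m ℕ.+ k) ℕ.+ suc w)))
            e₁ = ℕ-ring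
            e₂ : ∀ a r n b m x w v → (a ℕ.+ (suc r ℕ.+ n)) ℕ.+ (b ℕ.+ (m ℕ.+ ((x ℕ.+ w) ℕ.+ v))) ≡ x ℕ.+ (v ℕ.+ a ℕ.+ b ℕ.+ m ℕ.+ (r ℕ.+ n) ℕ.+ suc w)
            e₂ = ℕ-ring

    ribbons-from : ∀ {Z c} (L : Ladder g Z c y) → Z ≤ z → Z ℕ.+ g < d Z → Ribbon f f′ g Z → ∀ {W} → W ∈ tops L → Ribbon f f′ g W
    ribbons-from (top _ _) _ _ R (here refl) = R
    ribbons-from (up _ _) _ _ R (here refl) = R
    ribbons-from {Z} (up {z′ = Z′} h L) Z≤z gapZ R (there m) =
      ribbons-from L (ℕₚ.<⇒≤ (ℕₚ.<-≤-trans Z′<Z Z≤z)) gapZ′ (ribbon-up h h′ R) m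
      where
        Z′<Z = ladder-above h
        Z′g<Z = gap-up h gapZ
        gapZ′ : Z′ ℕ.+ g < d Z′
        gapZ′ = subst (Z′ ℕ.+ g <_) (sym (ladder-row (h 0 z≤n))) Z′g<Z
        h′ : ∀ i → i ≤ g → cover (Z′ ℕ.+ i) ≡ Z ℕ.+ i
        h′ i i≤g = ≡.trans (covered-else (ℕₚ.<-≤-trans (ℕₚ.≤-<-trans (ℕₚ.+-monoʳ-≤ Z′ i≤g) Z′g<Z) Z≤z)
            λ i′ i′<g e → ℕₚ.<⇒≱ (ℕₚ.<-≤-trans (apex-above L gapZ′ i′ i′<g) (summit-≤ L)) (subst (Z′ ≤_) e (ℕₚ.m≤m+n Z′ i)))
          (h i i≤g)

    ribbons : ∀ {Z} → Z ∈ tops ladder → Ribbon f f′ g Z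
    ribbons = ribbons-from ladder ℕₚ.≤-refl gap ribbon-base

    Outside : ℕ → Set
    Outside r = ∀ {Z} → Z ∈ tops ladder → r < Z ⊎ Z ℕ.+ g < r

    outside⇒unchanged : ∀ {r} → Outside r → f′ r ≡ f r
    outside⇒unchanged {r} = go ℓ r (ℕₚ.m≤n+m ℓ r)
      where
        go : ∀ k r → ℓ ≤ r ℕ.+ k → Outside r → f′ r ≡ f r
        go zero r ℓ≤ _ = ≡.trans (S′.f-zero ℓ≤r) (sym (f-zero ℓ≤r))
          where ℓ≤r = subst (ℓ ≤_) (ℕₚ.+-identityʳ r) ℓ≤
        go (suc k) r ℓ≤ out with out (z∈tops ladder)
        ... | inj₂ zg<r = unchanged-below zg<r
        ... | inj₁ r<z with ℕₚ.anyUpTo? (λ i → r ≟ y ℕ.+ i) g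
        -- An apex row now meets row q of the top translate instead of row q + 1; since `linked`
        -- gives f′ q + 1 = f (q + 1), its length does not change.
        ...   | yes (i , i<g , refl) = ℕₚ.+-cancelʳ-≡ (suc q) _ _ (begin
            f′ r ℕ.+ suc q ≡⟨ ℕₚ.+-suc (f′ r) q ⟩
            suc (f′ r ℕ.+ q) ≡⟨ cong suc (beads′-at (ℕₚ.suc-injective (≡.trans (covered-top i i<g r<z) (summit-apex ladder i i<g)))) ⟩
            suc (f′ q) ℕ.+ (r ℕ.+ n) ≡⟨ cong (ℕ._+ (r ℕ.+ n)) (Ribbon.linked (ribbons (summit∈tops ladder)) i i<g) ⟩
            f (suc q) ℕ.+ (r ℕ.+ n) ≡⟨ sym (beads-at (summit-apex ladder i i<g)) ⟩
            f r ℕ.+ suc q ∎)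
          where
            open ≡-Reasoning
            q = summit ladder ℕ.+ i
        ...   | no none = ℕₚ.+-cancelʳ-≡ (d r) _ _ (≡.trans (beads′-at (covered-else r<z ne))
            (≡.trans (cong (ℕ._+ (r ℕ.+ n)) (go k (d r) (ℕₚ.≤-trans ℓ≤ (subst (_≤ d r ℕ.+ k) (sym (ℕₚ.+-suc r k)) (ℕₚ.+-monoˡ-≤ k (d> r)))) out-d)) (sym (beads r))))
          where
            ne : ∀ i → i < g → r ≢ y ℕ.+ i
            ne i i<g e = none (i , i<g , e)
            -- If d r lay in a ribbon, r would lie in a ribbon itself or be an apex row, and both
            -- are excluded.
            out-d : Outside (d r)
            out-d {Z} m with d r <? Z | Z ℕ.+ g <? d r
            ... | yes p | _ = inj₁ p
            ... | no _ | yes p = inj₂ p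
            ... | no p | no q with tops-preimage ladder {r = r} (d r ℕ.∸ Z) m i≤g (sym Z+i)
              where
                Z+i : Z ℕ.+ (d r ℕ.∸ Z) ≡ d r
                Z+i = ℕₚ.m+[n∸m]≡n (ℕₚ.≮⇒≥ p)
                i≤g : d r ℕ.∸ Z ≤ g
                i≤g = ℕₚ.+-cancelˡ-≤ Z _ _ (subst (_≤ Z ℕ.+ g) (sym Z+i) (ℕₚ.≮⇒≥ q))
            ...   | inj₂ (i , i<g , e) = ⊥-elim (ne i i<g e)
            ...   | inj₁ (Z′ , m′ , e) = ⊥-elim (case out m′ of λ
                { (inj₁ r<Z′) → ℕₚ.<⇒≱ r<Z′ (subst (Z′ ≤_) (sym e) (ℕₚ.m≤m+n Z′ _))
                ; (inj₂ Zg<r) → ℕₚ.<⇒≱ Zg<r (subst (_≤ Z′ ℕ.+ g) (sym e) (ℕₚ.+-monoʳ-≤ Z′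
                    (ℕₚ.+-cancelˡ-≤ Z _ _ (subst (_≤ Z ℕ.+ g) (sym (ℕₚ.m+[n∸m]≡n (ℕₚ.≮⇒≥ p))) (ℕₚ.≮⇒≥ q))))) })

    locate : ∀ r → Outside r ⊎ (∃ λ Z → ∃ λ i → Z ∈ tops ladder × i ≤ g × r ≡ Z ℕ.+ i)
    locate r with Any.any? (λ Z → (Z ≤? r) ×-dec (r ≤? Z ℕ.+ g)) (tops ladder)
    ... | yes any with find any
    ...   | Z , m , Z≤r , r≤ = inj₂ (Z , r ℕ.∸ Z , m ,
              ℕₚ.+-cancelˡ-≤ Z _ _ (subst (_≤ Z ℕ.+ g) (sym (ℕₚ.m+[n∸m]≡n Z≤r)) r≤) , sym (ℕₚ.m+[n∸m]≡n Z≤r))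
    locate r | no none = inj₁ out
      where
        out : Outside r
        out {Z} m with r <? Z | Z ℕ.+ g <? r
        ... | yes p | _ = inj₁ p
        ... | no _ | yes p = inj₂ p
        ... | no p | no q = ⊥-elim (none (lose m (ℕₚ.≮⇒≥ p , ℕₚ.≮⇒≥ q)))

    cover-⊆ : ∀ r → f′ r ≤ f r
    cover-⊆ r with locate r
    ... | inj₁ out = eq≤ (outside⇒unchanged out)
    ... | inj₂ (Z , i , m , i≤g , refl) = ℕₚ.<⇒≤ (Ribbon.strict (ribbons m) decreasing i i≤g)

  tops-disjoint : ∀ {g z c y} (L : Ladder g z c y) → z ℕ.+ g < d z → ∀ {Z W} → Z ∈ tops L → W ∈ tops L →
    Z ≡ W ⊎ (Z ℕ.+ g < W ⊎ W ℕ.+ g < Z)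
  tops-disjoint (top _ _) gap (here refl) (here refl) = inj₁ refl
  tops-disjoint (up h L) gap (here refl) (here refl) = inj₁ refl
  tops-disjoint {g} (up h L) gap (here refl) (there m) = inj₂ (inj₂ (ℕₚ.≤-<-trans (ℕₚ.+-monoˡ-≤ g (tops-≤ L m)) (gap-up h gap)))
  tops-disjoint {g} (up h L) gap (there m) (here refl) = inj₂ (inj₁ (ℕₚ.≤-<-trans (ℕₚ.+-monoˡ-≤ g (tops-≤ L m)) (gap-up h gap)))
  tops-disjoint (up h L) gap (there m) (there m′) =
    tops-disjoint L (subst (_ <_) (sym (ladder-row (h 0 z≤n))) (gap-up h gap)) m m′

  tops-unique : ∀ {g z c y} (L : Ladder g z c y) → Unique (tops L)
  tops-unique (top _ _) = [] AllPairs.∷ AllPairs.[]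
  tops-unique (up h L) = All.tabulate (λ m e → ℕₚ.<⇒≱ (ladder-above h) (subst (_≤ _) (sym e) (tops-≤ L m))) AllPairs.∷ tops-unique L

  cover-upper : ∀ {z} (adm : Admissible z) → let open Admissible adm in
    ∀ {Z} → Z ∈ tops ladder → Z ≢ z → ∀ i → i ≤ height-1 → cover (Z ℕ.+ i) ≡ d (Z ℕ.+ i)
  cover-upper {z} adm {Z} m ne i i≤g = covered-else (ℕₚ.≤-<-trans (ℕₚ.+-monoʳ-≤ Z i≤g) Zg<z)
      λ i′ i′<g e → ℕₚ.<⇒≱ (ℕₚ.<-≤-trans (apex-above ladder gap i′ i′<g) (summit-min ladder m)) (subst (Z ≤_) e (ℕₚ.m≤m+n Z i))
    where
      open Admissible adm
      Zg<z : Z ℕ.+ height-1 < z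
      Zg<z with tops-disjoint ladder gap m (z∈tops ladder)
      ... | inj₁ e = ⊥-elim (ne e)
      ... | inj₂ (inj₁ p) = p
      ... | inj₂ (inj₂ p) = ⊥-elim (ℕₚ.<⇒≱ p (ℕₚ.≤-trans (tops-≤ ladder m) (ℕₚ.m≤m+n z _)))

  ladder-iter : ∀ {z} (adm : Admissible z) → let open Admissible adm in
    ∀ j {Z} → Z ∈ tops ladder → iter d j Z ∈ tops ladder → ∀ i → i ≤ height-1 →
    iter d j (Z ℕ.+ i) ≡ iter d j Z ℕ.+ i × iter cover j (Z ℕ.+ i) ≡ iter d j Z ℕ.+ i
  ladder-iter adm zero m m′ i i≤g = refl , refl
  ladder-iter {z} adm (suc j) {Z} m m′ i i≤g with tops-step (Admissible.ladder adm) m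
  ... | inj₁ refl = ⊥-elim (ℕₚ.<⇒≱ (ℕₚ.<-≤-trans (d> z) (iter-≤ j (d z))) (tops-≤ (Admissible.ladder adm) m′))
  ... | inj₂ (dZ∈ , e) with ladder-iter adm j dZ∈ m′ i i≤g
  ...   | p , q = ≡.trans (cong (iter d j) (e i i≤g)) p , ≡.trans (cong (iter cover j) (≡.trans (cover-upper adm m ne i i≤g) (e i i≤g))) q
    where
      open Admissible adm using (cover; ladder)
      ne : Z ≢ z
      ne refl = ℕₚ.<⇒≱ (d> z) (tops-≤ ladder dZ∈)

-- Components of skew shapes made of ribbons

any⁺ : ∀ {A : Set} (p : A → Bool) {xs x} → x ∈ xs → T (p x) → T (any p xs)
any⁺ p m t = Anyₚ.any⁺ p (lose m t)

any⁻ : ∀ {A : Set} (p : A → Bool) xs → T (any p xs) → ∃ λ x → x ∈ xs × T (p x)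
any⁻ p xs t = find (Anyₚ.any⁻ p xs t)

∨⁻ : ∀ {x y} → T (x ∨ y) → T x ⊎ T y
∨⁻ = Equivalence.to T-∨

∨⁺ˡ : ∀ {x y} → T x → T (x ∨ y)
∨⁺ˡ p = Equivalence.from T-∨ (inj₁ p)

∨⁺ʳ : ∀ {x y} → T y → T (x ∨ y)
∨⁺ʳ {x} p = Equivalence.from (T-∨ {x}) (inj₂ p)

≡ᵇ-refl : ∀ a → T (a ℕ.≡ᵇ a)
≡ᵇ-refl a = ℕₚ.≡⇒≡ᵇ a a refl

eqBox-refl : ∀ b → T (eqBox b b)
eqBox-refl (r , c) = ∧⁺ (≡ᵇ-refl r) (≡ᵇ-refl c)

eqBox⇒≡ : ∀ b b′ → T (eqBox b b′) → b ≡ b′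
eqBox⇒≡ (r , c) (r′ , c′) t = cong₂ _,_ (ℕₚ.≡ᵇ⇒≡ r r′ (proj₁ (∧⁻ t))) (ℕₚ.≡ᵇ⇒≡ c c′ (proj₂ (∧⁻ {r ℕ.≡ᵇ r′} t)))

memᵇ⁺ : ∀ {b S} → b ∈ S → T (memᵇ b S)
memᵇ⁺ {b} m = any⁺ (eqBox b) m (eqBox-refl b)

memᵇ⁻ : ∀ {b S} → T (memᵇ b S) → b ∈ S
memᵇ⁻ {b} {S} t with any⁻ (eqBox b) S t
... | b′ , m , e = subst (_∈ S) (sym (eqBox⇒≡ b b′ e)) m

∈-filterᵇ⁺ : ∀ {A : Set} (p : A → Bool) {x xs} → x ∈ xs → T (p x) → x ∈ filterᵇ p xs
∈-filterᵇ⁺ p = ∈-filter⁺ (T? ∘ p)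

∈-filterᵇ⁻ : ∀ {A : Set} (p : A → Bool) {x xs} → x ∈ filterᵇ p xs → x ∈ xs × T (p x)
∈-filterᵇ⁻ p {xs = xs} = ∈-filter⁻ (T? ∘ p) {xs = xs}

adj-left : ∀ r c → T (adj (r , c) (r , suc c))
adj-left r c = ∨⁺ˡ (∧⁺ (≡ᵇ-refl r) (∨⁺ˡ (≡ᵇ-refl c)))

adj-right : ∀ r c → T (adj (r , suc c) (r , c))
adj-right r c = ∨⁺ˡ (∧⁺ (≡ᵇ-refl r) (∨⁺ʳ {suc (suc c) ℕ.≡ᵇ c} (≡ᵇ-refl c)))

adj-up : ∀ r c → T (adj (r , c) (suc r , c))
adj-up r c = ∨⁺ʳ {(r ℕ.≡ᵇ suc r) ∧ _} (∧⁺ (≡ᵇ-refl c) (∨⁺ˡ (≡ᵇ-refl r)))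

adj-down : ∀ r c → T (adj (suc r , c) (r , c))
adj-down r c = ∨⁺ʳ {(suc r ℕ.≡ᵇ r) ∧ _} (∧⁺ (≡ᵇ-refl c) (∨⁺ʳ {suc (suc r) ℕ.≡ᵇ r} (≡ᵇ-refl r)))

adj⁻ : ∀ {r c r′ c′} → T (adj (r , c) (r′ , c′)) → r ≡ r′ ⊎ (c ≡ c′ × (suc r ≡ r′ ⊎ suc r′ ≡ r))
adj⁻ {r} {c} {r′} {c′} t with ∨⁻ {(r ℕ.≡ᵇ r′) ∧ ((suc c ℕ.≡ᵇ c′) ∨ (suc c′ ℕ.≡ᵇ c))} t
... | inj₁ s = inj₁ (ℕₚ.≡ᵇ⇒≡ r r′ (proj₁ (∧⁻ {r ℕ.≡ᵇ r′} s)))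
... | inj₂ s with ∧⁻ {c ℕ.≡ᵇ c′} s
...   | u , v with ∨⁻ {suc r ℕ.≡ᵇ r′} v
...     | inj₁ w = inj₂ (ℕₚ.≡ᵇ⇒≡ c c′ u , inj₁ (ℕₚ.≡ᵇ⇒≡ (suc r) r′ w))
...     | inj₂ w = inj₂ (ℕₚ.≡ᵇ⇒≡ c c′ u , inj₂ (ℕₚ.≡ᵇ⇒≡ (suc r′) r w))

reach : List Box → Box → Bool
reach S b = memᵇ b S ∨ any (adj b) S

spread : List Box → List Box → List Box
spread U S = filterᵇ (reach S) U

∈-spread⁺ : ∀ {U S x y} → x ∈ U → y ∈ S → T (adj x y) → x ∈ spread U S
∈-spread⁺ {U} {S} {x} x∈ y∈ t = ∈-filterᵇ⁺ (reach S) x∈ (∨⁺ʳ {memᵇ x S} (any⁺ (adj x) y∈ t))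

∈-spread-old : ∀ {U S x} → x ∈ U → x ∈ S → x ∈ spread U S
∈-spread-old {U} {S} x∈U x∈S = ∈-filterᵇ⁺ (reach S) x∈U (∨⁺ˡ (memᵇ⁺ x∈S))

grow-⊆ : ∀ (P : Box → Set) {U} → (∀ {x y} → x ∈ U → P y → T (adj x y) → P x) →
  ∀ m S → (∀ {x} → x ∈ S → P x) → ∀ {x} → x ∈ grow m U S → P x
grow-⊆ P cl zero S s m = s m
grow-⊆ P {U} cl (suc k) S s m = grow-⊆ P cl k (spread U S) s′ m
  where
    s′ : ∀ {x} → x ∈ spread U S → P x
    s′ {x} m with ∈-filterᵇ⁻ (reach S) {xs = U} m
    ... | x∈U , t with ∨⁻ {memᵇ x S} t
    ...   | inj₁ u = s (memᵇ⁻ u)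
    ...   | inj₂ u with any⁻ (adj x) S u
    ...     | y , y∈ , v = cl x∈U (s y∈) v

grow-old : ∀ m {U S x} → x ∈ U → x ∈ S → x ∈ grow m U S
grow-old zero x∈U x∈S = x∈S
grow-old (suc m) x∈U x∈S = grow-old m x∈U (∈-spread-old x∈U x∈S)

filterᵇ-mono : ∀ {A : Set} (p q : A → Bool) xs → (∀ {x} → x ∈ xs → T (p x) → T (q x)) →
  length (filterᵇ p xs) < length (filterᵇ q xs) ⊎ filterᵇ p xs ≡ filterᵇ q xs
filterᵇ-mono p q [] h = inj₂ refl
filterᵇ-mono p q (x ∷ xs) h with filterᵇ-mono p q xs (h ∘ there) | T? (p x) | T? (q x)
... | r | yes a | no b = ⊥-elim (b (h (here refl) a))
... | inj₁ r | yes a | yes b rewrite filterᵇ-true p {x} {xs} a | filterᵇ-true q {x} {xs} b = inj₁ (s≤s r)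
... | inj₂ r | yes a | yes b rewrite filterᵇ-true p {x} {xs} a | filterᵇ-true q {x} {xs} b = inj₂ (cong (x ∷_) r)
... | inj₁ r | no a | yes b rewrite filterᵇ-false p {x} {xs} a | filterᵇ-true q {x} {xs} b = inj₁ (ℕₚ.m<n⇒m<1+n r)
... | inj₂ r | no a | yes b rewrite filterᵇ-false p {x} {xs} a | filterᵇ-true q {x} {xs} b = inj₁ (s≤s (eq≤ (cong length r)))
... | inj₁ r | no a | no b rewrite filterᵇ-false p {x} {xs} a | filterᵇ-false q {x} {xs} b = inj₁ r
... | inj₂ r | no a | no b rewrite filterᵇ-false p {x} {xs} a | filterᵇ-false q {x} {xs} b = inj₂ r

grow-fixed : ∀ m U S → spread U S ≡ S → grow m U S ≡ S
grow-fixed zero U S e = refl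
grow-fixed (suc m) U S e = ≡.trans (cong (grow m U) e) (grow-fixed m U S e)

-- Each round either enlarges the set or has reached a fixed point, so the number of boxes still
-- missing bounds the rounds needed. Sets are written as filters of U so that two rounds can be
-- compared by length.
grow-stable : ∀ m U p → length U ≤ m ℕ.+ length (filterᵇ p U) →
  spread U (grow m U (filterᵇ p U)) ≡ grow m U (filterᵇ p U)
grow-stable m U p len with filterᵇ-mono p (reach (filterᵇ p U)) U (λ x∈ t → ∨⁺ˡ (memᵇ⁺ (∈-filterᵇ⁺ p x∈ t)))
... | inj₂ e rewrite grow-fixed m U (filterᵇ p U) (sym e) = sym e
grow-stable zero U p len | inj₁ lt = ⊥-elim (ℕₚ.<⇒≱ lt (ℕₚ.≤-trans (Listₚ.length-filter (T? ∘ reach (filterᵇ p U)) U) len))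
grow-stable (suc m) U p len | inj₁ lt = grow-stable m U (reach (filterᵇ p U))
  (ℕₚ.≤-trans len (ℕₚ.≤-trans (eq≤ (sym (ℕₚ.+-suc m _))) (ℕₚ.+-monoʳ-≤ m lt)))

length>0 : ∀ {A : Set} {xs : List A} {x} → x ∈ xs → 0 < length xs
length>0 (here _) = s≤s z≤n
length>0 (there _) = s≤s z≤n

grow-closed : ∀ b U {x y} → let V = b ∷ U ; R = grow (length V) V (b ∷ []) in
  x ∈ V → y ∈ R → T (adj x y) → x ∈ R
-- The first round brings the singleton of b into the form of a filter. The result still contains b,
-- so the remaining `length U` rounds are enough.
grow-closed b U {x} {y} x∈ y∈ t = subst (x ∈_) (grow-stable (length U) (b ∷ U) (reach (b ∷ []))
    (subst (_≤ length U ℕ.+ length (spread (b ∷ U) (b ∷ []))) (ℕₚ.+-comm (length U) 1)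
      (ℕₚ.+-monoʳ-≤ (length U) (length>0 (∈-spread-old {b ∷ U} {b ∷ []} (here refl) (here refl))))))
  (∈-spread⁺ {b ∷ U} x∈ y∈ t)

foldr-⊓-≤ : ∀ (bs : List Box) r {b} → b ∈ bs → foldr (λ b m → proj₁ b ℕ.⊓ m) r bs ≤ proj₁ b
foldr-⊓-≤ (b ∷ bs) r (here refl) = ℕₚ.m⊓n≤m _ _
foldr-⊓-≤ (b ∷ bs) r (there m) = ℕₚ.≤-trans (ℕₚ.m⊓n≤n _ _) (foldr-⊓-≤ bs r m)

foldr-⊓-≤-init : ∀ (bs : List Box) r → foldr (λ b m → proj₁ b ℕ.⊓ m) r bs ≤ r
foldr-⊓-≤-init [] r = ℕₚ.≤-refl
foldr-⊓-≤-init (b ∷ bs) r = ℕₚ.≤-trans (ℕₚ.m⊓n≤n _ _) (foldr-⊓-≤-init bs r)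

foldr-⊓-≥ : ∀ (bs : List Box) r Z → Z ≤ r → (∀ {b} → b ∈ bs → Z ≤ proj₁ b) → Z ≤ foldr (λ b m → proj₁ b ℕ.⊓ m) r bs
foldr-⊓-≥ [] r Z p q = p
foldr-⊓-≥ (b ∷ bs) r Z p q = ℕₚ.⊓-glb (q (here refl)) (foldr-⊓-≥ bs r Z p (q ∘ there))

minRow-≡ : ∀ C {Z b} → b ∈ C → proj₁ b ≡ Z → (∀ {b} → b ∈ C → Z ≤ proj₁ b) → minRow C ≡ Z
minRow-≡ ((r , c) ∷ bs) {Z} m e h = ℕₚ.≤-antisym (le m e) (foldr-⊓-≥ bs r Z (h (here refl)) (h ∘ there))
  where
    le : ∀ {b} → b ∈ (r , c) ∷ bs → proj₁ b ≡ Z → minRow ((r , c) ∷ bs) ≤ Z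
    le (here refl) refl = foldr-⊓-≤-init bs r
    le (there m) refl = foldr-⊓-≤ bs r m

maxRow-≡ : ∀ C {Z b} → b ∈ C → proj₁ b ≡ Z → (∀ {b} → b ∈ C → proj₁ b ≤ Z) → maxRow C ≡ Z
maxRow-≡ C m e h = ℕₚ.≤-antisym (ub C h) (subst (_≤ maxRow C) e (lb C m))
  where
    ub : ∀ C {Z} → (∀ {b} → b ∈ C → proj₁ b ≤ Z) → maxRow C ≤ Z
    ub [] h = z≤n
    ub (b ∷ C) h = ℕₚ.⊔-lub (h (here refl)) (ub C (h ∘ there))
    lb : ∀ C {b} → b ∈ C → proj₁ b ≤ maxRow C
    lb (b ∷ C) (here refl) = ℕₚ.m≤m⊔n _ _
    lb (b ∷ C) (there m) = ℕₚ.≤-trans (lb C m) (ℕₚ.m≤n⊔m _ _)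

module RibbonComponents (f f′ : ℕ → ℕ) (dec : Decreasing f) (g : ℕ) where

  Cell : Box → Set
  Cell (r , c) = f′ r ≤ c × c < f r

  Inside : ℕ → Box → Set
  Inside Z (r , _) = Z ≤ r × r ≤ Z ℕ.+ g

  Disjoint : List ℕ → Set
  Disjoint Zs = ∀ {Z W} → Z ∈ Zs → W ∈ Zs → Z ≡ W ⊎ (Z ℕ.+ g < W ⊎ W ℕ.+ g < Z)

  Spans : List ℕ → List Box → Set
  Spans Zs U = (∀ {b} → b ∈ U → Cell b × ∃ λ Z → Z ∈ Zs × Inside Z b) × (∀ {b Z} → Cell b → Z ∈ Zs → Inside Z b → b ∈ U)

  IsRibbon : List Box → ℕ → Set
  IsRibbon C Z = minRow C ≡ Z × height C ≡ suc g

  row-cell : ∀ {Z} → Ribbon f f′ g Z → ∀ i → i ≤ g → Cell (Z ℕ.+ i , f′ (Z ℕ.+ i))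
  row-cell R i i≤g = ℕₚ.≤-refl , Ribbon.strict R dec i i≤g

  module Grown {Zs : List ℕ} (disj : Disjoint Zs) (rib : ∀ {Z} → Z ∈ Zs → Ribbon f f′ g Z) {b U}
    (sp : Spans Zs (b ∷ U)) where

    V R : List Box
    V = b ∷ U
    R = grow (length V) V (b ∷ [])

    Z : ℕ
    Z = proj₁ (proj₂ (proj₁ sp (here refl)))

    Z∈ : Z ∈ Zs
    Z∈ = proj₁ (proj₂ (proj₂ (proj₁ sp (here refl))))

    b-inside : Inside Z b
    b-inside = proj₂ (proj₂ (proj₂ (proj₁ sp (here refl))))

    open Ribbon (rib Z∈)

    -- Ribbons of consecutive rows do not touch: below the last row of one, the diagram of f has no column in common with it.
    no-contact : ∀ {W W′ r c} → W ∈ Zs → W′ ∈ Zs → W ≢ W′ → Inside W (r , c) → Inside W′ (suc r , c) → Cell (r , c) → ¬ Cell (suc r , c)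
    no-contact {W} {W′} {r} m m′ ne (W≤r , r≤) (W′≤ , sr≤) (f′r≤c , _) (_ , c<fsr) with disj m m′
    ... | inj₁ e = ne e
    ... | inj₂ (inj₂ W′g<W) = ℕₚ.<⇒≱ W′g<W (ℕₚ.≤-trans (ℕₚ.m≤n⇒m≤1+n W≤r) sr≤)
    ... | inj₂ (inj₁ Wg<W′) with ℕₚ.≤-antisym r≤ (ℕₚ.≤-pred (ℕₚ.≤-trans Wg<W′ W′≤))
    ...   | refl = ℕₚ.<⇒≱ c<fsr (ℕₚ.≤-trans (Ribbon.lower (rib m)) f′r≤c)

    adj-same : ∀ {x y W W′} → W ∈ Zs → W′ ∈ Zs → Inside W x → Inside W′ y → Cell x → Cell y → T (adj x y) → W ≡ W′
    adj-same {r , c} {r′ , c′} {W} {W′} m m′ i i′ x y t with W ≟ W′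
    ... | yes e = e
    ... | no ne with adj⁻ {r} {c} {r′} {c′} t
    ...   | inj₂ (refl , inj₁ refl) = ⊥-elim (no-contact m m′ ne i i′ x y)
    ...   | inj₂ (refl , inj₂ refl) = ⊥-elim (no-contact m′ m (ne ∘ sym) i′ i y x)
    ...   | inj₁ refl with disj m m′
    ...     | inj₁ e = e
    ...     | inj₂ (inj₁ p) = ⊥-elim (ℕₚ.<⇒≱ p (ℕₚ.≤-trans (proj₁ i′) (proj₂ i)))
    ...     | inj₂ (inj₂ p) = ⊥-elim (ℕₚ.<⇒≱ p (ℕₚ.≤-trans (proj₁ i) (proj₂ i′)))

    R⊆ : ∀ {x} → x ∈ R → x ∈ V × Inside Z x
    R⊆ = grow-⊆ (λ x → x ∈ V × Inside Z x) closed (length V) (b ∷ []) λ { (here refl) → here refl , b-inside }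
      where
        closed : ∀ {x y} → x ∈ V → y ∈ V × Inside Z y → T (adj x y) → x ∈ V × Inside Z x
        closed {x} {y} x∈ (y∈ , iy) t with proj₁ sp x∈ | proj₁ sp y∈
        ... | cx , W , W∈ , ix | cy , _ with adj-same {x} {y} W∈ Z∈ ix iy cx cy t
        ...   | refl = x∈ , ix

    full-row : ℕ → Set
    full-row i = ∀ c → Cell (Z ℕ.+ i , c) → (Z ℕ.+ i , c) ∈ R

    inside-i : ∀ {i c} → i ≤ g → Inside Z (Z ℕ.+ i , c)
    inside-i i≤g = ℕₚ.m≤m+n Z _ , ℕₚ.+-monoʳ-≤ Z i≤g

    fill-right : ∀ {i} → i ≤ g → ∀ k c → f′ (Z ℕ.+ i) ≤ c → c ℕ.+ k < f (Z ℕ.+ i) → (Z ℕ.+ i , c) ∈ R → (Z ℕ.+ i , c ℕ.+ k) ∈ R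
    fill-right {i} i≤g zero c lo hi m rewrite ℕₚ.+-identityʳ c = m
    fill-right {i} i≤g (suc k) c lo hi m rewrite ℕₚ.+-suc c k = fill-right i≤g k (suc c) (ℕₚ.m≤n⇒m≤1+n lo) hi
      (grow-closed b U (proj₂ sp (ℕₚ.m≤n⇒m≤1+n lo , ℕₚ.≤-<-trans (ℕₚ.m≤m+n (suc c) k) hi) Z∈ (inside-i {i} {suc c} i≤g)) m (adj-right (Z ℕ.+ i) c))

    fill-left : ∀ {i} → i ≤ g → ∀ k c → f′ (Z ℕ.+ i) ≤ c → c ℕ.+ k < f (Z ℕ.+ i) → (Z ℕ.+ i , c ℕ.+ k) ∈ R → (Z ℕ.+ i , c) ∈ R
    fill-left {i} i≤g zero c lo hi m rewrite ℕₚ.+-identityʳ c = m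
    fill-left {i} i≤g (suc k) c lo hi m rewrite ℕₚ.+-suc c k =
      grow-closed b U (proj₂ sp (lo , ℕₚ.<-trans (ℕₚ.≤-<-trans (ℕₚ.m≤m+n c k) (ℕₚ.n<1+n _)) hi) Z∈ (inside-i {i} {c} i≤g))
        (fill-left i≤g k (suc c) (ℕₚ.m≤n⇒m≤1+n lo) hi m) (adj-left (Z ℕ.+ i) c)

    fill : ∀ {i} → i ≤ g → ∀ {c₀} → Cell (Z ℕ.+ i , c₀) → (Z ℕ.+ i , c₀) ∈ R → full-row i
    fill {i} i≤g {c₀} (lo₀ , hi₀) m c (lo , hi) with c₀ ≤? c
    ... | yes p = subst (λ a → (Z ℕ.+ i , a) ∈ R) (ℕₚ.m+[n∸m]≡n p)
            (fill-right i≤g (c ℕ.∸ c₀) c₀ lo₀ (subst (_< f (Z ℕ.+ i)) (sym (ℕₚ.m+[n∸m]≡n p)) hi) m)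
    ... | no q = fill-left i≤g (c₀ ℕ.∸ c) c lo (subst (_< f (Z ℕ.+ i)) (sym e) hi₀) (subst (λ a → (Z ℕ.+ i , a) ∈ R) (sym e) m)
      where
        e : c ℕ.+ (c₀ ℕ.∸ c) ≡ c₀
        e = ℕₚ.m+[n∸m]≡n (ℕₚ.<⇒≤ (ℕₚ.≰⇒> q))

    link : ∀ {i} → i < g → Cell (Z ℕ.+ suc i , f′ (Z ℕ.+ i))
    link {i} i<g rewrite ℕₚ.+-suc Z i = ℕₚ.≤-pred (subst (f′ (suc (Z ℕ.+ i)) <_) (sym (linked i i<g))
        (subst (λ a → f′ a < f a) (ℕₚ.+-suc Z i) (strict dec (suc i) i<g))) , eq≤ (linked i i<g)

    full-down : ∀ {i} → i < g → full-row i → full-row (suc i)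
    full-down {i} i<g full = fill i<g (link i<g) (subst (λ a → (a , f′ (Z ℕ.+ i)) ∈ R) (sym (ℕₚ.+-suc Z i))
      (grow-closed b U (subst (λ a → (a , f′ (Z ℕ.+ i)) ∈ V) (ℕₚ.+-suc Z i) (proj₂ sp (link i<g) Z∈ (inside-i {suc i} {0} i<g)))
        (full _ (row-cell (rib Z∈) i (ℕₚ.<⇒≤ i<g))) (adj-down (Z ℕ.+ i) (f′ (Z ℕ.+ i)))))

    full-up : ∀ {i} → i < g → full-row (suc i) → full-row i
    full-up {i} i<g full = fill (ℕₚ.<⇒≤ i<g) (row-cell (rib Z∈) i (ℕₚ.<⇒≤ i<g))
      (grow-closed b U (proj₂ sp (row-cell (rib Z∈) i (ℕₚ.<⇒≤ i<g)) Z∈ (inside-i {i} {0} (ℕₚ.<⇒≤ i<g)))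
        (subst (λ a → (a , f′ (Z ℕ.+ i)) ∈ R) (ℕₚ.+-suc Z i) (full _ (link i<g))) (adj-up (Z ℕ.+ i) (f′ (Z ℕ.+ i))))

    full-zero : ∀ i → i ≤ g → full-row i → full-row 0
    full-zero zero _ full = full
    full-zero (suc i) i<g full = full-zero i (ℕₚ.<⇒≤ i<g) (full-up i<g full)

    full-from-zero : full-row 0 → ∀ i → i ≤ g → full-row i
    full-from-zero full zero _ = full
    full-from-zero full (suc i) i<g = full-down i<g (full-from-zero full i (ℕₚ.<⇒≤ i<g))

    offset : ∀ {r} → Z ≤ r → r ≤ Z ℕ.+ g → ∃ λ i → i ≤ g × Z ℕ.+ i ≡ r
    offset {r} p q = r ℕ.∸ Z , ℕₚ.+-cancelˡ-≤ Z _ _ (subst (_≤ Z ℕ.+ g) (sym (ℕₚ.m+[n∸m]≡n p)) q) , ℕₚ.m+[n∸m]≡n p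

    -- From the row of the starting box the component is filled up to row Z and from there down to
    -- the last row, crossing between rows in the shared columns.
    full : ∀ i → i ≤ g → full-row i
    full with offset (proj₁ b-inside) (proj₂ b-inside)
    ... | i , i≤g , e = full-from-zero (full-zero i i≤g (fill i≤g (subst (λ a → Cell (a , proj₂ b)) (sym e) (proj₁ (proj₁ sp (here refl))))
            (subst (λ a → (a , proj₂ b) ∈ R) (sym e) (grow-old (length V) {V} {b ∷ []} (here refl) (here refl)))))

    ⊆R : ∀ {x} → Cell x → Inside Z x → x ∈ R
    ⊆R {r , c} cell (p , q) with offset p q
    ... | i , i≤g , refl = full i i≤g c cell

    R-ribbon : IsRibbon R Z
    R-ribbon = minRow-≡ R (⊆R (cell 0 z≤n) (in-row 0 z≤n)) (ℕₚ.+-identityʳ Z) (proj₁ ∘ proj₂ ∘ R⊆) , height≡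
      where
        cell = row-cell (rib Z∈)
        in-row : ∀ i → i ≤ g → Inside Z (Z ℕ.+ i , f′ (Z ℕ.+ i))
        in-row i i≤g = inside-i {i} {f′ (Z ℕ.+ i)} i≤g
        max : maxRow R ≡ Z ℕ.+ g
        max = maxRow-≡ R (⊆R (cell g ℕₚ.≤-refl) (in-row g ℕₚ.≤-refl)) refl (proj₂ ∘ proj₂ ∘ R⊆)
        inR : ℕ → Bool
        inR i = any (λ b → proj₁ b ℕ.≡ᵇ i) R
        height≡ : height R ≡ suc g
        height≡ rewrite max = ≡.trans (count-interval inR id Z (suc (Z ℕ.+ g)) out within) (≡.trans (cong (ℕ._∸ Z) (sym (ℕₚ.+-suc Z g))) (ℕₚ.m+n∸m≡n Z (suc g)))
          where
            out : ∀ c → c < Z → ¬ T (inR c)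
            out c c<Z t with any⁻ (λ b → proj₁ b ℕ.≡ᵇ c) R t
            ... | x , x∈ , e = ℕₚ.<⇒≱ c<Z (subst (Z ≤_) (ℕₚ.≡ᵇ⇒≡ _ c e) (proj₁ (proj₂ (R⊆ x∈))))
            within : ∀ c → Z ≤ c → c < suc (Z ℕ.+ g) → T (inR c)
            within c p q with offset p (ℕₚ.≤-pred q)
            ... | i , i≤g , refl = any⁺ (λ b → proj₁ b ℕ.≡ᵇ (Z ℕ.+ i)) (⊆R (cell i i≤g) (in-row i i≤g)) (≡ᵇ-refl (Z ℕ.+ i))

  -- The order in which components are found depends on the list of boxes, so the tops are recovered
  -- only up to a permutation. The test of a mark, the common height and the count of components
  -- below a mark are insensitive to it.
  ribbon-components : ∀ fuel {Zs U} → length U ≤ fuel → Disjoint Zs → Unique Zs → (∀ {Z} → Z ∈ Zs → Ribbon f f′ g Z) → Spans Zs U →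
    ∃ λ Ws → Ws ↭ Zs × Pointwise IsRibbon (componentsF fuel U) Ws
  ribbon-components fuel {[]} {[]} _ _ _ _ _ = [] , refl , subst (λ C → Pointwise IsRibbon C []) (sym (empty fuel)) []
    where
      empty : ∀ fuel → componentsF fuel [] ≡ []
      empty zero = refl
      empty (suc _) = refl
  ribbon-components fuel {Z ∷ Zs} {[]} _ _ _ rib sp with proj₂ sp (row-cell (rib (here refl)) 0 z≤n) (here refl)
    (ℕₚ.m≤m+n Z 0 , ℕₚ.+-monoʳ-≤ Z z≤n)
  ... | ()
  ribbon-components (suc fuel) {Zs} {b ∷ U} (s≤s len) disj uniq rib sp = Z ∷ Ws , perm , R-ribbon ∷ pw
    where
      open Grown disj rib sp
      keep : Box → Bool
      keep x = not (memᵇ x R)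
      Zs₁ = filter (λ W → ¬? (W ≟ Z)) Zs
      ∈Zs₁ : ∀ {W} → W ∈ Zs₁ → W ∈ Zs × W ≢ Z
      ∈Zs₁ = ∈-filter⁻ (λ W → ¬? (W ≟ Z)) {xs = Zs}
      len₁ : length (filterᵇ keep V) ≤ fuel
      len₁ rewrite filterᵇ-false keep {b} {U} (λ t → not⁻ t (memᵇ⁺ (grow-old (length V) {V} {b ∷ []} (here refl) (here refl)))) =
        ℕₚ.≤-trans (Listₚ.length-filter (T? ∘ keep) U) len
      sp₁ : Spans Zs₁ (filterᵇ keep V)
      sp₁ = fwd , bwd
        where
          fwd : ∀ {x} → x ∈ filterᵇ keep V → Cell x × ∃ λ W → W ∈ Zs₁ × Inside W x
          fwd {x} m with ∈-filterᵇ⁻ keep {xs = V} m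
          ... | x∈ , t with proj₁ sp x∈
          ...   | cx , W , W∈ , ix = cx , W , ∈-filter⁺ (λ W → ¬? (W ≟ Z)) W∈ (λ { refl → not⁻ t (memᵇ⁺ (⊆R cx ix)) }) , ix
          bwd : ∀ {x W} → Cell x → W ∈ Zs₁ → Inside W x → x ∈ filterᵇ keep V
          bwd {x} {W} cx W∈₁ ix with ∈Zs₁ W∈₁
          ... | W∈ , W≢Z = ∈-filterᵇ⁺ keep (proj₂ sp cx W∈ ix) (not⁺ λ t → case disj W∈ Z∈ of λ
            { (inj₁ e) → W≢Z e
            ; (inj₂ (inj₁ p)) → ℕₚ.<⇒≱ p (ℕₚ.≤-trans (proj₁ (proj₂ (R⊆ (memᵇ⁻ {x} {R} t)))) (proj₂ ix))
            ; (inj₂ (inj₂ p)) → ℕₚ.<⇒≱ p (ℕₚ.≤-trans (proj₁ ix) (proj₂ (proj₂ (R⊆ (memᵇ⁻ {x} {R} t))))) })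
      rec = ribbon-components fuel len₁ (λ m m′ → disj (proj₁ (∈Zs₁ m)) (proj₁ (∈Zs₁ m′)))
        (Uniqueₚ.filter⁺ (λ W → ¬? (W ≟ Z)) uniq) (rib ∘ proj₁ ∘ ∈Zs₁) sp₁
      Ws = proj₁ rec
      pw = proj₂ (proj₂ rec)
      perm : Z ∷ Ws ↭ Zs
      perm = trans (prep Z (proj₁ (proj₂ rec))) (unique-⇔⇒↭
        (All.tabulate (λ m e → proj₂ (∈Zs₁ m) (sym e)) AllPairs.∷ Uniqueₚ.filter⁺ (λ W → ¬? (W ≟ Z)) uniq) uniq
        (λ { (here refl) → Z∈ ; (there m) → proj₁ (∈Zs₁ m) }) to)
        where
          to : ∀ {W} → W ∈ Zs → W ∈ Z ∷ Zs₁
          to {W} m with W ≟ Z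
          ... | yes refl = here refl
          ... | no ne = there (∈-filter⁺ (λ W → ¬? (W ≟ Z)) m ne)

  any-top⁺ : ∀ {Cs Ws w} → Pointwise IsRibbon Cs Ws → w ∈ Ws → T (any (λ C → suc (minRow C) ℕ.≡ᵇ suc w) Cs)
  any-top⁺ {C ∷ Cs} {w = w} ((e , _) ∷ pw) (here refl) = ∨⁺ˡ (subst (λ a → T (a ℕ.≡ᵇ w)) (sym e) (≡ᵇ-refl w))
  any-top⁺ {C ∷ Cs} {w = w} (_ ∷ pw) (there m) = ∨⁺ʳ {minRow C ℕ.≡ᵇ w} (any-top⁺ pw m)

  any-top⁻ : ∀ {Cs Ws w} → Pointwise IsRibbon Cs Ws → T (any (λ C → suc (minRow C) ℕ.≡ᵇ suc w) Cs) → w ∈ Ws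
  any-top⁻ {C ∷ Cs} {w = w} ((e , _) ∷ pw) t with ∨⁻ {minRow C ℕ.≡ᵇ w} t
  ... | inj₁ u = here (≡.trans (sym (ℕₚ.≡ᵇ⇒≡ (minRow C) w u)) e)
  ... | inj₂ u = there (any-top⁻ pw u)

  heightAt-top : ∀ {Cs Ws w} → Pointwise IsRibbon Cs Ws → w ∈ Ws → heightAt (suc w) Cs ≡ suc g
  heightAt-top {C ∷ Cs} {w = w} ((e , h) ∷ pw) m with minRow C ℕ.≡ᵇ w in eq
  ... | true = h
  heightAt-top {C ∷ Cs} {w = w} ((e , h) ∷ pw) (there m) | false = heightAt-top pw m
  heightAt-top {C ∷ Cs} {w = w} ((e , h) ∷ pw) (here refl) | false = ⊥-elim (subst T eq (subst (λ a → T (a ℕ.≡ᵇ w)) (sym e) (≡ᵇ-refl w)))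

  count-tops : ∀ {Cs Ws} w → Pointwise IsRibbon Cs Ws → length (filterᵇ (λ C → suc w ℕ.<ᵇ suc (minRow C)) Cs) ≡ length (filterᵇ (λ Z → w ℕ.<ᵇ Z) Ws)
  count-tops w [] = refl
  count-tops {C ∷ Cs} {W ∷ Ws} w ((e , _) ∷ pw) with T? (w ℕ.<ᵇ W)
  ... | yes t rewrite filterᵇ-true (λ C → suc w ℕ.<ᵇ suc (minRow C)) {C} {Cs} (subst (λ a → T (w ℕ.<ᵇ a)) (sym e) t)
        | filterᵇ-true (λ Z → w ℕ.<ᵇ Z) {W} {Ws} t = cong suc (count-tops w pw)
  ... | no t rewrite filterᵇ-false (λ C → suc w ℕ.<ᵇ suc (minRow C)) {C} {Cs} (t ∘ subst (λ a → T (w ℕ.<ᵇ a)) e)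
        | filterᵇ-false (λ Z → w ℕ.<ᵇ Z) {W} {Ws} t = count-tops w pw

  components-length : ∀ {Cs Ws} → Pointwise IsRibbon Cs Ws → length Cs ≡ length Ws
  components-length [] = refl
  components-length (_ ∷ pw) = cong suc (components-length pw)

-- Interpolation between nested cores

module Interpolation {n ℓ : ℕ} {f d a e : ℕ → ℕ} (S : Shape n ℓ f d) (T : Shape n ℓ a e) (a≤f : ∀ r → a r ≤ f r) where

  module S = Shape S
  module T = Shape T
  open Ladders d S.d-mono S.d>
  open LadderTops d S.d-mono S.d>
  open CoverShape S

  iter-beads : ∀ {h δ : ℕ → ℕ} → (∀ r → h r ℕ.+ δ r ≡ h (δ r) ℕ.+ (r ℕ.+ n)) → ∀ j r → h r ℕ.+ iter δ j r ≡ h (iter δ j r) ℕ.+ (r ℕ.+ j ℕ.* n)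
  iter-beads {h} b zero r = cong (λ x → h r ℕ.+ x) (sym (ℕₚ.+-identityʳ r))
  iter-beads {h} {δ} b (suc j) r = ℕₚ.+-cancelʳ-≡ (h (δ r) ℕ.+ δ r) _ _ (begin
    h r ℕ.+ s ℕ.+ (h (δ r) ℕ.+ δ r) ≡⟨ e₁ (h r) s (h (δ r)) (δ r) ⟩
    (h r ℕ.+ δ r) ℕ.+ (h (δ r) ℕ.+ s) ≡⟨ cong₂ ℕ._+_ (b r) (iter-beads {h} b j (δ r)) ⟩
    (h (δ r) ℕ.+ (r ℕ.+ n)) ℕ.+ (h s ℕ.+ (δ r ℕ.+ j ℕ.* n)) ≡⟨ e₂ (h (δ r)) r n (h s) (δ r) (j ℕ.* n) ⟩
    h s ℕ.+ (r ℕ.+ (n ℕ.+ j ℕ.* n)) ℕ.+ (h (δ r) ℕ.+ δ r) ∎)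
    where
      open ≡-Reasoning
      s = iter δ j (δ r)
      e₁ : ∀ x s y v → x ℕ.+ s ℕ.+ (y ℕ.+ v) ≡ (x ℕ.+ v) ℕ.+ (y ℕ.+ s)
      e₁ = ℕ-ring
      e₂ : ∀ y r n x v k → (y ℕ.+ (r ℕ.+ n)) ℕ.+ (x ℕ.+ (v ℕ.+ k)) ≡ x ℕ.+ (r ℕ.+ (n ℕ.+ k)) ℕ.+ (y ℕ.+ v)
      e₂ = ℕ-ring

  iter-mono : ∀ {δ : ℕ → ℕ} → (∀ {r s} → r < s → δ r < δ s) → ∀ j {r s} → r < s → iter δ j r < iter δ j s
  iter-mono m zero p = p
  iter-mono m (suc j) p = iter-mono m j (m p)

  ladder-height : ∀ {g z c y} → Ladder g z c y → ∀ j → j < c → ∃ λ Z → iter d j Z ≡ z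
  ladder-height {z = z} _ zero _ = z , refl
  ladder-height (top _ _) (suc j) (s≤s ())
  ladder-height (up h L) (suc j) (s≤s j<c) with ladder-height L j j<c
  ... | Z , e = Z , ≡.trans (iter-shift d j Z) (≡.trans (cong d e) (ladder-row (h 0 z≤n)))

  copies>0 : ∀ {g z c y} → Ladder g z c y → 0 < c
  copies>0 (top _ _) = s≤s z≤n
  copies>0 (up _ _) = s≤s z≤n

  -- The blocked climb from z runs alongside the iterated preimages of row z + g + 1 until these
  -- stop, so they are no more numerous than those of z. It is used in reverse: a row of larger
  -- level cannot block.
  blocked-height : ∀ {g y z c y′ c′ y″} → Blocked g y z → Ladder g z c y′ → Ladder 0 (suc (z ℕ.+ g)) c′ y″ → c′ ≤ c
  blocked-height (stop _ none) L (up h _) = ⊥-elim (none _ (ladder-row (h 0 z≤n)))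
  blocked-height (stop _ none) (top _ _) (top _ _) = ℕₚ.≤-refl
  blocked-height (stop _ none) (up _ _) (top _ _) = s≤s z≤n
  blocked-height (up h B) (top none _) _ = ⊥-elim (none _ (ladder-row (h 0 z≤n)))
  blocked-height (up h B) (up _ _) (top _ _) = s≤s z≤n
  blocked-height {g} {z = z} (up {z′ = z′} h B) (up h′ L) (up h″ L″)
    with d-inj (≡.trans (ladder-row (h 0 z≤n)) (sym (ladder-row (h′ 0 z≤n))))
      | d-inj (≡.trans (ladder-row (h″ 0 z≤n)) (sym (row-+1 {z′} {z} {g} (h (suc g) ℕₚ.≤-refl))))
  ... | refl | refl = s≤s (blocked-height B L L″)

  -- One more than the number of iterated preimages of the row under d.
  level : ℕ → ℕ
  level r = proj₁ (ladder-start (suc r) r (ℕₚ.n<1+n r))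

  level-ladder : ∀ r → ∃ λ y → Ladder 0 r (level r) y
  level-ladder r = proj₂ (ladder-start (suc r) r (ℕₚ.n<1+n r))

  module _ (p : ℕ) (ap<fp : a p < f p) (same : ∀ r → p < r → a r ≡ f r) where

    private
      down-p : d p < e p
      down-p with d p <? e p
      ... | yes q = q
      ... | no q = ⊥-elim (ℕₚ.1+n≰n {0} (linear (a p ℕ.+ f p ℕ.+ f (d p) ℕ.+ f (e p) ℕ.+ (p ℕ.+ n) ℕ.+ d p ℕ.+ e p)
          (ap<fp ⊞ eq≥ ae ⊞ eq≤ (S.beads p) ⊞ S.decreasing ep≤dp ⊞ ep≤dp)
          (e₁ (a p) (f p) (f (d p)) (f (e p)) (p ℕ.+ n) (d p) (e p))
          (e₂ (a p) (f p) (f (d p)) (f (e p)) (p ℕ.+ n) (d p) (e p))))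
        where
          ep≤dp = ℕₚ.≮⇒≥ q
          ae : a p ℕ.+ e p ≡ f (e p) ℕ.+ (p ℕ.+ n)
          ae = ≡.trans (T.beads p) (cong (ℕ._+ (p ℕ.+ n)) (same (e p) (T.d> p)))
          e₁ : ∀ ap fp fd fe k dp ep → 1 ℕ.+ (ap ℕ.+ fp ℕ.+ fd ℕ.+ fe ℕ.+ k ℕ.+ dp ℕ.+ ep) ≡ suc ap ℕ.+ ((fe ℕ.+ k) ℕ.+ ((fp ℕ.+ dp) ℕ.+ (fd ℕ.+ ep)))
          e₁ = ℕ-ring
          e₂ : ∀ ap fp fd fe k dp ep → fp ℕ.+ ((ap ℕ.+ ep) ℕ.+ ((fd ℕ.+ k) ℕ.+ (fe ℕ.+ dp))) ≡ 0 ℕ.+ (ap ℕ.+ fp ℕ.+ fd ℕ.+ fe ℕ.+ k ℕ.+ dp ℕ.+ ep)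
          e₂ = ℕ-ring

      down-suc-p : e p < d (suc p)
      down-suc-p with e p <? d (suc p)
      ... | yes q = q
      ... | no q = ⊥-elim (ℕₚ.1+n≰n {0} (linear (a p ℕ.+ f (suc p) ℕ.+ f (d (suc p)) ℕ.+ f (e p) ℕ.+ (p ℕ.+ n) ℕ.+ d (suc p) ℕ.+ e p)
          (fsp≤ap ⊞ eq≤ ae ⊞ eq≥ (S.beads (suc p)) ⊞ S.decreasing dsp≤ep ⊞ dsp≤ep)
          (e₁ (a p) (f (suc p)) (f (d (suc p))) (f (e p)) p n (d (suc p)) (e p))
          (e₂ (a p) (f (suc p)) (f (d (suc p))) (f (e p)) p n (d (suc p)) (e p))))
        where
          dsp≤ep = ℕₚ.≮⇒≥ q
          ae : a p ℕ.+ e p ≡ f (e p) ℕ.+ (p ℕ.+ n)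
          ae = ≡.trans (T.beads p) (cong (ℕ._+ (p ℕ.+ n)) (same (e p) (T.d> p)))
          fsp≤ap : f (suc p) ≤ a p
          fsp≤ap = subst (_≤ a p) (same (suc p) (ℕₚ.n<1+n p)) (T.decreasing (ℕₚ.n≤1+n p))
          e₁ : ∀ ap fp fd fe p n dp ep → 1 ℕ.+ (ap ℕ.+ fp ℕ.+ fd ℕ.+ fe ℕ.+ (p ℕ.+ n) ℕ.+ dp ℕ.+ ep) ≡ fp ℕ.+ ((ap ℕ.+ ep) ℕ.+ ((fd ℕ.+ (suc p ℕ.+ n)) ℕ.+ (fe ℕ.+ dp)))
          e₁ = ℕ-ring
          e₂ : ∀ ap fp fd fe p n dp ep → ap ℕ.+ ((fe ℕ.+ (p ℕ.+ n)) ℕ.+ ((fp ℕ.+ dp) ℕ.+ (fd ℕ.+ ep))) ≡ 0 ℕ.+ (ap ℕ.+ fp ℕ.+ fd ℕ.+ fe ℕ.+ (p ℕ.+ n) ℕ.+ dp ℕ.+ ep)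
          e₂ = ℕ-ring

    -- Below p the two cores agree, which puts e p strictly between d p and d (p + 1). So a block
    -- that starts at or above p ends at p at the latest.
    break : d (suc p) ≢ suc (d p)
    break eq = ℕₚ.<⇒≱ down-suc-p (subst (_≤ e p) (sym eq) down-p)

    last-row : ∀ {fp′} → fp′ ℕ.+ suc (d p) ≡ f (suc (d p)) ℕ.+ (p ℕ.+ n) → a p ≤ fp′
    last-row {fp′} eq = linear (e p ℕ.+ f (e p) ℕ.+ f (suc (d p)) ℕ.+ (p ℕ.+ n) ℕ.+ suc (d p))
        (eq≤ ae ⊞ S.decreasing down-p ⊞ eq≥ eq ⊞ down-p)
        (e₁ (a p) (e p) (f (e p)) (f (suc (d p))) (p ℕ.+ n) (d p))
        (e₂ (f (e p)) (p ℕ.+ n) (f (suc (d p))) fp′ (d p) (e p))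
      where
        ae : a p ℕ.+ e p ≡ f (e p) ℕ.+ (p ℕ.+ n)
        ae = ≡.trans (T.beads p) (cong (ℕ._+ (p ℕ.+ n)) (same (e p) (T.d> p)))
        e₁ : ∀ x ep fe fd k dp → x ℕ.+ (ep ℕ.+ fe ℕ.+ fd ℕ.+ k ℕ.+ suc dp) ≡ (x ℕ.+ ep) ℕ.+ (fe ℕ.+ ((fd ℕ.+ k) ℕ.+ suc dp))
        e₁ = ℕ-ring
        e₂ : ∀ fe k fd y dp ep → (fe ℕ.+ k) ℕ.+ (fd ℕ.+ ((y ℕ.+ suc dp) ℕ.+ ep)) ≡ y ℕ.+ (ep ℕ.+ fe ℕ.+ fd ℕ.+ k ℕ.+ suc dp)
        e₂ = ℕ-ring

    -- Together with the choice of p, the hypotheses `link` and `unlink` say that q, ..., p are the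
    -- rows of the lowest component of the skew shape f / a. The cover is sought with its lowest
    -- ribbon there.
    module _ (q : ℕ) (q≤p : q ≤ p) (link : ∀ r → q ≤ r → r < p → a r < f (suc r)) (unlink : q ≡ 0 ⊎ ∃ λ q′ → q ≡ suc q′ × f q ≤ a q′) where

      gap-row : ∀ {r} → q ≤ r → r ≤ p → a r < f r
      gap-row {r} q≤r r≤p with ℕₚ.m≤n⇒m<n∨m≡n r≤p
      ... | inj₁ r<p = ℕₚ.<-≤-trans (link r q≤r r<p) (S.decreasing (ℕₚ.n≤1+n r))
      ... | inj₂ refl = ap<fp

      -- A row of least level in the component, and the last such row. Least level lets every row of
      -- the component be pulled up as often as needed; being last lets the ladder be widened over
      -- the whole block.
      Minimal : ℕ → Set
      Minimal z₀ = (∀ r → q ≤ r → r ≤ p → level z₀ ≤ level r) × (∀ r → z₀ < r → r ≤ p → level z₀ < level r)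

      minimal : ∃ λ z₀ → q ≤ z₀ × z₀ ≤ p × Minimal z₀
      minimal = widen (go (p ℕ.∸ q))
        where
          Min : ℕ → ℕ → Set
          Min t z₀ = q ≤ z₀ × z₀ ≤ t × (∀ r → q ≤ r → r ≤ t → level z₀ ≤ level r) × (∀ r → z₀ < r → r ≤ t → level z₀ < level r)
          go : ∀ k → ∃ (Min (q ℕ.+ k))
          go zero = q , ℕₚ.≤-refl , ℕₚ.m≤m+n q 0
            , (λ r q≤r r≤ → eq≤ (cong level (ℕₚ.≤-antisym q≤r (subst (r ≤_) (ℕₚ.+-identityʳ q) r≤))))
            , (λ r q<r r≤ → ⊥-elim (ℕₚ.<⇒≱ q<r (subst (r ≤_) (ℕₚ.+-identityʳ q) r≤)))
          go (suc k) with go k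
          ... | z₀ , q≤z₀ , z₀≤ , m₁ , m₂ with level z₀ <? level (q ℕ.+ suc k)
          ...   | yes lt = z₀ , q≤z₀ , ℕₚ.≤-trans z₀≤ (ℕₚ.+-monoʳ-≤ q (ℕₚ.n≤1+n k)) , m₁′ , m₂′
            where
              split : ∀ r → r ≤ q ℕ.+ suc k → r ≤ q ℕ.+ k ⊎ r ≡ q ℕ.+ suc k
              split r r≤ with ℕₚ.m≤n⇒m<n∨m≡n r≤
              ... | inj₁ r< = inj₁ (ℕₚ.≤-pred (subst (r <_) (ℕₚ.+-suc q k) r<))
              ... | inj₂ eq = inj₂ eq
              m₁′ : ∀ r → q ≤ r → r ≤ q ℕ.+ suc k → level z₀ ≤ level r
              m₁′ r q≤r r≤ with split r r≤
              ... | inj₁ r≤′ = m₁ r q≤r r≤′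
              ... | inj₂ refl = ℕₚ.<⇒≤ lt
              m₂′ : ∀ r → z₀ < r → r ≤ q ℕ.+ suc k → level z₀ < level r
              m₂′ r z₀<r r≤ with split r r≤
              ... | inj₁ r≤′ = m₂ r z₀<r r≤′
              ... | inj₂ refl = lt
          ...   | no ≮ = q ℕ.+ suc k , ℕₚ.m≤m+n q (suc k) , ℕₚ.≤-refl , m₁′ , λ r lt r≤ → ⊥-elim (ℕₚ.<⇒≱ lt r≤)
            where
              m₁′ : ∀ r → q ≤ r → r ≤ q ℕ.+ suc k → level (q ℕ.+ suc k) ≤ level r
              m₁′ r q≤r r≤ with ℕₚ.m≤n⇒m<n∨m≡n r≤
              ... | inj₁ r< = ℕₚ.≤-trans (ℕₚ.≮⇒≥ ≮) (m₁ r q≤r (ℕₚ.≤-pred (subst (r <_) (ℕₚ.+-suc q k) r<)))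
              ... | inj₂ refl = ℕₚ.≤-refl
          widen : ∃ (Min (q ℕ.+ (p ℕ.∸ q))) → ∃ λ z₀ → q ≤ z₀ × z₀ ≤ p × Minimal z₀
          widen (z₀ , q≤z₀ , z₀≤ , m) = subst (λ t → ∃ λ z₀ → q ≤ z₀ × z₀ ≤ t × (∀ r → q ≤ r → r ≤ t → level z₀ ≤ level r) × (∀ r → z₀ < r → r ≤ t → level z₀ < level r))
            (ℕₚ.m+[n∸m]≡n q≤p) (z₀ , q≤z₀ , z₀≤ , m)

      -- The bead of row Z of the smaller core, pushed down j levels, lies in some row; that row is not above r.
      pushed : ∀ j → (∀ r → q ≤ r → r ≤ p → j < level r) → ∀ k {Z} → q ℕ.+ k ≤ p → iter d j Z ≡ q ℕ.+ k → q ℕ.+ k ≤ iter e j Z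
      pushed j tall zero {Z} _ eq = subst (_≤ iter e j Z) (sym (ℕₚ.+-identityʳ q)) (base unlink)
        where
          ρ = iter e j Z
          base : q ≡ 0 ⊎ (∃ λ q′ → q ≡ suc q′ × f q ≤ a q′) → q ≤ ρ
          base (inj₁ refl) = z≤n
          base (inj₂ (q′ , q≡ , fq≤)) with q ≤? ρ
          ... | yes r = r
          ... | no r = ⊥-elim (ℕₚ.1+n≰n {0} (linear (a Z ℕ.+ f Z ℕ.+ f q ℕ.+ a q′ ℕ.+ a ρ ℕ.+ ρ ℕ.+ q ℕ.+ (Z ℕ.+ j ℕ.* n))
              (eq≥ (iter-beads {a} T.beads j Z) ⊞ eq≤ fZ ⊞ a≤f Z ⊞ fq≤ ⊞ T.decreasing ρ≤q′ ⊞ ρ<q)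
              (e₁ (a Z) (f Z) (f q) (a q′) (a ρ) ρ q (Z ℕ.+ j ℕ.* n))
              (e₂ (a Z) (f Z) (f q) (a q′) (a ρ) ρ q (Z ℕ.+ j ℕ.* n))))
            where
              ρ<q : ρ < q
              ρ<q = ℕₚ.≰⇒> r
              ρ≤q′ : ρ ≤ q′
              ρ≤q′ = ℕₚ.≤-pred (subst (ρ <_) q≡ ρ<q)
              fZ : f Z ℕ.+ q ≡ f q ℕ.+ (Z ℕ.+ j ℕ.* n)
              fZ = subst (λ x → f Z ℕ.+ x ≡ f x ℕ.+ (Z ℕ.+ j ℕ.* n)) (≡.trans eq (ℕₚ.+-identityʳ q)) (iter-beads {f} S.beads j Z)
              e₁ : ∀ aZ fZ fq aq aρ ρ q k → 1 ℕ.+ (aZ ℕ.+ fZ ℕ.+ fq ℕ.+ aq ℕ.+ aρ ℕ.+ ρ ℕ.+ q ℕ.+ k)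
                ≡ (aρ ℕ.+ k) ℕ.+ ((fZ ℕ.+ q) ℕ.+ (aZ ℕ.+ (fq ℕ.+ (aq ℕ.+ suc ρ))))
              e₁ = ℕ-ring
              e₂ : ∀ aZ fZ fq aq aρ ρ q k → (aZ ℕ.+ ρ) ℕ.+ ((fq ℕ.+ k) ℕ.+ (fZ ℕ.+ (aq ℕ.+ (aρ ℕ.+ q))))
                ≡ 0 ℕ.+ (aZ ℕ.+ fZ ℕ.+ fq ℕ.+ aq ℕ.+ aρ ℕ.+ ρ ℕ.+ q ℕ.+ k)
              e₂ = ℕ-ring
      pushed j tall (suc k) {Z} ≤p eq = subst (_≤ iter e j Z) (sym (ℕₚ.+-suc q k))
          (ℕₚ.≤-<-trans (pushed j tall k qk≤p (proj₂ Y)) (iter-mono T.d-mono j Y<Z))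
        where
          qk≤p : q ℕ.+ k ≤ p
          qk≤p = ℕₚ.≤-trans (ℕₚ.+-monoʳ-≤ q (ℕₚ.n≤1+n k)) ≤p
          Y : ∃ λ Y → iter d j Y ≡ q ℕ.+ k
          Y = ladder-height (proj₂ (level-ladder (q ℕ.+ k))) j (tall _ (ℕₚ.m≤m+n q k) qk≤p)
          Y<Z : proj₁ Y < Z
          Y<Z with proj₁ Y <? Z
          ... | yes lt = lt
          ... | no ≮ = ⊥-elim (ℕₚ.<⇒≱ (subst₂ _<_ (sym (proj₂ Y)) (sym eq) (ℕₚ.+-monoʳ-< q (ℕₚ.n<1+n k)))
                  (mono-≤ (ℕₚ.≮⇒≥ ≮)))
            where
              mono-≤ : ∀ {r s} → r ≤ s → iter d j r ≤ iter d j s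
              mono-≤ r≤s with ℕₚ.m≤n⇒m<n∨m≡n r≤s
              ... | inj₁ r<s = ℕₚ.<⇒≤ (iter-mono S.d-mono j r<s)
              ... | inj₂ refl = ℕₚ.≤-refl

      module _ (z₀ : ℕ) (q≤z₀ : q ≤ z₀) (min : Minimal z₀) where

        c₀ : ℕ
        c₀ = level z₀

        -- After `descend` the ladder may have more than c₀ translates. Each of them still arrives
        -- in the rows q, ..., p after fewer than c₀ steps, and that is the range in which `pushed`
        -- applies.
        Reaches : ∀ {g z c y} → Ladder g z c y → Set
        Reaches L = ∀ {Z} → Z ∈ tops L → ∃ λ j → j < c₀ × iter d j Z ∈ tops L × q ≤ iter d j Z

        ladder-at : ∀ {G} → z₀ ℕ.+ G ≤ p → ∀ g → g ≤ G → ∃ λ y → Ladder g z₀ c₀ y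
        ladder-at z₀G≤p zero _ = level-ladder z₀
        ladder-at {G} z₀G≤p (suc g) g<G with ladder-at z₀G≤p g (ℕₚ.<⇒≤ g<G)
        ... | y , L with ladder-extend L
        ...   | inj₁ (y′ , L′ , _) = y′ , L′
        ...   | inj₂ B = ⊥-elim (ℕₚ.<⇒≱ (proj₂ min (suc (z₀ ℕ.+ g)) (s≤s (ℕₚ.m≤m+n z₀ g)) sz≤p)
                  (blocked-height B L (proj₂ (level-ladder (suc (z₀ ℕ.+ g))))))
          where
            sz≤p : suc (z₀ ℕ.+ g) ≤ p
            sz≤p = ℕₚ.≤-trans (subst (_≤ z₀ ℕ.+ G) (ℕₚ.+-suc z₀ g) (ℕₚ.+-monoʳ-≤ z₀ g<G)) z₀G≤p

        initial-reaches : ∀ {g y} (L : Ladder g z₀ c₀ y) → Reaches L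
        initial-reaches L {Z} m with tops-path L m
        ... | j , eq = j , j<c₀ , subst (_∈ tops L) (sym eq) (z∈tops L) , subst (q ≤_) (sym eq) q≤z₀
          where
            j<c₀ : j < c₀
            j<c₀ = subst (_< c₀) (proj₂ (path-tops L j eq)) (subst (count-below Z (tops L) <_) (length-tops L)
              (Listₚ.filter-notAll (T? ∘ (λ W → Z ℕ.<ᵇ W)) (tops L) (lose m λ t → ℕₚ.<-irrefl refl (ℕₚ.<ᵇ⇒< Z Z t))))

        -- A block that contains its own image under d is replaced by that image, one level further down.
        descend : ∀ fuel {z G c y} → G < fuel → q ≤ z → z ℕ.+ G ≤ p → Block z G → (L : Ladder G z c y) → Reaches L →
          ∃ λ z → q ≤ z × Σ (Admissible z) λ adm → z ℕ.+ Admissible.height-1 adm ≤ p × Reaches (Admissible.ladder adm)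
        descend (suc fuel) {z} {G} {c} {y} (s≤s G<) q≤z zG≤p B L re with z ℕ.+ G <? d z
        ... | yes gap = z , q≤z , record { height-1 = G ; copies = c ; apex = y ; block = B ; gap = gap ; ladder = L } , zG≤p , re
        ... | no ≮ = descend fuel (ℕₚ.<-≤-trans G′<G G<) (ℕₚ.≤-trans q≤z (ℕₚ.<⇒≤ (S.d> z))) (ℕₚ.≤-trans (eq≤ z′G′) zG≤p) B′ L′ re′
          where
            i₀ = d z ℕ.∸ z
            zi₀ : z ℕ.+ i₀ ≡ d z
            zi₀ = ℕₚ.m+[n∸m]≡n (ℕₚ.<⇒≤ (S.d> z))
            i₀≤G : i₀ ≤ G
            i₀≤G = ℕₚ.+-cancelˡ-≤ z _ _ (subst (_≤ z ℕ.+ G) (sym zi₀) (ℕₚ.≮⇒≥ ≮))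
            G′ = G ℕ.∸ i₀
            i₀G′ : i₀ ℕ.+ G′ ≡ G
            i₀G′ = ℕₚ.m+[n∸m]≡n i₀≤G
            G′<G : G′ < G
            G′<G = ℕₚ.∸-monoʳ-< i₀>0 i₀≤G
              where
                i₀>0 : 0 < i₀
                i₀>0 = ℕₚ.m<n⇒0<n∸m (S.d> z)
            z′G′ : d z ℕ.+ G′ ≡ z ℕ.+ G
            z′G′ = ≡.trans (cong (ℕ._+ G′) (sym zi₀)) (≡.trans (ℕₚ.+-assoc z i₀ G′) (cong (z ℕ.+_) i₀G′))
            shift : ∀ i → d z ℕ.+ i ≡ z ℕ.+ (i₀ ℕ.+ i)
            shift i = ≡.trans (cong (ℕ._+ i) (sym zi₀)) (ℕₚ.+-assoc z i₀ i)
            ddz : d (d z) ≡ d z ℕ.+ i₀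
            ddz = ≡.trans (cong d (sym zi₀)) (Block.equal B i₀ i₀≤G)
            B′ : Block (d z) G′
            B′ = record
              { equal = λ i i≤ → ≡.trans (cong d (shift i)) (≡.trans (Block.equal B (i₀ ℕ.+ i) (subst (i₀ ℕ.+ i ≤_) i₀G′ (ℕₚ.+-monoʳ-≤ i₀ i≤)))
                  (≡.trans (sym (ℕₚ.+-assoc (d z) i₀ i)) (cong (ℕ._+ i) (sym ddz))))
              ; maximal = λ eq → Block.maximal B (begin
                  d (z ℕ.+ suc G) ≡⟨ cong (λ x → d (z ℕ.+ x)) (≡.trans (cong suc (sym i₀G′)) (sym (ℕₚ.+-suc i₀ G′))) ⟩
                  d (z ℕ.+ (i₀ ℕ.+ suc G′)) ≡⟨ cong d (sym (shift (suc G′))) ⟩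
                  d (d z ℕ.+ suc G′) ≡⟨ eq ⟩
                  d (d z) ℕ.+ suc G′ ≡⟨ cong (ℕ._+ suc G′) ddz ⟩
                  d z ℕ.+ i₀ ℕ.+ suc G′ ≡⟨ ℕₚ.+-assoc (d z) i₀ (suc G′) ⟩
                  d z ℕ.+ (i₀ ℕ.+ suc G′) ≡⟨ cong (d z ℕ.+_) (≡.trans (ℕₚ.+-suc i₀ G′) (cong suc i₀G′)) ⟩
                  d z ℕ.+ suc G ∎)
              }
              where open ≡-Reasoning
            L′ : Ladder G′ (d z) (suc c) y
            L′ = up (λ i i≤ → Block.equal B i (ℕₚ.≤-trans i≤ (ℕₚ.<⇒≤ G′<G))) (ladder-weaken (ℕₚ.<⇒≤ G′<G) L)
            weaken-tops : ∀ {g g′ z c y} (le : g ≤ g′) (L : Ladder g′ z c y) → tops (ladder-weaken le L) ≡ tops L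
            weaken-tops le (top _ _) = refl
            weaken-tops le (up h L) = cong (_ ∷_) (weaken-tops le L)
            tops≡ = weaken-tops (ℕₚ.<⇒≤ G′<G) L
            re′ : Reaches L′
            re′ (here refl) = 0 , copies>0 (proj₂ (level-ladder z₀)) , here refl , ℕₚ.≤-trans q≤z (ℕₚ.<⇒≤ (S.d> z))
            re′ (there m) with re (subst (_ ∈_) tops≡ m)
            ... | j , j< , m′ , q≤ = j , j< , there (subst (_ ∈_) (sym tops≡) m′) , q≤

        module _ {z : ℕ} (q≤z : q ≤ z) (adm : Admissible z) (zg≤p : z ℕ.+ Admissible.height-1 adm ≤ p) (re : Reaches (Admissible.ladder adm))
          {f′ : ℕ → ℕ} (S′ : Shape n ℓ f′ (Admissible.cover adm)) where

          open Admissible adm renaming (height-1 to g)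

          private
            rib : ∀ {Z} → Z ∈ tops ladder → Ribbon f f′ g Z
            rib = ribbons adm S′

            rows-≤p : ∀ {Z} → Z ∈ tops ladder → ∀ i → i ≤ g → Z ℕ.+ i ≤ p
            rows-≤p m i i≤g = ℕₚ.≤-trans (ℕₚ.+-mono-≤ (tops-≤ ladder m) i≤g) zg≤p

            bottom : ∀ {Z} → Z ∈ tops ladder → q ≤ Z → ∀ i → i ≤ g → a (Z ℕ.+ i) ≤ f′ (Z ℕ.+ i)
            bottom {Z} m q≤Z i i≤g with ℕₚ.m≤n⇒m<n∨m≡n i≤g
            ... | inj₁ i<g = ℕₚ.≤-pred (subst (a (Z ℕ.+ i) <_) (sym (Ribbon.linked (rib m) i i<g))
                    (link _ (ℕₚ.≤-trans q≤Z (ℕₚ.m≤m+n Z i)) (ℕₚ.<-≤-trans (ℕₚ.+-monoʳ-< Z i<g) (rows-≤p m g ℕₚ.≤-refl))))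
            ... | inj₂ refl with ℕₚ.m≤n⇒m<n∨m≡n (rows-≤p m g ℕₚ.≤-refl)
            ...   | inj₁ r<p = ℕₚ.≤-trans (ℕₚ.<⇒≤ (link _ (ℕₚ.≤-trans q≤Z (ℕₚ.m≤m+n Z g)) r<p)) (Ribbon.lower (rib m))
            ...   | inj₂ r≡p = subst (λ x → a x ≤ f′ x) (sym r≡p) (last-row bead-p)
              where
                p≡ : p ≡ z ℕ.+ g
                p≡ = ℕₚ.≤-antisym (subst (_≤ z ℕ.+ g) r≡p (ℕₚ.+-monoˡ-≤ g (tops-≤ ladder m))) zg≤p
                cover-p : cover p ≡ suc (d p)
                cover-p = covered-low (subst (z ≤_) (sym p≡) (ℕₚ.m≤m+n z g)) (eq≤ p≡)
                bead-p : f′ p ℕ.+ suc (d p) ≡ f (suc (d p)) ℕ.+ (p ℕ.+ n)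
                bead-p = ≡.trans (beads′-at adm S′ cover-p) (cong (ℕ._+ (p ℕ.+ n))
                  (unchanged-below adm S′ (subst (_< suc (d p)) p≡ (ℕₚ.m<n⇒m<1+n (S.d> p)))))

          -- A ladder row r is pushed down j levels to a row r₁ among q, ..., p, where containment
          -- holds by `bottom`. In the smaller core j steps from r end in a row ρ not above r₁, and
          -- the iterated bead equations bring the inequality back to r.
          contained : ∀ r → a r ≤ f′ r
          contained r with locate adm S′ r
          ... | inj₁ out = ℕₚ.≤-trans (a≤f r) (eq≥ (outside⇒unchanged adm S′ out))
          ... | inj₂ (Z , i , m , i≤g , refl) with re m
          ...   | j , j<c₀ , m₁ , q≤Z₁ = linear (ρ ℕ.+ a ρ ℕ.+ X ℕ.+ f′ r₁ ℕ.+ r₁)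
                  (eq≤ (iter-beads {a} T.beads j r) ⊞ ℕₚ.≤-trans (T.decreasing r₁≤ρ) (bottom m₁ q≤Z₁ i i≤g) ⊞ eq≥ f′r ⊞ r₁≤ρ)
                  (e₁ (a r) ρ (a ρ) X (f′ r₁) r₁) (e₂ (a ρ) X (f′ r₁) (f′ r) r₁ ρ)
            where
              r₁ = iter d j Z ℕ.+ i
              ρ = iter e j r
              X = r ℕ.+ j ℕ.* n
              lift = ladder-iter adm j m m₁ i i≤g
              f′r : f′ r ℕ.+ r₁ ≡ f′ r₁ ℕ.+ X
              f′r = subst (λ x → f′ r ℕ.+ x ≡ f′ x ℕ.+ X) (proj₂ lift) (iter-beads {f′} (Shape.beads S′) j r)
              q+ : q ℕ.+ (r₁ ℕ.∸ q) ≡ r₁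
              q+ = ℕₚ.m+[n∸m]≡n (ℕₚ.≤-trans q≤Z₁ (ℕₚ.m≤m+n _ i))
              r₁≤ρ : r₁ ≤ ρ
              r₁≤ρ = subst (_≤ ρ) q+ (pushed j (λ s q≤s s≤p → ℕₚ.<-≤-trans j<c₀ (proj₁ min s q≤s s≤p)) (r₁ ℕ.∸ q)
                (subst (_≤ p) (sym q+) (rows-≤p m₁ i i≤g)) (≡.trans (proj₁ lift) (sym q+)))
              e₁ : ∀ x ρ aρ X y r → x ℕ.+ (ρ ℕ.+ aρ ℕ.+ X ℕ.+ y ℕ.+ r) ≡ (x ℕ.+ ρ) ℕ.+ (aρ ℕ.+ ((y ℕ.+ X) ℕ.+ r))
              e₁ = ℕ-ring
              e₂ : ∀ aρ X y w r ρ → (aρ ℕ.+ X) ℕ.+ (y ℕ.+ ((w ℕ.+ r) ℕ.+ ρ)) ≡ w ℕ.+ (ρ ℕ.+ aρ ℕ.+ X ℕ.+ y ℕ.+ r)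
              e₂ = ℕ-ring

  Between : Set
  Between = ∃ λ z → Σ (Admissible z) λ adm → z ℕ.+ Admissible.height-1 adm < ℓ × 0 < f z ×
    (∀ {f′} → Shape n ℓ f′ (Admissible.cover adm) → ∀ r → a r ≤ f′ r)

  private
    between-at : ∀ p (ap<fp : a p < f p) (same : ∀ r → p < r → a r ≡ f r) q (q≤p : q ≤ p)
      (link : ∀ r → q ≤ r → r < p → a r < f (suc r)) (unlink : q ≡ 0 ⊎ ∃ λ q′ → q ≡ suc q′ × f q ≤ a q′) → Between
    between-at p ap<fp same q q≤p link unlink with minimal p ap<fp same q q≤p link unlink
    ... | z₀ , q≤z₀ , z₀≤p , min with find-block z₀ (p ℕ.∸ z₀) (λ h → break p ap<fp same
            (subst (λ x → d (suc x) ≡ suc (d x)) (ℕₚ.m+[n∸m]≡n z₀≤p) (run-step (p ℕ.∸ z₀) h)))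
    ...   | G , G≤ , B with ladder-at p ap<fp same q q≤p link unlink z₀ q≤z₀ min {G} z₀G≤p G ℕₚ.≤-refl
      where
        z₀G≤p : z₀ ℕ.+ G ≤ p
        z₀G≤p = subst (z₀ ℕ.+ G ≤_) (ℕₚ.m+[n∸m]≡n z₀≤p) (ℕₚ.+-monoʳ-≤ z₀ G≤)
    ...     | y , L with descend p ap<fp same q q≤p link unlink z₀ q≤z₀ min (suc G) (ℕₚ.n<1+n G) q≤z₀
                      (subst (z₀ ℕ.+ G ≤_) (ℕₚ.m+[n∸m]≡n z₀≤p) (ℕₚ.+-monoʳ-≤ z₀ G≤)) B L
                      (initial-reaches p ap<fp same q q≤p link unlink z₀ q≤z₀ min L)
    ...       | z , q≤z , adm , zg≤p , re = z , adm , ℕₚ.≤-<-trans zg≤p p<ℓ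
                , ℕₚ.≤-<-trans z≤n (gap-row p ap<fp same q q≤p link unlink q≤z (ℕₚ.≤-trans (ℕₚ.m≤m+n z _) zg≤p))
                , contained p ap<fp same q q≤p link unlink z₀ q≤z₀ min q≤z adm zg≤p re
      where
        p<ℓ : p < ℓ
        p<ℓ with p <? ℓ
        ... | yes lt = lt
        ... | no ≮ = ⊥-elim (ℕₚ.<⇒≱ ap<fp (subst (_≤ a p) (sym (S.f-zero (ℕₚ.≮⇒≥ ≮))) z≤n))

    last-difference : ∀ k → (∀ r → k ≤ r → a r ≡ f r) → (∀ r → a r ≡ f r) ⊎ ∃ λ p → a p < f p × (∀ r → p < r → a r ≡ f r)
    last-difference zero h = inj₁ λ r → h r z≤n
    last-difference (suc k) h with a k ≟ f k
    ... | no ne = inj₂ (k , ℕₚ.≤∧≢⇒< (a≤f k) ne , h)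
    ... | yes eq = last-difference k h′
      where
        h′ : ∀ r → k ≤ r → a r ≡ f r
        h′ r k≤r with ℕₚ.m≤n⇒m<n∨m≡n k≤r
        ... | inj₁ k<r = h r k<r
        ... | inj₂ refl = eq

    first-linked : ∀ p q → q ≤ p → (∀ r → q ≤ r → r < p → a r < f (suc r)) →
      ∃ λ q → q ≤ p × (∀ r → q ≤ r → r < p → a r < f (suc r)) × (q ≡ 0 ⊎ ∃ λ q′ → q ≡ suc q′ × f q ≤ a q′)
    first-linked p zero q≤p h = 0 , q≤p , h , inj₁ refl
    first-linked p (suc q) q<p h with a q <? f (suc q)
    ... | no ≮ = suc q , q<p , h , inj₂ (q , refl , ℕₚ.≮⇒≥ ≮)
    ... | yes lt = first-linked p q (ℕₚ.<⇒≤ q<p) h′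
      where
        h′ : ∀ r → q ≤ r → r < p → a r < f (suc r)
        h′ r q≤r r<p with ℕₚ.m≤n⇒m<n∨m≡n q≤r
        ... | inj₁ q<r = h r q<r r<p
        ... | inj₂ refl = lt

  interpolate : (∀ r → a r ≡ f r) ⊎ Between
  interpolate with last-difference ℓ (λ r ℓ≤r → ≡.trans (T.f-zero ℓ≤r) (sym (S.f-zero ℓ≤r)))
  ... | inj₁ e = inj₁ e
  ... | inj₂ (p , ap<fp , same) with first-linked p p ℕₚ.≤-refl (λ r p≤r r<p → ⊥-elim (ℕₚ.<⇒≱ r<p p≤r))
  ...   | q , q≤p , link , unlink = inj₂ (between-at p ap<fp same q q≤p link unlink)

-- Strong marked covers

sumTo-wt-pOf : ∀ K ℓ κ → T (isPartᵇ κ) → T (isCoreᵇ K κ) → length κ ≤ ℓ →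
  + size (pOf K κ) ≡ sumTo ℓ (λ r → + (suc K ℕ.+ r)) ℤ.- sumTo ℓ (λ r → + down K κ r)
sumTo-wt-pOf K ℓ κ part core len≤ℓ = ≡.trans (sum-get (pOf K κ) ℓ (subst (_≤ ℓ) (sym (length-map-upTo _ (length κ))) len≤ℓ))
  (≡.trans (sumTo-cong ℓ (λ r _ → pointwise r)) (sumTo-- ℓ (λ r → + (suc K ℕ.+ r)) (λ r → + down K κ r)))
  where
    pointwise : ∀ r → + get (pOf K κ) r ≡ + (suc K ℕ.+ r) ℤ.- + down K κ r
    pointwise r = ≡.trans (eq (+ get (pOf K κ) r) (+ down K κ r))
      (cong (λ a → + a ℤ.- + down K κ r) (bead-sum (part-decreasing κ part) (core-bead K κ part core r)))
      where
        eq : ∀ x y → x ≡ x ℤ.+ y ℤ.- y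
        eq = ℤ-ring

record MarkedCover (K : ℕ) (τ : List ℕ) (r : ℕ) (κ : List ℕ) : Set where
  field
    lower-core : T (isCoreᵇ K τ)
    size-step : suc (size (pOf K τ)) ≡ size (pOf K κ)
    component : T (any (λ C → suc (minRow C) ℕ.≡ᵇ r) (components (skew κ τ)))

markedCover⁻ : ∀ K τ r κ → T (markedCoverᵇ K τ r κ) → MarkedCover K τ r κ
markedCover⁻ K τ r κ t = record { lower-core = proj₁ t₁ ; size-step = ℕₚ.≡ᵇ⇒≡ _ _ (proj₁ t₄) ; component = proj₂ t₄ }
  where
    t₁ = ∧⁻ {isCoreᵇ K τ} t
    t₂ = ∧⁻ {isCoreᵇ K κ} (proj₂ t₁)
    t₃ = ∧⁻ {⊆ᵇ τ κ} (proj₂ t₂)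
    t₄ = ∧⁻ {suc (size (pOf K τ)) ℕ.≡ᵇ size (pOf K κ)} (proj₂ t₃)

markedCover⁺ : ∀ K τ r κ → T (isCoreᵇ K τ) → T (isCoreᵇ K κ) → (∀ i → get τ i ≤ get κ i) →
  suc (size (pOf K τ)) ≡ size (pOf K κ) → T (any (λ C → suc (minRow C) ℕ.≡ᵇ r) (components (skew κ τ))) → T (markedCoverᵇ K τ r κ)
markedCover⁺ K τ r κ c c′ ⊆ sz any = ∧⁺ {isCoreᵇ K τ} c (∧⁺ {isCoreᵇ K κ} c′ (∧⁺ {⊆ᵇ τ κ}
  (all⁺ (λ i → get τ i ℕ.≤ᵇ get κ i) {upTo (length τ ℕ.+ length κ)} λ {i} _ → ℕₚ.≤⇒≤ᵇ (⊆ i)) (∧⁺ {suc (size (pOf K τ)) ℕ.≡ᵇ size (pOf K κ)} (ℕₚ.≡⇒≡ᵇ _ _ sz) any)))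

module CoreCovers (K ℓ : ℕ) (κ : List ℕ) (part : T (isPartᵇ κ)) (core : T (isCoreᵇ K κ)) (len≤ℓ : length κ ≤ ℓ) where

  f d : ℕ → ℕ
  f = get κ
  d = down K κ

  S : Shape (suc K) ℓ f d
  S = core-shape K ℓ κ part core len≤ℓ

  open Shape S using (d-mono; d>; decreasing; d≤; d-zero; d-positive)
  open Ladders d d-mono d>
  open LadderTops d d-mono d>
  open CoverShape S

  module AtCover {z : ℕ} (adm : Admissible z) (zℓ : z ℕ.+ Admissible.height-1 adm < ℓ) (fz>0 : 0 < f z) where

    open Admissible adm public renaming (height-1 to g; copies to c; apex to y)
    open CoverDown {suc K} {ℓ} d≤ d-zero adm zℓ (d-positive fz>0)

    private
      module F = FromDown (suc K) ℓ (s≤s z≤n) cover cover-mono cover> cover≤ cover-zero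
      module FS = Shape F.shape

    τ : List ℕ
    τ = rows ℓ F.row

    get-τ : ∀ r → get τ r ≡ F.row r
    get-τ = get-rows ℓ F.row FS.decreasing FS.f-zero

    τ-part : T (isPartᵇ τ)
    τ-part = rows-part ℓ F.row FS.decreasing FS.f-zero

    τ-length : length τ ≤ ℓ
    τ-length = length-rows ℓ F.row

    τ-bead : ∀ r → BeadEquation K τ r (cover r)
    τ-bead r = bead (cover> r) (subst₂ (λ x v → x ℕ.+ cover r ≡ v ℕ.+ (r ℕ.+ suc K)) (sym (get-τ r)) (sym (get-τ (cover r))) (FS.beads r))

    τ-core : T (isCoreᵇ K τ)
    τ-core = beads⇒core K τ (part-decreasing τ τ-part) λ r _ → cover r , τ-bead r

    τ-down : ∀ r → down K τ r ≡ cover r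
    τ-down r = down-unique (part-decreasing τ τ-part) (τ-bead r)

    τ-shape : Shape (suc K) ℓ (get τ) cover
    τ-shape = record
      { n>0 = s≤s z≤n
      ; decreasing = part-decreasing τ τ-part
      ; d> = cover>
      ; beads = λ r → BeadEquation.equation (τ-bead r)
      ; f-zero = λ ℓ≤r → get-≥length τ (ℕₚ.≤-trans τ-length ℓ≤r)
      }

    τ-⊆ : ∀ r → get τ r ≤ f r
    τ-⊆ = cover-⊆ adm τ-shape

    -- Up to a constant, |𝔭| is minus the sum of the bead map over the first ℓ rows, and this sum
    -- grows by one.
    τ-size : suc (size (pOf K τ)) ≡ size (pOf K κ)
    τ-size = ℤₚ.+-injective (begin
      1ℤ ℤ.+ + size (pOf K τ) ≡⟨ cong (λ a → 1ℤ ℤ.+ a) (sumTo-wt-pOf K ℓ τ τ-part τ-core τ-length) ⟩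
      1ℤ ℤ.+ (A ℤ.- sumTo ℓ (λ r → + down K τ r))
        ≡⟨ cong (λ a → 1ℤ ℤ.+ (A ℤ.- a)) (≡.trans (sumTo-cong ℓ (λ r _ → cong +_ (τ-down r))) (sum-covered g ℕₚ.≤-refl)) ⟩
      1ℤ ℤ.+ (A ℤ.- (B ℤ.+ 1ℤ)) ≡⟨ eq A B ⟩
      A ℤ.- B ≡⟨ sym (sumTo-wt-pOf K ℓ κ part core len≤ℓ) ⟩
      + size (pOf K κ) ∎)
      where
        open ≡-Reasoning
        A = sumTo ℓ (λ r → + (suc K ℕ.+ r))
        B = sumTo ℓ (λ r → + d r)
        eq : ∀ a b → 1ℤ ℤ.+ (a ℤ.- (b ℤ.+ 1ℤ)) ≡ a ℤ.- b
        eq = ℤ-ring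

    open RibbonComponents f (get τ) decreasing g

    cell⁺ : ∀ {r c} → Cell (r , c) → (r , c) ∈ skew κ τ
    cell⁺ {r} {c} (lo , hi) = ∈-filterᵇ⁺ (λ b → get τ (proj₁ b) ℕ.≤ᵇ proj₂ b) (∈boxes⁺ κ (get>0⇒<length κ (ℕₚ.≤-<-trans z≤n hi)) hi) (ℕₚ.≤⇒≤ᵇ lo)

    cell⁻ : ∀ {b} → b ∈ skew κ τ → Cell b
    cell⁻ {r , c} m = ℕₚ.≤ᵇ⇒≤ (get τ r) c (proj₂ m′) , proj₂ (∈boxes⁻ κ (proj₁ m′))
      where m′ = ∈-filterᵇ⁻ (λ b → get τ (proj₁ b) ℕ.≤ᵇ proj₂ b) {xs = boxes κ} m

    spans : Spans (tops ladder) (skew κ τ)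
    spans = fwd , λ cell _ _ → cell⁺ cell
      where
        fwd : ∀ {b} → b ∈ skew κ τ → Cell b × ∃ λ Z → Z ∈ tops ladder × Inside Z b
        fwd {r , c} m = go (cell⁻ m) (locate adm τ-shape r)
          where
            go : Cell (r , c) → Outside adm τ-shape r ⊎ (∃ λ Z → ∃ λ i → Z ∈ tops ladder × i ≤ g × r ≡ Z ℕ.+ i) →
              Cell (r , c) × ∃ λ Z → Z ∈ tops ladder × Inside Z (r , c)
            go cell (inj₂ (Z , i , Z∈ , i≤g , refl)) = cell , Z , Z∈ , ℕₚ.m≤m+n Z i , ℕₚ.+-monoʳ-≤ Z i≤g
            go (lo , hi) (inj₁ out) = ⊥-elim (ℕₚ.<⇒≱ hi (subst (_≤ c) (outside⇒unchanged adm τ-shape out) lo))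

    skew-components : ∃ λ Ws → Ws ↭ tops ladder × Pointwise IsRibbon (components (skew κ τ)) Ws
    skew-components = ribbon-components (length (skew κ τ)) ℕₚ.≤-refl (tops-disjoint ladder gap) (tops-unique ladder) (ribbons adm τ-shape) spans

    private
      Ws = proj₁ skew-components
      Ws↭ = proj₁ (proj₂ skew-components)
      pw = proj₂ (proj₂ skew-components)

    marked⁺ : ∀ {w} → w ∈ tops ladder → T (markedCoverᵇ K τ (suc w) κ)
    marked⁺ {w} m = markedCover⁺ K τ (suc w) κ τ-core core τ-⊆ τ-size (any-top⁺ pw (Permₚ.∈-resp-↭ (↭-sym Ws↭) m))

    marked⁻ : ∀ {w} → T (markedCoverᵇ K τ (suc w) κ) → w ∈ tops ladder
    marked⁻ {w} t = Permₚ.∈-resp-↭ Ws↭ (any-top⁻ pw (MarkedCover.component (markedCover⁻ K τ (suc w) κ t)))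

    higher-count : ∀ w → length (filterᵇ (λ C → suc w ℕ.<ᵇ suc (minRow C)) (components (skew κ τ))) ≡ count-below w (tops ladder)
    higher-count w = ≡.trans (count-tops w pw) (Permₚ.↭-length (Permₚ.filter-↭ (T? ∘ (λ Z → w ℕ.<ᵇ Z)) Ws↭))

    spin-τ : ∀ {w} → w ∈ tops ladder → coverSpin τ (suc w) κ ≡ c ℕ.* g ℕ.+ count-below w (tops ladder)
    spin-τ {w} m = cong₂ ℕ._+_ (cong₂ (λ a b → a ℕ.* (b ℕ.∸ 1))
        (≡.trans (components-length pw) (≡.trans (Permₚ.↭-length Ws↭) (length-tops ladder)))
        (heightAt-top pw (Permₚ.∈-resp-↭ (↭-sym Ws↭) m)))
      (higher-count w)

  record Cover : Set where
    constructor cover-at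
    field
      {bottom} : ℕ
      admissible : Admissible bottom
      in-range : bottom ℕ.+ Admissible.height-1 admissible < ℓ
      positive : 0 < f bottom

    open AtCover admissible in-range positive public

  interpolation : ∀ τ → T (isPartᵇ τ) → T (isCoreᵇ K τ) → (∀ r → get τ r ≤ f r) →
    τ ≡ κ ⊎ Σ Cover λ C → ∀ r → get τ r ≤ get (Cover.τ C) r
  interpolation τ p c ⊆ = conclude (Interpolation.interpolate S τ-shape ⊆)
    where
      τ-len : length τ ≤ ℓ
      τ-len with length τ ≤? ℓ
      ... | yes q = q
      ... | no q = ⊥-elim (ℕₚ.<⇒≱ (part-pos τ p (ℕₚ.≰⇒> q)) (ℕₚ.≤-trans (⊆ ℓ) (eq≤ (get-≥length κ len≤ℓ))))
      τ-shape = core-shape K ℓ τ p c τ-len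
      conclude : (∀ r → get τ r ≡ f r) ⊎ Interpolation.Between S τ-shape ⊆ → τ ≡ κ ⊎ Σ Cover λ C → ∀ r → get τ r ≤ get (Cover.τ C) r
      conclude (inj₁ e) = inj₁ (part-ext τ κ p part e)
      conclude (inj₂ (z , adm , zℓ , fz>0 , h)) = inj₂ (cover-at adm zℓ fz>0 , h (AtCover.τ-shape adm zℓ fz>0))

-- By repeated interpolation: as long as the two cores differ, the larger one can be replaced by a
-- ladder cover that still contains the smaller one and has size one less.
core-size-mono : ∀ K ℓ m κ τ → size (pOf K κ) ≡ m → T (isPartᵇ κ) → T (isCoreᵇ K κ) → length κ ≤ ℓ →
  T (isPartᵇ τ) → T (isCoreᵇ K τ) → (∀ r → get τ r ≤ get κ r) → τ ≡ κ ⊎ size (pOf K τ) < m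
core-size-mono K ℓ m κ τ sz part core len p c ⊆ = conclude m sz (CoreCovers.interpolation K ℓ κ part core len τ p c ⊆)
  where
    conclude : ∀ m → size (pOf K κ) ≡ m → (τ ≡ κ ⊎ Σ (CoreCovers.Cover K ℓ κ part core len) λ C → ∀ r → get τ r ≤ get (CoreCovers.Cover.τ C) r) →
      τ ≡ κ ⊎ size (pOf K τ) < m
    conclude m sz (inj₁ e) = inj₁ e
    conclude zero sz (inj₂ (C , _)) = ⊥-elim (ℕₚ.1+n≢0 (≡.trans (CoreCovers.Cover.τ-size C) sz))
    conclude (suc m) sz (inj₂ (C , ⊆′)) = finish (core-size-mono K ℓ m (CoreCovers.Cover.τ C) τ (ℕₚ.suc-injective (≡.trans (CoreCovers.Cover.τ-size C) sz))
        (CoreCovers.Cover.τ-part C) (CoreCovers.Cover.τ-core C) (CoreCovers.Cover.τ-length C) p c ⊆′)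
      where
        finish : τ ≡ CoreCovers.Cover.τ C ⊎ size (pOf K τ) < m → τ ≡ κ ⊎ size (pOf K τ) < suc m
        finish (inj₁ e) = inj₂ (eq≤ (≡.trans (cong (λ σ → suc (size (pOf K σ))) e) (≡.trans (CoreCovers.Cover.τ-size C) sz)))
        finish (inj₂ lt) = inj₂ (ℕₚ.m<n⇒m<1+n lt)

-- Interpolation puts a ladder cover between τ and κ. It has the same size as τ, so it equals τ: no
-- strong cover escapes the ladders.
core-cover : ∀ K ℓ κ (part : T (isPartᵇ κ)) (core : T (isCoreᵇ K κ)) (len : length κ ≤ ℓ) τ →
  T (isPartᵇ τ) → T (isCoreᵇ K τ) → (∀ r → get τ r ≤ get κ r) → suc (size (pOf K τ)) ≡ size (pOf K κ) →
  Σ (CoreCovers.Cover K ℓ κ part core len) λ C → τ ≡ CoreCovers.Cover.τ C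
core-cover K ℓ κ part core len τ p c ⊆ sz = conclude (CoreCovers.interpolation K ℓ κ part core len τ p c ⊆)
  where
    conclude : (τ ≡ κ ⊎ Σ (CoreCovers.Cover K ℓ κ part core len) λ C → ∀ r → get τ r ≤ get (CoreCovers.Cover.τ C) r) →
      Σ (CoreCovers.Cover K ℓ κ part core len) λ C → τ ≡ CoreCovers.Cover.τ C
    conclude (inj₁ e) = ⊥-elim (ℕₚ.1+n≢n (≡.trans sz (cong (λ σ → size (pOf K σ)) (sym e))))
    conclude (inj₂ (C , ⊆′)) = finish (core-size-mono K ℓ (size (pOf K τ)) (CoreCovers.Cover.τ C) τ
        (ℕₚ.suc-injective (≡.trans (CoreCovers.Cover.τ-size C) (sym sz))) (CoreCovers.Cover.τ-part C) (CoreCovers.Cover.τ-core C) (CoreCovers.Cover.τ-length C) p c ⊆′)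
      where
        finish : τ ≡ CoreCovers.Cover.τ C ⊎ size (pOf K τ) < size (pOf K τ) → Σ (CoreCovers.Cover K ℓ κ part core len) λ C → τ ≡ CoreCovers.Cover.τ C
        finish (inj₁ e) = C , e
        finish (inj₂ lt) = ⊥-elim (ℕₚ.<-irrefl refl lt)

-- Enumeration of subpartitions and the operator of a single mark

subs⁻ : ∀ κ → T (isPartᵇ κ) → ∀ {τ} → τ ∈ subs κ → T (isPartᵇ τ) × (∀ i → get τ i ≤ get κ i)
subs⁻ [] p (here refl) = _ , λ i → z≤n
subs⁻ (a ∷ κ) p {τ} m with find (∈-concatMap⁻ (ext a) {xs = subs κ} m)
... | ν , ν∈ , m′ with subs⁻ κ (part-tail a κ p) ν∈
subs⁻ (a ∷ κ) p m | [] , _ , here refl | _ = _ , λ i → z≤n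
subs⁻ (a ∷ κ) p m | [] , _ , there m″ | _ with ∈-map⁻ (λ b → suc b ∷ []) m″
... | b , b∈ , refl = _ , λ { zero → ∈-upTo⁻ b∈ ; (suc i) → z≤n }
subs⁻ (a ∷ κ) p m | x ∷ ν , ν∈ , m′ | pν , ⊆ν with ∈-map⁻ (λ b → (x ℕ.+ b) ∷ x ∷ ν) m′
... | b , b∈ , refl = ∧⁺ (ℕₚ.≤⇒≤ᵇ (ℕₚ.m≤m+n x b)) pν , λ
      { zero → subst (x ℕ.+ b ≤_) (ℕₚ.m+[n∸m]≡n (ℕₚ.≤-trans (⊆ν 0) (part-step (a ∷ κ) p 0))) (ℕₚ.+-monoʳ-≤ x (ℕₚ.≤-pred (∈-upTo⁻ b∈)))
      ; (suc i) → ⊆ν i }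

subs⁺ : ∀ κ {τ} → T (isPartᵇ τ) → (∀ i → get τ i ≤ get κ i) → τ ∈ subs κ
subs⁺ [] {[]} p ⊆ = here refl
subs⁺ [] {x ∷ τ} p ⊆ = ⊥-elim (ℕₚ.<⇒≱ (part-pos (x ∷ τ) p {0} (s≤s z≤n)) (⊆ 0))
subs⁺ (a ∷ κ) {[]} p ⊆ = ∈-concatMap⁺ (ext a) (lose (subs⁺ κ {[]} _ (λ i → z≤n)) (here refl))
subs⁺ (a ∷ κ) {zero ∷ []} () ⊆
subs⁺ (a ∷ κ) {suc t ∷ []} p ⊆ = ∈-concatMap⁺ (ext a) (lose (subs⁺ κ {[]} _ (λ i → z≤n)) (there (∈-map⁺ (λ b → suc b ∷ []) (∈-upTo⁺ (⊆ 0)))))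
subs⁺ (a ∷ κ) {t ∷ x ∷ ν} p ⊆ = ∈-concatMap⁺ (ext a) (lose (subs⁺ κ {x ∷ ν} (part-tail t (x ∷ ν) p) (⊆ ∘ suc))
  (subst (λ b → b ∷ x ∷ ν ∈ ext a (x ∷ ν)) (ℕₚ.m+[n∸m]≡n (part-step (t ∷ x ∷ ν) p 0))
    (∈-map⁺ (λ b → (x ℕ.+ b) ∷ x ∷ ν) (∈-upTo⁺ (s≤s (ℕₚ.∸-monoˡ-≤ x (⊆ 0)))))))

subs-unique : ∀ κ → Unique (subs κ)
subs-unique [] = [] AllPairs.∷ AllPairs.[]
subs-unique (a ∷ κ) = Uniqueₚ.concat⁺ (Allₚ.map⁺ (All.tabulate (λ {ν} _ → ext-unique ν)))
    (AllPairsₚ.map⁺ (AllPairs.map (λ ne {τ} m → ne (≡.trans (sym (ext-tail _ (proj₁ m))) (ext-tail _ (proj₂ m)))) (subs-unique κ)))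
  where
    ext-unique : ∀ ν → Unique (ext a ν)
    ext-unique [] = All.tabulate (λ m e → case ∈-map⁻ (λ b → suc b ∷ []) m of λ { (b , _ , refl) → case e of λ () })
      AllPairs.∷ Uniqueₚ.map⁺ (λ { refl → refl }) (Uniqueₚ.upTo⁺ a)
    ext-unique (x ∷ ν) = Uniqueₚ.map⁺ (λ {b} {b′} e → ℕₚ.+-cancelˡ-≡ x b b′ (Listₚ.∷-injectiveˡ e)) (Uniqueₚ.upTo⁺ (suc (a ℕ.∸ x)))
    ext-tail : ∀ ν {τ} → τ ∈ ext a ν → drop 1 τ ≡ ν
    ext-tail [] (here refl) = refl
    ext-tail [] (there m) with ∈-map⁻ (λ b → suc b ∷ []) m
    ... | b , _ , refl = refl
    ext-tail (x ∷ ν) m with ∈-map⁻ (λ b → (x ℕ.+ b) ∷ x ∷ ν) m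
    ... | b , _ , refl = refl

∑ : ∀ {A : Set} → List A → (A → ℤ) → ℤ
∑ [] h = 0ℤ
∑ (x ∷ xs) h = h x ℤ.+ ∑ xs h

∑-cong : ∀ {A : Set} (xs : List A) {h k : A → ℤ} → (∀ {x} → x ∈ xs → h x ≡ k x) → ∑ xs h ≡ ∑ xs k
∑-cong [] e = refl
∑-cong (x ∷ xs) e = cong₂ ℤ._+_ (e (here refl)) (∑-cong xs (e ∘ there))

∑-↭ : ∀ {A : Set} {xs ys : List A} (h : A → ℤ) → xs ↭ ys → ∑ xs h ≡ ∑ ys h
∑-↭ h refl = refl
∑-↭ h (prep x p) = cong (λ a → h x ℤ.+ a) (∑-↭ h p)
∑-↭ h (swap x y p) rewrite ∑-↭ h p = eq (h x) (h y) _
  where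
    eq : ∀ a b c → a ℤ.+ (b ℤ.+ c) ≡ b ℤ.+ (a ℤ.+ c)
    eq = ℤ-ring
∑-↭ h (trans p q) = ≡.trans (∑-↭ h p) (∑-↭ h q)

∑-filterᵇ : ∀ {A : Set} (p : A → Bool) xs (h : A → ℤ) → ∑ (filterᵇ p xs) h ≡ ∑ xs (λ x → if p x then h x else 0ℤ)
∑-filterᵇ p [] h = refl
∑-filterᵇ p (x ∷ xs) h with p x
... | true = cong (λ a → h x ℤ.+ a) (∑-filterᵇ p xs h)
... | false = ≡.trans (∑-filterᵇ p xs h) (sym (ℤₚ.+-identityˡ _))

if-false : ∀ {A : Set} {b} {x y : A} → ¬ T b → (if b then x else y) ≡ y
if-false {b = false} _ = refl
if-false {b = true} p = ⊥-elim (p _)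

if-true : ∀ {A : Set} {b} {x y : A} → T b → (if b then x else y) ≡ x
if-true {b = true} _ = refl

module MarkOperator (K ℓ : ℕ) (κ : List ℕ) (part : T (isPartᵇ κ)) (core : T (isCoreᵇ K κ)) (len≤ℓ : length κ ≤ ℓ) where

  open CoreCovers K ℓ κ part core len≤ℓ hiding (S)
  open Shape (core-shape K ℓ κ part core len≤ℓ) using (d-mono; d>; decreasing; d≤; d-zero; d-positive)
  open Ladders d d-mono d>
  open LadderTops d d-mono d>
  open Catalan ℓ
  open Straightening (suc K) ℓ

  higher : ℕ → List ℕ → ℕ
  higher w τ = length (filterᵇ (λ C → suc w ℕ.<ᵇ suc (minRow C)) (components (skew κ τ)))

  -- The number of components below the mark locates the lowest ribbon: it starts at the row reached
  -- from w after that many steps. With `cover-unique` this makes a cover with mark w + 1 depend on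
  -- that number alone.
  marked-path : ∀ {w τ} → τ ∈ subs κ → T (markedCoverᵇ K τ (suc w) κ) →
    Σ (Cover) λ C → τ ≡ Cover.τ C × iter d (higher w τ) w ≡ Cover.bottom C
  marked-path {w} {τ} τ∈ t = conclude (core-cover K ℓ κ part core len≤ℓ τ (proj₁ τ⊆) (MarkedCover.lower-core mc) (proj₂ τ⊆) (MarkedCover.size-step mc))
    where
      τ⊆ = subs⁻ κ part τ∈
      mc = markedCover⁻ K τ (suc w) κ t
      conclude : (Σ (Cover) λ C → τ ≡ Cover.τ C) →
        Σ (Cover) λ C → τ ≡ Cover.τ C × iter d (higher w τ) w ≡ Cover.bottom C
      conclude (C , refl) = C , refl , subst (λ j → iter d j w ≡ Cover.bottom C) (sym count) (proj₂ path)
        where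
          w∈ = Cover.marked⁻ C t
          path = tops-path (Cover.ladder C) w∈
          count : higher w τ ≡ proj₁ path
          count = ≡.trans (Cover.higher-count C w) (proj₂ (path-tops (Cover.ladder C) (proj₁ path) (proj₂ path)))

  cover-unique : ∀ (C C′ : Cover) → Cover.bottom C ≡ Cover.bottom C′ → Cover.τ C ≡ Cover.τ C′
  cover-unique C@(cover-at {z} adm zℓ pos) C′@(cover-at adm′ zℓ′ pos′) refl =
      part-ext _ _ (Cover.τ-part C) (Cover.τ-part C′) (shape-ext (Cover.τ-shape C) (Cover.τ-shape C′) same)
    where
      module A = Admissible adm
      module A′ = Admissible adm′
      g≡ : A′.height-1 ≡ A.height-1
      g≡ = block-unique A′.block A.block
      same : ∀ r → A.cover r ≡ A′.cover r
      same r = ≡.trans (CoverStraightening.covered-apex (suc K) ℓ d d-mono d>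
          (ladder-apex-unique (subst (λ h → Ladder h z A′.copies A′.apex) g≡ A′.ladder) A.ladder) r)
        (cong (λ h → covered h z A′.apex r) (sym g≡))

  module _ {ψ : Functional} (cψ : Congruent ψ) (sψ : Supported ψ) (w : ℕ) (aψ : ∀ Z → suc Z ≢ w → Antisym ψ Z) where

    lowered : ℕ → ℕ → ℤ
    lowered z = H ψ (Δ d) (wt d ⊖ ind z)

    term : List ℕ → ℕ → ℤ
    term τ = coverSpin τ (suc w) κ ▹ S ψ (down K τ)

    -- The strong covers with mark w + 1 and at least e components below the mark; z stands for the
    -- e-th image of w, and the covers account for t^e h. Such lists are built along the orbit of w
    -- from its far end backwards.
    record Listing (e z : ℕ) (h : ℕ → ℤ) : Set where
      field
        covers : List (List ℕ)
        sound : ∀ {τ} → τ ∈ covers → τ ∈ subs κ × T (markedCoverᵇ K τ (suc w) κ) × e ≤ higher w τ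
        complete : ∀ {τ} → τ ∈ subs κ → T (markedCoverᵇ K τ (suc w) κ) → e ≤ higher w τ → τ ∈ covers
        unique : Unique covers
        value : ∀ e′ → (e ▹ h) e′ ≡ ∑ covers (λ τ → term τ e′)

    down-zero : ∀ {r} → f r ≡ 0 → d r ≡ suc K ℕ.+ r
    down-zero {r} fr = cong ((suc K ℕ.+ r) ℕ.∸_) (get-pOf-0 K κ (ℕₚ.≮⇒≥ λ lt → ℕₚ.<⇒≢ (part-pos κ part lt) (sym fr)))

    -- 𝔭 vanishes from row z on, so the lowering makes the tail sum at z equal to -1, and the
    -- support condition applies.
    lowered-zero : ∀ {z} → z < ℓ → f z ≡ 0 → ∀ e → lowered z e ≡ 0ℤ
    lowered-zero {z} z<ℓ fz = H-supported cψ sψ (Δ d) (λ {β} m → increasing {β} m) (wt d ⊖ ind z) z negative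
      where
        increasing : ∀ {β} → β ∈ Δ d → proj₁ β < proj₂ β × proj₂ β < ℓ
        increasing {i , j} m = ℕₚ.<-≤-trans (d> i) (proj₂ (proj₂ m′)) , proj₁ (proj₂ m′)
          where m′ = ∈Δ⁻ d m
        zeroes : ∀ r → r < ℓ → atLeast z r ℤ.* wt d r ≡ 0ℤ
        zeroes r _ with z ≤? r
        ... | yes z≤r = ≡.trans (cong (λ a → atLeast z r ℤ.* (+ (suc K ℕ.+ r) ℤ.- + a)) (down-zero (ℕₚ.n≤0⇒n≡0 (subst (f r ≤_) fz (decreasing z≤r)))))
                (≡.trans (cong (atLeast z r ℤ.*_) (ℤₚ.+-inverseʳ (+ (suc K ℕ.+ r)))) (ℤₚ.*-zeroʳ (atLeast z r)))
        ... | no z≰r = cong (ℤ._* wt d r) (atLeast-> (ℕₚ.≰⇒> z≰r))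
        negative : pairing (atLeast z) (wt d ⊖ ind z) ℤ.< 0ℤ
        negative = subst (ℤ._< 0ℤ) (sym (≡.trans (pairing-ind (atLeast z) (wt d) z<ℓ)
          (cong₂ ℤ._-_ (≡.trans (sumTo-cong ℓ zeroes) (sumTo-0 ℓ)) (atLeast-≤ (ℕₚ.≤-refl {z}))))) ℤ.-<+

    empty-listing : ∀ {e z h} → iter d e w ≡ z → f z ≡ 0 → (∀ e → h e ≡ 0ℤ) → Listing e z h
    empty-listing {e} {z} {h} path fz h0 = record
      { covers = []
      ; sound = λ ()
      ; complete = λ τ∈ t e≤ → ⊥-elim (absurd (marked-path τ∈ t) e≤)
      ; unique = AllPairs.[]
      ; value = λ e′ → ≡.trans (▹-cong e h0 e′) (▹-zero e e′)
      }
      where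
        absurd : ∀ {τ} → (Σ (Cover) λ C → τ ≡ Cover.τ C × iter d (higher w τ) w ≡ Cover.bottom C) → ¬ (e ≤ higher w τ)
        absurd {τ} (C , _ , q) e≤ = ℕₚ.<⇒≱ (Cover.positive C) (subst (f (Cover.bottom C) ≤_) fz (decreasing z≤))
          where
            z≤ : z ≤ Cover.bottom C
            z≤ = subst₂ _≤_ path (≡.trans (≡.trans (sym (iter-+ e (higher w τ ℕ.∸ e) w)) (cong (λ k → iter d k w) (ℕₚ.m+[n∸m]≡n e≤))) q)
                   (iter-≤ (higher w τ ℕ.∸ e) (iter d e w))

    block-at : ∀ {z} → z < ℓ → 0 < f z → ∃ λ g → z ℕ.+ g < ℓ × Block z g
    block-at {z} z<ℓ fz>0 = proj₁ fb , subst (z ℕ.+ proj₁ fb <_) zN (s≤s (ℕₚ.+-monoʳ-≤ z (proj₁ (proj₂ fb)))) , proj₂ (proj₂ fb)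
      where
        N = ℓ ℕ.∸ suc z
        zN : suc (z ℕ.+ N) ≡ ℓ
        zN = ℕₚ.m+[n∸m]≡n z<ℓ
        fb : ∃ λ g → g ≤ N × Block z g
        -- A run of consecutive values from z cannot reach row ℓ, where d ℓ = ℓ + K + 1, because d z
        -- < z + K + 1.
        fb = find-block z N λ h → ℕₚ.<⇒≢ (ℕₚ.+-monoˡ-< (suc N) (d-positive fz>0)) (≡.trans (sym (h (suc N) ℕₚ.≤-refl))
          (≡.trans (cong d (≡.trans (ℕₚ.+-suc z N) zN)) (≡.trans (d-zero ℕₚ.≤-refl)
            (≡.trans (cong (ℕ._+ suc K) (≡.trans (sym zN) (sym (ℕₚ.+-suc z N)))) (e z (suc N) (suc K))))))
          where
            e : ∀ a b c → a ℕ.+ b ℕ.+ c ≡ a ℕ.+ c ℕ.+ b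
            e = ℕ-ring

    raise : ℕ → ℕ → ℕ
    raise z = upd d z (suc (d z))

    Resolved : ℕ → Set
    Resolved z = (Σ (Admissible z) λ a → ∀ e → S ψ (raise z) e ≡ ((Admissible.copies a ℕ.* Admissible.height-1 a) ▹ S ψ (Admissible.cover a)) e)
      ⊎ (¬ Admissible z × (∀ e → S ψ (raise z) e ≡ 0ℤ))

    -- The cover whose lowest ribbon starts at z, if there is one, has exactly e components below
    -- the mark. It is put in front of the covers with more, which are found from d z on.
    extend-listing : ∀ {e z h h′} → iter d e w ≡ z → z < ℓ → 0 < f z → Resolved z →
      (∀ e′ → h e′ ≡ S ψ (raise z) e′ ℤ.+ (1 ▹ h′) e′) → Listing (suc e) (d z) h′ → Listing e z h
    extend-listing {e} {z} {h} {h′} path z<ℓ fz>0 (inj₂ (¬adm , zero-S)) split L = record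
      { covers = L.covers
      ; sound = λ m → proj₁ (L.sound m) , proj₁ (proj₂ (L.sound m)) , ℕₚ.<⇒≤ (proj₂ (proj₂ (L.sound m)))
      ; complete = λ {τ} τ∈ t e≤ → L.complete τ∈ t (ℕₚ.≤∧≢⇒< e≤ λ { refl → ¬adm (adm-at (marked-path τ∈ t) ) })
      ; unique = L.unique
      ; value = λ e′ → begin
          (e ▹ h) e′ ≡⟨ ▹-cong e (λ e″ → ≡.trans (split e″) (≡.trans (cong (ℤ._+ (1 ▹ h′) e″) (zero-S e″)) (ℤₚ.+-identityˡ _))) e′ ⟩
          (e ▹ 1 ▹ h′) e′ ≡⟨ ▹-▹ e 1 h′ e′ ⟩
          ((e ℕ.+ 1) ▹ h′) e′ ≡⟨ cong (λ k → (k ▹ h′) e′) (ℕₚ.+-comm e 1) ⟩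
          (suc e ▹ h′) e′ ≡⟨ L.value e′ ⟩
          ∑ L.covers (λ τ → term τ e′) ∎
      }
      where
        open ≡-Reasoning
        module L = Listing L
        adm-at : ∀ {τ} → (Σ (Cover) λ C → τ ≡ Cover.τ C × iter d e w ≡ Cover.bottom C) → Admissible z
        adm-at (C , _ , q) = subst Admissible (≡.trans (sym q) path) (Cover.admissible C)
    extend-listing {e} {z} {h} {h′} path z<ℓ fz>0 (inj₁ (adm , eq-S)) split L = record
      { covers = C.τ ∷ L.covers
      ; sound = λ { (here refl) → subs⁺ κ C.τ-part C.τ-⊆ , C.marked⁺ w∈ , eq≥ higher≡
                  ; (there m) → proj₁ (L.sound m) , proj₁ (proj₂ (L.sound m)) , ℕₚ.<⇒≤ (proj₂ (proj₂ (L.sound m))) }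
      ; complete = complete
      ; unique = All.tabulate (λ m q → ℕₚ.<⇒≢ (proj₂ (proj₂ (L.sound m))) (≡.trans (sym higher≡) (cong (higher w) q))) AllPairs.∷ L.unique
      ; value = λ e′ → begin
          (e ▹ h) e′ ≡⟨ ▹-cong e split e′ ⟩
          (e ▹ λ e″ → S ψ (raise z) e″ ℤ.+ (1 ▹ h′) e″) e′ ≡⟨ ▹-+ e (S ψ (raise z)) (1 ▹ h′) e′ ⟩
          (e ▹ S ψ (raise z)) e′ ℤ.+ (e ▹ 1 ▹ h′) e′ ≡⟨ cong₂ ℤ._+_ (first e′) (second e′) ⟩
          term C.τ e′ ℤ.+ ∑ L.covers (λ τ → term τ e′) ∎
      }
      where
        open ≡-Reasoning
        module L = Listing L
        zg<ℓ : z ℕ.+ Admissible.height-1 adm < ℓ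
        zg<ℓ = subst (λ g → z ℕ.+ g < ℓ) (block-unique (proj₂ (proj₂ (block-at z<ℓ fz>0))) (Admissible.block adm)) (proj₁ (proj₂ (block-at z<ℓ fz>0)))
        C : Cover
        C = cover-at adm zg<ℓ fz>0
        module C = Cover C
        w-tops = path-tops C.ladder e path
        w∈ = proj₁ w-tops
        higher≡ : higher w C.τ ≡ e
        higher≡ = ≡.trans (C.higher-count w) (proj₂ w-tops)
        complete : ∀ {τ} → τ ∈ subs κ → T (markedCoverᵇ K τ (suc w) κ) → e ≤ higher w τ → τ ∈ C.τ ∷ L.covers
        complete {τ} τ∈ t e≤ = decide (e ≟ higher w τ)
          where
            decide : Dec (e ≡ higher w τ) → τ ∈ C.τ ∷ L.covers
            decide (no ne) = there (L.complete τ∈ t (ℕₚ.≤∧≢⇒< e≤ ne))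
            decide (yes e≡) = here (≡.trans (proj₁ (proj₂ mp)) (cover-unique (proj₁ mp) C (≡.trans (sym (proj₂ (proj₂ mp)))
                (≡.trans (cong (λ k → iter d k w) (sym e≡)) path))))
              where mp = marked-path τ∈ t
        spin≡ : coverSpin C.τ (suc w) κ ≡ e ℕ.+ C.c ℕ.* C.g
        spin≡ = ≡.trans (C.spin-τ w∈) (≡.trans (cong (C.c ℕ.* C.g ℕ.+_) (proj₂ w-tops)) (ℕₚ.+-comm (C.c ℕ.* C.g) e))
        first : ∀ e′ → (e ▹ S ψ (raise z)) e′ ≡ term C.τ e′
        first e′ = begin
          (e ▹ S ψ (raise z)) e′ ≡⟨ ▹-cong e eq-S e′ ⟩
          (e ▹ (C.c ℕ.* C.g) ▹ S ψ C.cover) e′ ≡⟨ ▹-▹ e (C.c ℕ.* C.g) _ e′ ⟩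
          ((e ℕ.+ C.c ℕ.* C.g) ▹ S ψ C.cover) e′ ≡⟨ cong (λ k → (k ▹ S ψ C.cover) e′) (sym spin≡) ⟩
          (coverSpin C.τ (suc w) κ ▹ S ψ C.cover) e′ ≡⟨ ▹-cong (coverSpin C.τ (suc w) κ) (S-cong cψ λ r _ → sym (C.τ-down r)) e′ ⟩
          term C.τ e′ ∎
        second : ∀ e′ → (e ▹ 1 ▹ h′) e′ ≡ ∑ L.covers (λ τ → term τ e′)
        second e′ = ≡.trans (▹-▹ e 1 h′ e′) (≡.trans (cong (λ k → (k ▹ h′) e′) (ℕₚ.+-comm e 1)) (L.value e′))

    listing : ∀ fuel {e z} → ℓ ≤ z ℕ.+ fuel → iter d e w ≡ z → z < ℓ → Listing e z (lowered z)
    listing zero {e} {z} ℓ≤ path z<ℓ = ⊥-elim (ℕₚ.<⇒≱ z<ℓ (subst (ℓ ≤_) (ℕₚ.+-identityʳ z) ℓ≤))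
    listing (suc fuel) {e} {z} ℓ≤ path z<ℓ = decide (f z ≟ 0) (d z <? ℓ)
      where
        path′ : iter d (suc e) w ≡ d z
        path′ = ≡.trans (iter-shift d e w) (cong d path)
        raise-z : raise z z ≡ suc (d z)
        raise-z = upd-same d z (suc (d z))
        raise-else : ∀ r → r ≢ z → raise z r ≡ d r
        raise-else r = upd-diff d (suc (d z))
        resolved : 0 < f z → Resolved z
        resolved fz>0 = CoverStraightening.resolve (suc K) ℓ d d-mono d> cψ aψ {e₀ = e} path (proj₂ (proj₂ (block-at z<ℓ fz>0)))
          (proj₁ (proj₂ (block-at z<ℓ fz>0))) raise-z raise-else (d> z)
        decide : Dec (f z ≡ 0) → Dec (d z < ℓ) → Listing e z (lowered z)
        decide (yes fz) _ = empty-listing path fz (lowered-zero z<ℓ fz)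
        decide (no fz) (yes dz<ℓ) = extend-listing path z<ℓ (ℕₚ.n≢0⇒n>0 fz) (resolved (ℕₚ.n≢0⇒n>0 fz))
          (lower-step cψ d (raise z) z<ℓ raise-z raise-else dz<ℓ)
          (listing fuel (ℕₚ.≤-trans ℓ≤ (subst (_≤ d z ℕ.+ fuel) (sym (ℕₚ.+-suc z fuel)) (ℕₚ.+-monoˡ-≤ fuel (d> z)))) path′ dz<ℓ)
        -- The orbit leaves the first ℓ rows here: `lower-last` has no further term, and κ has no
        -- box in row d z, so no covers remain.
        decide (no fz) (no dz≮ℓ) = extend-listing {h′ = λ _ → 0ℤ} path z<ℓ (ℕₚ.n≢0⇒n>0 fz) (resolved (ℕₚ.n≢0⇒n>0 fz))
          (λ e′ → ≡.trans (lower-last cψ d (raise z) z<ℓ raise-z raise-else (ℕₚ.≮⇒≥ dz≮ℓ) e′)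
            (sym (≡.trans (cong (λ a → S ψ (raise z) e′ ℤ.+ a) (▹-zero 1 e′)) (ℤₚ.+-identityʳ _))))
          (empty-listing path′ (get-≥length κ (ℕₚ.≤-trans len≤ℓ (ℕₚ.≮⇒≥ dz≮ℓ))) (λ _ → refl))

    mark-operator : w < ℓ → ∀ e → lowered w e ≡ ∑ (subs κ) (λ τ → if markedCoverᵇ K τ (suc w) κ then term τ e else 0ℤ)
    mark-operator w<ℓ e = begin
      lowered w e ≡⟨ L.value e ⟩
      ∑ L.covers (λ τ → term τ e) ≡⟨ ∑-↭ _ (unique-⇔⇒↭ L.unique (Uniqueₚ.filter⁺ (T? ∘ p) (subs-unique κ)) to from) ⟩
      ∑ (filterᵇ p (subs κ)) (λ τ → term τ e) ≡⟨ ∑-filterᵇ p (subs κ) (λ τ → term τ e) ⟩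
      ∑ (subs κ) (λ τ → if p τ then term τ e else 0ℤ) ∎
      where
        open ≡-Reasoning
        p : List ℕ → Bool
        p τ = markedCoverᵇ K τ (suc w) κ
        module L = Listing (listing ℓ {0} {w} (ℕₚ.m≤n+m ℓ w) refl w<ℓ)
        to : ∀ {τ} → τ ∈ L.covers → τ ∈ filterᵇ p (subs κ)
        to m = ∈-filterᵇ⁺ p (proj₁ (L.sound m)) (proj₁ (proj₂ (L.sound m)))
        from : ∀ {τ} → τ ∈ filterᵇ p (subs κ) → τ ∈ L.covers
        from {τ} m = L.complete (proj₁ m′) (proj₂ m′) z≤n
          where m′ = ∈-filterᵇ⁻ p {xs = subs κ} m

-- The action of the elementary symmetric functions

module Lowering (ℓ : ℕ) where

  open Catalan ℓ

  -- lower i m φ = Σ φ (γ − ε_A) over the i-element subsets A of {0, …, m − 1}; for m = ℓ this is the action of e_i^⊥.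
  lower : ℕ → ℕ → Functional → Functional
  lower zero m φ γ = φ γ
  lower (suc i) zero φ γ = 0ℤ
  lower (suc i) (suc m) φ γ = lower (suc i) m φ γ ℤ.+ lower i m φ (γ ⊖ ind m)

  ⊖-cong : ∀ {γ δ} η → γ ≈ δ → γ ⊖ η ≈ δ ⊖ η
  ⊖-cong η e j j<ℓ = cong (ℤ._- η j) (e j j<ℓ)

  lower-congruent : ∀ {φ} → Congruent φ → ∀ i m → Congruent (lower i m φ)
  lower-congruent c zero m e = c e
  lower-congruent c (suc i) zero e = refl
  lower-congruent c (suc i) (suc m) e = cong₂ ℤ._+_ (lower-congruent c (suc i) m e) (lower-congruent c i m (⊖-cong (ind m) e))

  lower-supported : ∀ {φ} → Supported φ → ∀ i m → m ≤ ℓ → Supported (lower i m φ)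
  lower-supported s zero m _ γ j neg = s γ j neg
  lower-supported s (suc i) zero _ γ j neg = refl
  lower-supported s (suc i) (suc m) m<ℓ γ j neg =
    cong₂ ℤ._+_ (lower-supported s (suc i) m (ℕₚ.<⇒≤ m<ℓ) γ j neg) (lower-supported s i m (ℕₚ.<⇒≤ m<ℓ) (γ ⊖ ind m) j
      (subst (ℤ._< 0ℤ) (sym (pairing-ind (atLeast j) γ m<ℓ))
        (ℤₚ.≤-<-trans (ℤₚ.≤-trans (ℤₚ.+-monoʳ-≤ (pairing (atLeast j) γ) (ℤₚ.neg-mono-≤ (atLeast-nonneg j m))) (ℤₚ.≤-reflexive (ℤₚ.+-identityʳ _))) neg)))

  dot-lower : ∀ Z γ a → dot Z (γ ⊖ ind a) ≈ dot Z γ ⊖ ind (transpose Z a)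
  dot-lower Z γ a j _ rewrite ind-transpose Z a j = eq (γ (transpose Z j)) (ind (transpose Z a) j) (ind (suc Z) j) (ind Z j)
    where
      eq : ∀ g x u v → g ℤ.- x ℤ.+ (u ℤ.- v) ≡ g ℤ.+ (u ℤ.- v) ℤ.- x
      eq = ℤ-ring

  dot-lower′ : ∀ Z γ {a b} → transpose Z a ≡ b → dot Z γ ⊖ ind b ≈ dot Z (γ ⊖ ind a)
  dot-lower′ Z γ {a} refl j j<ℓ = sym (dot-lower Z γ a j j<ℓ)

  module _ {φ} (c : Congruent φ) (Z : ℕ) (a : Antisym φ Z) where

    private
      neg-+ : ∀ {x y u v} → x ≡ ℤ.- u → y ≡ ℤ.- v → x ℤ.+ y ≡ ℤ.- (u ℤ.+ v)
      neg-+ {u = u} {v} refl refl = sym (ℤₚ.neg-distrib-+ u v)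

    lower-antisym-above : ∀ i m → m ≤ Z → Antisym (lower i m φ) Z
    lower-antisym-above zero m _ = a
    lower-antisym-above (suc i) zero _ _ γ = refl
    lower-antisym-above (suc i) (suc m) m<Z sZ<ℓ γ = neg-+ (lower-antisym-above (suc i) m (ℕₚ.<⇒≤ m<Z) sZ<ℓ γ)
      (≡.trans (lower-congruent c i m (dot-lower′ Z γ (transpose-else (ℕₚ.<⇒≢ m<Z) (ℕₚ.<⇒≢ (ℕₚ.m<n⇒m<1+n m<Z)))))
        (lower-antisym-above i m (ℕₚ.<⇒≤ m<Z) sZ<ℓ (γ ⊖ ind m)))

    -- The subsets are grouped by how they meet the rows Z and Z + 1: those containing neither or
    -- both are kept by the transposition, and those containing just one are interchanged.
    lower-antisym-pair : ∀ i → Antisym (lower i (suc (suc Z)) φ) Z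
    lower-antisym-pair zero = a
    lower-antisym-pair (suc i) sZ<ℓ γ = two i
      where
        low : ∀ i → Antisym (lower i Z φ) Z
        low i = lower-antisym-above i Z ℕₚ.≤-refl
        fst≈ : ∀ γ → dot Z γ ⊖ ind Z ≈ dot Z (γ ⊖ ind (suc Z))
        fst≈ γ = dot-lower′ Z γ (transpose-snd Z)
        snd≈ : ∀ γ → dot Z γ ⊖ ind (suc Z) ≈ dot Z (γ ⊖ ind Z)
        snd≈ γ = dot-lower′ Z γ (transpose-fst Z)
        both : dot Z γ ⊖ ind (suc Z) ⊖ ind Z ≈ dot Z (γ ⊖ ind (suc Z) ⊖ ind Z)
        both j j<ℓ = ≡.trans (≡.trans (⊖-cong (ind Z) (snd≈ γ) j j<ℓ) (fst≈ (γ ⊖ ind Z) j j<ℓ)) (dot-cong sZ<ℓ (λ j _ → eq (γ j) (ind Z j) (ind (suc Z) j)) j j<ℓ)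
          where
            eq : ∀ g x y → g ℤ.- x ℤ.- y ≡ g ℤ.- y ℤ.- x
            eq = ℤ-ring
        move : ∀ i {γ δ} → γ ≈ dot Z δ → lower i Z φ γ ≡ ℤ.- lower i Z φ δ
        move i {δ = δ} e = ≡.trans (lower-congruent c i Z e) (low i sZ<ℓ δ)
        rearrange : ∀ x y u v → (ℤ.- x ℤ.+ ℤ.- y) ℤ.+ (ℤ.- u ℤ.+ ℤ.- v) ≡ ℤ.- ((x ℤ.+ u) ℤ.+ (y ℤ.+ v))
        rearrange = ℤ-ring
        rearrange₁ : ∀ x y u → (ℤ.- x ℤ.+ ℤ.- y) ℤ.+ ℤ.- u ≡ ℤ.- ((x ℤ.+ u) ℤ.+ y)
        rearrange₁ = ℤ-ring
        two : ∀ i → lower (suc i) (suc (suc Z)) φ (dot Z γ) ≡ ℤ.- lower (suc i) (suc (suc Z)) φ γ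
        two zero = ≡.trans (cong₂ ℤ._+_ (cong₂ ℤ._+_ (move 1 λ _ _ → refl) (move 0 (fst≈ γ))) (move 0 (snd≈ γ)))
          (rearrange₁ (lower 1 Z φ γ) (lower 0 Z φ (γ ⊖ ind (suc Z))) (lower 0 Z φ (γ ⊖ ind Z)))
        two (suc i) = ≡.trans (cong₂ ℤ._+_ (cong₂ ℤ._+_ (move (suc (suc i)) λ _ _ → refl) (move (suc i) (fst≈ γ))) (cong₂ ℤ._+_ (move (suc i) (snd≈ γ)) (move i both)))
          (rearrange (lower (suc (suc i)) Z φ γ) (lower (suc i) Z φ (γ ⊖ ind (suc Z))) (lower (suc i) Z φ (γ ⊖ ind Z)) (lower i Z φ (γ ⊖ ind (suc Z) ⊖ ind Z)))

    lower-antisym-below : ∀ i k → Antisym (lower i (suc (suc (k ℕ.+ Z))) φ) Z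
    lower-antisym-below i zero = lower-antisym-pair i
    lower-antisym-below zero (suc k) = a
    lower-antisym-below (suc i) (suc k) sZ<ℓ γ = neg-+ (lower-antisym-below (suc i) k sZ<ℓ γ)
      (≡.trans (lower-congruent c i (suc (suc (k ℕ.+ Z))) (dot-lower′ Z γ (transpose-else (ne (suc (suc k)) (s≤s z≤n)) (ne (suc k) (s≤s z≤n) ∘ ℕₚ.suc-injective))))
        (lower-antisym-below i k sZ<ℓ (γ ⊖ ind (suc (suc (k ℕ.+ Z))))))
      where
        ne : ∀ k → 0 < k → k ℕ.+ Z ≢ Z
        ne k 0<k e = ℕₚ.<⇒≢ (ℕₚ.+-monoˡ-< Z 0<k) (sym e)

    -- The transposition of Z and Z + 1 permutes the subsets of {0, ..., m - 1} unless m separates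
    -- the two rows, which is the excluded case m = Z + 1.
    lower-antisym : ∀ i m → suc Z ≢ m → Antisym (lower i m φ) Z
    lower-antisym i m ne with m ≤? Z
    ... | yes m≤Z = lower-antisym-above i m m≤Z
    ... | no m≰Z = subst (λ m → Antisym (lower i m φ) Z) e (lower-antisym-below i (m ℕ.∸ suc (suc Z)))
      where
        e : suc (suc (m ℕ.∸ suc (suc Z) ℕ.+ Z)) ≡ m
        e = ≡.trans (≡.trans (cong suc (sym (ℕₚ.+-suc _ Z))) (sym (ℕₚ.+-suc _ (suc Z)))) (ℕₚ.m∸n+n≡m (ℕₚ.≤∧≢⇒< (ℕₚ.≰⇒> m≰Z) ne))

  record Good (φ : Functional) : Set where
    field
      congruent : Congruent φ
      supported : Supported φ
      antisym : ∀ Z → Antisym φ Z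

  lower-good : ∀ {φ} → Good φ → ∀ i → Good (lower i ℓ φ)
  lower-good g i = record
    { congruent = lower-congruent G.congruent i ℓ
    ; supported = lower-supported G.supported i ℓ ℕₚ.≤-refl
    ; antisym = λ Z sZ<ℓ → lower-antisym G.congruent Z (G.antisym Z) i ℓ (ℕₚ.<⇒≢ sZ<ℓ) sZ<ℓ
    }
    where module G = Good g

  +-good : ∀ {φ ψ} → Good φ → Good ψ → Good (λ γ → φ γ ℤ.+ ψ γ)
  +-good {φ} {ψ} g h = record
    { congruent = λ e → cong₂ ℤ._+_ (G.congruent e) (H′.congruent e)
    ; supported = λ γ j n → cong₂ ℤ._+_ (G.supported γ j n) (H′.supported γ j n)
    ; antisym = λ Z b γ → ≡.trans (cong₂ ℤ._+_ (G.antisym Z b γ) (H′.antisym Z b γ)) (sym (ℤₚ.neg-distrib-+ (φ γ) (ψ γ)))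
    }
    where
      module G = Good g
      module H′ = Good h

  neg-good : ∀ {φ} → Good φ → Good (λ γ → ℤ.- φ γ)
  neg-good g = record
    { congruent = λ e → cong ℤ.-_ (G.congruent e)
    ; supported = λ γ j n → cong ℤ.-_ (G.supported γ j n)
    ; antisym = λ Z b γ → cong ℤ.-_ (G.antisym Z b γ)
    }
    where module G = Good g

  ones : ℕ → Weight
  ones m j = if does (j <? m) then 1ℤ else 0ℤ

  ones-suc : ∀ m j → ones (suc m) j ≡ ind m j ℤ.+ ones m j
  ones-suc m j with j ≟ m
  ... | yes refl rewrite dec-true (j <? suc j) (ℕₚ.n<1+n j) | dec-false (j <? j) (ℕₚ.<-irrefl refl) | ind-same j = refl
  ... | no ne rewrite ind-diff {m} {j} (ne ∘ sym) with j <? m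
  ...   | yes p rewrite dec-true (j <? suc m) (ℕₚ.m<n⇒m<1+n p) | dec-true (j <? m) p = refl
  ...   | no q rewrite dec-false (j <? suc m) (λ p → q (ℕₚ.≤∧≢⇒< (ℕₚ.≤-pred p) ne)) | dec-false (j <? m) q = refl

  ones-< : ∀ {m j} → j < m → ones m j ≡ 1ℤ
  ones-< {m} {j} p rewrite dec-true (j <? m) p = refl

  lower-exceed : ∀ φ i m γ → m < i → lower i m φ γ ≡ 0ℤ
  lower-exceed φ (suc i) zero γ _ = refl
  lower-exceed φ (suc i) (suc m) γ (s≤s m<i) = cong₂ ℤ._+_ (lower-exceed φ (suc i) m γ (ℕₚ.m<n⇒m<1+n m<i)) (lower-exceed φ i m (γ ⊖ ind m) m<i)

  lower-all : ∀ {φ} → Congruent φ → ∀ m γ → lower m m φ γ ≡ φ (γ ⊖ ones m)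
  lower-all {φ} c zero γ = c λ j _ → sym (ℤₚ.+-identityʳ (γ j))
  lower-all {φ} c (suc m) γ = ≡.trans (cong₂ ℤ._+_ (lower-exceed φ (suc m) m γ (ℕₚ.n<1+n m)) (lower-all c m (γ ⊖ ind m)))
    (≡.trans (ℤₚ.+-identityˡ _) (c λ j _ → ≡.trans (eq (γ j) (ind m j) (ones m j)) (cong (λ a → γ j ℤ.- a) (sym (ones-suc m j)))))
    where
      eq : ∀ g x y → g ℤ.- x ℤ.- y ≡ g ℤ.- (x ℤ.+ y)
      eq = ℤ-ring

-- Sorting signs and the coefficient of the empty Schur function

transpose-suc : ∀ i j → transpose (suc i) (suc j) ≡ suc (transpose i j)
transpose-suc i j with position i j
... | fst = ≡.trans (transpose-fst (suc i)) (cong suc (sym (transpose-fst i)))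
... | snd = ≡.trans (transpose-snd (suc i)) (cong suc (sym (transpose-snd i)))
... | else p q = ≡.trans (transpose-else (p ∘ ℕₚ.suc-injective) (q ∘ ℕₚ.suc-injective)) (cong suc (sym (transpose-else p q)))

transpose-0 : ∀ i → transpose (suc i) 0 ≡ 0
transpose-0 i = transpose-else (λ ()) (λ ())

sumTo-transpose : ∀ m i (h : ℕ → ℤ) → suc i < m → sumTo m (h ∘ transpose i) ≡ sumTo m h
sumTo-transpose (suc m) i h si<m = ≡.trans (sumTo-front m (h ∘ transpose i)) (≡.trans (go m i h si<m) (sym (sumTo-front m h)))
  where
    go : ∀ m i h → suc i < suc m → h (transpose i 0) ℤ.+ sumTo m (λ j → h (transpose i (suc j))) ≡ h 0 ℤ.+ sumTo m (h ∘ suc)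
    go zero zero h (s≤s ())
    go (suc m) zero h _ = begin
      h (transpose 0 0) ℤ.+ sumTo (suc m) (λ j → h (transpose 0 (suc j)))
        ≡⟨ cong₂ ℤ._+_ (cong h (transpose-fst 0)) (≡.trans (sumTo-front m (λ j → h (transpose 0 (suc j)))) (cong₂ ℤ._+_ (cong h (transpose-snd 0))
             (sumTo-cong m λ j _ → cong h (transpose-else (λ ()) (λ ()))))) ⟩
      h 1 ℤ.+ (h 0 ℤ.+ sumTo m (λ j → h (suc (suc j)))) ≡⟨ eq (h 1) (h 0) (sumTo m (λ j → h (suc (suc j)))) ⟩
      h 0 ℤ.+ (h 1 ℤ.+ sumTo m (λ j → h (suc (suc j)))) ≡⟨ cong (λ a → h 0 ℤ.+ a) (sym (sumTo-front m (h ∘ suc))) ⟩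
      h 0 ℤ.+ sumTo (suc m) (h ∘ suc) ∎
      where
        open ≡-Reasoning
        eq : ∀ a b c → a ℤ.+ (b ℤ.+ c) ≡ b ℤ.+ (a ℤ.+ c)
        eq = ℤ-ring
    go (suc m) (suc i) h (s≤s si<m) = cong₂ ℤ._+_ (cong h (transpose-0 i)) (≡.trans (sumTo-cong (suc m) (λ j _ → cong h (transpose-suc i j)))
      (≡.trans (sumTo-front m _) (≡.trans (go m i (h ∘ suc) si<m) (sym (sumTo-front m (h ∘ suc))))))

prodTo : ℕ → (ℕ → ℤ) → ℤ
prodTo zero h = 1ℤ
prodTo (suc m) h = h 0 ℤ.* prodTo m (h ∘ suc)

prodTo-cong : ∀ m {h k : ℕ → ℤ} → (∀ i → i < m → h i ≡ k i) → prodTo m h ≡ prodTo m k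
prodTo-cong zero e = refl
prodTo-cong (suc m) e = cong₂ ℤ._*_ (e 0 (s≤s z≤n)) (prodTo-cong m λ i i<m → e (suc i) (s≤s i<m))

prodTo-transpose : ∀ m i (h : ℕ → ℤ) → suc i < m → prodTo m (h ∘ transpose i) ≡ prodTo m h
prodTo-transpose (suc (suc m)) zero h _ rewrite transpose-fst 0 | transpose-snd 0 = ≡.trans
  (cong (λ a → h 1 ℤ.* (h 0 ℤ.* a)) (prodTo-cong m λ j _ → cong h (transpose-else (λ ()) (λ ()))))
  (eq (h 1) (h 0) (prodTo m (λ j → h (suc (suc j)))))
  where
    eq : ∀ a b c → a ℤ.* (b ℤ.* c) ≡ b ℤ.* (a ℤ.* c)
    eq = ℤ-ring
prodTo-transpose (suc m) (suc i) h (s≤s si<m) = cong₂ ℤ._*_ (cong h (transpose-0 i))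
  (≡.trans (prodTo-cong m (λ j _ → cong h (transpose-suc i j))) (prodTo-transpose m i (h ∘ suc) si<m))

sgn nonneg : ℤ → ℤ
sgn (+ zero) = 0ℤ
sgn (+ suc _) = 1ℤ
sgn -[1+ _ ] = -1ℤ
nonneg (+ _) = 1ℤ
nonneg -[1+ _ ] = 0ℤ

sgn-neg : ∀ x → sgn (ℤ.- x) ≡ ℤ.- sgn x
sgn-neg (+ zero) = refl
sgn-neg (+ suc _) = refl
sgn-neg -[1+ _ ] = refl

-- The sign of the permutation sorting v 0, …, v (m − 1) into decreasing order, or 0 if two of them agree or one is negative.
sortSign : ℕ → (ℕ → ℤ) → ℤ
sortSign zero v = 1ℤ
sortSign (suc m) v = nonneg (v 0) ℤ.* prodTo m (λ j → sgn (v 0 ℤ.- v (suc j))) ℤ.* sortSign m (v ∘ suc)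

sortSign-cong : ∀ m {v u : ℕ → ℤ} → (∀ i → i < m → v i ≡ u i) → sortSign m v ≡ sortSign m u
sortSign-cong zero e = refl
sortSign-cong (suc m) e = cong₂ ℤ._*_ (cong₂ ℤ._*_ (cong nonneg (e 0 (s≤s z≤n)))
    (prodTo-cong m λ j j<m → cong₂ (λ a b → sgn (a ℤ.- b)) (e 0 (s≤s z≤n)) (e (suc j) (s≤s j<m))))
  (sortSign-cong m λ i i<m → e (suc i) (s≤s i<m))

-- Exchanging two neighbours flips one factor, the sign of their difference, and only permutes the
-- others.
sortSign-transpose : ∀ m i (v : ℕ → ℤ) → suc i < m → sortSign m (v ∘ transpose i) ≡ ℤ.- sortSign m v
sortSign-transpose (suc (suc m)) zero v _ rewrite transpose-fst 0 | transpose-snd 0 = begin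
    n₁ ℤ.* (sgn (v 1 ℤ.- v 0) ℤ.* prodTo m (λ j → sgn (v 1 ℤ.- v (transpose 0 (suc (suc j)))))) ℤ.*
      (n₀ ℤ.* prodTo m (λ j → sgn (v 0 ℤ.- v (transpose 0 (suc (suc j))))) ℤ.* sortSign m (λ j → v (transpose 0 (suc (suc j)))))
      ≡⟨ cong₂ ℤ._*_ (cong₂ (λ a b → n₁ ℤ.* (a ℤ.* b)) (≡.trans (cong sgn (flip (v 1) (v 0))) (sgn-neg (v 0 ℤ.- v 1))) (prodTo-cong m λ j _ → cong (λ a → sgn (v 1 ℤ.- v a)) (fixed j)))
           (cong₂ ℤ._*_ (cong (n₀ ℤ.*_) (prodTo-cong m λ j _ → cong (λ a → sgn (v 0 ℤ.- v a)) (fixed j))) (sortSign-cong m λ j _ → cong v (fixed j))) ⟩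
    n₁ ℤ.* (ℤ.- s ℤ.* P₁) ℤ.* (n₀ ℤ.* P₀ ℤ.* W) ≡⟨ eq n₀ n₁ s P₀ P₁ W ⟩
    ℤ.- (n₀ ℤ.* (s ℤ.* P₀) ℤ.* (n₁ ℤ.* P₁ ℤ.* W)) ∎
  where
    open ≡-Reasoning
    n₀ = nonneg (v 0)
    n₁ = nonneg (v 1)
    s = sgn (v 0 ℤ.- v 1)
    P₀ = prodTo m (λ j → sgn (v 0 ℤ.- v (suc (suc j))))
    P₁ = prodTo m (λ j → sgn (v 1 ℤ.- v (suc (suc j))))
    W = sortSign m (λ j → v (suc (suc j)))
    fixed : ∀ j → transpose 0 (suc (suc j)) ≡ suc (suc j)
    fixed j = transpose-else (λ ()) (λ ())
    flip : ∀ a b → a ℤ.- b ≡ ℤ.- (b ℤ.- a)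
    flip = ℤ-ring
    eq : ∀ a b s p q w → b ℤ.* (ℤ.- s ℤ.* q) ℤ.* (a ℤ.* p ℤ.* w) ≡ ℤ.- (a ℤ.* (s ℤ.* p) ℤ.* (b ℤ.* q ℤ.* w))
    eq = ℤ-ring
sortSign-transpose (suc m) (suc i) v (s≤s si<m) = ≡.trans
  (cong₂ ℤ._*_ (cong₂ ℤ._*_ (cong (nonneg ∘ v) (transpose-0 i))
      (≡.trans (prodTo-cong m λ j _ → cong₂ (λ a b → sgn (v a ℤ.- v b)) (transpose-0 i) (transpose-suc i j)) (prodTo-transpose m i (λ j → sgn (v 0 ℤ.- v (suc j))) si<m)))
    (≡.trans (sortSign-cong m λ j _ → cong v (transpose-suc i j)) (sortSign-transpose m i (v ∘ suc) si<m)))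
  (sym (ℤₚ.neg-distribʳ-* (nonneg (v 0) ℤ.* prodTo m (λ j → sgn (v 0 ℤ.- v (suc j)))) (sortSign m (v ∘ suc))))

prodTo-zero : ∀ m (h : ℕ → ℤ) i → i < m → h i ≡ 0ℤ → prodTo m h ≡ 0ℤ
prodTo-zero (suc m) h zero _ e rewrite e = refl
prodTo-zero (suc m) h (suc i) (s≤s i<m) e rewrite prodTo-zero m (h ∘ suc) i i<m e = ℤₚ.*-zeroʳ (h 0)

sortSign-cases : ∀ m (v : ℕ → ℤ) → sortSign m v ≡ 0ℤ ⊎
  ((∀ i → i < m → v i ≡ + ℤ.∣ v i ∣) × (∀ {i j} → i < j → j < m → ℤ.∣ v i ∣ ≢ ℤ.∣ v j ∣))
sortSign-cases zero v = inj₂ ((λ _ ()) , λ _ ())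
sortSign-cases (suc m) v with sortSign-cases m (v ∘ suc)
... | inj₁ e = inj₁ (≡.trans (cong (nonneg (v 0) ℤ.* prodTo m (λ j → sgn (v 0 ℤ.- v (suc j))) ℤ.*_) e)
                 (ℤₚ.*-zeroʳ (nonneg (v 0) ℤ.* prodTo m (λ j → sgn (v 0 ℤ.- v (suc j))))))
... | inj₂ (pos , dist) with v 0 in v0
...   | -[1+ k ] = inj₁ (≡.trans (cong (ℤ._* sortSign m (v ∘ suc)) (ℤₚ.*-zeroˡ (prodTo m (λ j → sgn (-[1+ k ] ℤ.- v (suc j)))))) (ℤₚ.*-zeroˡ (sortSign m (v ∘ suc))))
...   | + a with ℕₚ.anyUpTo? (λ j → ℤ.∣ v (suc j) ∣ ≟ a) m
...     | yes (j , j<m , e) = inj₁ (≡.trans (cong (λ p → 1ℤ ℤ.* p ℤ.* sortSign m (v ∘ suc)) (prodTo-zero m (λ j → sgn (+ a ℤ.- v (suc j))) j j<m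
              (cong sgn (≡.trans (cong (λ b → + a ℤ.- b) (≡.trans (pos j j<m) (cong +_ e))) (ℤₚ.+-inverseʳ (+ a))))))
            (ℤₚ.*-zeroˡ (sortSign m (v ∘ suc))))
...     | no none = inj₂ (pos′ , dist′)
  where
    pos′ : ∀ i → i < suc m → v i ≡ + ℤ.∣ v i ∣
    pos′ zero _ = ≡.trans v0 (cong (λ x → + ℤ.∣ x ∣) (sym v0))
    pos′ (suc i) (s≤s i<m) = pos i i<m
    dist′ : ∀ {i j} → i < j → j < suc m → ℤ.∣ v i ∣ ≢ ℤ.∣ v j ∣
    dist′ {zero} {suc j} _ (s≤s j<m) e = none (j , j<m , ≡.trans (sym e) (cong ℤ.∣_∣ v0))
    dist′ {suc i} {suc j} (s≤s i<j) (s≤s j<m) = dist i<j j<m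

triangle : ℕ → ℕ
triangle zero = 0
triangle (suc q) = q ℕ.+ triangle q

-- By removal of the largest possible value N: the remaining numbers are distinct and below N, so
-- there are at most N of them, and N is large enough to pay for the next step of the triangle. The
-- bound on the length is carried along for this.
triangle-≤-sum : ∀ N xs → Unique xs → (∀ {x} → x ∈ xs → x < N) → triangle (length xs) ≤ sum xs × length xs ≤ N
triangle-≤-sum zero [] u b = z≤n , z≤n
triangle-≤-sum zero (x ∷ xs) u b = ⊥-elim (ℕₚ.n≮0 (b (here refl)))
triangle-≤-sum (suc N) xs u b with Any.any? (_≟ N) xs
... | no N∉ with triangle-≤-sum N xs u (λ m → ℕₚ.≤∧≢⇒< (ℕₚ.≤-pred (b m)) λ e → N∉ (lose m e))
...   | t , l = t , ℕₚ.m≤n⇒m≤1+n l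
triangle-≤-sum (suc N) xs u b | yes N∈ = subst₂ (λ k s → triangle k ≤ s × k ≤ suc N) (sym (Permₚ.↭-length perm)) (sym (sum-↭ perm))
    (ℕₚ.+-mono-≤ (proj₂ rec) (proj₁ rec) , s≤s (proj₂ rec))
  where
    ys = filter (λ x → ¬? (x ≟ N)) xs
    ∈ys : ∀ {x} → x ∈ ys → x ∈ xs × x ≢ N
    ∈ys = ∈-filter⁻ (λ x → ¬? (x ≟ N)) {xs = xs}
    u′ : Unique ys
    u′ = Uniqueₚ.filter⁺ (λ x → ¬? (x ≟ N)) u
    perm : xs ↭ N ∷ ys
    perm = unique-⇔⇒↭ u (All.tabulate (λ m e → proj₂ (∈ys m) (sym e)) AllPairs.∷ u′) to
        λ { (here refl) → find-N ; (there m) → proj₁ (∈ys m) }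
      where
        find-N : N ∈ xs
        find-N with find N∈
        ... | x , m , refl = m
        to : ∀ {x} → x ∈ xs → x ∈ N ∷ ys
        to {x} m with x ≟ N
        ... | yes refl = here refl
        ... | no ne = there (∈-filter⁺ (λ x → ¬? (x ≟ N)) m ne)
    rec = triangle-≤-sum N ys u′ λ m → ℕₚ.≤∧≢⇒< (ℕₚ.≤-pred (b (proj₁ (∈ys m)))) (proj₂ (∈ys m))

bounded : ∀ xs → ∃ λ N → ∀ {x} → x ∈ xs → x < N
bounded xs = suc (sum xs) , λ m → s≤s (go xs m)
  where
    go : ∀ xs {x} → x ∈ xs → x ≤ sum xs
    go (x ∷ xs) (here refl) = ℕₚ.m≤m+n x (sum xs)
    go (x ∷ xs) (there m) = ℕₚ.≤-trans (go xs m) (ℕₚ.m≤n+m (sum xs) x)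

sum-applyUpTo : ∀ (h : ℕ → ℕ) q → + sum (applyUpTo h q) ≡ sumTo q (λ i → + h i)
sum-applyUpTo h zero = refl
sum-applyUpTo h (suc q) = ≡.trans (cong (λ a → + h 0 ℤ.+ a) (sum-applyUpTo (h ∘ suc) q)) (sym (sumTo-front q (λ i → + h i)))

sumTo-triangle : ∀ q → sumTo q (λ i → + (q ℕ.∸ suc i)) ≡ + triangle q
sumTo-triangle zero = refl
sumTo-triangle (suc q) = ≡.trans (sumTo-front q (λ i → + (q ℕ.∸ i))) (cong (λ a → + q ℤ.+ a) (sumTo-triangle q))

module BaseFunctional (ℓ : ℕ) where

  open Catalan ℓ
  open Lowering ℓ

  ρ : Weight
  ρ i = + (ℓ ℕ.∸ suc i)

  total : Weight → ℤ
  total = pairing (λ _ → 1ℤ)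

  ifZero : ℤ → ℤ → ℤ
  ifZero (+ zero) x = x
  ifZero _ x = 0ℤ

  ifZero-0 : ∀ z → ifZero z 0ℤ ≡ 0ℤ
  ifZero-0 (+ zero) = refl
  ifZero-0 (+ suc _) = refl
  ifZero-0 -[1+ _ ] = refl

  ifZero-neg : ∀ z x → ifZero z (ℤ.- x) ≡ ℤ.- ifZero z x
  ifZero-neg (+ zero) x = refl
  ifZero-neg (+ suc _) x = refl
  ifZero-neg -[1+ _ ] x = refl

  -- ε γ is the coefficient of the empty Schur function in the straightening of s_γ.
  ε : Functional
  ε γ = ifZero (total γ) (sortSign ℓ (γ ⊕ ρ))

  tail-sum : ∀ m j (γ : Weight) → sumTo m (λ i → atLeast j i ℤ.* γ i) ≡ sumTo (m ℕ.∸ j) (λ i → γ (j ℕ.+ i))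
  tail-sum zero j γ rewrite ℕₚ.0∸n≡0 j = refl
  tail-sum (suc m) j γ with j ≤? m
  ... | yes j≤m rewrite ℕₚ.+-∸-assoc 1 j≤m | atLeast-≤ j≤m | ℕₚ.m+[n∸m]≡n j≤m = cong₂ ℤ._+_ (tail-sum m j γ) (ℤₚ.*-identityˡ (γ m))
  ... | no j≰m rewrite atLeast-> (ℕₚ.≰⇒> j≰m) | ℕₚ.m≤n⇒m∸n≡0 (ℕₚ.≰⇒> j≰m) = ≡.trans (ℤₚ.+-identityʳ _)
        (≡.trans (tail-sum m j γ) (cong (λ k → sumTo k (λ i → γ (j ℕ.+ i))) (ℕₚ.m≤n⇒m∸n≡0 (ℕₚ.<⇒≤ (ℕₚ.≰⇒> j≰m)))))

  -- The entries of γ + ρ from j on are q distinct natural numbers, so they sum to at least 0 + 1 +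
  -- ... + (q - 1), which is the tail sum of ρ.
  tail-bound : ∀ γ j → (∀ i → i < ℓ → (γ ⊕ ρ) i ≡ + ℤ.∣ (γ ⊕ ρ) i ∣) →
    (∀ {i k} → i < k → k < ℓ → ℤ.∣ (γ ⊕ ρ) i ∣ ≢ ℤ.∣ (γ ⊕ ρ) k ∣) → 0ℤ ℤ.≤ pairing (atLeast j) γ
  tail-bound γ j pos dist = subst (0ℤ ℤ.≤_) (sym (begin
      pairing (atLeast j) γ ≡⟨ tail-sum ℓ j γ ⟩
      sumTo q (λ i → γ (j ℕ.+ i)) ≡⟨ sumTo-cong q pointwise ⟩
      sumTo q (λ i → + v i ℤ.- + (q ℕ.∸ suc i)) ≡⟨ sumTo-- q (λ i → + v i) (λ i → + (q ℕ.∸ suc i)) ⟩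
      sumTo q (λ i → + v i) ℤ.- sumTo q (λ i → + (q ℕ.∸ suc i)) ≡⟨ cong₂ ℤ._-_ (sym (sum-applyUpTo v q)) (sumTo-triangle q) ⟩
      + sum xs ℤ.- + triangle q ∎)) (ℤₚ.i≤j⇒0≤j-i (ℤ.+≤+ (subst (λ k → triangle k ≤ sum xs) (Listₚ.length-applyUpTo v q)
        (proj₁ (triangle-≤-sum (proj₁ (bounded xs)) xs unique (proj₂ (bounded xs)))))))
    where
      open ≡-Reasoning
      q = ℓ ℕ.∸ j
      in-range : ∀ {i} → i < q → j ℕ.+ i < ℓ
      in-range {i} i<q = subst (j ℕ.+ i <_) (ℕₚ.m+[n∸m]≡n (ℕₚ.<⇒≤ (ℕₚ.m∸n≢0⇒n<m {ℓ} {j} λ e → ℕₚ.n≮0 (subst (i <_) e i<q)))) (ℕₚ.+-monoʳ-< j i<q)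
      v : ℕ → ℕ
      v i = ℤ.∣ (γ ⊕ ρ) (j ℕ.+ i) ∣
      xs = applyUpTo v q
      unique : Unique xs
      unique = Uniqueₚ.applyUpTo⁺₁ v q λ i<k k<q → dist (ℕₚ.+-monoʳ-< j i<k) (in-range k<q)
      pointwise : ∀ i → i < q → γ (j ℕ.+ i) ≡ + v i ℤ.- + (q ℕ.∸ suc i)
      pointwise i i<q = ≡.trans (eq (γ (j ℕ.+ i)) (ρ (j ℕ.+ i)))
        (cong₂ ℤ._-_ (pos (j ℕ.+ i) (in-range i<q)) (cong +_ (≡.trans (cong (ℓ ℕ.∸_) (sym (ℕₚ.+-suc j i))) (sym (ℕₚ.∸-+-assoc ℓ j (suc i))))))
        where
          eq : ∀ a b → a ≡ a ℤ.+ b ℤ.- b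
          eq = ℤ-ring

  total-dot : ∀ Z γ → suc Z < ℓ → total (dot Z γ) ≡ total γ
  total-dot Z γ sZ<ℓ = begin
    sumTo ℓ (λ j → 1ℤ ℤ.* dot Z γ j) ≡⟨ sumTo-cong ℓ (λ j _ → eq (γ (transpose Z j)) (ind (suc Z) j) (ind Z j)) ⟩
    sumTo ℓ (λ j → 1ℤ ℤ.* γ (transpose Z j) ℤ.+ (1ℤ ℤ.* ind (suc Z) j ℤ.- 1ℤ ℤ.* ind Z j)) ≡⟨ sumTo-+ ℓ (λ j → 1ℤ ℤ.* γ (transpose Z j)) _ ⟩
    sumTo ℓ (λ j → 1ℤ ℤ.* γ (transpose Z j)) ℤ.+ sumTo ℓ (λ j → 1ℤ ℤ.* ind (suc Z) j ℤ.- 1ℤ ℤ.* ind Z j)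
      ≡⟨ cong₂ ℤ._+_ (sumTo-transpose ℓ Z (λ j → 1ℤ ℤ.* γ j) sZ<ℓ) (≡.trans (sumTo-- ℓ (λ j → 1ℤ ℤ.* ind (suc Z) j) (λ j → 1ℤ ℤ.* ind Z j))
           (cong₂ ℤ._-_ (sumTo-ind ℓ (λ _ → 1ℤ) sZ<ℓ) (sumTo-ind ℓ (λ _ → 1ℤ) (ℕₚ.<-trans (ℕₚ.n<1+n Z) sZ<ℓ)))) ⟩
    total γ ℤ.+ 0ℤ ≡⟨ ℤₚ.+-identityʳ _ ⟩
    total γ ∎
    where
      open ≡-Reasoning
      eq : ∀ a b c → 1ℤ ℤ.* (a ℤ.+ (b ℤ.- c)) ≡ 1ℤ ℤ.* a ℤ.+ (1ℤ ℤ.* b ℤ.- 1ℤ ℤ.* c)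
      eq = ℤ-ring

  dot-ρ : ∀ Z γ → suc Z < ℓ → dot Z γ ⊕ ρ ≈ (γ ⊕ ρ) ∘ transpose Z
  dot-ρ Z γ sZ<ℓ j j<ℓ with position Z j
  ... | fst rewrite dot-fst Z γ | transpose-fst Z | sym (ℕₚ.suc-pred (ℓ ℕ.∸ suc Z) {{ℕ.>-nonZero (ℕₚ.m<n⇒0<n∸m sZ<ℓ)}}) | ℕₚ.pred[m∸n]≡m∸[1+n] ℓ (suc Z) = eq (γ (suc Z)) (+ (ℓ ℕ.∸ suc (suc Z)))
    where
      eq : ∀ a b → a ℤ.- 1ℤ ℤ.+ (1ℤ ℤ.+ b) ≡ a ℤ.+ b
      eq = ℤ-ring
  ... | snd rewrite dot-snd Z γ | transpose-snd Z | sym (ℕₚ.suc-pred (ℓ ℕ.∸ suc Z) {{ℕ.>-nonZero (ℕₚ.m<n⇒0<n∸m sZ<ℓ)}}) | ℕₚ.pred[m∸n]≡m∸[1+n] ℓ (suc Z) = eq (γ Z) (+ (ℓ ℕ.∸ suc (suc Z)))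
    where
      eq : ∀ a b → a ℤ.+ 1ℤ ℤ.+ b ≡ a ℤ.+ (1ℤ ℤ.+ b)
      eq = ℤ-ring
  ... | else p q rewrite dot-else γ p q | transpose-else p q = refl

  ε-good : Good ε
  ε-good = record
    { congruent = λ e → cong₂ ifZero (pairing-cong (λ _ → 1ℤ) e) (sortSign-cong ℓ λ i i<ℓ → cong (ℤ._+ ρ i) (e i i<ℓ))
    ; supported = supported
    ; antisym = λ Z sZ<ℓ γ → ≡.trans (cong₂ ifZero (total-dot Z γ sZ<ℓ) (≡.trans (sortSign-cong ℓ (dot-ρ Z γ sZ<ℓ)) (sortSign-transpose ℓ Z (γ ⊕ ρ) sZ<ℓ)))
        (ifZero-neg (total γ) (sortSign ℓ (γ ⊕ ρ)))
    }
    where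
      supported : Supported ε
      supported γ j neg with sortSign-cases ℓ (γ ⊕ ρ)
      ... | inj₁ e = ≡.trans (cong (ifZero (total γ)) e) (ifZero-0 (total γ))
      ... | inj₂ (pos , dist) = ⊥-elim (ℤₚ.<⇒≱ neg (tail-bound γ j pos dist))

  ε-degree : ∀ {γ} → 0ℤ ℤ.< total γ → ε γ ≡ 0ℤ
  ε-degree {γ} p with total γ
  ε-degree {γ} (ℤ.+<+ ()) | + zero
  ... | + suc _ = refl

  ε-zero : ∀ {γ} → (∀ i → i < ℓ → γ i ≡ 0ℤ) → ε γ ≡ 1ℤ
  ε-zero {γ} z = cong₂ ifZero (≡.trans (sumTo-cong ℓ (λ i i<ℓ → cong (1ℤ ℤ.*_) (z i i<ℓ))) (sumTo-0 ℓ))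
      (≡.trans (sortSign-cong ℓ (λ i i<ℓ → ≡.trans (cong (ℤ._+ ρ i) (z i i<ℓ)) (ℤₚ.+-identityˡ (ρ i)))) (staircase ℓ))
    where
      prod-1 : ∀ m (h : ℕ → ℤ) → (∀ j → j < m → h j ≡ 1ℤ) → prodTo m h ≡ 1ℤ
      prod-1 zero h e = refl
      prod-1 (suc m) h e rewrite e 0 (s≤s z≤n) | prod-1 m (h ∘ suc) (λ j j<m → e (suc j) (s≤s j<m)) = refl
      sgn-pos : ∀ a b → b < a → sgn (+ a ℤ.- + b) ≡ 1ℤ
      sgn-pos a b b<a = ≡.trans (cong sgn (≡.trans (ℤₚ.[+m]-[+n]≡m⊖n a b) (ℤₚ.⊖-≥ (ℕₚ.<⇒≤ b<a)))) (positive (a ℕ.∸ b) (ℕₚ.m<n⇒0<n∸m b<a))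
        where
          positive : ∀ k → 0 < k → sgn (+ k) ≡ 1ℤ
          positive (suc k) _ = refl
      staircase : ∀ m → sortSign m (λ i → + (m ℕ.∸ suc i)) ≡ 1ℤ
      staircase zero = refl
      staircase (suc m) rewrite prod-1 m (λ j → sgn (+ m ℤ.- + (m ℕ.∸ suc j))) (λ j j<m → sgn-pos m (m ℕ.∸ suc j) (ℕₚ.∸-monoʳ-< (s≤s z≤n) j<m)) | staircase m = refl

-- Operators on functionals of cores

CoreFunctional : Set
CoreFunctional = List ℕ → ℕ → ℤ

record Core (K ℓ : ℕ) (κ : List ℕ) : Set where
  constructor core-data
  field
    part : T (isPartᵇ κ)
    core : T (isCoreᵇ K κ)
    length≤ : length κ ≤ ℓ

lower-length : ∀ κ τ → T (isPartᵇ τ) → (∀ i → get τ i ≤ get κ i) → length τ ≤ length κ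
lower-length κ τ part ⊆ with length τ ≤? length κ
... | yes p = p
... | no p = ⊥-elim (ℕₚ.<⇒≱ (part-pos τ part (ℕₚ.≰⇒> p)) (ℕₚ.≤-trans (⊆ (length κ)) (eq≤ (get-≥length κ ℕₚ.≤-refl))))

∑-+ : ∀ {A : Set} (xs : List A) (h k : A → ℤ) → ∑ xs (λ x → h x ℤ.+ k x) ≡ ∑ xs h ℤ.+ ∑ xs k
∑-+ [] h k = refl
∑-+ (x ∷ xs) h k rewrite ∑-+ xs h k = eq (h x) (k x) (∑ xs h) (∑ xs k)
  where
    eq : ∀ a b c d → a ℤ.+ b ℤ.+ (c ℤ.+ d) ≡ a ℤ.+ c ℤ.+ (b ℤ.+ d)
    eq = ℤ-ring

∑-neg : ∀ {A : Set} (xs : List A) (h : A → ℤ) → ∑ xs (λ x → ℤ.- h x) ≡ ℤ.- ∑ xs h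
∑-neg [] h = refl
∑-neg (x ∷ xs) h rewrite ∑-neg xs h = sym (ℤₚ.neg-distrib-+ (h x) (∑ xs h))

∑-0 : ∀ {A : Set} (xs : List A) → ∑ xs (λ _ → 0ℤ) ≡ 0ℤ
∑-0 [] = refl
∑-0 (x ∷ xs) = ≡.trans (ℤₚ.+-identityˡ _) (∑-0 xs)

alternate : ℕ → ℤ → ℤ
alternate zero x = x
alternate (suc i) x = ℤ.- alternate i x

alternate-0 : ∀ i → alternate i 0ℤ ≡ 0ℤ
alternate-0 zero = refl
alternate-0 (suc i) = cong ℤ.-_ (alternate-0 i)

alternate-+ : ∀ i x y → alternate i (x ℤ.+ y) ≡ alternate i x ℤ.+ alternate i y
alternate-+ zero x y = refl
alternate-+ (suc i) x y = ≡.trans (cong ℤ.-_ (alternate-+ i x y)) (ℤₚ.neg-distrib-+ (alternate i x) (alternate i y))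

module Operators (K ℓ : ℕ) where

  open Catalan ℓ
  open Straightening (suc K) ℓ
  open Lowering ℓ

  -- The mark is w + 1: w is its 0-indexed row.
  U : ℕ → CoreFunctional → CoreFunctional
  U w Λ κ d = ∑ (subs κ) λ τ → if markedCoverᵇ K τ (suc w) κ then (coverSpin τ (suc w) κ ▹ Λ τ) d else 0ℤ

  -- Chains of i covers whose marks increase strictly and are at most m.
  E : ℕ → ℕ → CoreFunctional → CoreFunctional
  E zero m Λ = Λ
  E (suc i) zero Λ κ d = 0ℤ
  E (suc i) (suc m) Λ κ d = E (suc i) m Λ κ d ℤ.+ U m (E i m Λ) κ d

  -- Chains of j covers whose marks decrease weakly and are among the last k of 1, …, ℓ.
  Hᶜ : ℕ → ℕ → CoreFunctional → CoreFunctional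
  Hᶜ zero k Λ = Λ
  Hᶜ (suc j) zero Λ κ d = 0ℤ
  Hᶜ (suc j) (suc k) Λ κ d = Hᶜ (suc j) k Λ κ d ℤ.+ U (ℓ ℕ.∸ suc k) (Hᶜ j (suc k) Λ) κ d

  if-map : ∀ {b} {x y : ℤ} → (T b → x ≡ y) → (if b then x else 0ℤ) ≡ (if b then y else 0ℤ)
  if-map {true} e = e _
  if-map {false} e = refl

  below-core : ∀ {κ τ w} → Core K ℓ κ → τ ∈ subs κ → T (markedCoverᵇ K τ w κ) → Core K ℓ τ
  below-core {κ} {τ} {w} (core-data part core len) τ∈ t = core-data (proj₁ τ⊆) (MarkedCover.lower-core (markedCover⁻ K τ w κ t))
      (ℕₚ.≤-trans (lower-length κ τ (proj₁ τ⊆) (proj₂ τ⊆)) len)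
    where τ⊆ = subs⁻ κ part τ∈

  U-cong : ∀ w {Λ M : CoreFunctional} → (∀ τ → Core K ℓ τ → ∀ d → Λ τ d ≡ M τ d) → ∀ κ → Core K ℓ κ → ∀ d → U w Λ κ d ≡ U w M κ d
  U-cong w e κ c d = ∑-cong (subs κ) λ {τ} τ∈ → if-map λ t → ▹-cong (coverSpin τ (suc w) κ) (e τ (below-core {w = suc w} c τ∈ t)) d

  U-cong-all : ∀ w {Λ M : CoreFunctional} → (∀ τ d → Λ τ d ≡ M τ d) → ∀ κ d → U w Λ κ d ≡ U w M κ d
  U-cong-all w e κ d = ∑-cong (subs κ) λ {τ} τ∈ → if-map λ t → ▹-cong (coverSpin τ (suc w) κ) (e τ) d

  if-+ : ∀ {b} {x y z : ℤ} → x ≡ y ℤ.+ z → (if b then x else 0ℤ) ≡ (if b then y else 0ℤ) ℤ.+ (if b then z else 0ℤ)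
  if-+ {true} e = e
  if-+ {false} e = refl

  if-neg : ∀ {b} {x y : ℤ} → x ≡ ℤ.- y → (if b then x else 0ℤ) ≡ ℤ.- (if b then y else 0ℤ)
  if-neg {true} e = e
  if-neg {false} e = refl

  U-+ : ∀ w (Λ M : CoreFunctional) κ d → U w (λ τ e → Λ τ e ℤ.+ M τ e) κ d ≡ U w Λ κ d ℤ.+ U w M κ d
  U-+ w Λ M κ d = ≡.trans (∑-cong (subs κ) λ {τ} _ → if-+ {markedCoverᵇ K τ (suc w) κ} (▹-+ (coverSpin τ (suc w) κ) (Λ τ) (M τ) d)) (∑-+ (subs κ) _ _)

  U-neg : ∀ w (Λ : CoreFunctional) κ d → U w (λ τ e → ℤ.- Λ τ e) κ d ≡ ℤ.- U w Λ κ d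
  U-neg w Λ κ d = ≡.trans (∑-cong (subs κ) λ {τ} _ → if-neg {markedCoverᵇ K τ (suc w) κ} (▹-neg (coverSpin τ (suc w) κ) (Λ τ) d)) (∑-neg (subs κ) _)

  U-alternate : ∀ w i (Λ : CoreFunctional) κ d → U w (λ τ e → alternate i (Λ τ e)) κ d ≡ alternate i (U w Λ κ d)
  U-alternate w zero Λ κ d = refl
  U-alternate w (suc i) Λ κ d = ≡.trans (U-neg w (λ τ e → alternate i (Λ τ e)) κ d) (cong ℤ.-_ (U-alternate w i Λ κ d))

  -- alternating k j i is the sum over a + b = i + j, a ≥ i, of (−1)^a Hᶜ_b E_a, with the marks of Hᶜ among the last k.
  alternating : ℕ → ℕ → ℕ → CoreFunctional → CoreFunctional
  alternating k zero i Λ κ d = alternate i (Hᶜ zero k (E i ℓ Λ) κ d)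
  alternating k (suc j) i Λ κ d = alternate i (Hᶜ (suc j) k (E i ℓ Λ) κ d) ℤ.+ alternating k j (suc i) Λ κ d

  alternating-suc : ∀ k j i Λ κ d → alternating (suc k) (suc j) i Λ κ d ≡
    alternating k (suc j) i Λ κ d ℤ.+ U (ℓ ℕ.∸ suc k) (alternating (suc k) j i Λ) κ d
  alternating-suc k j i Λ κ d = ≡.trans (cong₂ ℤ._+_ (alternate-+ i (Hᶜ (suc j) k X κ d) (U m (Hᶜ j (suc k) X) κ d)) refl) (step j)
    where
      X = E i ℓ Λ
      m = ℓ ℕ.∸ suc k
      shuffle : ∀ a b c e → a ℤ.+ b ℤ.+ (c ℤ.+ e) ≡ a ℤ.+ c ℤ.+ (b ℤ.+ e)
      shuffle = ℤ-ring
      swap-last : ∀ a b c → a ℤ.+ b ℤ.+ c ≡ a ℤ.+ c ℤ.+ b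
      swap-last = ℤ-ring
      step : ∀ j → alternate i (Hᶜ (suc j) k X κ d) ℤ.+ alternate i (U m (Hᶜ j (suc k) X) κ d) ℤ.+ alternating (suc k) j (suc i) Λ κ d ≡
        alternating k (suc j) i Λ κ d ℤ.+ U m (alternating (suc k) j i Λ) κ d
      step zero = ≡.trans (swap-last (alternate i (Hᶜ 1 k X κ d)) (alternate i (U m X κ d)) (alternating k zero (suc i) Λ κ d))
        (cong (λ a → alternate i (Hᶜ 1 k X κ d) ℤ.+ alternating k zero (suc i) Λ κ d ℤ.+ a) (sym (U-alternate m i X κ d)))
      step (suc j) = ≡.trans (cong (λ a → A ℤ.+ B ℤ.+ a) (alternating-suc k j (suc i) Λ κ d))
        (≡.trans (shuffle A B (alternating k (suc j) (suc i) Λ κ d) (U m (alternating (suc k) j (suc i) Λ) κ d))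
          (cong (λ a → A ℤ.+ alternating k (suc j) (suc i) Λ κ d ℤ.+ a) (sym (≡.trans (U-+ m (λ τ e → alternate i (Hᶜ (suc j) (suc k) X τ e)) (alternating (suc k) j (suc i) Λ) κ d)
            (cong (ℤ._+ U m (alternating (suc k) j (suc i) Λ) κ d) (U-alternate m i (Hᶜ (suc j) (suc k) X) κ d))))))
        where
          A = alternate i (Hᶜ (suc (suc j)) k X κ d)
          B = alternate i (U m (Hᶜ (suc j) (suc k) X) κ d)

  alternating-zero : ∀ j i Λ κ d → alternating 0 j i Λ κ d ≡ alternate (i ℕ.+ j) (E (i ℕ.+ j) ℓ Λ κ d)
  alternating-zero zero i Λ κ d rewrite ℕₚ.+-identityʳ i = refl
  alternating-zero (suc j) i Λ κ d rewrite ℕₚ.+-suc i j =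
    ≡.trans (cong (ℤ._+ alternating 0 j (suc i) Λ κ d) (alternate-0 i)) (≡.trans (ℤₚ.+-identityˡ _) (alternating-zero j (suc i) Λ κ d))

  -- With generating functions E = (1 + U_{ℓ−1}) ⋯ (1 + U_0) and H = (1 − U_0)⁻¹ ⋯ (1 − U_{ℓ−1})⁻¹, the product telescopes.
  alternating-telescope : ∀ k j Λ κ d → k ≤ ℓ → alternating k j 0 Λ κ d ≡ alternate j (E j (ℓ ℕ.∸ k) Λ κ d)
  alternating-telescope zero j Λ κ d _ = alternating-zero j 0 Λ κ d
  alternating-telescope (suc k) zero Λ κ d _ = refl
  alternating-telescope (suc k) (suc j) Λ κ d k<ℓ = begin
    alternating (suc k) (suc j) 0 Λ κ d ≡⟨ alternating-suc k j 0 Λ κ d ⟩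
    alternating k (suc j) 0 Λ κ d ℤ.+ U m (alternating (suc k) j 0 Λ) κ d
      ≡⟨ cong₂ ℤ._+_ (alternating-telescope k (suc j) Λ κ d (ℕₚ.<⇒≤ k<ℓ))
           (≡.trans (U-cong-all m (λ τ e → alternating-telescope (suc k) j Λ τ e k<ℓ) κ d) (U-alternate m j (E j m Λ) κ d)) ⟩
    ℤ.- alternate j (E (suc j) (ℓ ℕ.∸ k) Λ κ d) ℤ.+ alternate j (U m (E j m Λ) κ d)
      ≡⟨ cong (λ a → ℤ.- alternate j (E (suc j) a Λ κ d) ℤ.+ alternate j (U m (E j m Λ) κ d)) sm ⟩
    ℤ.- alternate j (E (suc j) m Λ κ d ℤ.+ U m (E j m Λ) κ d) ℤ.+ alternate j (U m (E j m Λ) κ d)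
      ≡⟨ cong (λ a → ℤ.- a ℤ.+ alternate j (U m (E j m Λ) κ d)) (alternate-+ j (E (suc j) m Λ κ d) (U m (E j m Λ) κ d)) ⟩
    ℤ.- (alternate j (E (suc j) m Λ κ d) ℤ.+ alternate j (U m (E j m Λ) κ d)) ℤ.+ alternate j (U m (E j m Λ) κ d)
      ≡⟨ cancel (alternate j (E (suc j) m Λ κ d)) (alternate j (U m (E j m Λ) κ d)) ⟩
    ℤ.- alternate j (E (suc j) m Λ κ d) ∎
    where
      open ≡-Reasoning
      m = ℓ ℕ.∸ suc k
      sm : ℓ ℕ.∸ k ≡ suc m
      sm = ℕₚ.+-cancelʳ-≡ k _ _ (≡.trans (ℕₚ.m∸n+n≡m (ℕₚ.<⇒≤ k<ℓ)) (sym (≡.trans (sym (ℕₚ.+-suc m k)) (ℕₚ.m∸n+n≡m k<ℓ))))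
      cancel : ∀ a b → ℤ.- (a ℤ.+ b) ℤ.+ b ≡ ℤ.- a
      cancel = ℤ-ring

  -- For k = ℓ the telescoped sum is `E` with no mark allowed, hence 0. Isolating its term without
  -- `E` expresses `Hᶜ` through shorter `Hᶜ` composed with `E`, whose action on functionals is
  -- already known.
  Hᶜ-by-E : ∀ j Λ κ d → Hᶜ (suc j) ℓ Λ κ d ≡ ℤ.- alternating ℓ j 1 Λ κ d
  Hᶜ-by-E j Λ κ d = ≡.trans (eq (Hᶜ (suc j) ℓ Λ κ d) (alternating ℓ j 1 Λ κ d)) (≡.trans (cong (ℤ._- alternating ℓ j 1 Λ κ d) vanish) (ℤₚ.+-identityˡ _))
    where
      vanish : Hᶜ (suc j) ℓ Λ κ d ℤ.+ alternating ℓ j 1 Λ κ d ≡ 0ℤ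
      vanish = ≡.trans (alternating-telescope ℓ (suc j) Λ κ d ℕₚ.≤-refl)
        (≡.trans (cong (λ m → alternate (suc j) (E (suc j) m Λ κ d)) (ℕₚ.n∸n≡0 ℓ)) (alternate-0 (suc j)))
      eq : ∀ a b → a ≡ a ℤ.+ b ℤ.- b
      eq = ℤ-ring

  S-+ : ∀ φ ψ s d → S (λ γ → φ γ ℤ.+ ψ γ) s d ≡ S φ s d ℤ.+ S ψ s d
  S-+ φ ψ s = H-+ φ ψ (Δ s) (wt s)

  S-neg : ∀ φ s d → S (λ γ → ℤ.- φ γ) s d ≡ ℤ.- S φ s d
  S-neg φ s = H-neg φ (Δ s) (wt s)

  S-alternate : ∀ i φ s d → S (λ γ → alternate i (φ γ)) s d ≡ alternate i (S φ s d)
  S-alternate zero φ s d = refl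
  S-alternate (suc i) φ s d = ≡.trans (S-neg (λ γ → alternate i (φ γ)) s d) (cong ℤ.-_ (S-alternate i φ s d))

  -- The bridge between the two sides: `Λ` is built from chains of covers, `φ` from operations on
  -- weights, and they agree when `φ` is applied to the Catalan function of each core.
  Represents : Functional → CoreFunctional → Set
  Represents φ Λ = ∀ κ → Core K ℓ κ → ∀ d → Λ κ d ≡ S φ (down K κ) d

  U-represents : ∀ {ψ Λ} → Congruent ψ → Supported ψ → ∀ w → (∀ Z → suc Z ≢ w → Antisym ψ Z) → w < ℓ → Represents ψ Λ →
    ∀ κ → Core K ℓ κ → ∀ d → U w Λ κ d ≡ H ψ (Δ (down K κ)) (wt (down K κ) ⊖ ind w) d
  U-represents {ψ} {Λ} cψ sψ w aψ w<ℓ rep κ c@(core-data part core len) d =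
    ≡.trans (U-cong w rep κ c d) (sym (MarkOperator.mark-operator K ℓ κ part core len cψ sψ w aψ w<ℓ d))

  -- Increasing marks put the largest mark on the outermost cover, so `U m` meets the functional
  -- `lower i m φ`. That functional can fail to be antisymmetric only at the transposition of m - 1
  -- and m, just where `U-represents` asks for nothing.
  E-represents : ∀ {φ Λ} → Good φ → Represents φ Λ → ∀ i m → m ≤ ℓ → Represents (lower i m φ) (E i m Λ)
  E-represents g rep zero m _ = rep
  E-represents g rep (suc i) zero _ κ c d = sym (H-0 (Δ (down K κ)) (wt (down K κ)) d)
  E-represents {φ} g rep (suc i) (suc m) m<ℓ κ c d = ≡.trans
    (cong₂ ℤ._+_ (E-represents g rep (suc i) m (ℕₚ.<⇒≤ m<ℓ) κ c d)
      (U-represents (lower-congruent G.congruent i m) (lower-supported G.supported i m (ℕₚ.<⇒≤ m<ℓ)) m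
        (λ Z ne → lower-antisym G.congruent Z (G.antisym Z) i m ne) m<ℓ (E-represents g rep i m (ℕₚ.<⇒≤ m<ℓ)) κ c d))
    (sym (≡.trans (H-+ (lower (suc i) m φ) (λ γ → lower i m φ (γ ⊖ ind m)) (Δ (down K κ)) (wt (down K κ)) d)
      (cong (λ a → S (lower (suc i) m φ) (down K κ) d ℤ.+ a) (H-translate (lower-congruent G.congruent i m) (ind m) (Δ (down K κ)) (wt (down K κ)) d))))
    where module G = Good g

-- Complete symmetric functions by recursion through the elementary ones

module Complete (ℓ : ℕ) where

  open Catalan ℓ
  open Lowering ℓ

  -- One functional φ′ has to serve every K at once. If it were allowed to depend on K, levels k and
  -- k + 1 could not be compared in the end.
  Transform : (∀ K → CoreFunctional → CoreFunctional) → Functional → Set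
  Transform X φ = Σ Functional λ φ′ → Good φ′ × (∀ K Λ → Operators.Represents K ℓ φ Λ → Operators.Represents K ℓ φ′ (X K Λ))

  complete-transform : ∀ j {φ} → Good φ → Transform (λ K → Operators.Hᶜ K ℓ j ℓ) φ
  alternating-transform : ∀ j i {φ} → Good φ → Transform (λ K → Operators.alternating K ℓ ℓ j i) φ

  alternate-good : ∀ i {φ} → Good φ → Good (λ γ → alternate i (φ γ))
  alternate-good zero g = g
  alternate-good (suc i) g = neg-good (alternate-good i g)

  complete-transform zero {φ} g = φ , g , λ K Λ rep → rep
  complete-transform (suc j) {φ} g = finish (alternating-transform j 1 g)
    where
      finish : Transform (λ K → Operators.alternating K ℓ ℓ j 1) φ → Transform (λ K → Operators.Hᶜ K ℓ (suc j) ℓ) φ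
      finish (φ′ , g′ , r) = (λ γ → ℤ.- φ′ γ) , neg-good g′ , λ K Λ rep κ c d →
        ≡.trans (Operators.Hᶜ-by-E K ℓ j Λ κ d) (≡.trans (cong ℤ.-_ (r K Λ rep κ c d)) (sym (Operators.S-neg K ℓ φ′ (down K κ) d)))

  alternating-transform j i {φ} g = finish j (complete-transform j (lower-good g i))
    where
      finish : ∀ j → Transform (λ K → Operators.Hᶜ K ℓ j ℓ) (lower i ℓ φ) → Transform (λ K → Operators.alternating K ℓ ℓ j i) φ
      finish zero (φ₁ , g₁ , r₁) = (λ γ → alternate i (φ₁ γ)) , alternate-good i g₁ , λ K Λ rep κ c d →
        ≡.trans (cong (alternate i) (r₁ K (Operators.E K ℓ i ℓ Λ) (Operators.E-represents K ℓ g rep i ℓ ℕₚ.≤-refl) κ c d)) (sym (Operators.S-alternate K ℓ i φ₁ (down K κ) d))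
      finish (suc j) (φ₁ , g₁ , r₁) = add (alternating-transform j (suc i) g)
        where
          add : Transform (λ K → Operators.alternating K ℓ ℓ j (suc i)) φ → Transform (λ K → Operators.alternating K ℓ ℓ (suc j) i) φ
          add (φ₂ , g₂ , r₂) = (λ γ → alternate i (φ₁ γ) ℤ.+ φ₂ γ) , +-good (alternate-good i g₁) g₂ , λ K Λ rep κ c d →
            ≡.trans (cong₂ ℤ._+_
                (≡.trans (cong (alternate i) (r₁ K (Operators.E K ℓ i ℓ Λ) (Operators.E-represents K ℓ g rep i ℓ ℕₚ.≤-refl) κ c d)) (sym (Operators.S-alternate K ℓ i φ₁ (down K κ) d)))
                (r₂ K Λ rep κ c d))
              (sym (Operators.S-+ K ℓ (λ γ → alternate i (φ₁ γ)) φ₂ (down K κ) d))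

-- Strong marked tableaux

∑-++ : ∀ {A : Set} (xs ys : List A) (h : A → ℤ) → ∑ (xs ++ ys) h ≡ ∑ xs h ℤ.+ ∑ ys h
∑-++ [] ys h = sym (ℤₚ.+-identityˡ _)
∑-++ (x ∷ xs) ys h = ≡.trans (cong (λ a → h x ℤ.+ a) (∑-++ xs ys h)) (sym (ℤₚ.+-assoc (h x) (∑ xs h) (∑ ys h)))

∑-concatMap : ∀ {A B : Set} (k : A → List B) xs (h : B → ℤ) → ∑ (concatMap k xs) h ≡ ∑ xs (λ x → ∑ (k x) h)
∑-concatMap k [] h = refl
∑-concatMap k (x ∷ xs) h = ≡.trans (∑-++ (k x) (concatMap k xs) h) (cong (λ a → ∑ (k x) h ℤ.+ a) (∑-concatMap k xs h))

∑-map : ∀ {A B : Set} (k : A → B) xs (h : B → ℤ) → ∑ (map k xs) h ≡ ∑ xs (h ∘ k)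
∑-map k [] h = refl
∑-map k (x ∷ xs) h = cong (λ a → h (k x) ℤ.+ a) (∑-map k xs h)

∑-swap : ∀ {A B : Set} (xs : List A) (ys : List B) (h : A → B → ℤ) → ∑ xs (λ x → ∑ ys (h x)) ≡ ∑ ys (λ y → ∑ xs (λ x → h x y))
∑-swap [] ys h = sym (∑-0 ys)
∑-swap (x ∷ xs) ys h = ≡.trans (cong (λ a → ∑ ys (h x) ℤ.+ a) (∑-swap xs ys h)) (sym (∑-+ ys (h x) (λ y → ∑ xs (λ x → h x y))))

∑-applyUpTo : ∀ (k : ℕ → ℕ) m (h : ℕ → ℤ) → ∑ (applyUpTo k m) h ≡ sumTo m (h ∘ k)
∑-applyUpTo k zero h = refl
∑-applyUpTo k (suc m) h = ≡.trans (cong (λ a → h (k 0) ℤ.+ a) (∑-applyUpTo (k ∘ suc) m h)) (sym (sumTo-front m (h ∘ k)))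

▹-∑ : ∀ {A : Set} c (xs : List A) (h : A → ℕ → ℤ) d → (c ▹ λ e → ∑ xs (λ x → h x e)) d ≡ ∑ xs (λ x → (c ▹ h x) d)
▹-∑ c [] h d = ▹-zero c d
▹-∑ c (x ∷ xs) h d = ≡.trans (▹-+ c (h x) _ d) (cong (λ a → (c ▹ h x) d ℤ.+ a) (▹-∑ c xs h d))

▹-if : ∀ c b (f : ℕ → ℤ) d → (c ▹ λ e → if b then f e else 0ℤ) d ≡ (if b then (c ▹ f) d else 0ℤ)
▹-if c true f d = refl
▹-if c false f d = ▹-zero c d

▹-∸ : ∀ c (f : ℕ → ℤ) d → (c ▹ f) d ≡ (if c ℕ.≤ᵇ d then f (d ℕ.∸ c) else 0ℤ)
▹-∸ zero f d = refl
▹-∸ (suc c) f zero = refl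
▹-∸ (suc c) f (suc d) = ≡.trans (▹-∸ c f d) (shift c)
  where
    shift : ∀ c → (if c ℕ.≤ᵇ d then f (d ℕ.∸ c) else 0ℤ) ≡ (if suc c ℕ.≤ᵇ suc d then f (d ℕ.∸ c) else 0ℤ)
    shift zero = refl
    shift (suc c) = refl

sumTo-extend : ∀ m k (h : ℕ → ℤ) → m ≤ k → (∀ r → m ≤ r → h r ≡ 0ℤ) → sumTo m h ≡ sumTo k h
sumTo-extend m zero h z≤n z = refl
sumTo-extend m (suc k) h m≤ z with ℕₚ.m≤n⇒m<n∨m≡n m≤
... | inj₂ refl = refl
... | inj₁ m<sk = ≡.trans (sumTo-extend m k h (ℕₚ.≤-pred m<sk) z) (sym (≡.trans (cong (λ a → sumTo k h ℤ.+ a) (z k (ℕₚ.≤-pred m<sk))) (ℤₚ.+-identityʳ _)))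

+-length-filterᵇ : ∀ {A : Set} (p : A → Bool) xs → + length (filterᵇ p xs) ≡ ∑ xs (λ x → if p x then 1ℤ else 0ℤ)
+-length-filterᵇ p [] = refl
+-length-filterᵇ p (x ∷ xs) with p x
... | true = cong (λ a → 1ℤ ℤ.+ a) (+-length-filterᵇ p xs)
... | false = ≡.trans (+-length-filterᵇ p xs) (sym (ℤₚ.+-identityˡ _))

+-sum-map : ∀ {A : Set} (h : A → ℕ) xs → + sum (map h xs) ≡ ∑ xs (λ x → + h x)
+-sum-map h [] = refl
+-sum-map h (x ∷ xs) = cong (λ a → + h x ℤ.+ a) (+-sum-map h xs)

take-++ˡ : ∀ {A : Set} m (xs ys : List A) → m ≤ length xs → take m (xs ++ ys) ≡ take m xs
take-++ˡ zero xs ys _ = refl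
take-++ˡ (suc m) (x ∷ xs) ys (s≤s p) = cong (x ∷_) (take-++ˡ m xs ys p)

drop-++ˡ : ∀ {A : Set} m (xs ys : List A) → m ≤ length xs → drop m (xs ++ ys) ≡ drop m xs ++ ys
drop-++ˡ zero xs ys _ = refl
drop-++ˡ (suc m) (x ∷ xs) ys (s≤s p) = drop-++ˡ m xs ys p

strictInc-snoc : ∀ ms a b → strictIncᵇ ((ms ++ a ∷ []) ++ b ∷ []) ≡ strictIncᵇ (ms ++ a ∷ []) ∧ (a ℕ.<ᵇ b)
strictInc-snoc [] a b = ∧-identityʳ (a ℕ.<ᵇ b)
strictInc-snoc (x ∷ []) a b = ≡.trans (cong ((x ℕ.<ᵇ a) ∧_) (∧-identityʳ (a ℕ.<ᵇ b))) (cong (_∧ (a ℕ.<ᵇ b)) (sym (∧-identityʳ (x ℕ.<ᵇ a))))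
strictInc-snoc (x ∷ y ∷ ms) a b = ≡.trans (cong ((x ℕ.<ᵇ y) ∧_) (strictInc-snoc (y ∷ ms) a b)) (sym (∧-assoc (x ℕ.<ᵇ y) _ (a ℕ.<ᵇ b)))

weakDec-snoc : ∀ ms a b → weakDecᵇ ((ms ++ a ∷ []) ++ b ∷ []) ≡ weakDecᵇ (ms ++ a ∷ []) ∧ (b ℕ.≤ᵇ a)
weakDec-snoc [] a b = ∧-identityʳ (b ℕ.≤ᵇ a)
weakDec-snoc (x ∷ []) a b = ≡.trans (cong ((a ℕ.≤ᵇ x) ∧_) (∧-identityʳ (b ℕ.≤ᵇ a))) (cong (_∧ (b ℕ.≤ᵇ a)) (sym (∧-identityʳ (a ℕ.≤ᵇ x))))
weakDec-snoc (x ∷ y ∷ ms) a b = ≡.trans (cong ((y ℕ.≤ᵇ x) ∧_) (weakDec-snoc (y ∷ ms) a b)) (sym (∧-assoc (y ℕ.≤ᵇ x) _ (b ℕ.≤ᵇ a)))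

lastShape : List ℕ → List (ℕ × List ℕ) → List ℕ
lastShape τ [] = τ
lastShape τ ((r , σ) ∷ st) = lastShape σ st

chainSpin-snoc : ∀ τ st r κ → chainSpin τ (st ++ (r , κ) ∷ []) ≡ chainSpin τ st ℕ.+ coverSpin (lastShape τ st) r κ
chainSpin-snoc τ [] r κ = ℕₚ.+-identityʳ _
chainSpin-snoc τ ((s , σ) ∷ st) r κ = ≡.trans (cong (coverSpin τ s σ ℕ.+_) (chainSpin-snoc σ st r κ)) (sym (ℕₚ.+-assoc (coverSpin τ s σ) _ _))

validChain-snoc : ∀ K τ st r κ → validChainᵇ K τ (st ++ (r , κ) ∷ []) ≡ validChainᵇ K τ st ∧ markedCoverᵇ K (lastShape τ st) r κ
validChain-snoc K τ [] r κ = ∧-identityʳ _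
validChain-snoc K τ ((s , σ) ∷ st) r κ = ≡.trans (cong (markedCoverᵇ K τ s σ ∧_) (validChain-snoc K σ st r κ)) (sym (∧-assoc (markedCoverᵇ K τ s σ) _ _))

snoc : ℕ → List ℕ → Tab → Tab
snoc r κ C = proj₁ C , proj₂ C ++ (r , κ) ∷ []

marks-snoc : ∀ r κ C → marks (snoc r κ C) ≡ marks C ++ r ∷ []
marks-snoc r κ C = Listₚ.map-++ proj₁ (proj₂ C) ((r , κ) ∷ [])

chainsEnd-suc⁻ : ∀ κ m {C} → C ∈ chainsEnd κ (suc m) →
  ∃ λ τ → ∃ λ r → ∃ λ C′ → τ ∈ subs κ × C′ ∈ chainsEnd τ m × C ≡ snoc (suc r) κ C′
chainsEnd-suc⁻ κ m {C} C∈ = τ , r , C′ , proj₁ (proj₂ a) , proj₁ (proj₂ c) , proj₂ (proj₂ c)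
  where
    step : List ℕ → ℕ → List Tab
    step τ r = map (λ C → (proj₁ C , proj₂ C ++ ((suc r , κ) ∷ []))) (chainsEnd τ m)
    a = find (∈-concatMap⁻ (λ τ → concatMap (step τ) (upTo (length κ))) {xs = subs κ} C∈)
    τ = proj₁ a
    b = find (∈-concatMap⁻ (step τ) {xs = upTo (length κ)} (proj₂ (proj₂ a)))
    r = proj₁ b
    c = ∈-map⁻ (λ C → (proj₁ C , proj₂ C ++ ((suc r , κ) ∷ []))) (proj₂ (proj₂ b))
    C′ = proj₁ c

lastShape-snoc : ∀ τ st r κ → lastShape τ (st ++ (r , κ) ∷ []) ≡ κ
lastShape-snoc τ [] r κ = refl
lastShape-snoc τ ((s , σ) ∷ st) r κ = lastShape-snoc σ st r κ

chainsEnd-last : ∀ κ m {C} → C ∈ chainsEnd κ m → lastShape (proj₁ C) (proj₂ C) ≡ κ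
chainsEnd-last κ zero (here refl) = refl
chainsEnd-last κ (suc m) C∈ with chainsEnd-suc⁻ κ m C∈
... | τ , r , C′ , _ , _ , refl = lastShape-snoc (proj₁ C′) (proj₂ C′) (suc r) κ

chainsEnd-length : ∀ κ m {C} → C ∈ chainsEnd κ m → length (proj₂ C) ≡ m
chainsEnd-length κ zero (here refl) = refl
chainsEnd-length κ (suc m) C∈ with chainsEnd-suc⁻ κ m C∈
... | τ , r , C′ , _ , C′∈ , refl = ≡.trans (Listₚ.length-++ (proj₂ C′)) (≡.trans (ℕₚ.+-comm _ 1) (cong suc (chainsEnd-length τ m C′∈)))

module Chains (K ℓ : ℕ) where

  open Operators K ℓ

  valid : Tab → Bool
  valid C = validChainᵇ K (proj₁ C) (proj₂ C)

  chainsEnd-core : ∀ κ m {C} → Core K ℓ κ → C ∈ chainsEnd κ m → T (valid C) → Core K ℓ (proj₁ C) × size (pOf K (proj₁ C)) ℕ.+ m ≡ size (pOf K κ)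
  chainsEnd-core κ zero c (here refl) _ = c , ℕₚ.+-identityʳ _
  chainsEnd-core κ (suc m) c C∈ v with chainsEnd-suc⁻ κ m C∈
  ... | τ , r , C′ , τ∈ , C′∈ , refl = proj₁ rec , ≡.trans (ℕₚ.+-suc _ m) (≡.trans (cong suc (proj₂ rec)) (MarkedCover.size-step (markedCover⁻ K τ (suc r) κ marked)))
    where
      both = ∧⁻ {valid C′} (subst T (validChain-snoc K (proj₁ C′) (proj₂ C′) (suc r) κ) v)
      marked : T (markedCoverᵇ K τ (suc r) κ)
      marked = subst (λ σ → T (markedCoverᵇ K σ (suc r) κ)) (chainsEnd-last τ m C′∈) (proj₂ both)
      rec = chainsEnd-core τ m (below-core {w = suc r} c τ∈ marked) C′∈ (proj₁ both)

  chainSum : ℕ → List ℕ → (List ℕ → Bool) → CoreFunctional → ℕ → ℤ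
  chainSum m κ P Λ d = ∑ (chainsEnd κ m) λ C → if valid C ∧ P (marks C) then (spin C ▹ Λ (proj₁ C)) d else 0ℤ

  chainSum-cong : ∀ m κ {P Q : List ℕ → Bool} {Λ M : CoreFunctional} → Core K ℓ κ →
    (∀ ms → length ms ≡ m → P ms ≡ Q ms) → (∀ τ → Core K ℓ τ → size (pOf K τ) ℕ.+ m ≡ size (pOf K κ) → ∀ d → Λ τ d ≡ M τ d) →
    ∀ d → chainSum m κ P Λ d ≡ chainSum m κ Q M d
  chainSum-cong m κ {P} {Q} {Λ} {M} c e f d = ∑-cong (chainsEnd κ m) λ {C} C∈ →
    ≡.trans (cong (λ b → if valid C ∧ b then (spin C ▹ Λ (proj₁ C)) d else 0ℤ) (e (marks C) (≡.trans (Listₚ.length-map proj₁ (proj₂ C)) (chainsEnd-length κ m C∈))))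
      (if-map λ t → ▹-cong (spin C) (f (proj₁ C) (proj₁ (facts C∈ t)) (proj₂ (facts C∈ t))) d)
    where
      facts : ∀ {C} → C ∈ chainsEnd κ m → T (valid C ∧ Q (marks C)) → Core K ℓ (proj₁ C) × size (pOf K (proj₁ C)) ℕ.+ m ≡ size (pOf K κ)
      facts {C} C∈ t = chainsEnd-core κ m c C∈ (proj₁ (∧⁻ {valid C} t))

  chainSum-zero : ∀ m κ (P : List ℕ → Bool) (Λ : CoreFunctional) d → (∀ ms → P ms ≡ false) → chainSum m κ P Λ d ≡ 0ℤ
  chainSum-zero m κ P Λ d e = ≡.trans (∑-cong (chainsEnd κ m) (λ {C} _ → if-false {b = valid C ∧ P (marks C)} λ t →
    subst T (e (marks C)) (proj₂ (∧⁻ {valid C} t)))) (∑-0 (chainsEnd κ m))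

  chainSum-step : ∀ m κ P Λ d → chainSum (suc m) κ P Λ d ≡ ∑ (upTo (length κ)) (λ r → U r (λ τ → chainSum m τ (λ ms → P (ms ++ suc r ∷ [])) Λ) κ d)
  chainSum-step m κ P Λ d = begin
      chainSum (suc m) κ P Λ d ≡⟨ ∑-concatMap _ (subs κ) h ⟩
      ∑ (subs κ) (λ τ → ∑ (concatMap (λ r → map (snoc (suc r) κ) (chainsEnd τ m)) (upTo (length κ))) h)
        ≡⟨ ∑-cong (subs κ) (λ {τ} _ → ≡.trans (∑-concatMap _ (upTo (length κ)) h) (∑-cong (upTo (length κ)) (λ {r} _ → ≡.trans (∑-map _ (chainsEnd τ m) h) (inner τ r)))) ⟩
      ∑ (subs κ) (λ τ → ∑ (upTo (length κ)) (λ r → if markedCoverᵇ K τ (suc r) κ then (coverSpin τ (suc r) κ ▹ chainSum m τ (λ ms → P (ms ++ suc r ∷ [])) Λ) d else 0ℤ))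
        ≡⟨ ∑-swap (subs κ) (upTo (length κ)) _ ⟩
      ∑ (upTo (length κ)) (λ r → U r (λ τ → chainSum m τ (λ ms → P (ms ++ suc r ∷ [])) Λ) κ d) ∎
    where
      open ≡-Reasoning
      h : Tab → ℤ
      h C = if valid C ∧ P (marks C) then (spin C ▹ Λ (proj₁ C)) d else 0ℤ
      regroup : ∀ v b p (x : ℤ) → (if (v ∧ b) ∧ p then x else 0ℤ) ≡ (if b then (if v ∧ p then x else 0ℤ) else 0ℤ)
      regroup true true p x = refl
      regroup true false p x = refl
      regroup false true p x = refl
      regroup false false p x = refl
      inner : ∀ τ r → ∑ (chainsEnd τ m) (h ∘ snoc (suc r) κ) ≡ (if markedCoverᵇ K τ (suc r) κ then (coverSpin τ (suc r) κ ▹ chainSum m τ (λ ms → P (ms ++ suc r ∷ [])) Λ) d else 0ℤ)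
      inner τ r = ≡.trans (∑-cong (chainsEnd τ m) (λ {C} C∈ → term C C∈)) (pull (markedCoverᵇ K τ (suc r) κ))
        where
          c = coverSpin τ (suc r) κ
          Q : List ℕ → Bool
          Q ms = P (ms ++ suc r ∷ [])
          k : Tab → ℤ
          k C = if valid C ∧ Q (marks C) then ((spin C ℕ.+ c) ▹ Λ (proj₁ C)) d else 0ℤ
          term : ∀ C → C ∈ chainsEnd τ m → h (snoc (suc r) κ C) ≡ (if markedCoverᵇ K τ (suc r) κ then k C else 0ℤ)
          term C C∈ rewrite validChain-snoc K (proj₁ C) (proj₂ C) (suc r) κ | chainSpin-snoc (proj₁ C) (proj₂ C) (suc r) κ
            | chainsEnd-last τ m C∈ | marks-snoc (suc r) κ C = regroup (valid C) (markedCoverᵇ K τ (suc r) κ) (Q (marks C)) (((spin C ℕ.+ c) ▹ Λ (proj₁ C)) d)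
          pull : ∀ b → ∑ (chainsEnd τ m) (λ C → if b then k C else 0ℤ) ≡ (if b then (c ▹ chainSum m τ Q Λ) d else 0ℤ)
          pull false = ∑-0 (chainsEnd τ m)
          pull true = sym (≡.trans (▹-∑ c (chainsEnd τ m) (λ C e → if valid C ∧ Q (marks C) then (spin C ▹ Λ (proj₁ C)) e else 0ℤ) d)
            (∑-cong (chainsEnd τ m) λ {C} _ → ≡.trans (▹-if c (valid C ∧ Q (marks C)) (spin C ▹ Λ (proj₁ C)) d)
              (cong (λ a → if valid C ∧ Q (marks C) then a else 0ℤ) (≡.trans (▹-▹ c (spin C) (Λ (proj₁ C)) d) (cong (λ s → (s ▹ Λ (proj₁ C)) d) (ℕₚ.+-comm c (spin C)))))))

  -- The lowest ribbon of a cover starts in a nonempty row of κ, and this row is on the orbit of the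
  -- marked row, hence not above it. So the range of marks can be extended from the length of κ to
  -- ℓ, uniformly in the core.
  U-outside : ∀ {w} Λ κ → Core K ℓ κ → length κ ≤ w → ∀ d → U w Λ κ d ≡ 0ℤ
  U-outside {w} Λ κ (core-data part core len) len≤w d = ≡.trans (∑-cong (subs κ) (λ {τ} τ∈ → if-false (unmarked τ∈))) (∑-0 (subs κ))
    where
      module M = MarkOperator K ℓ κ part core len
      module S′ = Shape (core-shape K ℓ κ part core len)
      unmarked : ∀ {τ} → τ ∈ subs κ → ¬ T (markedCoverᵇ K τ (suc w) κ)
      unmarked {τ} τ∈ t = absurd (M.higher w τ) (proj₁ mp) (proj₂ (proj₂ mp))
        where
          mp = M.marked-path τ∈ t
          absurd : ∀ e (C : CoreCovers.Cover K ℓ κ part core len) → iter (down K κ) e w ≡ CoreCovers.Cover.bottom C → ⊥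
          absurd e C q = ℕₚ.<⇒≱ (CoreCovers.Cover.positive C) (eq≤ (get-≥length κ (ℕₚ.≤-trans len≤w
            (subst (w ≤_) q (Ladders.iter-≤ (down K κ) S′.d-mono S′.d> e w)))))

  chainSum-suc : ∀ m κ P Λ d → Core K ℓ κ →
    chainSum (suc m) κ P Λ d ≡ sumTo ℓ (λ r → U r (λ τ → chainSum m τ (λ ms → P (ms ++ suc r ∷ [])) Λ) κ d)
  chainSum-suc m κ P Λ d c = ≡.trans (chainSum-step m κ P Λ d) (≡.trans (∑-applyUpTo id (length κ) _)
    (sumTo-extend (length κ) ℓ _ (Core.length≤ c) λ r len≤r → U-outside _ κ c len≤r d))

pOf-positive : ∀ K ℓ κ → Core K ℓ κ → ∀ {r} → r < length κ → 0 < get (pOf K κ) r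
pOf-positive K ℓ κ (core-data part core len) {r} r<len = ℕₚ.n≢0⇒n>0 λ e →
    ℕₚ.<⇒≢ (Shape.d-positive S (part-pos κ part r<len)) (≡.trans (cong (ℕ._+ down K κ r) (sym e))
      (≡.trans (bead-sum (part-decreasing κ part) (core-bead K κ part core r)) (ℕₚ.+-comm (suc K) r)))
  where S = core-shape K ℓ κ part core len

size-0⇒[] : ∀ K ℓ κ → Core K ℓ κ → size (pOf K κ) ≡ 0 → κ ≡ []
size-0⇒[] K ℓ [] c e = refl
size-0⇒[] K ℓ κ@(x ∷ xs) c e = ⊥-elim (ℕₚ.<⇒≢ (ℕₚ.<-≤-trans (pOf-positive K ℓ κ c {0} (s≤s z≤n)) (head≤sum (pOf K κ))) (sym e))
  where
    head≤sum : ∀ ys → get ys 0 ≤ sum ys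
    head≤sum [] = z≤n
    head≤sum (y ∷ ys) = ℕₚ.m≤m+n y (sum ys)

-- The core counterpart of `ε`: it picks out the chains that start in the empty core.
unit : CoreFunctional
unit [] zero = 1ℤ
unit [] (suc d) = 0ℤ
unit (x ∷ κ) d = 0ℤ

▹-unit : ∀ c d → (c ▹ unit []) d ≡ (if c ℕ.≡ᵇ d then 1ℤ else 0ℤ)
▹-unit zero zero = refl
▹-unit zero (suc d) = refl
▹-unit (suc c) zero = refl
▹-unit (suc c) (suc d) = ▹-unit c d

module _ (K ℓ : ℕ) where

  open Catalan ℓ
  open Straightening (suc K) ℓ
  open BaseFunctional ℓ
  open Lowering ℓ
  open Operators K ℓ
  open Chains K ℓ

  total-wt : ∀ κ → Core K ℓ κ → total (wt (down K κ)) ≡ + size (pOf K κ)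
  total-wt κ (core-data part core len) = ≡.trans (sumTo-cong ℓ (λ r _ → ℤₚ.*-identityˡ (wt (down K κ) r)))
    (≡.trans (sumTo-- ℓ (λ r → + (suc K ℕ.+ r)) (λ r → + down K κ r)) (sym (sumTo-wt-pOf K ℓ κ part core len)))

  -- For the empty core the weight is zero and any raising makes a tail sum negative. For any other
  -- core the weight has positive total, which raising preserves, while `ε` lives in total 0.
  unit-represents : Represents ε unit
  unit-represents [] c zero = sym (≡.trans (H-constant (Δ (down K [])) (wt (down K [])))
      (ε-zero λ r _ → ℤₚ.+-inverseʳ (+ (suc K ℕ.+ r))))
    where
      H-constant : ∀ Ψ γ → H ε Ψ γ 0 ≡ ε γ
      H-constant [] γ = refl
      H-constant (β ∷ Ψ) γ = H-constant Ψ γ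
  unit-represents [] c (suc d) = sym (no-roots (Δ (down K [])) increasing d)
    where
      γ = wt (down K [])
      increasing : ∀ {β} → β ∈ Δ (down K []) → proj₁ β < proj₂ β × proj₂ β < ℓ
      increasing {i , j} m = ℕₚ.<-≤-trans (s≤s (ℕₚ.m≤n+m i K)) (proj₂ (proj₂ m′)) , proj₁ (proj₂ m′)
        where m′ = ∈Δ⁻ (down K []) m
      zero-pairing : ∀ j → pairing (atLeast j) γ ≡ 0ℤ
      zero-pairing j = ≡.trans (sumTo-cong ℓ (λ r _ → ≡.trans (cong (atLeast j r ℤ.*_) (ℤₚ.+-inverseʳ (+ (suc K ℕ.+ r)))) (ℤₚ.*-zeroʳ (atLeast j r)))) (sumTo-0 ℓ)
      negative : ∀ {a b} → a < b → b < ℓ → pairing (atLeast b) (γ ⊕ root (a , b)) ℤ.< 0ℤ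
      negative {a} {b} a<b b<ℓ = subst (ℤ._< 0ℤ) (sym (≡.trans (pairing-root (atLeast b) γ (ℕₚ.<-trans a<b b<ℓ) b<ℓ)
        (cong₂ ℤ._+_ (zero-pairing b) (cong₂ ℤ._-_ (atLeast-> a<b) (atLeast-≤ (ℕₚ.≤-refl {b})))))) ℤ.-<+
      no-roots : ∀ Ψ → (∀ {β} → β ∈ Ψ → proj₁ β < proj₂ β × proj₂ β < ℓ) → ∀ d → H ε Ψ γ (suc d) ≡ 0ℤ
      no-roots [] inc d = refl
      no-roots (β ∷ Ψ) inc d = cong₂ ℤ._+_ (no-roots Ψ (inc ∘ there) d)
        (H-supported (Good.congruent ε-good) (Good.supported ε-good) (β ∷ Ψ) inc (γ ⊕ root β) (proj₂ β) (negative (proj₁ (inc (here refl))) (proj₂ (inc (here refl)))) d)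
  unit-represents κ@(x ∷ xs) c d = sym (H-vanish (Good.congruent ε-good) (λ γ → 0ℤ ℤ.< total γ) ε-degree (Δ (down K κ)) step (wt (down K κ)) positive d)
    where
      step : ∀ {β} → β ∈ Δ (down K κ) → ∀ {γ} → 0ℤ ℤ.< total γ → 0ℤ ℤ.< total (γ ⊕ root β)
      step {a , b} m {γ} p = subst (0ℤ ℤ.<_) (sym (≡.trans (pairing-root (λ _ → 1ℤ) γ (proj₁ m′) (proj₁ (proj₂ m′))) (ℤₚ.+-identityʳ _))) p
        where m′ = ∈Δ⁻ (down K κ) m
      positive : 0ℤ ℤ.< total (wt (down K κ))
      positive = subst (0ℤ ℤ.<_) (sym (total-wt κ c)) (ℤ.+<+ (ℕₚ.n≢0⇒n>0 λ e → case size-0⇒[] K ℓ κ c e of λ ()))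

  E-sum : ∀ i m Λ κ d → E (suc i) m Λ κ d ≡ sumTo m (λ r → U r (E i r Λ) κ d)
  E-sum i zero Λ κ d = refl
  E-sum i (suc m) Λ κ d = cong (ℤ._+ U m (E i m Λ) κ d) (E-sum i m Λ κ d)

  U-zero : ∀ w {Λ} κ d → (∀ τ d → Λ τ d ≡ 0ℤ) → U w Λ κ d ≡ 0ℤ
  U-zero w {Λ} κ d e = ≡.trans (∑-cong (subs κ) (λ {τ} _ → pointwise (markedCoverᵇ K τ (suc w) κ) (≡.trans (▹-cong (coverSpin τ (suc w) κ) (e τ) d) (▹-zero (coverSpin τ (suc w) κ) d)))) (∑-0 (subs κ))
    where
      pointwise : ∀ b {x : ℤ} → x ≡ 0ℤ → (if b then x else 0ℤ) ≡ 0ℤ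
      pointwise true e = e
      pointwise false e = refl

  chainSum-0 : ∀ κ P Λ d → T (P []) → chainSum 0 κ P Λ d ≡ Λ κ d
  chainSum-0 κ P Λ d t with P []
  ... | true = ℤₚ.+-identityʳ _

  -- The extra mark b + 1 at the end encodes the upper bound on the marks, and peeling off the
  -- outermost cover reproduces a condition of the same form with the mark of that cover as the new
  -- bound.
  strict-chains-below : ∀ m b Λ → b ≤ ℓ → ∀ κ → Core K ℓ κ → ∀ d → chainSum m κ (λ ms → strictIncᵇ (ms ++ suc b ∷ [])) Λ d ≡ E m b Λ κ d
  strict-chains-below zero b Λ b≤ℓ κ c d = chainSum-0 κ (λ ms → strictIncᵇ (ms ++ suc b ∷ [])) Λ d _
  strict-chains-below (suc m) b Λ b≤ℓ κ c d = begin
    chainSum (suc m) κ (λ ms → strictIncᵇ (ms ++ suc b ∷ [])) Λ d ≡⟨ chainSum-suc m κ (λ ms → strictIncᵇ (ms ++ suc b ∷ [])) Λ d c ⟩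
    sumTo ℓ g ≡⟨ sym (sumTo-extend b ℓ g b≤ℓ λ r b≤r → U-zero r κ d λ τ e → chainSum-zero m τ _ Λ e λ ms →
                   ≡.trans (strictInc-snoc ms (suc r) (suc b)) (≡.trans (cong (strictIncᵇ (ms ++ suc r ∷ []) ∧_) (¬T⇒≡false λ t → ℕₚ.<⇒≱ (ℕₚ.<ᵇ⇒< r b t) b≤r)) (∧-zeroʳ _))) ⟩
    sumTo b g ≡⟨ sumTo-cong b (λ r r<b → U-cong r (λ τ cτ e → ≡.trans (chainSum-cong m τ cτ (λ ms _ →
                   ≡.trans (strictInc-snoc ms (suc r) (suc b)) (≡.trans (cong (strictIncᵇ (ms ++ suc r ∷ []) ∧_) (T⇒≡true (ℕₚ.<⇒<ᵇ r<b))) (∧-identityʳ _))) (λ _ _ _ _ → refl) e)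
                   (strict-chains-below m r Λ (ℕₚ.<⇒≤ (ℕₚ.<-≤-trans r<b b≤ℓ)) τ cτ e)) κ c d) ⟩
    sumTo b (λ r → U r (E m r Λ) κ d) ≡⟨ sym (E-sum m b Λ κ d) ⟩
    E (suc m) b Λ κ d ∎
    where
      open ≡-Reasoning
      g : ℕ → ℤ
      g r = U r (λ τ → chainSum m τ (λ ms → strictIncᵇ ((ms ++ suc r ∷ []) ++ suc b ∷ [])) Λ) κ d

  strict-chains : ∀ m Λ κ → Core K ℓ κ → ∀ d → chainSum m κ strictIncᵇ Λ d ≡ E m ℓ Λ κ d
  strict-chains zero Λ κ c d = chainSum-0 κ strictIncᵇ Λ d _
  strict-chains (suc m) Λ κ c d = ≡.trans (chainSum-suc m κ strictIncᵇ Λ d c)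
    (≡.trans (sumTo-cong ℓ (λ r r<ℓ → U-cong r (strict-chains-below m r Λ (ℕₚ.<⇒≤ r<ℓ)) κ c d)) (sym (E-sum m ℓ Λ κ d)))

  atLeast-∸suc : ∀ k r → suc k ≤ ℓ → atLeast (ℓ ℕ.∸ suc k) r ≡ atLeast (ℓ ℕ.∸ k) r ℤ.+ ind (ℓ ℕ.∸ suc k) r
  atLeast-∸suc k r k<ℓ = subst (λ a → atLeast m r ≡ atLeast a r ℤ.+ ind m r) (sym sm) (split (ℕₚ.<-cmp r m))
    where
      m = ℓ ℕ.∸ suc k
      sm : ℓ ℕ.∸ k ≡ suc m
      sm = ℕₚ.+-cancelʳ-≡ k _ _ (≡.trans (ℕₚ.m∸n+n≡m (ℕₚ.<⇒≤ k<ℓ)) (sym (≡.trans (sym (ℕₚ.+-suc m k)) (ℕₚ.m∸n+n≡m k<ℓ))))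
      split : Tri (r < m) (r ≡ m) (m < r) → atLeast m r ≡ atLeast (suc m) r ℤ.+ ind m r
      split (tri< r<m r≢m _) rewrite atLeast-> r<m | atLeast-> (ℕₚ.m<n⇒m<1+n r<m) | ind-diff {m} {r} (r≢m ∘ sym) = refl
      split (tri≈ _ refl _) rewrite atLeast-≤ (ℕₚ.≤-refl {r}) | atLeast-> (ℕₚ.n<1+n r) | ind-same r = refl
      split (tri> _ r≢m m<r) rewrite atLeast-≤ (ℕₚ.<⇒≤ m<r) | atLeast-≤ m<r | ind-diff {m} {r} (r≢m ∘ sym) = refl

  -- The factor `atLeast` cuts the sum down to r ≥ ℓ - k while its range stays ℓ, so that it matches
  -- `chainSum-suc` term by term.
  Hᶜ-sum : ∀ j k Λ κ d → k ≤ ℓ → Hᶜ (suc j) k Λ κ d ≡ sumTo ℓ (λ r → U r (Hᶜ j (ℓ ℕ.∸ r) Λ) κ d ℤ.* atLeast (ℓ ℕ.∸ k) r)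
  Hᶜ-sum j zero Λ κ d _ = sym (≡.trans (sumTo-cong ℓ (λ r r<ℓ → ≡.trans (cong (U r (Hᶜ j (ℓ ℕ.∸ r) Λ) κ d ℤ.*_) (atLeast-> r<ℓ)) (ℤₚ.*-zeroʳ (U r (Hᶜ j (ℓ ℕ.∸ r) Λ) κ d)))) (sumTo-0 ℓ))
  Hᶜ-sum j (suc k) Λ κ d k<ℓ = sym (begin
    sumTo ℓ (λ r → g r ℤ.* atLeast m r) ≡⟨ sumTo-cong ℓ (λ r _ → ≡.trans (cong (g r ℤ.*_) (atLeast-∸suc k r k<ℓ)) (ℤₚ.*-distribˡ-+ (g r) (atLeast (ℓ ℕ.∸ k) r) (ind m r))) ⟩
    sumTo ℓ (λ r → g r ℤ.* atLeast (ℓ ℕ.∸ k) r ℤ.+ g r ℤ.* ind m r) ≡⟨ sumTo-+ ℓ (λ r → g r ℤ.* atLeast (ℓ ℕ.∸ k) r) (λ r → g r ℤ.* ind m r) ⟩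
    sumTo ℓ (λ r → g r ℤ.* atLeast (ℓ ℕ.∸ k) r) ℤ.+ sumTo ℓ (λ r → g r ℤ.* ind m r)
      ≡⟨ cong₂ ℤ._+_ (sym (Hᶜ-sum j k Λ κ d (ℕₚ.<⇒≤ k<ℓ))) (sumTo-ind ℓ g (ℕₚ.∸-monoʳ-< {ℓ} (s≤s z≤n) k<ℓ)) ⟩
    Hᶜ (suc j) k Λ κ d ℤ.+ U m (Hᶜ j (ℓ ℕ.∸ m) Λ) κ d ≡⟨ cong (λ a → Hᶜ (suc j) k Λ κ d ℤ.+ U m (Hᶜ j a Λ) κ d) (ℕₚ.m∸[m∸n]≡n k<ℓ) ⟩
    Hᶜ (suc j) k Λ κ d ℤ.+ U m (Hᶜ j (suc k) Λ) κ d ∎)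
    where
      open ≡-Reasoning
      m = ℓ ℕ.∸ suc k
      g : ℕ → ℤ
      g r = U r (Hᶜ j (ℓ ℕ.∸ r) Λ) κ d

  weak-chains-above : ∀ m b Λ → b ≤ ℓ → ∀ κ → Core K ℓ κ → ∀ d → chainSum m κ (λ ms → weakDecᵇ (ms ++ suc b ∷ [])) Λ d ≡ Hᶜ m (ℓ ℕ.∸ b) Λ κ d
  weak-chains-above zero b Λ b≤ℓ κ c d = chainSum-0 κ (λ ms → weakDecᵇ (ms ++ suc b ∷ [])) Λ d _
  weak-chains-above (suc m) b Λ b≤ℓ κ c d = ≡.trans (chainSum-suc m κ (λ ms → weakDecᵇ (ms ++ suc b ∷ [])) Λ d c)
    (≡.trans (sumTo-cong ℓ (λ r r<ℓ → term r r<ℓ (b ≤? r)))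
      (sym (Hᶜ-sum m (ℓ ℕ.∸ b) Λ κ d (ℕₚ.m∸n≤m ℓ b))))
    where
      b≡ : ℓ ℕ.∸ (ℓ ℕ.∸ b) ≡ b
      b≡ = ℕₚ.m∸[m∸n]≡n b≤ℓ
      term : ∀ r → r < ℓ → Dec (b ≤ r) → U r (λ τ → chainSum m τ (λ ms → weakDecᵇ ((ms ++ suc r ∷ []) ++ suc b ∷ [])) Λ) κ d
        ≡ U r (Hᶜ m (ℓ ℕ.∸ r) Λ) κ d ℤ.* atLeast (ℓ ℕ.∸ (ℓ ℕ.∸ b)) r
      term r r<ℓ (yes b≤r) = ≡.trans (U-cong r (λ τ cτ e → ≡.trans (chainSum-cong m τ cτ (λ ms _ →
          ≡.trans (weakDec-snoc ms (suc r) (suc b)) (≡.trans (cong (weakDecᵇ (ms ++ suc r ∷ []) ∧_) (T⇒≡true (ℕₚ.≤⇒≤ᵇ (s≤s b≤r)))) (∧-identityʳ _))) (λ _ _ _ _ → refl) e)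
          (weak-chains-above m r Λ (ℕₚ.<⇒≤ r<ℓ) τ cτ e)) κ c d)
        (sym (≡.trans (cong (U r (Hᶜ m (ℓ ℕ.∸ r) Λ) κ d ℤ.*_) (≡.trans (cong (λ a → atLeast a r) b≡) (atLeast-≤ b≤r))) (ℤₚ.*-identityʳ _)))
      term r r<ℓ (no b≰r) = ≡.trans (U-zero r κ d λ τ e → chainSum-zero m τ _ Λ e λ ms →
          ≡.trans (weakDec-snoc ms (suc r) (suc b)) (≡.trans (cong (weakDecᵇ (ms ++ suc r ∷ []) ∧_) (¬T⇒≡false λ t → b≰r (ℕₚ.≤-pred (ℕₚ.≤ᵇ⇒≤ (suc b) (suc r) t)))) (∧-zeroʳ _)))
        (sym (≡.trans (cong (U r (Hᶜ m (ℓ ℕ.∸ r) Λ) κ d ℤ.*_) (≡.trans (cong (λ a → atLeast a r) b≡) (atLeast-> (ℕₚ.≰⇒> b≰r)))) (ℤₚ.*-zeroʳ (U r (Hᶜ m (ℓ ℕ.∸ r) Λ) κ d))))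

  weak-chains : ∀ m Λ κ → Core K ℓ κ → ∀ d → chainSum m κ weakDecᵇ Λ d ≡ Hᶜ m ℓ Λ κ d
  weak-chains zero Λ κ c d = chainSum-0 κ weakDecᵇ Λ d _
  weak-chains (suc m) Λ κ c d = ≡.trans (chainSum-suc m κ weakDecᵇ Λ d c)
    (≡.trans (sumTo-cong ℓ (λ r r<ℓ → ≡.trans (U-cong r (weak-chains-above m r Λ (ℕₚ.<⇒≤ r<ℓ)) κ c d)
        (sym (≡.trans (cong (U r (Hᶜ m (ℓ ℕ.∸ r) Λ) κ d ℤ.*_) (≡.trans (cong (λ a → atLeast a r) (ℕₚ.n∸n≡0 ℓ)) (atLeast-≤ (z≤n {r})))) (ℤₚ.*-identityʳ _)))))
      (sym (Hᶜ-sum m ℓ Λ κ d ℕₚ.≤-refl)))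

  chainSum-split : ∀ m₁ m₂ κ (P P₁ P₂ : List ℕ → Bool) Λ → Core K ℓ κ → (∀ ms → length ms ≡ m₁ ℕ.+ m₂ → P ms ≡ P₁ (take m₁ ms) ∧ P₂ (drop m₁ ms)) →
    ∀ d → chainSum (m₁ ℕ.+ m₂) κ P Λ d ≡ chainSum m₂ κ P₂ (λ τ → chainSum m₁ τ P₁ Λ) d
  chainSum-split m₁ zero κ P P₁ P₂ Λ c e d rewrite ℕₚ.+-identityʳ m₁ =
      ≡.trans (chainSum-cong m₁ κ c (λ ms len → ≡.trans (e ms len) (cong₂ (λ a b → P₁ a ∧ P₂ b) (Listₚ.take-all m₁ ms (eq≤ len)) (Listₚ.drop-all m₁ ms (eq≤ len)))) (λ _ _ _ _ → refl) d)
        (by-case (P₂ []) refl)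
    where
      by-case : ∀ b → P₂ [] ≡ b → chainSum m₁ κ (λ ms → P₁ ms ∧ P₂ []) Λ d ≡ chainSum 0 κ P₂ (λ τ → chainSum m₁ τ P₁ Λ) d
      by-case true q = ≡.trans (chainSum-cong m₁ κ {Q = P₁} c (λ ms _ → ≡.trans (cong (P₁ ms ∧_) q) (∧-identityʳ _)) (λ _ _ _ _ → refl) d)
        (sym (chainSum-0 κ P₂ (λ τ → chainSum m₁ τ P₁ Λ) d (subst T (sym q) _)))
      by-case false q = ≡.trans (chainSum-zero m₁ κ _ Λ d λ ms → ≡.trans (cong (P₁ ms ∧_) q) (∧-zeroʳ _)) (sym (zero-case q))
        where
          zero-case : P₂ [] ≡ false → chainSum 0 κ P₂ (λ τ → chainSum m₁ τ P₁ Λ) d ≡ 0ℤ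
          zero-case q rewrite q = refl
  chainSum-split m₁ (suc m₂) κ P P₁ P₂ Λ c e d rewrite ℕₚ.+-suc m₁ m₂ = ≡.trans (chainSum-suc (m₁ ℕ.+ m₂) κ P Λ d c)
    (≡.trans (sumTo-cong ℓ (λ r _ → U-cong r (λ τ cτ → chainSum-split m₁ m₂ τ _ P₁ (λ ms → P₂ (ms ++ suc r ∷ [])) Λ cτ (split r)) κ c d))
      (sym (chainSum-suc m₂ κ P₂ (λ τ → chainSum m₁ τ P₁ Λ) d c)))
    where
      split : ∀ r ms → length ms ≡ m₁ ℕ.+ m₂ → P (ms ++ suc r ∷ []) ≡ P₁ (take m₁ ms) ∧ P₂ (drop m₁ ms ++ suc r ∷ [])
      split r ms len = ≡.trans (e (ms ++ suc r ∷ []) (≡.trans (Listₚ.length-++ ms) (≡.trans (ℕₚ.+-comm (length ms) 1) (cong suc len))))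
          (cong₂ (λ a b → P₁ a ∧ P₂ b) (take-++ˡ m₁ ms _ m₁≤) (drop-++ˡ m₁ ms _ m₁≤))
        where
          m₁≤ : m₁ ≤ length ms
          m₁≤ = subst (m₁ ≤_) (sym len) (ℕₚ.m≤m+n m₁ m₂)

  -- The coefficient functional of x^η: the first block of marks is the innermost one.
  word : List ℕ → CoreFunctional → CoreFunctional
  word [] Λ = Λ
  word (e ∷ η) Λ = word η (Hᶜ e ℓ Λ)

  word-chains : ∀ η Λ κ → Core K ℓ κ → ∀ d → chainSum (sum η) κ (λ ms → all weakDecᵇ (blocks η ms)) Λ d ≡ word η Λ κ d
  word-chains [] Λ κ c d = chainSum-0 κ (λ ms → all weakDecᵇ (blocks [] ms)) Λ d _
  word-chains (e ∷ η) Λ κ c d = ≡.trans (chainSum-split e (sum η) κ (λ ms → all weakDecᵇ (blocks (e ∷ η) ms)) weakDecᵇ (λ ms → all weakDecᵇ (blocks η ms)) Λ c (λ _ _ → refl) d)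
    (≡.trans (chainSum-cong (sum η) κ {P = λ ms → all weakDecᵇ (blocks η ms)} c (λ _ _ → refl) (λ τ cτ _ → weak-chains e Λ τ cτ) d) (word-chains η (Hᶜ e ℓ Λ) κ c d))

  kSchur-word : ∀ η κ → Core K ℓ κ → sum η ≡ size (pOf K κ) → ∀ d → + kSchurCoeff K κ η d ≡ word η unit κ d
  kSchur-word η κ c e d = begin
      + kSchurCoeff K κ η d ≡⟨ cong +_ (if-true (ℕₚ.≡⇒≡ᵇ (sum η) (size (pOf K κ)) e)) ⟩
      + smtCount K η κ d ≡⟨ +-length-filterᵇ _ (chainsEnd κ (sum η)) ⟩
      ∑ (chainsEnd κ (sum η)) (λ C → if isSMTᵇ K η C ∧ (spin C ℕ.≡ᵇ d) then 1ℤ else 0ℤ)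
        ≡⟨ ∑-cong (chainsEnd κ (sum η)) (λ {C} C∈ → pointwise C C∈ (valid C) refl) ⟩
      chainSum (sum η) κ (λ ms → all weakDecᵇ (blocks η ms)) unit d ≡⟨ word-chains η unit κ c d ⟩
      word η unit κ d ∎
    where
      open ≡-Reasoning
      B : Tab → Bool
      B C = all weakDecᵇ (blocks η (marks C))
      pointwise : ∀ C → C ∈ chainsEnd κ (sum η) → ∀ v → valid C ≡ v →
        (if isSMTᵇ K η C ∧ (spin C ℕ.≡ᵇ d) then 1ℤ else 0ℤ) ≡ (if valid C ∧ B C then (spin C ▹ unit (proj₁ C)) d else 0ℤ)
      pointwise C C∈ false q = ≡.trans (if-false {b = isSMTᵇ K η C ∧ (spin C ℕ.≡ᵇ d)} λ t →
          subst T q (proj₁ (∧⁻ {valid C} (proj₂ (∧⁻ {isCoreᵇ K (proj₁ C)} (proj₁ (∧⁻ {isSMTᵇ K η C} t)))))))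
        (sym (if-false {b = valid C ∧ B C} λ t → subst T q (proj₁ (∧⁻ {valid C} t))))
      pointwise C C∈ true q = ≡.trans (cong (λ b → if b ∧ (spin C ℕ.≡ᵇ d) then 1ℤ else 0ℤ) smt≡)
          (≡.trans (nested (B C) (spin C ℕ.≡ᵇ d)) (≡.trans (cong (λ x → if B C then x else 0ℤ) (sym value))
            (cong (λ v → if v ∧ B C then (spin C ▹ unit (proj₁ C)) d else 0ℤ) (sym q))))
        where
          facts = chainsEnd-core κ (sum η) c C∈ (subst T (sym q) _)
          -- Each cover raises the size by one and the chain has |η| = |𝔭(κ)| covers, so nothing is
          -- left for its first core.
          start≡[] : proj₁ C ≡ []
          start≡[] = size-0⇒[] K ℓ (proj₁ C) (proj₁ facts) (ℕₚ.+-cancelʳ-≡ (sum η) _ 0 (≡.trans (proj₂ facts) (sym e)))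
          smt≡ : isSMTᵇ K η C ≡ B C
          smt≡ = ≡.trans (cong (_∧ (valid C ∧ ((length (proj₂ C) ℕ.≡ᵇ sum η) ∧ B C))) (T⇒≡true (Core.core (proj₁ facts))))
            (≡.trans (cong (_∧ ((length (proj₂ C) ℕ.≡ᵇ sum η) ∧ B C)) q) (cong (_∧ B C) (T⇒≡true (ℕₚ.≡⇒≡ᵇ _ (sum η) (chainsEnd-length κ (sum η) C∈)))))
          value : (spin C ▹ unit (proj₁ C)) d ≡ (if spin C ℕ.≡ᵇ d then 1ℤ else 0ℤ)
          value = ≡.trans (cong (λ τ → (spin C ▹ unit τ) d) start≡[]) (▹-unit (spin C) d)
          nested : ∀ a b → (if a ∧ b then 1ℤ else 0ℤ) ≡ (if a then (if b then 1ℤ else 0ℤ) else 0ℤ)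
          nested true b = refl
          nested false b = refl

  kSchur-wrong-degree : ∀ η κ → sum η ≢ size (pOf K κ) → ∀ d → kSchurCoeff K κ η d ≡ 0
  kSchur-wrong-degree η κ ne d = if-false λ t → ne (ℕₚ.≡ᵇ⇒≡ (sum η) (size (pOf K κ)) t)

  rhs-chains : ∀ η κ → Core K ℓ κ → ∀ d → + rhsCoeff K ℓ κ η d ≡ chainSum ℓ κ strictIncᵇ (λ τ e → + kSchurCoeff K τ η e) d
  rhs-chains η κ c d = begin
      + rhsCoeff K ℓ κ η d ≡⟨ +-sum-map _ (vsmtList K (ℓ ∷ []) κ) ⟩
      ∑ (vsmtList K (ℓ ∷ []) κ) g ≡⟨ ∑-filterᵇ (isVSMTᵇ K (ℓ ∷ [])) (chainsEnd κ (ℓ ℕ.+ 0)) g ⟩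
      ∑ (chainsEnd κ (ℓ ℕ.+ 0)) (λ C → if isVSMTᵇ K (ℓ ∷ []) C then g C else 0ℤ)
        ≡⟨ cong (λ m → ∑ (chainsEnd κ m) (λ C → if isVSMTᵇ K (ℓ ∷ []) C then g C else 0ℤ)) (ℕₚ.+-identityʳ ℓ) ⟩
      ∑ (chainsEnd κ ℓ) (λ C → if isVSMTᵇ K (ℓ ∷ []) C then g C else 0ℤ) ≡⟨ ∑-cong (chainsEnd κ ℓ) (λ {C} C∈ → pointwise C C∈ (valid C) refl) ⟩
      chainSum ℓ κ strictIncᵇ (λ τ e → + kSchurCoeff K τ η e) d ∎
    where
      open ≡-Reasoning
      g : Tab → ℤ
      g C = + (if spin C ℕ.≤ᵇ d then kSchurCoeff K (proj₁ C) η (d ℕ.∸ spin C) else 0)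
      push : ∀ b x → + (if b then x else 0) ≡ (if b then + x else 0ℤ)
      push true x = refl
      push false x = refl
      pointwise : ∀ C → C ∈ chainsEnd κ ℓ → ∀ v → valid C ≡ v →
        (if isVSMTᵇ K (ℓ ∷ []) C then g C else 0ℤ) ≡ (if valid C ∧ strictIncᵇ (marks C) then (spin C ▹ λ e → + kSchurCoeff K (proj₁ C) η e) d else 0ℤ)
      pointwise C C∈ false q = ≡.trans (if-false {b = isVSMTᵇ K (ℓ ∷ []) C} λ t →
          subst T q (proj₁ (∧⁻ {valid C} (proj₂ (∧⁻ {isCoreᵇ K (proj₁ C)} t)))))
        (sym (if-false {b = valid C ∧ strictIncᵇ (marks C)} λ t → subst T q (proj₁ (∧⁻ {valid C} t))))
      pointwise C C∈ true q = ≡.trans (cong (λ b → if b then g C else 0ℤ) vsmt≡)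
          (≡.trans (cong (λ x → if strictIncᵇ (marks C) then x else 0ℤ) (≡.trans (push (spin C ℕ.≤ᵇ d) _) (sym (▹-∸ (spin C) (λ e → + kSchurCoeff K (proj₁ C) η e) d))))
            (cong (λ v → if v ∧ strictIncᵇ (marks C) then (spin C ▹ λ e → + kSchurCoeff K (proj₁ C) η e) d else 0ℤ) (sym q)))
        where
          len : length (marks C) ≡ ℓ
          len = ≡.trans (Listₚ.length-map proj₁ (proj₂ C)) (chainsEnd-length κ ℓ C∈)
          vsmt≡ : isVSMTᵇ K (ℓ ∷ []) C ≡ strictIncᵇ (marks C)
          vsmt≡ = ≡.trans (cong (_∧ (valid C ∧ ((length (proj₂ C) ℕ.≡ᵇ (ℓ ℕ.+ 0)) ∧ (strictIncᵇ (take ℓ (marks C)) ∧ true)))) (T⇒≡true (Core.core (proj₁ (chainsEnd-core κ ℓ c C∈ (subst T (sym q) _))))))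
            (≡.trans (cong (_∧ ((length (proj₂ C) ℕ.≡ᵇ (ℓ ℕ.+ 0)) ∧ (strictIncᵇ (take ℓ (marks C)) ∧ true))) q)
              (≡.trans (cong (_∧ (strictIncᵇ (take ℓ (marks C)) ∧ true)) (T⇒≡true (ℕₚ.≡⇒≡ᵇ _ (ℓ ℕ.+ 0) (≡.trans (chainsEnd-length κ ℓ C∈) (sym (ℕₚ.+-identityʳ ℓ))))))
                (≡.trans (∧-identityʳ _) (cong strictIncᵇ (Listₚ.take-all ℓ (marks C) (eq≤ len))))))

word-transform : ∀ ℓ η {φ} → Lowering.Good ℓ φ → Complete.Transform ℓ (λ K → word K ℓ η) φ
word-transform ℓ [] {φ} g = φ , g , λ K Λ rep → rep
word-transform ℓ (e ∷ η) g = conclude (Complete.complete-transform ℓ e g)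
  where
    conclude : Complete.Transform ℓ (λ K → Operators.Hᶜ K ℓ e ℓ) _ → Complete.Transform ℓ (λ K → word K ℓ (e ∷ η)) _
    conclude (φ₁ , g₁ , r₁) = finish (word-transform ℓ η g₁)
      where
        finish : Complete.Transform ℓ (λ K → word K ℓ η) φ₁ → Complete.Transform ℓ (λ K → word K ℓ (e ∷ η)) _
        finish (φ₂ , g₂ , r₂) = φ₂ , g₂ , λ K Λ rep → r₂ K (Operators.Hᶜ K ℓ e ℓ Λ) (r₁ K Λ rep)

-- Passing from level k to level k + 1

length-by-pOf : ∀ K ℓ κ xs → T (isPartᵇ κ) → T (isCoreᵇ K κ) → pOf K κ ≈ₚ xs → length xs ≤ ℓ → length κ ≤ ℓ
length-by-pOf K ℓ κ xs part core e len≤ℓ with length κ ≤? ℓ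
... | yes p = p
... | no p = ⊥-elim (ℕₚ.<⇒≢ (pOf-positive K (length κ) κ (core-data part core ℕₚ.≤-refl) (ℕₚ.≰⇒> p)) (sym (≡.trans (e ℓ) (get-≥length xs len≤ℓ))))

get-zipWith-suc : ∀ {ℓ} (μ : Vec ℕ ℓ) r → r < ℓ → get (toList (zipWith ℕ._+_ μ (replicate ℓ 1))) r ≡ suc (get (toList μ) r)
get-zipWith-suc (x ∷ μ) zero _ = ℕₚ.+-comm x 1
get-zipWith-suc (x ∷ μ) (suc r) (s≤s p) = get-zipWith-suc μ r p

sumTo-1 : ∀ m → sumTo m (λ _ → 1ℤ) ≡ + m
sumTo-1 zero = refl
sumTo-1 (suc m) = ≡.trans (cong (ℤ._+ 1ℤ) (sumTo-1 m)) (ℤₚ.+-comm (+ m) 1ℤ)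

module ShiftInvariance (n ℓ : ℕ) where

  open Catalan ℓ
  open Lowering ℓ

  H-ext : ∀ {φ ψ : Functional} → (∀ γ → φ γ ≡ ψ γ) → ∀ Ψ γ d → H φ Ψ γ d ≡ H ψ Ψ γ d
  H-ext e [] γ zero = e γ
  H-ext e [] γ (suc d) = refl
  H-ext e (β ∷ Ψ) γ zero = H-ext e Ψ γ zero
  H-ext e (β ∷ Ψ) γ (suc d) = cong₂ ℤ._+_ (H-ext e Ψ γ (suc d)) (H-ext e (β ∷ Ψ) (γ ⊕ root β) d)

  -- At level n + 1 the same map has the same roots and a weight larger by one in every row. The
  -- only ℓ-element subset of the ℓ rows is all of them, so `lower ℓ ℓ` takes exactly this back.
  shift-invariance : ∀ {φ} → Good φ → ∀ s s′ → (∀ r → r < ℓ → s′ r ≡ s r) → ∀ d →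
    Straightening.S (suc n) ℓ (lower ℓ ℓ φ) s′ d ≡ Straightening.S n ℓ φ s d
  shift-invariance {φ} g s s′ e d = begin
      Straightening.S (suc n) ℓ (lower ℓ ℓ φ) s′ d ≡⟨ Straightening.S-cong (suc n) ℓ (lower-congruent c ℓ ℓ) e d ⟩
      H (lower ℓ ℓ φ) (Δ s) (wt′ s) d ≡⟨ H-ext (lower-all c ℓ) (Δ s) (wt′ s) d ⟩
      H (λ γ → φ (γ ⊖ ones ℓ)) (Δ s) (wt′ s) d ≡⟨ H-translate c (ones ℓ) (Δ s) (wt′ s) d ⟩
      H φ (Δ s) (wt′ s ⊖ ones ℓ) d ≡⟨ H-cong c (Δ s) (λ r r<ℓ → ≡.trans (cong (λ a → wt′ s r ℤ.- a) (ones-< r<ℓ)) (eq (+ (n ℕ.+ r)) (+ s r))) d ⟩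
      Straightening.S n ℓ φ s d ∎
    where
      open ≡-Reasoning
      open Straightening n ℓ using (Δ)
      c = Good.congruent g
      wt′ = Straightening.wt (suc n) ℓ
      eq : ∀ a b → 1ℤ ℤ.+ a ℤ.- b ℤ.- 1ℤ ≡ a ℤ.- b
      eq = ℤ-ring

open import Data.Nat using (_+_)

theorem2p6 : (k ℓ : ℕ) → 1 ≤ k → 1 ≤ ℓ → (μ : Vec ℕ ℓ) → T (boundedParᵇ k (toList μ)) →
    (κ : List ℕ) → T (isPartᵇ κ) → T (isCoreᵇ k κ) → pOf k κ ≈ₚ toList μ →
    (κ' : List ℕ) → T (isPartᵇ κ') → T (isCoreᵇ (suc k) κ') →
    pOf (suc k) κ' ≈ₚ toList (zipWith _+_ μ (replicate ℓ 1)) →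
    (η : List ℕ) (d : ℕ) →
    kSchurCoeff k κ η d ≡ rhsCoeff (suc k) ℓ κ' η d
theorem2p6 k ℓ _ _ μ _ κ part core p≈μ κ' part' core' p≈μ+1 η d = ℤₚ.+-injective (by-degree (sum η ≟ size (pOf k κ)))
  where
    open Catalan ℓ
    open BaseFunctional ℓ

    length≤ : length κ ≤ ℓ
    length≤ = length-by-pOf k ℓ κ (toList μ) part core p≈μ (eq≤ (length-toList μ))

    length≤' : length κ' ≤ ℓ
    length≤' = length-by-pOf (suc k) ℓ κ' (toList (zipWith _+_ μ (replicate ℓ 1))) part' core' p≈μ+1 (eq≤ (length-toList (zipWith _+_ μ (replicate ℓ 1))))

    c : Core k ℓ κ
    c = core-data part core length≤

    c' : Core (suc k) ℓ κ'
    c' = core-data part' core' length≤'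

    parts : ∀ r → r < ℓ → get (pOf (suc k) κ') r ≡ suc (get (pOf k κ) r)
    parts r r<ℓ = ≡.trans (p≈μ+1 r) (≡.trans (get-zipWith-suc μ r r<ℓ) (cong suc (sym (p≈μ r))))

    down≡ : ∀ r → r < ℓ → down (suc k) κ' r ≡ down k κ r
    -- Level and part both grow by one, so the difference is the same. From row ℓ on only the level
    -- grows, which is why the comparison stops there.
    down≡ r r<ℓ = cong (suc (suc k) + r ℕ.∸_) (parts r r<ℓ)

    size≡ : size (pOf (suc k) κ') ≡ size (pOf k κ) + ℓ
    size≡ = ℤₚ.+-injective (begin
      + size (pOf (suc k) κ') ≡⟨ sum-get (pOf (suc k) κ') ℓ (subst (_≤ ℓ) (sym (length-map-upTo _ (length κ'))) length≤') ⟩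
      sumTo ℓ (λ r → + get (pOf (suc k) κ') r) ≡⟨ sumTo-cong ℓ (λ r r<ℓ → ≡.trans (cong +_ (parts r r<ℓ)) (ℤₚ.+-comm 1ℤ (+ get (pOf k κ) r))) ⟩
      sumTo ℓ (λ r → + get (pOf k κ) r ℤ.+ 1ℤ) ≡⟨ sumTo-+ ℓ (λ r → + get (pOf k κ) r) (λ _ → 1ℤ) ⟩
      sumTo ℓ (λ r → + get (pOf k κ) r) ℤ.+ sumTo ℓ (λ _ → 1ℤ)
        ≡⟨ cong₂ ℤ._+_ (sym (sum-get (pOf k κ) ℓ (subst (_≤ ℓ) (sym (length-map-upTo _ (length κ))) length≤))) (sumTo-1 ℓ) ⟩
      + (size (pOf k κ) + ℓ) ∎)
      where open ≡-Reasoning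

    start-size : ∀ τ → size (pOf (suc k) τ) + ℓ ≡ size (pOf (suc k) κ') → size (pOf (suc k) τ) ≡ size (pOf k κ)
    start-size τ e = ℕₚ.+-cancelʳ-≡ ℓ _ _ (≡.trans e size≡)

    by-degree : Dec (sum η ≡ size (pOf k κ)) → + kSchurCoeff k κ η d ≡ + rhsCoeff (suc k) ℓ κ' η d
    -- In the wrong degree both sides vanish: every chain of ℓ covers ending in κ' starts in a core
    -- of size |𝔭(κ)|, so the coefficient of x^η is 0 for each of them.
    by-degree (no ne) = ≡.trans (cong +_ (kSchur-wrong-degree k ℓ η κ ne d)) (sym (begin
        + rhsCoeff (suc k) ℓ κ' η d ≡⟨ rhs-chains (suc k) ℓ η κ' c' d ⟩
        chainSum ℓ κ' strictIncᵇ (λ τ e → + kSchurCoeff (suc k) τ η e) d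
          ≡⟨ chainSum-cong ℓ κ' {P = strictIncᵇ} c' (λ _ _ → refl) (λ τ _ s e → cong +_ (kSchur-wrong-degree (suc k) ℓ η τ (λ q → ne (≡.trans q (start-size τ s))) e)) d ⟩
        chainSum ℓ κ' strictIncᵇ (λ _ _ → 0ℤ) d ≡⟨ strict-chains (suc k) ℓ ℓ (λ _ _ → 0ℤ) κ' c' d ⟩
        Operators.E (suc k) ℓ ℓ ℓ (λ _ _ → 0ℤ) κ' d ≡⟨ E-0 ℓ ℓ κ' d ⟩
        0ℤ ∎))
      where
        open ≡-Reasoning
        open Chains (suc k) ℓ
        E-0 : ∀ i m κ d → Operators.E (suc k) ℓ i m (λ _ _ → 0ℤ) κ d ≡ 0ℤ
        E-0 zero m κ d = refl
        E-0 (suc i) zero κ d = refl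
        E-0 (suc i) (suc m) κ d = cong₂ ℤ._+_ (E-0 (suc i) m κ d) (U-zero (suc k) ℓ m κ d (E-0 i m))
    by-degree (yes e) = conclude (word-transform ℓ η ε-good)
      where
        open ≡-Reasoning
        open Chains (suc k) ℓ
        conclude : Complete.Transform ℓ (λ K → word K ℓ η) ε → + kSchurCoeff k κ η d ≡ + rhsCoeff (suc k) ℓ κ' η d
        conclude (φ , g , represents) = begin
          + kSchurCoeff k κ η d ≡⟨ kSchur-word k ℓ η κ c e d ⟩
          word k ℓ η unit κ d ≡⟨ represents k unit (unit-represents k ℓ) κ c d ⟩
          Straightening.S (suc k) ℓ φ (down k κ) d ≡⟨ sym (ShiftInvariance.shift-invariance (suc k) ℓ g (down k κ) (down (suc k) κ') down≡ d) ⟩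
          Straightening.S (suc (suc k)) ℓ (Lowering.lower ℓ ℓ ℓ φ) (down (suc k) κ') d
            ≡⟨ sym (Operators.E-represents (suc k) ℓ g (represents (suc k) unit (unit-represents (suc k) ℓ)) ℓ ℓ ℕₚ.≤-refl κ' c' d) ⟩
          Operators.E (suc k) ℓ ℓ ℓ (word (suc k) ℓ η unit) κ' d ≡⟨ sym (strict-chains (suc k) ℓ ℓ (word (suc k) ℓ η unit) κ' c' d) ⟩
          chainSum ℓ κ' strictIncᵇ (word (suc k) ℓ η unit) d
            ≡⟨ sym (chainSum-cong ℓ κ' {P = strictIncᵇ} c' (λ _ _ → refl) (λ τ cτ s → kSchur-word (suc k) ℓ η τ cτ (≡.trans e (sym (start-size τ s)))) d) ⟩
          chainSum ℓ κ' strictIncᵇ (λ τ e → + kSchurCoeff (suc k) τ η e) d ≡⟨ sym (rhs-chains (suc k) ℓ η κ' c' d) ⟩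
          + rhsCoeff (suc k) ℓ κ' η d ∎
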